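{- There is an absolute constant $C>0$ such that the following holds. Let $N$ be a positive integer, let $0<\delta\le 1$, let $A \subset \{1,2,\dots, N\}$ with $|A| \geq \delta N$, and let $0<\varepsilon \leq 1/2$. Then either $N \leq \exp\big(C\varepsilon^{ -C}\big)$, or there exists an integer $d \neq 0$ such that $$\#\{x \in A : x+d\in A \text{ and } x+d^2 \in A\} \geq (\delta^3-\varepsilon) N.$$ -}

module Defs where

open import Data.Bool using (Bool; true; false; _∧_)
open import Data.Nat as ℕ using (ℕ; suc)
open import Data.Integer as ℤ using (ℤ; +_; -[1+_])
open import Data.List using (List; map; upTo; length; filterᵇ)
open import Data.Rational as ℚ using (ℚ; _/_; 1ℚ)

[1‥_] : ℕ → List ℕ
[1‥ N ] = map suc (upTo N)

-- A finite set of positive integers is represented by its Boolean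
-- indicator function on ℕ.  Membership of an integer (possibly ≤ 0):
_∈ℤ_ : ℤ → (ℕ → Bool) → Bool
(+ n)      ∈ℤ A = A n
-[1+ n ]   ∈ℤ A = false

count : ℕ → (ℕ → Bool) → ℕ
count N P = length (filterᵇ P [1‥ N ])

ℕ→ℚ : ℕ → ℚ
ℕ→ℚ n = + n / 1

_^ℚ_ : ℚ → ℕ → ℚ
q ^ℚ 0       = 1ℚ
q ^ℚ (suc k) = q ℚ.* (q ^ℚ k)

patternCount : ℕ → (ℕ → Bool) → ℤ → ℕ
patternCount N A d =
  count N (λ x → A x ∧ (((+ x) ℤ.+ d) ∈ℤ A) ∧ (((+ x) ℤ.+ (d ℤ.* d)) ∈ℤ A))

{-# OPTIONS --safe #-}

-- The argument takes place on the cyclic group of order N and in physical space, without characters.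
-- The number of configurations x, x + d, x + d² is an inner product of 1_A with a dual function, an
-- average over d of f₀(x - d²) f₁(x + d - d²). By van der Corput's inequality and a concatenation
-- argument, a large inner product forces a large box norm of the dual function along four long
-- progressions with a small common step. For a dual function two directions can be traded for a single
-- one (degree lowering), so after three rounds it correlates with its average along one progression.
-- Applied to the difference of a dual function and its average this is absurd unless the difference is
-- small; hence the last copy of 1_A may be replaced by its average along a progression of step a
-- multiple of q², and then the middle copy by its average along one of step a multiple of q.
-- An energy increment over polynomially many scales q yields a scale at which these averages hardly
-- change when the progressions become so long and fine that they absorb all shifts by d and d².
-- There the count is close to the mean of 1_A G₁ G₂ with two averages G₁ and G₂ of 1_A, and the pointwise
-- bound p₁ p₂ + δ³/p₁ + δ³/p₂ ≥ 3δ², in which 1_A/pᵢ has mean about 1, gives at least δ³.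
-- All thresholds are powers of 1/K with K about 1/ε, and all lengths are at most 2 to a power of K.
module Submission where

open import Defs
open import Data.Bool using (Bool; true)
open import Data.Nat as ℕ using (ℕ; _^_)
open import Data.Integer as ℤ using (ℤ)
open import Data.Rational as ℚ using (ℚ; 0ℚ; 1ℚ; ½)
open import Data.Product using (Σ; _×_; ∃)
open import Data.Sum using (_⊎_)
open import Relation.Binary.PropositionalEquality using (_≡_; _≢_)

open import Algebra using (CommutativeRing; IsCommutativeRing)
import Algebra.Solver.Ring
open import Algebra.Solver.Ring.AlmostCommutativeRing using (fromCommutativeRing; _-Raw-AlmostCommutative⟶_)
open import Data.Bool as Bool using (false; _∧_)
open import Data.Fin as Fin using (Fin; zero; suc; toℕ)
import Data.Fin.Properties as Finₚ
open import Data.Integer using (0ℤ)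
import Data.Integer.DivMod as ℤᵈ
import Data.Integer.Properties as ℤₚ
open import Data.List using (List; []; _∷_; map; _++_; applyUpTo; length; filterᵇ)
open import Data.Maybe using (Maybe; just; nothing)
open import Data.Nat using (zero; suc; _!)
open import Data.Nat.Divisibility using (_∣_; divides; m≤n⇒m!∣n!; ∣-trans; m∣m*n)
import Data.Nat.Properties as ℕₚ
open import Data.Nat.Tactic.RingSolver using (solve-∀)
open import Data.Product using (_,_; proj₁; proj₂)
open import Data.Rational using (_≤_; _<_)
open import Data.Rational.Properties as ℚₚ using (≤-refl; ≤-trans; ≤-reflexive)
open import Data.Rational.Unnormalised as ℚᵘ using ()
import Data.Rational.Unnormalised.Properties as ℚᵘₚ
open import Data.Sum using (inj₁; inj₂)
open import Function using (_∘_; id)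
open import Level using (0ℓ)
open import Relation.Binary.PropositionalEquality
  using (refl; sym; trans; cong; cong₂; subst; subst₂; module ≡-Reasoning)
open import Relation.Nullary using (¬_; Dec; yes; no; contradiction)
open import Relation.Nullary.Decidable using (True; toWitness)

-- Losses polynomial in ε are possible because every inequality bounds V, V² or V/2 by W plus a tiny
-- error; such bounds survive averaging, and a chain of them costs only a fixed power of κ. The
-- obstacle is arithmetic: linearisation leaves progressions whose steps are multiples of a, b and a
-- + b, one triple for each choice of shifts, with nothing common to all of them. The shifts are
-- therefore drawn from families like σ (A + i) with A huge and σ, i small. Two steps of this kind
-- have a small integer combination from which A cancels, leaving a small nonzero integer, and one
-- number divisible by all small integers then provides a single progression inside every sum of two
-- windows. Degree lowering rests on the path u ↦ (q (2 d₁ u + u²), q (2 d₂ u + u²)): its quadratic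
-- part is diagonal, so averaging along the diagonal leaves the linear motion 2 q (d₁ - d₂) u. The
-- difference of a dual function and its average is again an average of dual functions, which is why
-- the inverse theorem can be applied to it.

-- Arithmetic with rationals and integers

infix  8 -_
infixl 7 _*_
infixl 6 _+_ _-_

-- The operations are opaque so that unification treats them as rigid.
opaque
  _+_ _*_ : ℚ → ℚ → ℚ
  _+_ = ℚ._+_
  _*_ = ℚ._*_
  -_ : ℚ → ℚ
  -_ = ℚ.-_

_-_ : ℚ → ℚ → ℚ
a - b = a + - b

opaque
  unfolding _+_
  ℚ-isCommutativeRing : IsCommutativeRing _≡_ _+_ _*_ -_ 0ℚ 1ℚ
  ℚ-isCommutativeRing = ℚₚ.+-*-isCommutativeRing

ℚ-ring : CommutativeRing 0ℓ 0ℓ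
ℚ-ring = record { isCommutativeRing = ℚ-isCommutativeRing }

open CommutativeRing ℚ-ring public using
  (+-identityˡ; +-identityʳ; +-assoc; +-comm; *-identityˡ; *-identityʳ; *-assoc; *-comm; distribˡ; distribʳ; zeroˡ; zeroʳ; -‿inverseʳ)

opaque
  unfolding _+_
  +-coeff : ∀ a b → a ℚ.+ b ≡ a + b
  +-coeff a b = refl
  *-coeff : ∀ a b → a ℚ.* b ≡ a * b
  *-coeff a b = refl
  neg-coeff : ∀ a → ℚ.- a ≡ - a
  neg-coeff a = refl

coefficients : ℚ.+-*-rawRing -Raw-AlmostCommutative⟶ fromCommutativeRing ℚ-ring
coefficients = record
  { ⟦_⟧ = id ; +-homo = +-coeff ; *-homo = *-coeff
  ; -‿homo = neg-coeff ; 0-homo = refl ; 1-homo = refl }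

coeff≟ : ∀ a b → Maybe (a ≡ b)
coeff≟ a b with a ℚₚ.≟ b
... | yes p = just p
... | no  _ = nothing

open Algebra.Solver.Ring ℚ.+-*-rawRing (fromCommutativeRing ℚ-ring) coefficients coeff≟
  using (solve; con; _:+_; _:*_; _:-_; :-_; _:=_) public

opaque
  unfolding _+_
  +-mono-≤ : ∀ {a b c d} → a ≤ b → c ≤ d → a + c ≤ b + d
  +-mono-≤ = ℚₚ.+-mono-≤
  +-monoˡ-≤ : ∀ c {a b} → a ≤ b → a + c ≤ b + c
  +-monoˡ-≤ = ℚₚ.+-monoˡ-≤
  +-monoʳ-≤ : ∀ c {a b} → a ≤ b → c + a ≤ c + b
  +-monoʳ-≤ = ℚₚ.+-monoʳ-≤
  *-monoʳ : ∀ {a b c} → 0ℚ ≤ c → a ≤ b → a * c ≤ b * c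
  *-monoʳ {c = c} 0≤c = ℚₚ.*-monoʳ-≤-nonNeg c ⦃ ℚ.nonNegative 0≤c ⦄
  *-monoˡ : ∀ {a b c} → 0ℚ ≤ c → a ≤ b → c * a ≤ c * b
  *-monoˡ {c = c} 0≤c = ℚₚ.*-monoˡ-≤-nonNeg c ⦃ ℚ.nonNegative 0≤c ⦄
  *-pos : ∀ {a b} → 0ℚ < a → 0ℚ < b → 0ℚ < a * b
  *-pos {a} {b} 0<a 0<b = ℚₚ.positive⁻¹ (a * b) ⦃ ℚₚ.pos*pos⇒pos a ⦃ ℚ.positive 0<a ⦄ b ⦃ ℚ.positive 0<b ⦄ ⦄
  *-cancelʳ-pos : ∀ {a b c} → 0ℚ < c → a * c ≤ b * c → a ≤ b
  *-cancelʳ-pos {c = c} 0<c = ℚₚ.*-cancelʳ-≤-pos c ⦃ ℚ.positive 0<c ⦄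

infix  8 -ᶻ_
infixl 7 _*ᶻ_
infixl 6 _+ᶻ_ _-ᶻ_

opaque
  _+ᶻ_ _*ᶻ_ : ℤ → ℤ → ℤ
  _+ᶻ_ = ℤ._+_
  _*ᶻ_ = ℤ._*_
  -ᶻ_ : ℤ → ℤ
  -ᶻ_ = ℤ.-_

_-ᶻ_ : ℤ → ℤ → ℤ
a -ᶻ b = a +ᶻ -ᶻ b

opaque
  unfolding _+ᶻ_
  ℤ-isCommutativeRing : IsCommutativeRing _≡_ _+ᶻ_ _*ᶻ_ -ᶻ_ ℤ.0ℤ ℤ.1ℤ
  ℤ-isCommutativeRing = ℤₚ.+-*-isCommutativeRing
  +ᶻ-def : ∀ a b → a ℤ.+ b ≡ a +ᶻ b
  +ᶻ-def a b = refl
  *ᶻ-def : ∀ a b → a ℤ.* b ≡ a *ᶻ b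
  *ᶻ-def a b = refl
  -ᶻ-def : ∀ a → ℤ.- a ≡ -ᶻ a
  -ᶻ-def a = refl

ℤ-ring : CommutativeRing 0ℓ 0ℓ
ℤ-ring = record { isCommutativeRing = ℤ-isCommutativeRing }

ℤ-coefficients : ℤ.+-*-rawRing -Raw-AlmostCommutative⟶ fromCommutativeRing ℤ-ring
ℤ-coefficients = record
  { ⟦_⟧ = id ; +-homo = +ᶻ-def ; *-homo = *ᶻ-def
  ; -‿homo = -ᶻ-def ; 0-homo = refl ; 1-homo = refl }

ℤ-coeff≟ : ∀ a b → Maybe (a ≡ b)
ℤ-coeff≟ a b with a ℤ.≟ b
... | yes p = just p
... | no  _ = nothing

open Algebra.Solver.Ring ℤ.+-*-rawRing (fromCommutativeRing ℤ-ring) ℤ-coefficients ℤ-coeff≟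
  using () renaming (solve to solveᶻ; con to # ; _:+_ to _⊞_; _:*_ to _⊠_; _:-_ to _⊟_; :-_ to ⊟_; _:=_ to _≔_) public

mix : ∀ a b c d → (a * b) * (c * d) ≡ (a * c) * (b * d)
mix = solve 4 (λ a b c d → (a :* b) :* (c :* d) := (a :* c) :* (b :* d)) refl

2ℚ 4ℚ : ℚ
2ℚ = 1ℚ + 1ℚ
4ℚ = 2ℚ + 2ℚ

≤-by : ∀ {a b} c → 0ℚ ≤ c → b ≡ a + c → a ≤ b
≤-by {a} {b} c 0≤c e = begin
  a      ≡⟨ sym (+-identityʳ a) ⟩
  a + 0ℚ ≤⟨ +-monoʳ-≤ a 0≤c ⟩
  a + c  ≡⟨ sym e ⟩
  b      ∎
  where open ℚₚ.≤-Reasoning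

0≤b-a : ∀ {a b} → a ≤ b → 0ℚ ≤ b - a
0≤b-a {a} {b} a≤b = subst (_≤ b - a) (-‿inverseʳ a) (+-monoˡ-≤ (- a) a≤b)

0≤+ : ∀ {a b} → 0ℚ ≤ a → 0ℚ ≤ b → 0ℚ ≤ a + b
0≤+ {a} {b} p q = subst (_≤ a + b) (+-identityʳ 0ℚ) (+-mono-≤ p q)

0≤* : ∀ {a b} → 0ℚ ≤ a → 0ℚ ≤ b → 0ℚ ≤ a * b
0≤* {a} {b} 0≤a 0≤b = subst (_≤ a * b) (zeroˡ b) (*-monoʳ 0≤b 0≤a)

*-mono : ∀ {a b c d} → 0ℚ ≤ a → 0ℚ ≤ d → a ≤ b → c ≤ d → a * c ≤ b * d
*-mono 0≤a 0≤d a≤b c≤d = ≤-trans (*-monoˡ 0≤a c≤d) (*-monoʳ 0≤d a≤b)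

0≤1 : 0ℚ ≤ 1ℚ
0≤1 = ℚ.*≤* (ℤ.+≤+ ℕ.z≤n)

0≤½ : 0ℚ ≤ ½
0≤½ = ℚ.*≤* (ℤ.+≤+ ℕ.z≤n)

0≤2 : 0ℚ ≤ 2ℚ
0≤2 = 0≤+ 0≤1 0≤1

0≤neg : ∀ {a} → a ≤ 0ℚ → 0ℚ ≤ - a
0≤neg {a} a≤0 = subst (0ℚ ≤_) (+-identityˡ (- a)) (0≤b-a a≤0)

0≤sq : ∀ a → 0ℚ ≤ a * a
0≤sq a with ℚₚ.≤-total 0ℚ a
... | inj₁ p = 0≤* p p
... | inj₂ n = subst (0ℚ ≤_) (solve 1 (λ a → (:- a) :* (:- a) := a :* a) refl a)
                 (0≤* (0≤neg n) (0≤neg n))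

sq-mono : ∀ {a b} → 0ℚ ≤ a → a ≤ b → a * a ≤ b * b
sq-mono 0≤a a≤b = *-mono 0≤a (≤-trans 0≤a a≤b) a≤b a≤b

Bd : ℚ → Set
Bd a = (a ≤ 1ℚ) × (- 1ℚ ≤ a)

infix 4 _≈[_]_
_≈[_]_ : ℚ → ℚ → ℚ → Set
a ≈[ θ ] b = (a ≤ b + θ) × (b ≤ a + θ)

private
  ½≤ : ∀ {c} d → 0ℚ ≤ d → c ≡ ½ * d → 0ℚ ≤ c
  ½≤ d 0≤d e = subst (0ℚ ≤_) (sym e) (0≤* 0≤½ 0≤d)

  lo : ∀ {a} → - 1ℚ ≤ a → 0ℚ ≤ 1ℚ + a
  lo {a} p = subst (0ℚ ≤_) (solve 1 (λ a → a :- (:- con 1ℚ) := con 1ℚ :+ a) refl a) (0≤b-a p)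

0≤θ : ∀ {a b θ} → a ≈[ θ ] b → 0ℚ ≤ θ
0≤θ {a} {b} {θ} (p , q) = ½≤ _ (0≤+ (0≤b-a p) (0≤b-a q))
  (solve 3 (λ a b θ → θ := con ½ :* ((b :+ θ :- a) :+ (a :+ θ :- b))) refl a b θ)

-- Certificates: 1 - a b and 1 + a b are halves of sums of products of the nonnegative numbers 1 -
-- a, 1 + a, 1 - b and 1 + b. The estimates for closeness below are found in the same way.
Bd-* : ∀ {a b} → Bd a → Bd b → Bd (a * b)
Bd-* {a} {b} (a1 , a2) (b1 , b2) =
  ≤-by _ (0≤* 0≤½ (0≤+ (0≤* (0≤b-a a1) (lo b2)) (0≤* (lo a2) (0≤b-a b1))))
    (solve 2 (λ a b → con 1ℚ := a :* b :+ con ½ :* ((con 1ℚ :- a) :* (con 1ℚ :+ b) :+ (con 1ℚ :+ a) :* (con 1ℚ :- b))) refl a b) ,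
  ≤-by _ (0≤* 0≤½ (0≤+ (0≤* (lo a2) (lo b2)) (0≤* (0≤b-a a1) (0≤b-a b1))))
    (solve 2 (λ a b → a :* b := :- con 1ℚ :+ con ½ :* ((con 1ℚ :+ a) :* (con 1ℚ :+ b) :+ (con 1ℚ :- a) :* (con 1ℚ :- b))) refl a b)

Bd-sq : ∀ {a} → Bd a → a * a ≤ 1ℚ
Bd-sq p = proj₁ (Bd-* p p)

-1≤0 : - 1ℚ ≤ 0ℚ
-1≤0 = ≤-by 1ℚ 0≤1 (solve 0 (con 0ℚ := :- con 1ℚ :+ con 1ℚ) refl)

Bd-1 : Bd 1ℚ
Bd-1 = ≤-refl , ≤-trans -1≤0 0≤1

Bd-01 : ∀ {a} → 0ℚ ≤ a → a ≤ 1ℚ → Bd a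
Bd-01 p q = q , ≤-trans -1≤0 p

≈-refl : ∀ {a θ} → 0ℚ ≤ θ → a ≈[ θ ] a
≈-refl {a} {θ} p = q , q where q = ≤-by θ p refl

≈-sym : ∀ {a b θ} → a ≈[ θ ] b → b ≈[ θ ] a
≈-sym (p , q) = q , p

≈-trans : ∀ {a b c θ θ′} → a ≈[ θ ] b → b ≈[ θ′ ] c → a ≈[ θ + θ′ ] c
≈-trans {a} {b} {c} {θ} {θ′} (p , q) (p′ , q′) =
  ≤-trans p (≤-trans (+-monoˡ-≤ θ p′) (≤-reflexive (solve 3 (λ c x y → c :+ y :+ x := c :+ (x :+ y)) refl c θ θ′))) ,
  ≤-trans q′ (≤-trans (+-monoˡ-≤ θ′ q) (≤-reflexive (+-assoc a θ θ′)))

≈-sq : ∀ {a b θ} → Bd a → Bd b → a ≈[ θ ] b → a * a ≤ b * b + (θ + θ)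
≈-sq {a} {b} {θ} (a1 , a2) (b1 , b2) (p , q) =
  ≤-by _ (0≤* 0≤½ (0≤+ (0≤* (0≤b-a p) (0≤+ (lo a2) (lo b2))) (0≤* (0≤b-a q) (0≤+ (0≤b-a a1) (0≤b-a b1)))))
   (solve 3 (λ a b θ → b :* b :+ (θ :+ θ) := a :* a :+ con ½ :*
      ((b :+ θ :- a) :* ((con 1ℚ :+ a) :+ (con 1ℚ :+ b)) :+ (a :+ θ :- b) :* ((con 1ℚ :- a) :+ (con 1ℚ :- b)))) refl a b θ)

≈-*ˡ : ∀ {a b c θ} → Bd c → a ≈[ θ ] b → c * a ≈[ θ ] c * b
≈-*ˡ {a} {b} {c} {θ} (c1 , c2) (p , q) =
  ≤-by _ (0≤* 0≤½ (0≤+ (0≤* (0≤b-a c1) (0≤b-a q)) (0≤* (lo c2) (0≤b-a p))))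
   (solve 4 (λ a b c θ → c :* b :+ θ := c :* a :+ con ½ :* ((con 1ℚ :- c) :* (a :+ θ :- b) :+ (con 1ℚ :+ c) :* (b :+ θ :- a))) refl a b c θ) ,
  ≤-by _ (0≤* 0≤½ (0≤+ (0≤* (0≤b-a c1) (0≤b-a p)) (0≤* (lo c2) (0≤b-a q))))
   (solve 4 (λ a b c θ → c :* a :+ θ := c :* b :+ con ½ :* ((con 1ℚ :- c) :* (b :+ θ :- a) :+ (con 1ℚ :+ c) :* (a :+ θ :- b))) refl a b c θ)

≈-*ʳ : ∀ {a b c θ} → Bd c → a ≈[ θ ] b → a * c ≈[ θ ] b * c
≈-*ʳ {a} {b} {c} {θ} bc p = subst (λ t → t ≈[ θ ] b * c) (*-comm c a)
  (subst (λ t → c * a ≈[ θ ] t) (*-comm c b) (≈-*ˡ bc p))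

≈-* : ∀ {a b c d θ θ′} → Bd b → Bd c → a ≈[ θ ] b → c ≈[ θ′ ] d → a * c ≈[ θ + θ′ ] b * d
≈-* bb bc p q = ≈-trans (≈-*ʳ bc p) (≈-*ˡ bb q)

≈-≡ˡ : ∀ {a a′ b θ} → a ≡ a′ → a ≈[ θ ] b → a′ ≈[ θ ] b
≈-≡ˡ refl p = p

≈-≡ʳ : ∀ {a b b′ θ} → b ≡ b′ → a ≈[ θ ] b → a ≈[ θ ] b′
≈-≡ʳ refl p = p

≈-weaken : ∀ {a b θ θ′} → θ ≤ θ′ → a ≈[ θ ] b → a ≈[ θ′ ] b
≈-weaken {a} {b} h (p , q) = ≤-trans p (+-monoʳ-≤ b h) , ≤-trans q (+-monoʳ-≤ a h)

-- Finite averages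

-- Means are finite, so that averages commute; they are given as a universe of codes
-- because a bare positive functional would not satisfy Fubini.
data Mean : Set → Set₁ where
  uni : (n : ℕ) → Mean (Fin (suc n))
  _⊗_ : ∀ {I J} → Mean I → Mean J → Mean (I × J)

infixr 5 _⊗_

sumF : ∀ n → (Fin n → ℚ) → ℚ
sumF zero    φ = 0ℚ
sumF (suc n) φ = φ zero + sumF n (φ ∘ suc)

1/suc : ℕ → ℚ
1/suc n = (ℤ.+ 1) ℚ./ suc n

opaque
  average : ∀ n → (Fin (suc n) → ℚ) → ℚ
  average n φ = sumF (suc n) φ * 1/suc n

  average-def : ∀ n φ → average n φ ≡ sumF (suc n) φ * 1/suc n
  average-def n φ = refl

E : ∀ {I} → Mean I → (I → ℚ) → ℚ
E (uni n) φ = average n φ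
E (μ ⊗ ν) φ = E μ λ i → E ν λ j → φ (i , j)

syntax E μ (λ i → e) = 𝔼[ i ∈ μ ] e

sumF-cong : ∀ n {φ ψ : Fin n → ℚ} → (∀ i → φ i ≡ ψ i) → sumF n φ ≡ sumF n ψ
sumF-cong zero    h = refl
sumF-cong (suc n) h = cong₂ _+_ (h zero) (sumF-cong n (h ∘ suc))

sumF-+ : ∀ n (φ ψ : Fin n → ℚ) → sumF n (λ i → φ i + ψ i) ≡ sumF n φ + sumF n ψ
sumF-+ zero    φ ψ = sym (+-identityʳ 0ℚ)
sumF-+ (suc n) φ ψ rewrite sumF-+ n (φ ∘ suc) (ψ ∘ suc) =
  solve 4 (λ a b c d → a :+ b :+ (c :+ d) := a :+ c :+ (b :+ d)) refl (φ zero) (ψ zero) _ _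

sumF-* : ∀ n c (φ : Fin n → ℚ) → sumF n (λ i → c * φ i) ≡ c * sumF n φ
sumF-* zero    c φ = sym (zeroʳ c)
sumF-* (suc n) c φ rewrite sumF-* n c (φ ∘ suc) = sym (distribˡ c _ _)

sumF-mono : ∀ n {φ ψ : Fin n → ℚ} → (∀ i → φ i ≤ ψ i) → sumF n φ ≤ sumF n ψ
sumF-mono zero    h = ≤-refl
sumF-mono (suc n) h = +-mono-≤ (h zero) (sumF-mono n (h ∘ suc))

fromℕ : ℕ → ℚ
fromℕ zero    = 0ℚ
fromℕ (suc n) = 1ℚ + fromℕ n

opaque
  unfolding _+_
  fromℕ-/1 : ∀ n → fromℕ n ≡ (ℤ.+ n) ℚ./ 1
  fromℕ-/1 zero    = refl
  fromℕ-/1 (suc n) = trans (cong (1ℚ +_) (fromℕ-/1 n)) (ℚₚ.toℚᵘ-injective (begin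
    ℚ.toℚᵘ (1ℚ + (ℤ.+ n) ℚ./ 1)                 ≈⟨ ℚₚ.toℚᵘ-homo-+ 1ℚ ((ℤ.+ n) ℚ./ 1) ⟩
    ℚ.toℚᵘ 1ℚ ℚᵘ.+ ℚ.toℚᵘ ((ℤ.+ n) ℚ./ 1)       ≈⟨ ℚᵘₚ.+-congʳ (ℚ.toℚᵘ 1ℚ) (ℚₚ.toℚᵘ-fromℚᵘ (ℚᵘ.mkℚᵘ (ℤ.+ n) 0)) ⟩
    ℚᵘ.mkℚᵘ (ℤ.+ 1) 0 ℚᵘ.+ ℚᵘ.mkℚᵘ (ℤ.+ n) 0      ≈⟨ ℚᵘ.*≡* (cong (λ t → t ℤ.* ℤ.+ 1) (cong (λ t → ℤ.+ 1 ℤ.+ t) (ℤₚ.*-identityʳ (ℤ.+ n)))) ⟩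
    ℚᵘ.mkℚᵘ (ℤ.+ suc n) 0                       ≈⟨ ℚᵘₚ.≃-sym (ℚₚ.toℚᵘ-fromℚᵘ (ℚᵘ.mkℚᵘ (ℤ.+ suc n) 0)) ⟩
    ℚ.toℚᵘ ((ℤ.+ suc n) ℚ./ 1)                  ∎))
    where
    open import Data.Rational.Unnormalised as ℚᵘ using ()
    open import Data.Rational.Unnormalised.Properties as ℚᵘₚ using ()
    open ℚᵘₚ.≃-Reasoning

  suc*1/suc : ∀ n → fromℕ (suc n) * 1/suc n ≡ 1ℚ
  suc*1/suc n = trans (cong (_* 1/suc n) (fromℕ-/1 (suc n))) (ℚₚ.toℚᵘ-injective (begin
    ℚ.toℚᵘ ((ℤ.+ suc n) ℚ./ 1 * 1/suc n)              ≈⟨ ℚₚ.toℚᵘ-homo-* ((ℤ.+ suc n) ℚ./ 1) (1/suc n) ⟩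
    ℚ.toℚᵘ ((ℤ.+ suc n) ℚ./ 1) ℚᵘ.* ℚ.toℚᵘ (1/suc n)  ≈⟨ ℚᵘₚ.*-cong (ℚₚ.toℚᵘ-fromℚᵘ (ℚᵘ.mkℚᵘ (ℤ.+ suc n) 0)) (ℚₚ.toℚᵘ-fromℚᵘ (ℚᵘ.mkℚᵘ (ℤ.+ 1) n)) ⟩
    ℚᵘ.mkℚᵘ (ℤ.+ suc n) 0 ℚᵘ.* ℚᵘ.mkℚᵘ (ℤ.+ 1) n        ≈⟨ ℚᵘ.*≡* (trans (ℤₚ.*-identityʳ _) (trans (ℤₚ.*-identityʳ (ℤ.+ suc n)) (trans (cong (λ t → ℤ.+ suc t) (sym (ℕₚ.+-identityʳ n))) (sym (ℤₚ.*-identityˡ _))))) ⟩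
    ℚᵘ.mkℚᵘ (ℤ.+ 1) 0                                 ∎))
    where
    open import Data.Rational.Unnormalised as ℚᵘ using ()
    open import Data.Rational.Unnormalised.Properties as ℚᵘₚ using ()
    open import Data.Nat.Properties as ℕₚ using ()
    open ℚᵘₚ.≃-Reasoning

0≤fromℕ : ∀ n → 0ℚ ≤ fromℕ n
0≤fromℕ zero    = ≤-refl
0≤fromℕ (suc n) = 0≤+ 0≤1 (0≤fromℕ n)

0≤1/suc : ∀ n → 0ℚ ≤ 1/suc n
0≤1/suc n = ℚₚ.nonNegative⁻¹ (1/suc n) ⦃ ℚₚ.normalize-nonNeg 1 (suc n) ⦄

sumF-const : ∀ n c → sumF n (λ _ → c) ≡ fromℕ n * c
sumF-const zero    c = sym (zeroˡ c)
sumF-const (suc n) c rewrite sumF-const n c = solve 2 (λ c m → c :+ m :* c := (con 1ℚ :+ m) :* c) refl c _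

opaque
  unfolding average
  E-cong : ∀ {I} (μ : Mean I) {φ ψ : I → ℚ} → (∀ i → φ i ≡ ψ i) → E μ φ ≡ E μ ψ
  E-cong (uni n) h = cong (_* 1/suc n) (sumF-cong (suc n) h)
  E-cong (μ ⊗ ν) h = E-cong μ λ i → E-cong ν λ j → h (i , j)

opaque
  unfolding average
  E-+ : ∀ {I} (μ : Mean I) (φ ψ : I → ℚ) → 𝔼[ i ∈ μ ] (φ i + ψ i) ≡ E μ φ + E μ ψ
  E-+ (uni n) φ ψ = trans (cong (_* 1/suc n) (sumF-+ (suc n) φ ψ)) (distribʳ (1/suc n) _ _)
  E-+ (μ ⊗ ν) φ ψ = trans (E-cong μ λ i → E-+ ν _ _) (E-+ μ _ _)

opaque
  unfolding average
  E-*ˡ : ∀ {I} (μ : Mean I) c (φ : I → ℚ) → 𝔼[ i ∈ μ ] (c * φ i) ≡ c * E μ φ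
  E-*ˡ (uni n) c φ = trans (cong (_* 1/suc n) (sumF-* (suc n) c φ)) (*-assoc c _ _)
  E-*ˡ (μ ⊗ ν) c φ = trans (E-cong μ λ i → E-*ˡ ν c _) (E-*ˡ μ c _)

E-*ʳ : ∀ {I} (μ : Mean I) c (φ : I → ℚ) → 𝔼[ i ∈ μ ] (φ i * c) ≡ E μ φ * c
E-*ʳ μ c φ = trans (E-cong μ λ i → *-comm (φ i) c) (trans (E-*ˡ μ c φ) (*-comm c _))

opaque
  unfolding average
  E-mono : ∀ {I} (μ : Mean I) {φ ψ : I → ℚ} → (∀ i → φ i ≤ ψ i) → E μ φ ≤ E μ ψ
  E-mono (uni n) h = *-monoʳ (0≤1/suc n) (sumF-mono (suc n) h)
  E-mono (μ ⊗ ν) h = E-mono μ λ i → E-mono ν λ j → h (i , j)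

opaque
  unfolding average
  E-const : ∀ {I} (μ : Mean I) c → 𝔼[ _ ∈ μ ] c ≡ c
  E-const (uni n) c = trans (cong (_* 1/suc n) (sumF-const (suc n) c))
    (trans (solve 3 (λ m c i → m :* c :* i := m :* i :* c) refl _ c (1/suc n))
    (trans (cong (_* c) (suc*1/suc n)) (*-identityˡ c)))
  E-const (μ ⊗ ν) c = trans (E-cong μ λ _ → E-const ν c) (E-const μ c)

E-sumF : ∀ {I} (μ : Mean I) n (φ : I → Fin n → ℚ) →
  𝔼[ i ∈ μ ] sumF n (φ i) ≡ sumF n λ j → 𝔼[ i ∈ μ ] φ i j
E-sumF μ zero    φ = E-const μ 0ℚ
E-sumF μ (suc n) φ = trans (E-+ μ _ _) (cong₂ _+_ refl (E-sumF μ n λ i j → φ i (suc j)))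

opaque
  unfolding average
  E-swap : ∀ {I J} (μ : Mean I) (ν : Mean J) (φ : I → J → ℚ) →
    𝔼[ i ∈ μ ] 𝔼[ j ∈ ν ] φ i j ≡ 𝔼[ j ∈ ν ] 𝔼[ i ∈ μ ] φ i j
  E-swap μ (uni n) φ = trans (E-*ʳ μ (1/suc n) _) (cong (_* 1/suc n) (E-sumF μ (suc n) φ))
  E-swap μ (ν ⊗ ρ) φ = trans (E-swap μ ν _) (E-cong ν λ j → E-swap μ ρ _)

E-neg : ∀ {I} (μ : Mean I) (φ : I → ℚ) → 𝔼[ i ∈ μ ] (- φ i) ≡ - E μ φ
E-neg μ φ = trans (E-cong μ λ i → solve 1 (λ a → :- a := (:- con 1ℚ) :* a) refl (φ i))
  (trans (E-*ˡ μ (- 1ℚ) φ) (solve 1 (λ a → (:- con 1ℚ) :* a := :- a) refl (E μ φ)))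

E-minus : ∀ {I} (μ : Mean I) (φ ψ : I → ℚ) → 𝔼[ i ∈ μ ] (φ i - ψ i) ≡ E μ φ - E μ ψ
E-minus μ φ ψ = trans (E-+ μ φ (λ i → - ψ i)) (cong (E μ φ +_) (E-neg μ ψ))

E-+ᶜ : ∀ {I} (μ : Mean I) (φ : I → ℚ) c → 𝔼[ i ∈ μ ] (φ i + c) ≡ E μ φ + c
E-+ᶜ μ φ c = trans (E-+ μ φ (λ _ → c)) (cong (E μ φ +_) (E-const μ c))

E-≤ : ∀ {I} (μ : Mean I) {φ : I → ℚ} {c} → (∀ i → φ i ≤ c) → E μ φ ≤ c
E-≤ μ {φ} {c} h = ≤-trans (E-mono μ h) (≤-reflexive (E-const μ c))

E-≥ : ∀ {I} (μ : Mean I) {φ : I → ℚ} {c} → (∀ i → c ≤ φ i) → c ≤ E μ φ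
E-≥ μ {φ} {c} h = ≤-trans (≤-reflexive (sym (E-const μ c))) (E-mono μ h)

E-mono+ : ∀ {I} (μ : Mean I) {φ ψ : I → ℚ} {c} → (∀ i → φ i ≤ ψ i + c) → E μ φ ≤ E μ ψ + c
E-mono+ μ {φ} {ψ} {c} h = ≤-trans (E-mono μ h) (≤-reflexive (E-+ᶜ μ ψ c))

E-Bd : ∀ {I} (μ : Mean I) {φ : I → ℚ} → (∀ i → Bd (φ i)) → Bd (E μ φ)
E-Bd μ h = E-≤ μ (proj₁ ∘ h) , E-≥ μ (proj₂ ∘ h)

E-≈ : ∀ {I} (μ : Mean I) {φ ψ : I → ℚ} {θ} → (∀ i → φ i ≈[ θ ] ψ i) → E μ φ ≈[ θ ] E μ ψ
E-≈ μ h = E-mono+ μ (proj₁ ∘ h) , E-mono+ μ (proj₂ ∘ h)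

E-0≤ : ∀ {I} (μ : Mean I) {φ : I → ℚ} → (∀ i → 0ℚ ≤ φ i) → 0ℚ ≤ E μ φ
E-0≤ μ h = E-≥ μ h

-- The difference of the two sides is the variance of φ.
jensen : ∀ {I} (μ : Mean I) (φ : I → ℚ) → E μ φ * E μ φ ≤ 𝔼[ i ∈ μ ] (φ i * φ i)
jensen μ φ = ≤-by _ (E-0≤ μ λ i → 0≤sq (φ i - m)) (begin
  S                                                       ≡⟨ solve 2 (λ S m → S := m :* m :+ (S :+ ((:- m :* m :- m :* m) :+ m :* m))) refl S m ⟩
  m * m + (S + ((- m * m - m * m) + m * m))               ≡⟨ cong (λ t → m * m + (S + t)) (sym (trans (E-+ᶜ μ _ (m * m)) (cong (_+ m * m) (trans (E-*ʳ-lin) refl)))) ⟩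
  m * m + (S + 𝔼[ i ∈ μ ] ((- m * φ i - m * φ i) + m * m)) ≡⟨ cong (m * m +_) (sym (E-+ μ _ _)) ⟩
  m * m + 𝔼[ i ∈ μ ] (φ i * φ i + ((- m * φ i - m * φ i) + m * m)) ≡⟨ cong (m * m +_) (E-cong μ λ i →
       solve 2 (λ x m → x :* x :+ ((:- m :* x :- m :* x) :+ m :* m) := (x :- m) :* (x :- m)) refl (φ i) m) ⟩
  m * m + 𝔼[ i ∈ μ ] ((φ i - m) * (φ i - m)) ∎)
  where
  open ≡-Reasoning
  m S : ℚ
  m = E μ φ
  S = 𝔼[ i ∈ μ ] (φ i * φ i)
  E-*ʳ-lin : 𝔼[ i ∈ μ ] (- m * φ i - m * φ i) ≡ - m * m - m * m
  E-*ʳ-lin = trans (E-minus μ _ _) (cong₂ _-_ (E-*ˡ μ (- m) φ) (E-*ˡ μ m φ))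

E-sq : ∀ {I} (μ : Mean I) (φ : I → ℚ) → E μ φ * E μ φ ≡ 𝔼[ i ∈ μ ] 𝔼[ j ∈ μ ] (φ i * φ j)
E-sq μ φ = sym (trans (E-cong μ λ i → E-*ˡ μ (φ i) φ) (E-*ʳ μ (E μ φ) φ))

E-prod : ∀ {I J} (μ : Mean I) (ν : Mean J) (φ : I → ℚ) (ψ : J → ℚ) →
  E μ φ * E ν ψ ≡ 𝔼[ i ∈ μ ] 𝔼[ j ∈ ν ] (φ i * ψ j)
E-prod μ ν φ ψ = sym (trans (E-cong μ λ i → E-*ˡ ν (φ i) ψ) (E-*ʳ μ (E ν ψ) φ))

-- The weight α, of which only |α| ≤ 1 is known, disappears, and the rest is squared. This is how
-- unstructured functions are discarded below.
cauchy-schwarz : ∀ {O} (μ : Mean O) (α β : O → ℚ) → (∀ o → Bd (α o)) →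
  (𝔼[ o ∈ μ ] (α o * β o)) * (𝔼[ o ∈ μ ] (α o * β o)) ≤ 𝔼[ o ∈ μ ] (β o * β o)
cauchy-schwarz μ α β bα = ≤-trans (jensen μ _) (E-mono μ λ o → begin
  α o * β o * (α o * β o)   ≡⟨ solve 2 (λ a b → a :* b :* (a :* b) := a :* a :* (b :* b)) refl (α o) (β o) ⟩
  α o * α o * (β o * β o)   ≤⟨ *-monoʳ (0≤sq (β o)) (Bd-sq (bα o)) ⟩
  1ℚ * (β o * β o)          ≡⟨ *-identityˡ _ ⟩
  β o * β o                 ∎)
  where open ℚₚ.≤-Reasoning

sum-extract : ∀ n (φ : Fin n → ℚ) {c} → 0ℚ < c → sumF n (λ _ → c) ≤ sumF n φ → n ≢ 0 → ∃ λ i → c ≤ φ i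
sum-extract zero φ _ _ n≢0 = contradiction refl n≢0
sum-extract (suc n) φ {c} 0<c h _ with ℚₚ._≤?_ c (φ zero)
... | yes p = zero , p
sum-extract (suc zero) φ {c} 0<c h _ | no ¬p = contradiction (subst₂′ h) ¬p
  where
  subst₂′ : c + 0ℚ ≤ φ zero + 0ℚ → c ≤ φ zero
  subst₂′ h = subst (λ t → t ≤ φ zero) (+-identityʳ c) (subst (c + 0ℚ ≤_) (+-identityʳ (φ zero)) h)
sum-extract (suc (suc n)) φ {c} 0<c h _ | no ¬p =
  let (i , q) = sum-extract (suc n) (φ ∘ suc) 0<c rest (λ ()) in suc i , q
  where
  open ℚₚ.≤-Reasoning
  A B : ℚ
  A = sumF (suc n) (λ _ → c)
  B = sumF (suc n) (φ ∘ suc)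
  rest : A ≤ B
  rest = begin
    A                ≡⟨ solve 2 (λ a c → a := (c :+ a) :- c) refl A c ⟩
    (c + A) - c      ≤⟨ +-monoˡ-≤ (- c) h ⟩
    (φ zero + B) - c ≤⟨ +-monoˡ-≤ (- c) (+-monoˡ-≤ B (ℚₚ.<⇒≤ (ℚₚ.≰⇒> ¬p))) ⟩
    (c + B) - c      ≡⟨ solve 2 (λ c b → (c :+ b) :- c := b) refl c B ⟩
    B                ∎

opaque
  unfolding average
  -- Pigeonhole; at the very end it turns a large average over d into one popular difference.
  E-extract : ∀ {I} (μ : Mean I) (φ : I → ℚ) {c} → 0ℚ < c → c ≤ E μ φ → ∃ λ i → c ≤ φ i
  E-extract (uni n) φ {c} 0<c h = sum-extract (suc n) φ 0<c
    (*-cancelʳ-pos {c = 1/suc n} (ℚₚ.positive⁻¹ (1/suc n) ⦃ ℚₚ.normalize-pos 1 (suc n) ⦄)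
       (≤-trans (≤-reflexive (E-const (uni n) c)) h)) (λ ())
  E-extract (μ ⊗ ν) φ 0<c h =
    let (i , p) = E-extract μ _ 0<c h
        (j , q) = E-extract ν _ 0<c p
    in (i , j) , q

-- Losses, windows and van der Corput's inequality

data Step : Set where
  ln sq hf : Step

lose : Step → ℚ → ℚ
lose ln V = V
lose sq V = V * V
lose hf V = ½ * V

-- The list of losses is an index because a family of chains can be averaged only if all its members
-- lose in the same way. Identity, square and half all pass through averages by linearity or by
-- Jensen's inequality.
data Chain (e : ℚ) : List Step → ℚ → ℚ → Set where
  done : ∀ {V} → Chain e [] V V
  link : ∀ {s S V W V′} → lose s V ≤ W + e → Chain e S W V′ → Chain e (s ∷ S) V V′

infixr 5 _⟫_
_⟫_ : ∀ {e S S′ U V W} → Chain e S U V → Chain e S′ V W → Chain e (S ++ S′) U W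
done     ⟫ q = q
link p c ⟫ q = link p (c ⟫ q)

step : ∀ {e V W} s → lose s V ≤ W + e → Chain e (s ∷ []) V W
step s p = link p done

middle : ∀ {e s S V V′} → Chain e (s ∷ S) V V′ → ℚ
middle (link {W = W} _ _) = W

first-link : ∀ {e s S V V′} (c : Chain e (s ∷ S) V V′) → lose s V ≤ middle c + e
first-link (link p _) = p

later-links : ∀ {e s S V V′} (c : Chain e (s ∷ S) V V′) → Chain e S (middle c) V′
later-links (link _ c) = c

Chain-≡ : ∀ {e S U V W} → Chain e S U V → V ≡ W → Chain e S U W
Chain-≡ c refl = c

≡-Chain : ∀ {e S U V W} → U ≡ V → Chain e S V W → Chain e S U W
≡-Chain refl c = c

E-lose : ∀ {I} s (μ : Mean I) (V : I → ℚ) → lose s (E μ V) ≤ 𝔼[ i ∈ μ ] lose s (V i)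
E-lose ln μ V = ≤-refl
E-lose sq μ V = jensen μ V
E-lose hf μ V = ≤-reflexive (sym (E-*ˡ μ ½ V))

E-chain : ∀ {I e} S (μ : Mean I) {V V′ : I → ℚ} →
  (∀ i → Chain e S (V i) (V′ i)) → Chain e S (E μ V) (E μ V′)
E-chain []      μ c = Chain-≡ done (E-cong μ λ i → ends (c i))
  where
  ends : ∀ {e V V′} → Chain e [] V V′ → V ≡ V′
  ends done = refl
E-chain (s ∷ S) μ {V} c = link
  (≤-trans (E-lose s μ V) (E-mono+ μ λ i → first-link (c i)))
  (E-chain S μ λ i → later-links (c i))

infixr 8 _^^_
_^^_ : ℚ → ℕ → ℚ
κ ^^ zero  = 1ℚ
κ ^^ suc n = κ * κ ^^ n

0<^ : ∀ {κ} → 0ℚ < κ → ∀ m → 0ℚ < κ ^^ m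
0<^ 0<κ zero    = ℚₚ.positive⁻¹ 1ℚ
0<^ 0<κ (suc m) = *-pos 0<κ (0<^ 0<κ m)

-- If V ≥ κ^n, each of the three losses leaves at least κ^(2n+1). As κ ≤ 1/2, this is at least twice
-- κ^(2n+2), and one half pays for the error.
next : ℕ → ℕ
next n = suc (suc (n ℕ.+ n))

-- Opaque, because the unfolded exponent doubles with every step.
opaque
  nexts : List Step → ℕ → ℕ
  nexts []      n = n
  nexts (_ ∷ S) n = nexts S (next n)

n≤next : ∀ n → n ℕ.≤ next n
n≤next n = ℕₚ.m≤n⇒m≤1+n (ℕₚ.m≤n⇒m≤1+n (ℕₚ.m≤m+n n n))

opaque
  unfolding nexts
  n≤nexts : ∀ S n → n ℕ.≤ nexts S n
  n≤nexts []      n = ℕₚ.≤-refl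
  n≤nexts (_ ∷ S) n = ℕₚ.≤-trans (n≤next n) (n≤nexts S (next n))

module Threshold {κ : ℚ} (0≤κ : 0ℚ ≤ κ) (κ≤½ : κ ≤ ½) where

  0≤^ : ∀ n → 0ℚ ≤ κ ^^ n
  0≤^ zero    = 0≤1
  0≤^ (suc n) = 0≤* 0≤κ (0≤^ n)

  ^-+ : ∀ m n → κ ^^ (m ℕ.+ n) ≡ κ ^^ m * κ ^^ n
  ^-+ zero    n = sym (*-identityˡ _)
  ^-+ (suc m) n = trans (cong (κ *_) (^-+ m n)) (sym (*-assoc κ _ _))

  ^-half : ∀ n → κ ^^ suc n + κ ^^ suc n ≤ κ ^^ n
  ^-half n = ≤-by _ (0≤* (0≤* 0≤2 (0≤b-a κ≤½)) (0≤^ n))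
    (solve 2 (λ k t → t := (k :* t :+ k :* t) :+ ((con 1ℚ :+ con 1ℚ) :* (con ½ :- k)) :* t) refl κ (κ ^^ n))

  ^-anti : ∀ {m n} → m ℕ.≤ n → κ ^^ n ≤ κ ^^ m
  ^-anti {m} {n} m≤n with ℕₚ.m≤n⇒∃[o]m+o≡n m≤n
  ... | o , refl = go m o
    where
    dec : ∀ n → κ ^^ suc n ≤ κ ^^ n
    dec n = ≤-trans (≤-by _ (0≤^ (suc n)) refl) (^-half n)
    go : ∀ m o → κ ^^ (m ℕ.+ o) ≤ κ ^^ m
    go zero zero = ≤-refl
    go zero (suc o) = ≤-trans (dec o) (go zero o)
    go (suc m) o = *-monoˡ 0≤κ (go m o)

  reach-step : ∀ {e V W} s n → lose s V ≤ W + e → e ≤ κ ^^ next n → κ ^^ n ≤ V → κ ^^ next n ≤ W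
  reach-step {e} {V} {W} s n p q r = begin
    κ ^^ next n                                    ≤⟨ ≤-by _ (0≤b-a (^-half (suc (n ℕ.+ n))))
        (solve 2 (λ a b → b :- a := a :+ (b :- (a :+ a))) refl _ _) ⟩
    κ ^^ suc (n ℕ.+ n) - κ ^^ next n               ≤⟨ +-mono-≤ (bound s r) ≤-refl ⟩
    lose s V - κ ^^ next n                         ≤⟨ +-monoˡ-≤ _ p ⟩
    W + e - κ ^^ next n                            ≤⟨ ≤-by _ (0≤b-a q) (solve 3 (λ W e t → W := (W :+ e :- t) :+ (t :- e)) refl W e _) ⟩
    W                                              ∎
    where
    open ℚₚ.≤-Reasoning
    n≤ : n ℕ.≤ suc (n ℕ.+ n)
    n≤ = ℕₚ.m≤n⇒m≤1+n (ℕₚ.m≤m+n n n)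
    bound : ∀ s → κ ^^ n ≤ V → κ ^^ suc (n ℕ.+ n) ≤ lose s V
    bound ln r = ≤-trans (^-anti n≤) r
    bound sq r = ≤-trans (^-anti {n ℕ.+ n} (ℕₚ.n≤1+n _)) (≤-trans (≤-reflexive (^-+ n n)) (sq-mono (0≤^ n) r))
    bound hf r = *-mono 0≤κ (≤-trans (0≤^ n) r) κ≤½ (≤-trans (^-anti (ℕₚ.m≤m+n n n)) r)

  opaque
    unfolding nexts
    reach : ∀ {e V W} S n → Chain e S V W → e ≤ κ ^^ nexts S n → κ ^^ n ≤ V → κ ^^ nexts S n ≤ W
    reach []      n done       q r = r
    reach (s ∷ S) n (link p c) q r = reach S (next n) c q
      (reach-step s n p (≤-trans q (^-anti (n≤nexts S (next n)))) r)

-- A finitely supported probability measure on the integers, given by a parametrisation, so that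
-- repeated values carry weight.
record Win : Set₁ where
  constructor win
  field
    {Ix} : Set
    mean : Mean Ix
    at   : Ix → ℤ
open Win public

avg : Win → (ℤ → ℚ) → ℚ
avg W φ = 𝔼[ i ∈ mean W ] φ (at W i)

-- The autocorrelation of the measure. It is symmetric under negation, which makes averaging along
-- it self-adjoint.
Diff : Win → Win
Diff W = win (mean W ⊗ mean W) λ (i , j) → at W i -ᶻ at W j

Scale : ℤ → Win → Win
Scale c W = win (mean W) λ i → c *ᶻ at W i

-- Closeness of the measure to its translate in total variation, expressed by testing against
-- functions bounded by 1.
record Inv (θ : ℚ) (W : Win) (s : ℤ) : Set where
  constructor inv
  field shift : ∀ (φ : ℤ → ℚ) → (∀ n → Bd (φ n)) → avg W (λ n → φ (n +ᶻ s)) ≈[ θ ] avg W φ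
open Inv public

Inv-Diff : ∀ {θ W s} → Inv θ W s → Inv θ (Diff W) s
Inv-Diff {θ} {W} {s} h = inv λ φ b → ≈-≡ˡ (E-swap M M _) (≈-≡ʳ (E-swap M M _) (E-≈ M λ j →
  ≈-≡ˡ (E-cong M λ i → cong φ (eq (at W i) (at W j) s)) (shift h (λ n → φ (n -ᶻ at W j)) (λ n → b _))))
  where
  M = mean W
  eq : ∀ a b s → (a +ᶻ s) -ᶻ b ≡ a -ᶻ b +ᶻ s
  eq a b s = solveᶻ 3 (λ a b s → (a ⊞ s) ⊟ b ≔ a ⊟ b ⊞ s) refl a b s

avg-in : ∀ {θ Σ} (𝒟 : Win) (σ : Mean Σ) (h : Σ → ℤ) → (∀ i → Inv θ 𝒟 (h i)) →
  (a : ℤ → ℚ) → (∀ n → Bd (a n)) →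
  avg 𝒟 a ≈[ θ ] avg 𝒟 (λ d → 𝔼[ i ∈ σ ] a (d +ᶻ h i))
avg-in {θ} 𝒟 σ h ih a b =
  ≈-≡ʳ (E-swap σ (mean 𝒟) _) (≈-≡ˡ (E-const σ _) (E-≈ σ λ i → ≈-sym (shift (ih i) a b)))

-- The invariance of the window puts an average over shifts inside the average over d, and
-- Cauchy-Schwarz moves the square inwards. Squares of numbers in [-1, 1] differ by at most twice
-- the difference of the numbers, hence 2θ.
vdc-pt : ∀ {θ Σ} (𝒟 : Win) (σ : Mean Σ) (h : Σ → ℤ) → (∀ i → Inv θ 𝒟 (h i)) →
  (a : ℤ → ℚ) → (∀ n → Bd (a n)) →
  avg 𝒟 a * avg 𝒟 a ≤
  avg 𝒟 (λ d → (𝔼[ i ∈ σ ] a (d +ᶻ h i)) * (𝔼[ i ∈ σ ] a (d +ᶻ h i))) + (θ + θ)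
vdc-pt 𝒟 σ h ih a b = ≤-trans
  (≈-sq (E-Bd (mean 𝒟) λ d → b _) (E-Bd (mean 𝒟) λ d → E-Bd σ λ i → b _) (avg-in 𝒟 σ h ih a b))
  (+-monoˡ-≤ _ (jensen (mean 𝒟) _))

vdc : ∀ {O θ Σ} (μ : Mean O) (𝒟 : Win) (σ : Mean Σ) (h : Σ → ℤ) → (∀ i → Inv θ 𝒟 (h i)) →
  (α : O → ℚ) → (∀ o → Bd (α o)) → (a : O → ℤ → ℚ) → (∀ o n → Bd (a o n)) →
  (𝔼[ o ∈ μ ] (α o * avg 𝒟 (a o))) * (𝔼[ o ∈ μ ] (α o * avg 𝒟 (a o))) ≤
  𝔼[ o ∈ μ ] avg 𝒟 (λ d → 𝔼[ i ∈ σ ] 𝔼[ j ∈ σ ] (a o (d +ᶻ h i) * a o (d +ᶻ h j))) + (θ + θ)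
vdc μ 𝒟 σ h ih α bα a ba = ≤-trans (cauchy-schwarz μ α _ bα) (E-mono+ μ λ o →
  ≤-trans (vdc-pt 𝒟 σ h ih (a o) (ba o))
    (≤-reflexive (cong (_+ _) (E-cong (mean 𝒟) λ d → E-sq σ _))))

-- Cauchy–Schwarz in two variables: factors missing one of the variables disappear.
box-cauchy-schwarz : ∀ {O P Q} (μ : Mean O) (ν : Mean P) (ρ : Mean Q)
  (α : O → P → ℚ) (β : O → Q → ℚ) (G : O → P → Q → ℚ) →
  (∀ o p → Bd (α o p)) → (∀ o q → Bd (β o q)) →
  let V = 𝔼[ o ∈ μ ] 𝔼[ p ∈ ν ] 𝔼[ q ∈ ρ ] (α o p * (β o q * G o p q)) in
  (V * V) * (V * V) ≤
  𝔼[ o ∈ μ ] 𝔼[ p ∈ ν ] 𝔼[ p′ ∈ ν ] 𝔼[ q ∈ ρ ] 𝔼[ q′ ∈ ρ ]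
    ((G o p q * G o p′ q) * (G o p q′ * G o p′ q′))
box-cauchy-schwarz μ ν ρ α β G bα bβ = begin
  (V * V) * (V * V)  ≤⟨ sq-mono (0≤sq V) V²≤ ⟩
  V₁ * V₁            ≤⟨ cauchy-schwarz (μ ⊗ (ρ ⊗ ρ)) (λ (o , q , q′) → β o q * β o q′) (λ (o , q , q′) → K o q q′)
                          (λ (o , q , q′) → Bd-* (bβ o q) (bβ o q′)) ⟩
  𝔼[ o ∈ μ ] 𝔼[ q ∈ ρ ] 𝔼[ q′ ∈ ρ ] (K o q q′ * K o q q′)
                     ≡⟨ E-cong μ (λ o → trans
                          (E-cong ρ λ q → E-cong ρ λ q′ → trans (E-sq ν _) (E-cong ν λ p → E-cong ν λ p′ → mix _ _ _ _))
                          (E-swap (ρ ⊗ ρ) (ν ⊗ ν) (λ (q , q′) (p , p′) → (G o p q * G o p′ q) * (G o p q′ * G o p′ q′)))) ⟩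
  𝔼[ o ∈ μ ] 𝔼[ p ∈ ν ] 𝔼[ p′ ∈ ν ] 𝔼[ q ∈ ρ ] 𝔼[ q′ ∈ ρ ]
    ((G o p q * G o p′ q) * (G o p q′ * G o p′ q′)) ∎
  where
  open ℚₚ.≤-Reasoning
  K : _ → _ → _ → ℚ
  K o q q′ = 𝔼[ p ∈ ν ] (G o p q * G o p q′)
  V V₁ : ℚ
  V  = 𝔼[ o ∈ μ ] 𝔼[ p ∈ ν ] 𝔼[ q ∈ ρ ] (α o p * (β o q * G o p q))
  V₁ = 𝔼[ o ∈ μ ] 𝔼[ q ∈ ρ ] 𝔼[ q′ ∈ ρ ] (β o q * β o q′ * K o q q′)
  V²≤ : V * V ≤ V₁
  V²≤ = begin
    V * V
      ≡⟨ cong (λ t → t * t) (E-cong μ λ o → E-cong ν λ p → E-*ˡ ρ (α o p) _) ⟩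
    _ ≤⟨ cauchy-schwarz (μ ⊗ ν) (λ (o , p) → α o p) (λ (o , p) → 𝔼[ q ∈ ρ ] (β o q * G o p q)) (λ (o , p) → bα o p) ⟩
    𝔼[ o ∈ μ ] 𝔼[ p ∈ ν ] ((𝔼[ q ∈ ρ ] (β o q * G o p q)) * (𝔼[ q ∈ ρ ] (β o q * G o p q)))
      ≡⟨ E-cong μ (λ o → trans (E-cong ν λ p → trans (E-sq ρ _) (E-cong ρ λ q → E-cong ρ λ q′ → mix _ _ _ _))
           (trans (E-swap ν (ρ ⊗ ρ) (λ p (q , q′) → β o q * β o q′ * (G o p q * G o p q′)))
                  (E-cong ρ λ q → E-cong ρ λ q′ → E-*ˡ ν (β o q * β o q′) _))) ⟩
    V₁ ∎

-- Box norms

2ᶻ : ℤ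
2ᶻ = ℤ.+ 2

-- An action of the integers with an invariant mean. It is kept abstract because the argument runs
-- on the cyclic group with the action speeded up by a factor Q that depends on the stage of the
-- energy increment.
record System : Set₁ where
  infixl 6 _⊕_
  field
    X       : Set
    space   : Mean X
    _⊕_     : X → ℤ → X
    ⊕-assoc : ∀ x m n → x ⊕ m ⊕ n ≡ x ⊕ (m +ᶻ n)
    ⊕-zero  : ∀ x → x ⊕ 0ℤ ≡ x
    E-inv   : ∀ (φ : X → ℚ) n → E space (φ ∘ (_⊕ n)) ≡ E space φ

module Dynamics (𝒮 : System) where
  open System 𝒮 public

  sh : ∀ (f : X → ℚ) x {a b c} → a +ᶻ b ≡ c → f (x ⊕ a ⊕ b) ≡ f (x ⊕ c)
  sh f x {a} {b} e = cong f (trans (⊕-assoc x a b) (cong (x ⊕_) e))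

  E-shift : ∀ {I} (μ : Mean I) (s : I → ℤ) (φ : X → I → ℚ) →
    𝔼[ x ∈ space ] 𝔼[ i ∈ μ ] φ x i ≡ 𝔼[ x ∈ space ] 𝔼[ i ∈ μ ] φ (x ⊕ s i) i
  E-shift μ s φ = trans (E-swap space μ φ) (trans
    (E-cong μ λ i → sym (E-inv (λ x → φ x i) (s i))) (E-swap μ space _))

  E-shifted : ∀ {I} (μ : Mean I) (s : I → ℤ) {φ ψ : X → I → ℚ} →
    (∀ x i → φ (x ⊕ s i) i ≡ ψ x i) →
    𝔼[ x ∈ space ] 𝔼[ i ∈ μ ] φ x i ≡ 𝔼[ x ∈ space ] 𝔼[ i ∈ μ ] ψ x i
  E-shifted μ s h = trans (E-shift μ s _) (E-cong space λ x → E-cong μ λ i → h x i)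

  pair : (X → ℚ) → ℤ → ℤ → X → ℚ
  pair F m n x = F (x ⊕ m) * F (x ⊕ n)

  -- The Gowers box norm raised to the power 2^k for k windows: the mean of the product of F over
  -- the vertices of a k-dimensional box. Without the root it stays rational.
  box : List Win → (X → ℚ) → ℚ
  box []       F = E space F
  box (W ∷ Ws) F = 𝔼[ i ∈ mean W ] 𝔼[ j ∈ mean W ] box Ws (pair F (at W i) (at W j))

  Bdd : (X → ℚ) → Set
  Bdd F = ∀ x → Bd (F x)

  pair-Bd : ∀ {F} m n → Bdd F → Bdd (pair F m n)
  pair-Bd m n b x = Bd-* (b _) (b _)

  box-Bd : ∀ Ws {F} → Bdd F → Bd (box Ws F)
  box-Bd []       b = E-Bd space b
  box-Bd (W ∷ Ws) b = E-Bd (mean W) λ i → E-Bd (mean W) λ j → box-Bd Ws (pair-Bd _ _ b)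

  box-cong : ∀ Ws {F G : X → ℚ} → (∀ x → F x ≡ G x) → box Ws F ≡ box Ws G
  box-cong []       h = E-cong space h
  box-cong (W ∷ Ws) h = E-cong (mean W) λ i → E-cong (mean W) λ j →
    box-cong Ws λ x → cong₂ _*_ (h _) (h _)

  box-translate : ∀ Ws F c → box Ws (λ x → F (x ⊕ c)) ≡ box Ws F
  box-translate []       F c = E-inv F c
  box-translate (W ∷ Ws) F c = E-cong (mean W) λ i → E-cong (mean W) λ j → trans
    (box-cong Ws λ x → cong₂ _*_ (comm x (at W i)) (comm x (at W j)))
    (box-translate Ws (pair F (at W i) (at W j)) c)
    where
    comm : ∀ x n → F (x ⊕ n ⊕ c) ≡ F (x ⊕ c ⊕ n)
    comm x n = trans (sh F x (solveᶻ 2 (λ n c → n ⊞ c ≔ c ⊞ n) refl n c)) (sym (sh F x refl))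

  smooth : Win → (X → ℚ) → X → ℚ
  smooth W F x = avg W λ n → F (x ⊕ n)

  box₁ : ∀ W F → box (W ∷ []) F ≡ 𝔼[ x ∈ space ] (smooth W F x * smooth W F x)
  box₁ W F = trans (E-swap (mean W ⊗ mean W) space _) (E-cong space λ x → sym (E-sq (mean W) _))

  0≤box₁ : ∀ W F → 0ℚ ≤ box (W ∷ []) F
  0≤box₁ W F = subst (0ℚ ≤_) (sym (box₁ W F)) (E-0≤ space λ x → 0≤sq _)

  -- An element (F , e) of the list stands for the factor F (x ⊕ e d).
  lin : List ((X → ℚ) × ℤ) → X → ℤ → ℚ
  lin []            x d = 1ℚ
  lin ((F , e) ∷ r) x d = F (x ⊕ e *ᶻ d) * lin r x d

  form : Win → List ((X → ℚ) × ℤ) → ℚ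
  form 𝒟 r = 𝔼[ x ∈ space ] avg 𝒟 (lin r x)

  infixr 5 _◂_
  data AllBdd : List ((X → ℚ) × ℤ) → Set where
    nil : AllBdd []
    _◂_ : ∀ {F e r} → Bdd F → AllBdd r → AllBdd ((F , e) ∷ r)

  lin-Bd : ∀ {r} → AllBdd r → ∀ x d → Bd (lin r x d)
  lin-Bd nil      x d = Bd-1
  lin-Bd (b ◂ bs) x d = Bd-* (b _) (lin-Bd bs x d)

  double : ℤ → ℤ → ℤ → (X → ℚ) × ℤ → (X → ℚ) × ℤ
  double e l l′ (F , e′) = pair F ((e′ -ᶻ e) *ᶻ l) ((e′ -ᶻ e) *ᶻ l′) , e′ -ᶻ e

  relin : ℤ → (X → ℚ) × ℤ → (X → ℚ) × ℤ
  relin e (F , e′) = F , e′ -ᶻ e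

  lin-relin : ∀ e r x d → lin r (x ⊕ -ᶻ (e *ᶻ d)) d ≡ lin (map (relin e) r) x d
  lin-relin e []             x d = refl
  lin-relin e ((F , e′) ∷ r) x d = cong₂ _*_ (sh F x (eq e e′ d)) (lin-relin e r x d)
    where
    eq : ∀ e e′ d → -ᶻ (e *ᶻ d) +ᶻ e′ *ᶻ d ≡ (e′ -ᶻ e) *ᶻ d
    eq e e′ d = solveᶻ 3 (λ e e′ d → ⊟ (e ⊠ d) ⊞ e′ ⊠ d ≔ (e′ ⊟ e) ⊠ d) refl e e′ d

  relin-Bdd : ∀ e {r} → AllBdd r → AllBdd (map (relin e) r)
  relin-Bdd e nil      = nil
  relin-Bdd e (b ◂ bs) = b ◂ relin-Bdd e bs

  double-Bdd : ∀ e l l′ {r} → AllBdd r → AllBdd (map (double e l l′) r)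
  double-Bdd e l l′ nil      = nil
  double-Bdd e l l′ (b ◂ bs) = pair-Bd _ _ b ◂ double-Bdd e l l′ bs

  lin-double : ∀ e l l′ r x d →
    lin (map (relin e) r) x (d +ᶻ l) * lin (map (relin e) r) x (d +ᶻ l′) ≡ lin (map (double e l l′) r) x d
  lin-double e l l′ []             x d = *-identityˡ 1ℚ
  lin-double e l l′ ((F , e′) ∷ r) x d = trans
    (solve 4 (λ a b c d → (a :* b) :* (c :* d) := (a :* c) :* (b :* d)) refl
      (F (x ⊕ (e′ -ᶻ e) *ᶻ (d +ᶻ l))) _ (F (x ⊕ (e′ -ᶻ e) *ᶻ (d +ᶻ l′))) _)
    (cong₂ _*_ (cong₂ _*_ (eq l) (eq l′)) (lin-double e l l′ r x d))
    where
    eq : ∀ l → F (x ⊕ (e′ -ᶻ e) *ᶻ (d +ᶻ l)) ≡ F (x ⊕ (e′ -ᶻ e) *ᶻ d ⊕ (e′ -ᶻ e) *ᶻ l)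
    eq l = sym (sh F x (solveᶻ 3 (λ a d l → a ⊠ d ⊞ a ⊠ l ≔ a ⊠ (d ⊞ l)) refl (e′ -ᶻ e) d l))

  -- Translating x by - e d frees the first factor of d, so that Cauchy-Schwarz discards it. Each
  -- remaining factor is doubled along shifts from ℒ multiplied by its slope relative to e.
  eliminate : ∀ {e₀ θ} 𝒟 (ℒ : Win) → (∀ i → Inv θ 𝒟 (at ℒ i)) → θ + θ ≤ e₀ → ∀ {F e r} →
    Bdd F → AllBdd r → Chain e₀ (sq ∷ []) (form 𝒟 ((F , e) ∷ r))
      (𝔼[ i ∈ mean ℒ ] 𝔼[ j ∈ mean ℒ ] form 𝒟 (map (double e (at ℒ i) (at ℒ j)) r))
  eliminate {e₀} {θ} 𝒟 ℒ il small {F} {e} {r} bF br = step sq (begin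
    form 𝒟 ((F , e) ∷ r) * form 𝒟 ((F , e) ∷ r)
      ≡⟨ cong (λ t → t * t) (trans
           (E-shifted (mean 𝒟) (λ i → -ᶻ (e *ᶻ at 𝒟 i)) λ x i → cong₂ _*_
             (sh F x (solveᶻ 1 (λ a → ⊟ a ⊞ a ≔ # 0ℤ) refl (e *ᶻ at 𝒟 i))) (lin-relin e r x (at 𝒟 i)))
           (E-cong space λ x → E-*ˡ (mean 𝒟) (F (x ⊕ 0ℤ)) _)) ⟩
    _ ≤⟨ vdc space 𝒟 (mean ℒ) (at ℒ) il (λ x → F (x ⊕ 0ℤ)) (λ x → bF _)
           (lin (map (relin e) r)) (lin-Bd (relin-Bdd e br)) ⟩
    _ ≡⟨ cong (_+ (θ + θ)) (trans
           (E-cong space λ x → E-cong (mean 𝒟) λ d → E-cong (mean ℒ) λ i → E-cong (mean ℒ) λ j → lin-double e _ _ r x _)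
           (E-swap (space ⊗ mean 𝒟) (mean ℒ ⊗ mean ℒ) λ (x , d) (i , j) → lin (map (double e (at ℒ i) (at ℒ j)) r) x (at 𝒟 d))) ⟩
    _ ≤⟨ +-monoʳ-≤ _ small ⟩
    _ ∎)
    where open ℚₚ.≤-Reasoning

  form-last : ∀ 𝒟 F e → form 𝒟 ((F , e) ∷ []) ≡ E space F
  form-last 𝒟 F e = trans (E-swap space (mean 𝒟) _) (trans
    (E-cong (mean 𝒟) λ i → trans (E-cong space λ x → *-identityʳ _) (E-inv F (e *ᶻ at 𝒟 i)))
    (E-const (mean 𝒟) _))

  -- Each elimination subtracts the eliminated slope from all the others, so differences of the
  -- original slopes persist. The last factor is thus doubled along ℒ scaled by e₄ - e₁, e₄ - e₂ and
  -- e₄ - e₃.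
  eliminate₃ : ∀ {e₀ θ} 𝒟 (ℒ : Win) → (∀ i → Inv θ 𝒟 (at ℒ i)) → θ + θ ≤ e₀ →
    ∀ {F₁ F₂ F₃ F₄ e₁ e₂ e₃ e₄ c₁ c₂ c₃} → Bdd F₁ → Bdd F₂ → Bdd F₃ → Bdd F₄ →
    e₄ -ᶻ e₁ ≡ c₁ → e₄ -ᶻ e₂ ≡ c₂ → e₄ -ᶻ e₃ ≡ c₃ →
    Chain e₀ (sq ∷ sq ∷ sq ∷ []) (form 𝒟 ((F₁ , e₁) ∷ (F₂ , e₂) ∷ (F₃ , e₃) ∷ (F₄ , e₄) ∷ []))
      (box (Scale c₁ ℒ ∷ Scale c₂ ℒ ∷ Scale c₃ ℒ ∷ []) F₄)
  eliminate₃ {e₀} {θ} 𝒟 ℒ il small {F₁} {F₂} {F₃} {F₄} {e₁} {e₂} {e₃} {e₄} b₁ b₂ b₃ b₄ refl refl refl =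
    _⟫_ {S = sq ∷ []} (eliminate 𝒟 ℒ il small b₁ (b₂ ◂ b₃ ◂ b₄ ◂ nil))
      (E-chain (sq ∷ sq ∷ []) M (λ i → E-chain (sq ∷ sq ∷ []) M λ j → second i j))
    where
    M = mean ℒ
    G₃ : Ix ℒ → Ix ℒ → X → ℚ
    G₃ i j = pair F₃ ((e₃ -ᶻ e₁) *ᶻ at ℒ i) ((e₃ -ᶻ e₁) *ᶻ at ℒ j)
    G₄ : Ix ℒ → Ix ℒ → X → ℚ
    G₄ i j = pair F₄ ((e₄ -ᶻ e₁) *ᶻ at ℒ i) ((e₄ -ᶻ e₁) *ᶻ at ℒ j)
    eq : ∀ a b c → (a -ᶻ c) -ᶻ (b -ᶻ c) ≡ a -ᶻ b
    eq a b c = solveᶻ 3 (λ a b c → (a ⊟ c) ⊟ (b ⊟ c) ≔ a ⊟ b) refl a b c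
    third : ∀ G₃ G₄ e₃ e₄ c → e₄ -ᶻ e₃ ≡ c → Bdd G₃ → Bdd G₄ →
      Chain e₀ (sq ∷ []) (form 𝒟 ((G₃ , e₃) ∷ (G₄ , e₄) ∷ [])) (box (Scale c ℒ ∷ []) G₄)
    third G₃ G₄ e₃ e₄ c refl b₃ b₄ = Chain-≡ {S = sq ∷ []} (eliminate 𝒟 ℒ il small b₃ (b₄ ◂ nil))
      (E-cong M λ i → E-cong M λ j → form-last 𝒟 (pair G₄ (c *ᶻ at ℒ i) (c *ᶻ at ℒ j)) c)
    second : ∀ i j → Chain e₀ (sq ∷ sq ∷ [])
      (form 𝒟 (map (double e₁ (at ℒ i) (at ℒ j)) ((F₂ , e₂) ∷ (F₃ , e₃) ∷ (F₄ , e₄) ∷ [])))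
      (box (Scale (e₄ -ᶻ e₂) ℒ ∷ Scale (e₄ -ᶻ e₃) ℒ ∷ []) (G₄ i j))
    second i j = _⟫_ {S = sq ∷ []} (eliminate 𝒟 ℒ il small (pair-Bd _ _ b₂) (pair-Bd _ _ b₃ ◂ pair-Bd _ _ b₄ ◂ nil))
      (E-chain (sq ∷ []) M λ k → E-chain (sq ∷ []) M λ l →
        Chain-≡ {S = sq ∷ []}
         (third _ (pair (G₄ i j) (((e₄ -ᶻ e₁) -ᶻ (e₂ -ᶻ e₁)) *ᶻ at ℒ k) (((e₄ -ᶻ e₁) -ᶻ (e₂ -ᶻ e₁)) *ᶻ at ℒ l)) _ _ (e₄ -ᶻ e₃)
           (trans (cong₂ _-ᶻ_ (eq e₄ e₂ e₁) (eq e₃ e₂ e₁)) (eq e₄ e₃ e₂))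
           (pair-Bd _ _ (pair-Bd _ _ b₃)) (pair-Bd _ _ (pair-Bd _ _ b₄)))
         (cong (λ t → box (Scale (e₄ -ᶻ e₃) ℒ ∷ []) (pair (G₄ i j) (t *ᶻ at ℒ k) (t *ᶻ at ℒ l))) (eq e₄ e₂ e₁)))

-- Linearisation of the counting operator

module Count (𝒮 : System) (q : ℤ) where
  open Dynamics 𝒮 public

  Λ : Win → (X → ℚ) → (X → ℚ) → (X → ℚ) → ℚ
  Λ 𝒟 f₀ f₁ f₂ = 𝔼[ x ∈ space ] (f₀ x * avg 𝒟 λ d → f₁ (x ⊕ d) * f₂ (x ⊕ q *ᶻ (d *ᶻ d)))

  slope intercept : ℤ → ℤ → ℤ
  slope     h k = 2ᶻ *ᶻ q *ᶻ (h +ᶻ k)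
  intercept h k = q *ᶻ ((h +ᶻ k) *ᶻ (h +ᶻ k)) -ᶻ k

  factor : (X → ℚ) → ℤ → ℤ → (X → ℚ) × ℤ
  factor f h k = (λ y → f (y ⊕ intercept h k)) , slope h k

  -- Slopes are proportional to h + k. With the factor for (h′, k′) in last place, its slope exceeds
  -- the others by multiples of k′ - k, h′ - h and their sum, which become the directions of a box
  -- norm.
  fourForm : Win → (X → ℚ) → (h h′ k k′ : ℤ) → ℚ
  fourForm 𝒟 f h h′ k k′ = form 𝒟 (factor f h′ k ∷ factor f h k′ ∷ factor f h k ∷ factor f h′ k′ ∷ [])

  -- Two van der Corput steps remove f₀ and then f₁; the remaining four factors are linear in d.
  linearise : ∀ {e θ A B} 𝒟 (σ : Mean A) (h : A → ℤ) (τ : Mean B) (k : B → ℤ) →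
    (∀ i → Inv θ 𝒟 (h i)) → (∀ i → Inv θ 𝒟 (k i)) → θ + θ ≤ e →
    ∀ {f₀ f₁ f} → Bdd f₀ → Bdd f₁ → Bdd f →
    Chain e (sq ∷ sq ∷ []) (Λ 𝒟 f₀ f₁ f)
      (𝔼[ i ∈ σ ] 𝔼[ j ∈ σ ] 𝔼[ r ∈ τ ] 𝔼[ s ∈ τ ] fourForm 𝒟 f (h i) (h j) (k r) (k s))
  linearise {e} {θ} {A} {B} 𝒟 σ h τ k invh invk small {f₀} {f₁} {f} b₀ b₁ b =
    link (≤-trans step₁ (+-monoʳ-≤ _ small)) (step sq (≤-trans step₂ (+-monoʳ-≤ _ small)))
    where
    open ℚₚ.≤-Reasoning
    M = mean 𝒟
    a₁ : X → ℤ → ℚ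
    a₁ x d = f₁ (x ⊕ d) * f (x ⊕ q *ᶻ (d *ᶻ d))
    b₁′ : X → A → ℤ → ℚ
    b₁′ x i d = f (x ⊕ (q *ᶻ ((d +ᶻ h i) *ᶻ (d +ᶻ h i)) -ᶻ d))
    b₂ : A × A × X → ℤ → ℚ
    b₂ (i , j , x) d = b₁′ x i d * b₁′ x j d
    α : A × A × X → ℚ
    α (i , j , x) = f₁ (x ⊕ h i) * f₁ (x ⊕ h j)
    Q₁ : ℚ
    Q₁ = 𝔼[ o ∈ σ ⊗ (σ ⊗ space) ] (α o * avg 𝒟 (b₂ o))
    -- Replacing x by x - d frees f₁ of d; the copies of f then sit at q (d + h)² - d.
    shift₁ : ∀ x d i → a₁ (x ⊕ -ᶻ d) (d +ᶻ h i) ≡ f₁ (x ⊕ h i) * b₁′ x i d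
    shift₁ x d i = cong₂ _*_
      (sh f₁ x (solveᶻ 2 (λ d h → ⊟ d ⊞ (d ⊞ h) ≔ h) refl d (h i)))
      (sh f x (solveᶻ 3 (λ q d h → ⊟ d ⊞ q ⊠ ((d ⊞ h) ⊠ (d ⊞ h)) ≔ q ⊠ ((d ⊞ h) ⊠ (d ⊞ h)) ⊟ d) refl q d (h i)))
    step₁ : Λ 𝒟 f₀ f₁ f * Λ 𝒟 f₀ f₁ f ≤ Q₁ + (θ + θ)
    step₁ = begin
      Λ 𝒟 f₀ f₁ f * Λ 𝒟 f₀ f₁ f
        ≤⟨ vdc space 𝒟 σ h invh f₀ b₀ a₁ (λ x d → Bd-* (b₁ _) (b _)) ⟩
      _ ≡⟨ cong (_+ (θ + θ)) (trans
             (E-shifted M (λ d → -ᶻ at 𝒟 d) (λ x d → E-cong σ λ i → E-cong σ λ j → trans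
               (cong₂ _*_ (shift₁ x (at 𝒟 d) i) (shift₁ x (at 𝒟 d) j)) (mix _ _ _ _)))
             (trans (E-swap (space ⊗ M) (σ ⊗ σ) λ (x , d) (i , j) → α (i , j , x) * b₂ (i , j , x) (at 𝒟 d))
               (E-cong (σ ⊗ σ) λ (i , j) → E-cong space λ x → E-*ˡ M (α (i , j , x)) _))) ⟩
      Q₁ + (θ + θ) ∎
    -- A second translation cancels the quadratic term, since (d + k + h)² - d² is linear in d.
    shift₂ : ∀ x d r i → b₁′ (x ⊕ -ᶻ (q *ᶻ (d *ᶻ d) -ᶻ d)) i (d +ᶻ k r) ≡
      f (x ⊕ slope (h i) (k r) *ᶻ d ⊕ intercept (h i) (k r))
    shift₂ x d r i = trans (sh f x (solveᶻ 4 (λ q d h k →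
        ⊟ (q ⊠ (d ⊠ d) ⊟ d) ⊞ (q ⊠ ((d ⊞ k ⊞ h) ⊠ (d ⊞ k ⊞ h)) ⊟ (d ⊞ k))
        ≔ # 2ᶻ ⊠ q ⊠ (h ⊞ k) ⊠ d ⊞ (q ⊠ ((h ⊞ k) ⊠ (h ⊞ k)) ⊟ k)) refl q d (h i) (k r)))
      (sym (sh f x refl))
    step₂ : Q₁ * Q₁ ≤ 𝔼[ i ∈ σ ] 𝔼[ j ∈ σ ] 𝔼[ r ∈ τ ] 𝔼[ s ∈ τ ] fourForm 𝒟 f (h i) (h j) (k r) (k s) + (θ + θ)
    step₂ = begin
      Q₁ * Q₁
        ≤⟨ vdc (σ ⊗ (σ ⊗ space)) 𝒟 τ k invk α (λ _ → Bd-* (b₁ _) (b₁ _)) b₂ (λ _ _ → Bd-* (b _) (b _)) ⟩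
      _ ≡⟨ cong (_+ (θ + θ)) (E-cong σ λ i → E-cong σ λ j → trans
             (E-shifted M (λ d → -ᶻ (q *ᶻ (at 𝒟 d *ᶻ at 𝒟 d) -ᶻ at 𝒟 d)) λ x d → E-cong τ λ r → E-cong τ λ s → trans
               (cong₂ _*_ (cong₂ _*_ (shift₂ x (at 𝒟 d) r i) (shift₂ x (at 𝒟 d) r j))
                          (cong₂ _*_ (shift₂ x (at 𝒟 d) s i) (shift₂ x (at 𝒟 d) s j)))
               (solve 4 (λ a b c d → (a :* b) :* (c :* d) := b :* (c :* (a :* (d :* con 1ℚ)))) refl
                 (f (x ⊕ slope (h i) (k r) *ᶻ at 𝒟 d ⊕ intercept (h i) (k r)))
                 (f (x ⊕ slope (h j) (k r) *ᶻ at 𝒟 d ⊕ intercept (h j) (k r)))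
                 (f (x ⊕ slope (h i) (k s) *ᶻ at 𝒟 d ⊕ intercept (h i) (k s)))
                 (f (x ⊕ slope (h j) (k s) *ᶻ at 𝒟 d ⊕ intercept (h j) (k s)))))
             (E-swap (space ⊗ M) (τ ⊗ τ) λ (x , d) (r , s) →
               lin (factor f (h j) (k r) ∷ factor f (h i) (k s) ∷ factor f (h i) (k r) ∷ factor f (h j) (k s) ∷ []) x (at 𝒟 d))) ⟩
      _ ∎

  fourForm-box : ∀ {e θ} 𝒟 (ℒ : Win) → (∀ i → Inv θ 𝒟 (at ℒ i)) → θ + θ ≤ e → ∀ {f} → Bdd f →
    ∀ h h′ k k′ {a b} → h′ -ᶻ h ≡ a → k′ -ᶻ k ≡ b →
    Chain e (sq ∷ sq ∷ sq ∷ []) (fourForm 𝒟 f h h′ k k′)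
      (box (Scale (2ᶻ *ᶻ q *ᶻ b) ℒ ∷ Scale (2ᶻ *ᶻ q *ᶻ a) ℒ ∷ Scale (2ᶻ *ᶻ q *ᶻ (a +ᶻ b)) ℒ ∷ []) f)
  fourForm-box 𝒟 ℒ il small {f} bf h h′ k k′ refl refl =
    Chain-≡ {S = sq ∷ sq ∷ sq ∷ []}
      (eliminate₃ 𝒟 ℒ il small (tb (intercept h′ k)) (tb (intercept h k′)) (tb (intercept h k)) (tb (intercept h′ k′))
        (solveᶻ 5 (λ q h h′ k k′ → # 2ᶻ ⊠ q ⊠ (h′ ⊞ k′) ⊟ # 2ᶻ ⊠ q ⊠ (h′ ⊞ k) ≔ # 2ᶻ ⊠ q ⊠ (k′ ⊟ k)) refl q h h′ k k′)
        (solveᶻ 5 (λ q h h′ k k′ → # 2ᶻ ⊠ q ⊠ (h′ ⊞ k′) ⊟ # 2ᶻ ⊠ q ⊠ (h ⊞ k′) ≔ # 2ᶻ ⊠ q ⊠ (h′ ⊟ h)) refl q h h′ k k′)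
        (solveᶻ 5 (λ q h h′ k k′ → # 2ᶻ ⊠ q ⊠ (h′ ⊞ k′) ⊟ # 2ᶻ ⊠ q ⊠ (h ⊞ k) ≔ # 2ᶻ ⊠ q ⊠ ((h′ ⊟ h) ⊞ (k′ ⊟ k))) refl q h h′ k k′))
      (box-translate (Scale (2ᶻ *ᶻ q *ᶻ (k′ -ᶻ k)) ℒ ∷ Scale (2ᶻ *ᶻ q *ᶻ (h′ -ᶻ h)) ℒ ∷ Scale (2ᶻ *ᶻ q *ᶻ ((h′ -ᶻ h) +ᶻ (k′ -ᶻ k))) ℒ ∷ [])
        f (intercept h′ k′))
    where
    tb : ∀ c → Bdd (λ y → f (y ⊕ c))
    tb c y = bf (y ⊕ c)

-- The diagonal terms that `off` replaces by zero have to pass through the same list of losses as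
-- the genuine terms.
zero-chain : ∀ {e V} s S → 0ℚ ≤ e → 0ℚ ≤ V → Chain e (s ∷ S) 0ℚ V
zero-chain {e} {V} s [] 0≤e 0≤V = step s (go s)
  where
  go : ∀ s → lose s 0ℚ ≤ V + e
  go ln = 0≤+ 0≤V 0≤e
  go sq = subst (_≤ V + e) (sym (zeroˡ 0ℚ)) (0≤+ 0≤V 0≤e)
  go hf = subst (_≤ V + e) (sym (zeroʳ ½)) (0≤+ 0≤V 0≤e)
zero-chain {e} s (s′ ∷ S) 0≤e 0≤V = link (go s) (zero-chain s′ S 0≤e 0≤V)
  where
  go : ∀ s → lose s 0ℚ ≤ 0ℚ + e
  go ln = 0≤+ ≤-refl 0≤e
  go sq = subst (_≤ 0ℚ + e) (sym (zeroˡ 0ℚ)) (0≤+ ≤-refl 0≤e)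
  go hf = subst (_≤ 0ℚ + e) (sym (zeroʳ ½)) (0≤+ ≤-refl 0≤e)

twice : ∀ {e V W} → 0ℚ ≤ e → (V * V) * (V * V) ≤ W → Chain e (sq ∷ sq ∷ []) V W
twice {e} 0≤e p = link (≤-by e 0≤e refl) (step sq (≤-trans p (≤-by e 0≤e refl)))

-- Arithmetic information on two members of a family exists only for distinct indices. The diagonal
-- is a fraction 1/(n+1) of all pairs, so it is put to zero and charged to the error.
off : ∀ {n} → Fin n → Fin n → ℚ → ℚ
off i j y with i Fin.≟ j
... | yes _ = 0ℚ
... | no  _ = y

off-sum : ∀ {n} (i : Fin n) (ψ : Fin n → ℚ) → (∀ j → ψ j ≤ 1ℚ) →
  sumF n ψ ≤ sumF n (λ j → off i j (ψ j)) + 1ℚ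
off-sum {suc n} zero ψ b = ≤-trans (+-monoˡ-≤ _ (b zero))
  (≤-reflexive (trans (solve 2 (λ a s → con 1ℚ :+ s := (con 0ℚ :+ s) :+ con 1ℚ) refl (ψ zero) (sumF n (ψ ∘ suc)))
    (cong (λ t → (0ℚ + t) + 1ℚ) (sumF-cong n λ j → refl))))
off-sum {suc n} (suc i) ψ b = ≤-trans (+-monoʳ-≤ (ψ zero) (off-sum i (ψ ∘ suc) (b ∘ suc)))
  (≤-reflexive (trans (sym (+-assoc _ _ _)) (cong (λ t → (ψ zero + t) + 1ℚ) (sumF-cong n λ j → eq j))))
  where
  eq : ∀ j → off i j (ψ (suc j)) ≡ off (suc i) (suc j) (ψ (suc j))
  eq j with i Fin.≟ j
  ... | yes _ = refl
  ... | no  _ = refl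

E-off : ∀ n (ψ : Fin (suc n) → Fin (suc n) → ℚ) → (∀ i j → ψ i j ≤ 1ℚ) →
  𝔼[ i ∈ uni n ] 𝔼[ j ∈ uni n ] ψ i j ≤ 𝔼[ i ∈ uni n ] 𝔼[ j ∈ uni n ] off i j (ψ i j) + 1/suc n
E-off n ψ b = E-mono+ (uni n) λ i → ≤-trans (≤-reflexive (average-def n _)) (≤-trans (*-monoʳ (0≤1/suc n) (off-sum i (ψ i) (b i)))
  (≤-reflexive (trans (solve 2 (λ s c → (s :+ con 1ℚ) :* c := s :* c :+ c) refl _ (1/suc n)) (cong (_+ 1/suc n) (sym (average-def n _))))))

off-case : ∀ {n} (P : ℚ → Set) (i j : Fin n) y → P 0ℚ → (i ≢ j → P y) → P (off i j y)
off-case P i j y p q with i Fin.≟ j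
... | yes _ = p
... | no ¬e = q ¬e

module Invariance (𝒮 : System) where
  open Dynamics 𝒮 public

  box₁-diff : ∀ W F → box (W ∷ []) F ≡ 𝔼[ x ∈ space ] (F (x ⊕ 0ℤ) * smooth (Diff W) F x)
  box₁-diff W F = trans (E-swap (mean W) (mean W) _) (trans (sym (E-swap space (mean W ⊗ mean W) λ x (j , i) → pair F (at W i) (at W j) x)) (trans
    (E-shifted (mean W ⊗ mean W) (λ (j , i) → -ᶻ at W i) λ x (j , i) → cong₂ _*_
      (sh F x (solveᶻ 1 (λ a → ⊟ a ⊞ a ≔ # 0ℤ) refl (at W i))) (sh F x (solveᶻ 2 (λ a b → ⊟ a ⊞ b ≔ b ⊟ a) refl (at W i) (at W j))))
    (E-cong space λ x → E-*ˡ (mean (Diff W)) (F (x ⊕ 0ℤ)) λ k → F (x ⊕ at (Diff W) k))))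

  record AlmostInv (e : ℚ) (G : X → ℚ) (m : ℤ) : Set where
    constructor almost
    field near : ∀ x → G (x ⊕ m) ≈[ e ] G x
  open AlmostInv public

  smooth-Bd : ∀ W {F} → Bdd F → Bdd (smooth W F)
  smooth-Bd W b x = E-Bd (mean W) λ i → b _

  smooth-inv : ∀ {θ W m F} → Bdd F → Inv θ W m → AlmostInv θ (smooth W F) m
  smooth-inv {W = W} {m} {F} b h = almost λ x → ≈-≡ˡ
    (E-cong (mean W) λ i → sym (sh F x (solveᶻ 2 (λ m n → m ⊞ n ≔ n ⊞ m) refl m (at W i))))
    (shift h (λ n → F (x ⊕ n)) (λ n → b _))

  *-inv : ∀ {e e′ G K m} → Bdd G → Bdd K → AlmostInv e G m → AlmostInv e′ K m →
    AlmostInv (e + e′) (λ x → G x * K x) m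
  *-inv bG bK g k = almost λ x → ≈-* (bG _) (bK _) (near g x) (near k x)

  translate-inv : ∀ {e G m} c → AlmostInv e G m → AlmostInv e (λ x → G (x ⊕ c)) m
  translate-inv {G = G} {m} c g = almost λ x → ≈-≡ˡ
    (trans (sh G x (solveᶻ 2 (λ c m → c ⊞ m ≔ m ⊞ c) refl c m)) (sym (sh G x refl))) (near g (x ⊕ c))

  pair-inv : ∀ {e G m} a b → Bdd G → AlmostInv e G m → AlmostInv (e + e) (pair G a b) m
  pair-inv a b bG g = *-inv (λ x → bG _) (λ x → bG _) (translate-inv a g) (translate-inv b g)

  -- An almost W-invariant factor can be removed at the cost of averaging over W.
  remove-invariant : ∀ {O e} (μ : Mean O) (W : Win) (G J : O → X → ℚ) →
    (∀ o → Bdd (G o)) → (∀ o → Bdd (J o)) → (∀ o i → AlmostInv e (J o) (at W i)) →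
    let V = 𝔼[ o ∈ μ ] 𝔼[ x ∈ space ] (G o x * J o x) in
    V * V ≤ 𝔼[ o ∈ μ ] box (W ∷ []) (G o) + (e + e)
  remove-invariant {e = e} μ W G J bG bJ ai = begin
    _ ≤⟨ ≈-sq (E-Bd μ λ o → E-Bd space λ x → Bd-* (bG o _) (bJ o _))
             (E-Bd μ λ o → E-Bd space λ x → Bd-* (bJ o _) (smooth-Bd W (bG o) x))
             (E-≈ μ λ o → ≈-≡ˡ (sym (spread o)) (E-≈ space λ x → ≈-≡ʳ (pull o x)
               (E-≈ (mean W) λ i → ≈-*ˡ (bG o _) (near (ai o i) x)))) ⟩
    _ ≤⟨ +-monoˡ-≤ _ (cauchy-schwarz (μ ⊗ space) (λ (o , x) → J o x) (λ (o , x) → smooth W (G o) x) (λ (o , x) → bJ o x)) ⟩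
    _ ≡⟨ cong (_+ (e + e)) (E-cong μ λ o → sym (box₁ W (G o))) ⟩
    _ ∎
    where
    open ℚₚ.≤-Reasoning
    spread : ∀ o → 𝔼[ x ∈ space ] (G o x * J o x) ≡
      𝔼[ x ∈ space ] 𝔼[ i ∈ mean W ] (G o (x ⊕ at W i) * J o (x ⊕ at W i))
    spread o = trans (E-cong space λ x → sym (E-const (mean W) _)) (E-shift (mean W) (at W) λ x _ → G o x * J o x)
    pull : ∀ o x → 𝔼[ i ∈ mean W ] (G o (x ⊕ at W i) * J o x) ≡ J o x * smooth W (G o) x
    pull o x = trans (E-*ʳ (mean W) (J o x) _) (*-comm _ _)

  -- Smoothing along W makes g nearly invariant under the shifts that W absorbs, and g itself is
  -- nearly invariant under the others. A further average over U therefore changes the smoothed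
  -- function little; the two averages commute, and the one over W is dropped by convexity.
  box-refine : ∀ {θ e} (W U : Win) (g : X → ℚ) → Bdd g →
    (∀ i → Σ ℤ λ m → Σ ℤ λ m′ → at U i ≡ m +ᶻ m′ × Inv θ W m × AlmostInv e g m′) →
    box (W ∷ []) g ≤ box (U ∷ []) g + ((e + θ) + (e + θ))
  box-refine {θ} {e} W U g bg dec = begin
    box (W ∷ []) g
      ≡⟨ box₁ W g ⟩
    𝔼[ x ∈ space ] (smooth W g x * smooth W g x)
      ≤⟨ E-mono+ space (λ x → ≈-sq (smooth-Bd W bg x) (E-Bd (mean U) λ i → smooth-Bd W bg _) (≈-sym (close x))) ⟩
    𝔼[ x ∈ space ] (avg U (λ p → smooth W g (x ⊕ p)) * avg U (λ p → smooth W g (x ⊕ p))) + _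
      ≡⟨ cong (_+ _) (E-cong space λ x → cong (λ t → t * t) (trans (E-swap (mean U) (mean W) _)
           (E-cong (mean W) λ k → E-cong (mean U) λ p → trans (sh g x (solveᶻ 2 (λ a b → a ⊞ b ≔ b ⊞ a) refl (at U p) (at W k))) (sym (sh g x refl))))) ⟩
    𝔼[ x ∈ space ] (avg W (λ k → smooth U g (x ⊕ k)) * avg W (λ k → smooth U g (x ⊕ k))) + _
      ≤⟨ +-monoˡ-≤ _ (E-mono space λ x → jensen (mean W) _) ⟩
    𝔼[ x ∈ space ] avg W (λ k → smooth U g (x ⊕ k) * smooth U g (x ⊕ k)) + _
      ≡⟨ cong (_+ _) (trans (sym (E-shift (mean W) (at W) λ x _ → smooth U g x * smooth U g x))
           (trans (E-cong space λ x → E-const (mean W) _) (sym (box₁ U g)))) ⟩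
    box (U ∷ []) g + _ ∎
    where
    open ℚₚ.≤-Reasoning
    close : ∀ x → avg U (λ p → smooth W g (x ⊕ p)) ≈[ e + θ ] smooth W g x
    close x = ≈-≡ʳ (E-const (mean U) _) (E-≈ (mean U) λ i →
      let (m , m′ , eq , im , im′) = dec i in
      ≈-trans
        (≈-≡ˡ (E-cong (mean W) λ k → trans (sh g x refl) (trans (cong (λ t → g (x ⊕ t))
                 (trans (solveᶻ 3 (λ k m m′ → k ⊞ m ⊞ m′ ≔ m ⊞ m′ ⊞ k) refl (at W k) m m′) (cong (_+ᶻ at W k) (sym eq)))) (sym (sh g x refl))))
              (E-≈ (mean W) λ k → near im′ (x ⊕ (at W k +ᶻ m))))
        (shift im (λ n → g (x ⊕ n)) (λ n → bg _)))

  -- One of the four copies of the average is expanded, and the two applications of Cauchy-Schwarz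
  -- in `box-cauchy-schwarz` discard the other three. The power 4 stands in for the triangle
  -- inequality of the box norm.
  box-convex : ∀ {J} (ν : Mean J) (U W : Win) (ψ : J → X → ℚ) → (∀ j → Bdd (ψ j)) →
    let V = box (U ∷ W ∷ []) (λ x → 𝔼[ j ∈ ν ] ψ j x) in
    (V * V) * (V * V) ≤ 𝔼[ j ∈ ν ] box (U ∷ W ∷ []) (ψ j)
  box-convex {J} ν U W ψ bψ = begin
    (V * V) * (V * V)  ≡⟨ cong (λ t → (t * t) * (t * t)) V≡ ⟩
    (V₁ * V₁) * (V₁ * V₁) ≤⟨ box-cauchy-schwarz O (mean U) (mean W) α β H
                              (λ o p → Bd-* (bG _) (bG _)) (λ o q → bG _) ⟩
    _                  ≡⟨ E-reorder ⟩
    𝔼[ j ∈ ν ] box (U ∷ W ∷ []) (ψ j) ∎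
    where
    open ℚₚ.≤-Reasoning
    G : X → ℚ
    G x = 𝔼[ j ∈ ν ] ψ j x
    bG : Bdd G
    bG x = E-Bd ν λ j → bψ j x
    V V₁ : ℚ
    V = box (U ∷ W ∷ []) G
    O = mean U ⊗ (mean W ⊗ (ν ⊗ space))
    α : Ix U × Ix W × J × X → Ix U → ℚ
    α (i , k , j , x) p = G (x ⊕ at W k ⊕ at U p) * G (x ⊕ at W k ⊕ at U i)
    β : Ix U × Ix W × J × X → Ix W → ℚ
    β (i , k , j , x) r = G (x ⊕ at W r ⊕ at U i)
    H : Ix U × Ix W × J × X → Ix U → Ix W → ℚ
    H (i , k , j , x) p r = ψ j (x ⊕ at W r ⊕ at U p)
    V₁ = 𝔼[ o ∈ O ] 𝔼[ p ∈ mean U ] 𝔼[ r ∈ mean W ] (α o p * (β o r * H o p r))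
    V≡ : V ≡ V₁
    V≡ = trans (E-swap (mean U) (mean U) _) (E-cong (mean U) λ i →
      trans (E-cong (mean U) λ p → E-swap (mean W) (mean W) _)
      (trans (E-swap (mean U) (mean W) _) (E-cong (mean W) λ k →
      trans (E-cong (mean U) λ p → E-cong (mean W) λ r → E-cong space λ x →
        trans (solve 4 (λ a b c d → (a :* b) :* (c :* d) := a :* ((c :* d) :* b)) refl
                 (G (x ⊕ at W r ⊕ at U p)) (G (x ⊕ at W r ⊕ at U i)) (G (x ⊕ at W k ⊕ at U p)) (G (x ⊕ at W k ⊕ at U i)))
        (trans (sym (E-*ʳ ν _ _)) (E-cong ν λ j → solve 3 (λ a c b → a :* (c :* b) := c :* (b :* a)) refl
                 (ψ j (x ⊕ at W r ⊕ at U p)) (G (x ⊕ at W k ⊕ at U p) * G (x ⊕ at W k ⊕ at U i)) (G (x ⊕ at W r ⊕ at U i)))))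
      (trans (E-cong (mean U) λ p → E-cong (mean W) λ r → E-swap space ν _)
        (E-swap (mean U ⊗ mean W) (ν ⊗ space) λ (p , r) (j , x) →
           (G (x ⊕ at W k ⊕ at U p) * G (x ⊕ at W k ⊕ at U i)) * (G (x ⊕ at W r ⊕ at U i) * ψ j (x ⊕ at W r ⊕ at U p)))))))
    E-reorder : 𝔼[ o ∈ O ] 𝔼[ p ∈ mean U ] 𝔼[ p′ ∈ mean U ] 𝔼[ r ∈ mean W ] 𝔼[ r′ ∈ mean W ]
        ((H o p r * H o p′ r) * (H o p r′ * H o p′ r′)) ≡ 𝔼[ j ∈ ν ] box (U ∷ W ∷ []) (ψ j)
    E-reorder = trans (E-const (mean U) _) (trans (E-const (mean W) _) (E-cong ν λ j →
      E-swap space (mean U ⊗ (mean U ⊗ (mean W ⊗ mean W))) λ x (p , p′ , r , r′) →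
        (ψ j (x ⊕ at W r ⊕ at U p) * ψ j (x ⊕ at W r ⊕ at U p′)) * (ψ j (x ⊕ at W r′ ⊕ at U p) * ψ j (x ⊕ at W r′ ⊕ at U p′))))

-- Concatenation

-- Of the multiples of θ treated here, 10θ is the largest; it is lost in `box-refine₂`.
module Errors {θ e : ℚ} (0≤θ : 0ℚ ≤ θ) (16θ≤e : 2ℚ * (2ℚ * (2ℚ * (θ + θ))) ≤ e) where

  2θ≤ : θ + θ ≤ e
  2θ≤ = ≤-trans (≤-by ((con14) * θ) (0≤* (0≤+ 0≤2 (0≤+ (0≤+ 0≤2 0≤2) (0≤+ (0≤+ 0≤2 0≤2) (0≤+ 0≤2 0≤2)))) 0≤θ)
    (solve 1 (λ t → two :* (two :* (two :* (t :+ t))) := (t :+ t) :+ (two :+ ((two :+ two) :+ ((two :+ two) :+ (two :+ two)))) :* t) refl θ)) 16θ≤e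
    where
    con14 = 2ℚ + ((2ℚ + 2ℚ) + ((2ℚ + 2ℚ) + (2ℚ + 2ℚ)))
    two = con 1ℚ :+ con 1ℚ

  0≤e : 0ℚ ≤ e
  0≤e = ≤-trans (0≤+ 0≤θ 0≤θ) 2θ≤

  4θ≤ : (θ + θ) + (θ + θ) ≤ e
  4θ≤ = ≤-trans (≤-by ((2ℚ + 2ℚ + 2ℚ + 2ℚ + 2ℚ + 2ℚ) * θ) (0≤* (0≤+ (0≤+ (0≤+ (0≤+ (0≤+ 0≤2 0≤2) 0≤2) 0≤2) 0≤2) 0≤2) 0≤θ)
    (solve 1 (λ t → two :* (two :* (two :* (t :+ t))) := (t :+ t :+ (t :+ t)) :+ (two :+ two :+ two :+ two :+ two :+ two) :* t) refl θ)) 16θ≤e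
    where two = con 1ℚ :+ con 1ℚ

  10θ≤ : (((θ + θ) + (θ + θ)) + θ) + (((θ + θ) + (θ + θ)) + θ) ≤ e
  10θ≤ = ≤-trans (≤-by ((2ℚ + 2ℚ + 2ℚ) * θ) (0≤* (0≤+ (0≤+ 0≤2 0≤2) 0≤2) 0≤θ)
    (solve 1 (λ t → two :* (two :* (two :* (t :+ t))) := ((t :+ t :+ (t :+ t) :+ t) :+ (t :+ t :+ (t :+ t) :+ t)) :+ (two :+ two :+ two) :* t) refl θ)) 16θ≤e
    where two = con 1ℚ :+ con 1ℚ

  θ≤ : θ ≤ e
  θ≤ = ≤-trans (≤-by θ 0≤θ refl) 2θ≤

module Concatenation (𝒮 : System) where
  open Invariance 𝒮 public

  box-swap : ∀ U W F → box (U ∷ W ∷ []) F ≡ box (W ∷ U ∷ []) F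
  box-swap U W F = trans (E-swap (mean U ⊗ mean U) (mean W ⊗ mean W) _)
    (E-cong (mean W) λ k → E-cong (mean W) λ l → E-cong (mean U) λ i → E-cong (mean U) λ j → E-cong space λ x →
      trans (mix _ _ _ _) (cong₂ _*_ (cong₂ _*_ (c x i k) (c x i l)) (cong₂ _*_ (c x j k) (c x j l))))
    where
    c : ∀ x i k → F (x ⊕ at W k ⊕ at U i) ≡ F (x ⊕ at U i ⊕ at W k)
    c x i k = trans (sh F x (solveᶻ 2 (λ a b → a ⊞ b ≔ b ⊞ a) refl (at W k) (at U i))) (sym (sh F x refl))

  -- The dual function of the box norm in two directions: F at the three vertices of a parallelogram
  -- other than x, averaged over parallelograms.
  dual : Win → Win → (X → ℚ) → X → ℚ
  dual A C F x = avg (Diff A) λ n → avg (Diff C) λ p → F (x ⊕ n) * (F (x ⊕ p) * F (x ⊕ (n +ᶻ p)))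

  dual-Bd : ∀ A C {F} → Bdd F → Bdd (dual A C F)
  dual-Bd A C b x = E-Bd (mean (Diff A)) λ i → E-Bd (mean (Diff C)) λ j → Bd-* (b _) (Bd-* (b _) (b _))

  box-dual : ∀ A C F → box (A ∷ C ∷ []) F ≡ 𝔼[ x ∈ space ] (F (x ⊕ 0ℤ) * dual A C F x)
  box-dual A C F = begin
    box (A ∷ C ∷ []) F
      ≡⟨ sym (E-swap space (MA ⊗ (MC)) λ x ((i , j) , (k , l)) → pair (pair F (at A i) (at A j)) (at C k) (at C l) x) ⟩
    _ ≡⟨ E-shifted (MA ⊗ MC) (λ ((i , j) , (k , l)) → -ᶻ (at C l +ᶻ at A j)) (λ x ((i , j) , (k , l)) → trans
           (cong₂ _*_ (cong₂ _*_ (v x (at C k) (at A i) _ (solveᶻ 4 (λ i j k l → ⊟ (l ⊞ j) ⊞ (k ⊞ i) ≔ i ⊟ j ⊞ (k ⊟ l)) refl (at A i) (at A j) (at C k) (at C l)))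
                                 (v x (at C k) (at A j) _ (solveᶻ 3 (λ j k l → ⊟ (l ⊞ j) ⊞ (k ⊞ j) ≔ k ⊟ l) refl (at A j) (at C k) (at C l))))
                      (cong₂ _*_ (v x (at C l) (at A i) _ (solveᶻ 3 (λ i j l → ⊟ (l ⊞ j) ⊞ (l ⊞ i) ≔ i ⊟ j) refl (at A i) (at A j) (at C l)))
                                 (v x (at C l) (at A j) _ (solveᶻ 2 (λ j l → ⊟ (l ⊞ j) ⊞ (l ⊞ j) ≔ # 0ℤ) refl (at A j) (at C l)))))
           (solve 4 (λ a b c d → (a :* b) :* (c :* d) := d :* (c :* (b :* a))) refl
             (F (x ⊕ (at A i -ᶻ at A j +ᶻ (at C k -ᶻ at C l)))) (F (x ⊕ (at C k -ᶻ at C l))) (F (x ⊕ (at A i -ᶻ at A j))) (F (x ⊕ 0ℤ)))) ⟩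
    _ ≡⟨ E-cong space (λ x → E-*ˡ (MA ⊗ MC) (F (x ⊕ 0ℤ)) λ ((i , j) , (k , l)) →
           F (x ⊕ (at A i -ᶻ at A j)) * (F (x ⊕ (at C k -ᶻ at C l)) * F (x ⊕ (at A i -ᶻ at A j +ᶻ (at C k -ᶻ at C l))))) ⟩
    _ ∎
    where
    open ≡-Reasoning
    MA = mean (Diff A)
    MC = mean (Diff C)
    v : ∀ x {s} c a t → s +ᶻ (c +ᶻ a) ≡ t → F (x ⊕ s ⊕ c ⊕ a) ≡ F (x ⊕ t)
    v x {s} c a t eq = trans (cong F (⊕-assoc (x ⊕ s) c a)) (sh F x eq)

  corr : Win → (X → ℚ) → ℤ → X → ℚ
  corr C F n = smooth (Diff C) (pair F (-ᶻ n) 0ℤ)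

  corr-Bd : ∀ C {F} n → Bdd F → Bdd (corr C F n)
  corr-Bd C n b = smooth-Bd (Diff C) (pair-Bd _ _ b)

  -- Translating x by - n isolates one factor F that is free of n. Once it is discarded, the dual
  -- function leaves correlations of F with its translate by n, averaged along C and therefore
  -- nearly invariant along C.
  correlate : ∀ A C F S′ → Bdd F → Bdd S′ →
    let V = 𝔼[ x ∈ space ] (dual A C F x * S′ x) in
    V * V ≤ avg (Diff A) λ n → avg (Diff A) λ n₂ →
      𝔼[ x ∈ space ] ((corr C F n x * corr C F n₂ x) * (S′ (x ⊕ -ᶻ n) * S′ (x ⊕ -ᶻ n₂)))
  correlate A C F S′ bF bS = begin
    V * V ≡⟨ cong (λ t → t * t) (trans (E-cong space λ x → sym (E-*ʳ MA (S′ x) _))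
               (trans (E-shifted MA (λ i → -ᶻ at (Diff A) i) λ x i → re x (at (Diff A) i))
                 (E-cong space λ x → E-*ˡ MA (F (x ⊕ 0ℤ)) _))) ⟩
    _ ≤⟨ cauchy-schwarz space (λ x → F (x ⊕ 0ℤ)) (λ x → avg (Diff A) λ n → corr C F n x * S′ (x ⊕ -ᶻ n)) (λ x → bF _) ⟩
    _ ≡⟨ trans (E-cong space λ x → trans (E-sq MA _) (E-cong MA λ i → E-cong MA λ j → mix _ _ _ _))
           (E-swap space (MA ⊗ MA) λ x (i , j) → (corr C F (at (Diff A) i) x * corr C F (at (Diff A) j) x)
              * (S′ (x ⊕ -ᶻ at (Diff A) i) * S′ (x ⊕ -ᶻ at (Diff A) j))) ⟩
    _ ∎
    where
    open ℚₚ.≤-Reasoning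
    MA = mean (Diff A)
    MC = mean (Diff C)
    V = 𝔼[ x ∈ space ] (dual A C F x * S′ x)
    re : ∀ x n → avg (Diff C) (λ p → F (x ⊕ -ᶻ n ⊕ n) * (F (x ⊕ -ᶻ n ⊕ p) * F (x ⊕ -ᶻ n ⊕ (n +ᶻ p)))) * S′ (x ⊕ -ᶻ n)
      ≡ F (x ⊕ 0ℤ) * (corr C F n x * S′ (x ⊕ -ᶻ n))
    re x n = trans (cong (_* S′ (x ⊕ -ᶻ n)) (trans (E-cong MC λ p → cong₂ _*_
        (sh F x (solveᶻ 1 (λ n → ⊟ n ⊞ n ≔ # 0ℤ) refl n))
        (cong₂ _*_ (trans (sh F x (solveᶻ 2 (λ n p → ⊟ n ⊞ p ≔ p ⊞ ⊟ n) refl n (at (Diff C) p))) (sym (sh F x refl)))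
                   (trans (sh F x (solveᶻ 2 (λ n p → ⊟ n ⊞ (n ⊞ p) ≔ p ⊞ # 0ℤ) refl n (at (Diff C) p))) (sym (sh F x refl)))))
      (E-*ˡ MC (F (x ⊕ 0ℤ)) _))) (*-assoc _ _ _)

  module Kill {θ} (A A♭ C C♭ : Win) (invA : ∀ i → Inv θ A (at A♭ i)) (invC : ∀ i → Inv θ C (at C♭ i))
              (F : X → ℚ) (bF : Bdd F) where

    K : ℤ → X → ℚ
    K p = smooth (Diff A) (pair F 0ℤ p)

    dual≡ : ∀ y → dual A C F y ≡ avg (Diff C) λ p → F (y ⊕ p) * K p y
    dual≡ y = trans (E-swap (mean (Diff A)) (mean (Diff C)) _) (E-cong (mean (Diff C)) λ p → trans
      (E-cong (mean (Diff A)) λ n → trans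
        (solve 3 (λ a b c → a :* (b :* c) := b :* (a :* c)) refl (F (y ⊕ at (Diff A) n)) (F (y ⊕ at (Diff C) p)) (F (y ⊕ (at (Diff A) n +ᶻ at (Diff C) p))))
        (cong (F (y ⊕ at (Diff C) p) *_) (cong₂ _*_
          (sym (sh F y (solveᶻ 1 (λ n → n ⊞ # 0ℤ ≔ n) refl (at (Diff A) n)))) (sym (sh F y refl)))))
      (E-*ˡ (mean (Diff A)) (F (y ⊕ at (Diff C) p)) _))

    -- For fixed p the other factors of the dual function average along A to `K p`, which is nearly
    -- A-invariant and is removed by averaging over A♭. This doubles the remaining factors F along
    -- A♭; their averages along C are nearly C-invariant and are removed by averaging over C♭.
    kill : ∀ n n₂ (G : X → ℚ) → Bdd G → ∀ {e} → (θ + θ) + (θ + θ) ≤ e →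
      Chain e (sq ∷ sq ∷ []) (𝔼[ x ∈ space ] (G x * (dual A C F (x ⊕ -ᶻ n) * dual A C F (x ⊕ -ᶻ n₂))))
        (box (A♭ ∷ C♭ ∷ []) G)
    kill n n₂ G bG {e} small = link (≤-trans first (+-monoʳ-≤ _ small)) (step sq (≤-trans second (+-monoʳ-≤ _ small)))
      where
      open ℚₚ.≤-Reasoning
      MC = mean (Diff C)
      B : Ix (Diff C) × Ix (Diff C) → X → ℚ
      B (p , r) x = F (x ⊕ -ᶻ n ⊕ at (Diff C) p) * F (x ⊕ -ᶻ n₂ ⊕ at (Diff C) r)
      KK : Ix (Diff C) × Ix (Diff C) → X → ℚ
      KK (p , r) x = K (at (Diff C) p) (x ⊕ -ᶻ n) * K (at (Diff C) r) (x ⊕ -ᶻ n₂)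
      bB : ∀ o → Bdd (B o)
      bB o x = Bd-* (bF _) (bF _)
      bK : ∀ p → Bdd (K p)
      bK p = smooth-Bd (Diff A) (pair-Bd _ _ bF)
      W₁ : ℚ
      W₁ = 𝔼[ o ∈ MC ⊗ MC ] box (A♭ ∷ []) (λ x → G x * B o x)
      first : 𝔼[ x ∈ space ] (G x * (dual A C F (x ⊕ -ᶻ n) * dual A C F (x ⊕ -ᶻ n₂)))
            * 𝔼[ x ∈ space ] (G x * (dual A C F (x ⊕ -ᶻ n) * dual A C F (x ⊕ -ᶻ n₂))) ≤ W₁ + ((θ + θ) + (θ + θ))
      first = begin
        _ ≡⟨ cong (λ t → t * t) (trans (E-cong space λ x → trans
               (cong (G x *_) (trans (cong₂ _*_ (dual≡ _) (dual≡ _)) (E-prod MC MC _ _)))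
               (trans (sym (E-*ˡ (MC ⊗ MC) (G x) λ (p , r) → (F (x ⊕ -ᶻ n ⊕ at (Diff C) p) * K (at (Diff C) p) (x ⊕ -ᶻ n)) * (F (x ⊕ -ᶻ n₂ ⊕ at (Diff C) r) * K (at (Diff C) r) (x ⊕ -ᶻ n₂))))
                 (E-cong (MC ⊗ MC) λ o → trans (cong (G x *_) (mix _ _ _ _)) (sym (*-assoc _ _ _)))))
               (E-swap space (MC ⊗ MC) λ x o → (G x * B o x) * KK o x)) ⟩
        _ ≤⟨ remove-invariant (MC ⊗ MC) A♭ (λ o x → G x * B o x) KK
               (λ o x → Bd-* (bG x) (bB o x)) (λ o x → Bd-* (bK _ _) (bK _ _))
               (λ (p , r) i → *-inv (λ x → bK _ _) (λ x → bK _ _)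
                 (translate-inv (-ᶻ n) (smooth-inv (pair-Bd _ _ bF) (Inv-Diff {W = A} (invA i))))
                 (translate-inv (-ᶻ n₂) (smooth-inv (pair-Bd _ _ bF) (Inv-Diff {W = A} (invA i))))) ⟩
        _ ∎
      L : ℤ → ℤ → X → ℚ
      L a b = smooth (Diff C) (pair F a b)
      bL : ∀ a b → Bdd (L a b)
      bL a b = smooth-Bd (Diff C) (pair-Bd _ _ bF)
      J : Ix A♭ × Ix A♭ → X → ℚ
      J (i , j) x = L (at A♭ i) (at A♭ j) (x ⊕ -ᶻ n) * L (at A♭ i) (at A♭ j) (x ⊕ -ᶻ n₂)
      comm : ∀ x a m p → F (x ⊕ a ⊕ m ⊕ p) ≡ F (x ⊕ m ⊕ p ⊕ a)
      comm x a m p = trans (cong F (⊕-assoc (x ⊕ a) m p)) (trans (sh F x (solveᶻ 3 (λ a m p → a ⊞ (m ⊞ p) ≔ (m ⊞ p) ⊞ a) refl a m p))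
        (trans (sym (sh F x refl)) (cong (λ y → F (y ⊕ a)) (sym (⊕-assoc x m p)))))
      second : W₁ * W₁ ≤ box (A♭ ∷ C♭ ∷ []) G + ((θ + θ) + (θ + θ))
      second = begin
        W₁ * W₁ ≡⟨ cong (λ t → t * t) (trans (E-swap (MC ⊗ MC) (mean A♭ ⊗ mean A♭) λ o (i , j) → 𝔼[ x ∈ space ] pair (λ x → G x * B o x) (at A♭ i) (at A♭ j) x)
                     (E-cong (mean A♭) λ i → E-cong (mean A♭) λ j → trans (E-swap (MC ⊗ MC) space _) (E-cong space λ x → trans
                       (E-cong (MC ⊗ MC) λ o → mix _ _ _ _)
                       (trans (E-*ˡ (MC ⊗ MC) (pair G (at A♭ i) (at A♭ j) x) λ o → pair (B o) (at A♭ i) (at A♭ j) x)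
                         (cong (pair G (at A♭ i) (at A♭ j) x *_) (trans
                           (E-cong (MC ⊗ MC) λ (p , r) → trans (mix _ _ _ _) (cong₂ _*_
                             (cong₂ _*_ (comm x (at A♭ i) (-ᶻ n) (at (Diff C) p)) (comm x (at A♭ j) (-ᶻ n) (at (Diff C) p)))
                             (cong₂ _*_ (comm x (at A♭ i) (-ᶻ n₂) (at (Diff C) r)) (comm x (at A♭ j) (-ᶻ n₂) (at (Diff C) r)))))
                           (sym (E-prod MC MC _ _)))))))) ⟩
        _ ≤⟨ remove-invariant (mean A♭ ⊗ mean A♭) C♭ (λ (i , j) → pair G (at A♭ i) (at A♭ j)) J
               (λ _ → pair-Bd _ _ bG) (λ o x → Bd-* (bL _ _ _) (bL _ _ _))
               (λ (i , j) k → *-inv (λ x → bL _ _ _) (λ x → bL _ _ _)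
                 (translate-inv (-ᶻ n) (smooth-inv (pair-Bd _ _ bF) (Inv-Diff {W = C} (invC k))))
                 (translate-inv (-ᶻ n₂) (smooth-inv (pair-Bd _ _ bF) (Inv-Diff {W = C} (invC k))))) ⟩
        _ ∎

Splits : ℚ → Win → Win → Win → Set
Splits θ U W V = ∀ i → Σ ℤ λ m → Σ ℤ λ m′ → at U i ≡ m +ᶻ m′ × Inv θ W m × Inv θ V m′

concatSteps : List Step
concatSteps = sq ∷ sq ∷ sq ∷ ln ∷ ln ∷ sq ∷ sq ∷ sq ∷ []

module Concatenate (𝒮 : System) {θ e : ℚ} (0≤θ : 0ℚ ≤ θ)
  (16θ≤e : 2ℚ * (2ℚ * (2ℚ * (θ + θ))) ≤ e) where
  open Concatenation 𝒮 public
  open Errors 0≤θ 16θ≤e public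

  box-refine₂ : ∀ {G} (A C V U : Win) → Bdd G → (∀ m → Inv θ V m → AlmostInv (θ + θ) G m) →
    Splits θ U C V → Splits θ U A V → Chain e (ln ∷ ln ∷ []) (box (A ∷ C ∷ []) G) (box (U ∷ U ∷ []) G)
  box-refine₂ {G} A C V U bG ai sC sA =
    link {W = box (A ∷ U ∷ []) G} (≤-trans (E-mono+ (mean A) λ i → E-mono+ (mean A) λ j →
      box-refine C U (pair G (at A i) (at A j)) (pair-Bd _ _ bG) λ k →
        let (m , m′ , eq , h , h′) = sC k in m , m′ , eq , h , pair-inv _ _ bG (ai m′ h′)) (+-monoʳ-≤ _ 10θ≤))
    (step ln (≤-trans (≤-trans (≤-reflexive (box-swap A U G)) (E-mono+ (mean U) λ i → E-mono+ (mean U) λ j →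
      box-refine A U (pair G (at U i) (at U j)) (pair-Bd _ _ bG) λ k →
        let (m , m′ , eq , h , h′) = sA k in m , m′ , eq , h , pair-inv _ _ bG (ai m′ h′))) (+-monoʳ-≤ _ 10θ≤)))

  module Isolate (A C U : Win) {F : X → ℚ} (bF : Bdd F) where

    N MC : _
    N = mean (Diff A)
    MC = mean (Diff C)
    UU : Mean (Ix U × Ix U × Ix U × Ix U)
    UU = mean U ⊗ (mean U ⊗ (mean U ⊗ mean U))

    cube : (X → ℚ) → Ix U × Ix U × Ix U × Ix U → X → ℚ
    cube G (i , j , k , l) = pair (pair G (at U i) (at U j)) (at U k) (at U l)

    cube-Bd : ∀ u → Bdd (cube F u)
    cube-Bd (i , j , k , l) = pair-Bd _ _ (pair-Bd _ _ bF)

    cube-shift : ∀ G c u x → cube (λ y → G (y ⊕ c)) u x ≡ cube G u (x ⊕ c)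
    cube-shift G c (i , j , k , l) x = cong₂ _*_ (cong₂ _*_ (v k i) (v k j)) (cong₂ _*_ (v l i) (v l j))
      where
      v : ∀ k i → G (x ⊕ at U k ⊕ at U i ⊕ c) ≡ G (x ⊕ c ⊕ at U k ⊕ at U i)
      v k i = trans (cong (λ y → G (y ⊕ c)) (⊕-assoc x _ _)) (trans (sh G x (solveᶻ 3 (λ k i c → (k ⊞ i) ⊞ c ≔ c ⊞ (k ⊞ i)) refl (at U k) (at U i) c))
        (trans (sym (sh G x refl)) (cong G (sym (⊕-assoc (x ⊕ c) (at U k) (at U i))))))

    cube-* : ∀ G H u x → cube (λ y → G y * H y) u x ≡ cube G u x * cube H u x
    cube-* G H (i , j , k , l) x = trans (cong₂ _*_ (mix _ _ _ _) (mix _ _ _ _)) (mix _ _ _ _)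

    ψ : ℤ → ℤ → ℤ → ℤ → X → ℚ
    ψ n n₂ p r x = pair F (-ᶻ n) 0ℤ (x ⊕ p) * pair F (-ᶻ n₂) 0ℤ (x ⊕ r)

    cube-ψ : ∀ n n₂ p r u x → cube (ψ n n₂ p r) u x ≡
      (cube F u (x ⊕ p ⊕ 0ℤ) * (cube F u (x ⊕ r ⊕ -ᶻ n₂) * cube F u (x ⊕ r ⊕ 0ℤ))) * cube F u (x ⊕ p ⊕ -ᶻ n)
    cube-ψ n n₂ p r u x = trans (cube-* (λ y → pair F (-ᶻ n) 0ℤ (y ⊕ p)) (λ y → pair F (-ᶻ n₂) 0ℤ (y ⊕ r)) u x)
      (trans (cong₂ _*_ (two n p) (two n₂ r))
        (solve 4 (λ a b c d → (a :* b) :* (c :* d) := (b :* (c :* d)) :* a) refl (cube F u (x ⊕ p ⊕ -ᶻ n)) (cube F u (x ⊕ p ⊕ 0ℤ)) (cube F u (x ⊕ r ⊕ -ᶻ n₂)) (cube F u (x ⊕ r ⊕ 0ℤ))))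
      where
      two : ∀ n p → cube (λ y → pair F (-ᶻ n) 0ℤ (y ⊕ p)) u x ≡ cube F u (x ⊕ p ⊕ -ᶻ n) * cube F u (x ⊕ p ⊕ 0ℤ)
      two n p = trans (cube-shift (pair F (-ᶻ n) 0ℤ) p u x) (trans (cube-* (λ y → F (y ⊕ -ᶻ n)) (λ y → F (y ⊕ 0ℤ)) u (x ⊕ p))
        (cong₂ _*_ (cube-shift F (-ᶻ n) u (x ⊕ p)) (cube-shift F 0ℤ u (x ⊕ p))))

    -- Of the four cubes of F in each product, exactly one involves n. Cauchy-Schwarz discards the
    -- other three, and the average over n becomes a third direction A.
    isolate : let V = avg (Diff A) λ n → avg (Diff A) λ n₂ → avg (Diff C) λ p → avg (Diff C) λ r → box (U ∷ U ∷ []) (ψ n n₂ p r) in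
      V * V ≤ box (U ∷ U ∷ A ∷ []) F
    isolate = begin
      V * V ≡⟨ cong (λ t → t * t) (trans
                 (E-cong N λ n → E-cong N λ n₂ → E-cong MC λ p → E-cong MC λ r → E-cong UU λ u → E-cong space λ x →
                    cube-ψ (at (Diff A) n) (at (Diff A) n₂) (at (Diff C) p) (at (Diff C) r) u x)
                 (trans (E-swap N O λ n (n₂ , p , r , u , x) → α (n₂ , p , r , u , x) * γ p u x n)
                   (E-cong O λ (n₂ , p , r , u , x) → E-*ˡ N (α (n₂ , p , r , u , x)) (γ p u x)))) ⟩
      _ ≤⟨ cauchy-schwarz O α (λ (n₂ , p , r , u , x) → E N (γ p u x)) (λ _ → Bd-* (cube-Bd _ _) (Bd-* (cube-Bd _ _) (cube-Bd _ _))) ⟩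
      𝔼[ _ ∈ N ] 𝔼[ p ∈ MC ] 𝔼[ _ ∈ MC ] 𝔼[ u ∈ UU ] 𝔼[ x ∈ space ] (E N (γ p u x) * E N (γ p u x))
        ≡⟨ trans (E-const N _) (trans (E-cong MC λ p → trans (E-const MC _) (E-cong UU λ u →
             E-inv (λ x → (avg (Diff A) λ n → cube F u (x ⊕ -ᶻ n)) * (avg (Diff A) λ n → cube F u (x ⊕ -ᶻ n))) (at (Diff C) p)))
             (E-const MC _)) ⟩
      𝔼[ u ∈ UU ] 𝔼[ x ∈ space ] ((avg (Diff A) λ n → cube F u (x ⊕ -ᶻ n)) * (avg (Diff A) λ n → cube F u (x ⊕ -ᶻ n)))
        ≤⟨ E-mono UU (λ u → E-mono space λ x → jensen (mean A) _) ⟩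
      𝔼[ u ∈ UU ] 𝔼[ x ∈ space ] 𝔼[ i ∈ mean A ] (g u x i * g u x i)
        ≡⟨ E-cong UU (λ u → trans (E-shifted (mean A) (at A) (λ x i → cong (λ t → t * t) (E-cong (mean A) λ j →
               sh (cube F u) x (solveᶻ 2 (λ a b → a ⊞ ⊟ (a ⊟ b) ≔ b) refl (at A i) (at A j)))))
             (trans (E-cong space λ x → E-const (mean A) _) (sym (box₁ A (cube F u))))) ⟩
      box (U ∷ U ∷ A ∷ []) F ∎
      where
      open ℚₚ.≤-Reasoning
      V : ℚ
      V = avg (Diff A) λ n → avg (Diff A) λ n₂ → avg (Diff C) λ p → avg (Diff C) λ r → box (U ∷ U ∷ []) (ψ n n₂ p r)
      O = N ⊗ (MC ⊗ (MC ⊗ (UU ⊗ space)))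
      α : _ → ℚ
      α (n₂ , p , r , u , x) = cube F u (x ⊕ at (Diff C) p ⊕ 0ℤ) *
        (cube F u (x ⊕ at (Diff C) r ⊕ -ᶻ at (Diff A) n₂) * cube F u (x ⊕ at (Diff C) r ⊕ 0ℤ))
      γ : _ → _ → _ → _ → ℚ
      γ p u x n = cube F u (x ⊕ at (Diff C) p ⊕ -ᶻ at (Diff A) n)
      g : _ → X → Ix A → ℚ
      g u x i = 𝔼[ j ∈ mean A ] cube F u (x ⊕ -ᶻ (at A i -ᶻ at A j))

  -- The correlations left by `correlate` are nearly C-invariant. Removing the second dual function
  -- leaves their box norm along A♭ and C♭. Every shift in U is a sum of one absorbed by A♭ and one
  -- absorbed by C, and likewise for C♭ and C, so both directions may be replaced by U. Expanding
  -- the correlations then recovers F.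
  concatenate : ∀ (A C A′ C′ A♭ C♭ U : Win) →
    (∀ i → Inv θ A′ (at A♭ i)) → (∀ i → Inv θ C′ (at C♭ i)) →
    Splits θ U C♭ C → Splits θ U A♭ C → ∀ {F} → Bdd F →
    Chain e concatSteps (𝔼[ x ∈ space ] (dual A C F x * dual A′ C′ F x)) (box (U ∷ U ∷ A ∷ []) F)
  concatenate A C A′ C′ A♭ C♭ U iA iC sC sA {F} bF =
    _⟫_ (step sq (≤-trans (correlate A C F (dual A′ C′ F) bF (dual-Bd A′ C′ bF)) (≤-by e 0≤e refl)))
    (_⟫_
      (E-chain (sq ∷ sq ∷ ln ∷ ln ∷ sq ∷ sq ∷ []) (mean (Diff A)) λ i → E-chain (sq ∷ sq ∷ ln ∷ ln ∷ sq ∷ sq ∷ []) (mean (Diff A)) λ j →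
        inner (at (Diff A) i) (at (Diff A) j))
      (step sq (≤-trans (Isolate.isolate A C U bF) (≤-by e 0≤e refl))))
    where
    inner : ∀ n n₂ → Chain e (sq ∷ sq ∷ ln ∷ ln ∷ sq ∷ sq ∷ [])
      (𝔼[ x ∈ space ] ((corr C F n x * corr C F n₂ x) * (dual A′ C′ F (x ⊕ -ᶻ n) * dual A′ C′ F (x ⊕ -ᶻ n₂))))
      (avg (Diff C) λ p → avg (Diff C) λ r → box (U ∷ U ∷ []) (Isolate.ψ A C U bF n n₂ p r))
    inner n n₂ =
      _⟫_ (Kill.kill A′ A♭ C′ C♭ iA iC F bF n n₂ G bG 4θ≤)
      (_⟫_ (box-refine₂ A♭ C♭ C U bG ai sC sA)
        (≡-Chain (box-cong (U ∷ U ∷ []) λ x → E-prod MC MC (λ p → pair F (-ᶻ n) 0ℤ (x ⊕ at (Diff C) p)) (λ r → pair F (-ᶻ n₂) 0ℤ (x ⊕ at (Diff C) r)))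
          (twice 0≤e (box-convex (MC ⊗ MC) U U (λ (p , r) → Isolate.ψ A C U bF n n₂ (at (Diff C) p) (at (Diff C) r))
            (λ _ x → Bd-* (pair-Bd _ _ bF _) (pair-Bd _ _ bF _))))))
      where
      MC = mean (Diff C)
      G : X → ℚ
      G x = corr C F n x * corr C F n₂ x
      bG : Bdd G
      bG x = Bd-* (corr-Bd C n bF x) (corr-Bd C n₂ bF x)
      ai : ∀ m → Inv θ C m → AlmostInv (θ + θ) G m
      ai m h = *-inv (corr-Bd C n bF) (corr-Bd C n₂ bF)
        (smooth-inv (pair-Bd _ _ bF) (Inv-Diff {W = C} h)) (smooth-inv (pair-Bd _ _ bF) (Inv-Diff {W = C} h))

widenSteps : List Step
widenSteps = sq ∷ ln ∷ sq ∷ []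

globaliseSteps : List Step
globaliseSteps = sq ∷ concatSteps ++ widenSteps ++ widenSteps

module Widening (𝒮 : System) {θ e : ℚ} (0≤θ : 0ℚ ≤ θ)
  (16θ≤e : 2ℚ * (2ℚ * (2ℚ * (θ + θ))) ≤ e) where
  open Concatenate 𝒮 0≤θ 16θ≤e public

  0≤box : ∀ Ws W F → 0ℚ ≤ box (Ws ++ W ∷ []) F
  0≤box []       W F = 0≤box₁ W F
  0≤box (V ∷ Ws) W F = E-0≤ (mean V) λ i → E-0≤ (mean V) λ j → 0≤box Ws W _

  -- Largeness along many sparse windows forces largeness along a window U inside the sums of any two of them.
  widen : ∀ {O} (μ : Mean O) n (W : Fin (suc n) → Win) (U : Win) → 1/suc n ≤ e →
    (∀ i i′ → i ≢ i′ → Splits θ U (W i) (W i′)) → (φ : O → X → ℚ) → (∀ o → Bdd (φ o)) →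
    Chain e widenSteps (𝔼[ o ∈ μ ] 𝔼[ i ∈ uni n ] box (W i ∷ []) (φ o)) (𝔼[ o ∈ μ ] box (U ∷ []) (φ o))
  widen {O} μ n W U small sp φ bφ = link first
    (Chain-≡ (E-chain (ln ∷ sq ∷ []) (uni n) λ i → E-chain (ln ∷ sq ∷ []) (uni n) λ i′ →
       off-case (λ t → Chain e (ln ∷ sq ∷ []) t D) i i′ (ψ i i′)
         (zero-chain ln (sq ∷ []) 0≤e (E-0≤ μ λ o → 0≤box₁ U (φ o)))
         λ i≢i′ → link (≤-trans (proj₁ (close i i′ i≢i′)) (+-monoʳ-≤ _ 2θ≤)) (step sq (≤-trans (second i i′) (≤-by e 0≤e refl))))
     (trans (E-const (uni n) _) (E-const (uni n) D)))
    where
    open ℚₚ.≤-Reasoning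
    D : ℚ
    D = 𝔼[ o ∈ μ ] box (U ∷ []) (φ o)
    s : Fin (suc n) → O → X → ℚ
    s i o = smooth (Diff (W i)) (φ o)
    bs : ∀ i o → Bdd (s i o)
    bs i o = smooth-Bd (Diff (W i)) (bφ o)
    ψ T : Fin (suc n) → Fin (suc n) → ℚ
    ψ i i′ = 𝔼[ o ∈ μ ] 𝔼[ x ∈ space ] (s i o x * s i′ o x)
    M : ∀ i i′ → Mean ((Ix (W i) × Ix (W i)) × (Ix (W i′) × Ix (W i′)))
    M i i′ = mean (Diff (W i)) ⊗ mean (Diff (W i′))
    c : ∀ i i′ → (Ix (W i) × Ix (W i)) × (Ix (W i′) × Ix (W i′)) → ℤ
    c i i′ (k , k′) = at (Diff (W i)) k +ᶻ at (Diff (W i′)) k′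
    T i i′ = 𝔼[ o ∈ μ ] 𝔼[ x ∈ space ] (φ o (x ⊕ 0ℤ) * 𝔼[ k ∈ M i i′ ] smooth U (φ o) (x ⊕ c i i′ k))
    first : (𝔼[ o ∈ μ ] 𝔼[ i ∈ uni n ] box (W i ∷ []) (φ o)) * (𝔼[ o ∈ μ ] 𝔼[ i ∈ uni n ] box (W i ∷ []) (φ o)) ≤
      𝔼[ i ∈ uni n ] 𝔼[ i′ ∈ uni n ] off i i′ (ψ i i′) + e
    first = begin
      _ ≡⟨ cong (λ t → t * t) (E-cong μ λ o → trans (E-cong (uni n) λ i → box₁-diff (W i) (φ o))
             (trans (E-swap (uni n) space λ i x → φ o (x ⊕ 0ℤ) * s i o x) (E-cong space λ x → E-*ˡ (uni n) (φ o (x ⊕ 0ℤ)) λ i → s i o x))) ⟩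
      _ ≤⟨ cauchy-schwarz (μ ⊗ space) (λ (o , x) → φ o (x ⊕ 0ℤ)) (λ (o , x) → 𝔼[ i ∈ uni n ] s i o x) (λ (o , x) → bφ o _) ⟩
      _ ≡⟨ trans (E-cong (μ ⊗ space) λ (o , x) → E-sq (uni n) λ i → s i o x)
             (E-swap (μ ⊗ space) (uni n ⊗ uni n) λ (o , x) (i , i′) → s i o x * s i′ o x) ⟩
      𝔼[ i ∈ uni n ] 𝔼[ i′ ∈ uni n ] ψ i i′
        ≤⟨ E-off n ψ (λ i i′ → proj₁ (E-Bd μ λ o → E-Bd space λ x → Bd-* (bs i o x) (bs i′ o x))) ⟩
      _ ≤⟨ +-monoʳ-≤ _ small ⟩
      _ ∎
    recentre : ∀ i i′ o → 𝔼[ x ∈ space ] (s i o x * s i′ o x) ≡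
      𝔼[ x ∈ space ] (φ o (x ⊕ 0ℤ) * 𝔼[ k ∈ M i i′ ] φ o (x ⊕ c i i′ k))
    recentre i i′ o = trans (E-cong space λ x → trans (E-prod (mean (Diff (W i))) (mean (Diff (W i′))) _ _)
        (E-swap (mean (W i)) (mean (W i)) _))
      (trans (E-shifted (M i i′) (λ ((b , a) , _) → -ᶻ (at (W i) a -ᶻ at (W i) b)) λ x ((b , a) , k′) → cong₂ _*_
          (sh (φ o) x (solveᶻ 2 (λ a b → ⊟ (a ⊟ b) ⊞ (a ⊟ b) ≔ # 0ℤ) refl (at (W i) a) (at (W i) b)))
          (sh (φ o) x (solveᶻ 3 (λ a b t → ⊟ (a ⊟ b) ⊞ t ≔ b ⊟ a ⊞ t) refl (at (W i) a) (at (W i) b) (at (Diff (W i′)) k′))))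
        (E-cong space λ x → E-*ˡ (M i i′) (φ o (x ⊕ 0ℤ)) λ k → φ o (x ⊕ c i i′ k)))
    -- By translation invariance the correlation of two smoothed functions is that of φ with its
    -- average over sums of the two difference windows. Every shift in U splits between these
    -- windows, so a further average over U is almost free.
    close : ∀ i i′ → i ≢ i′ → ψ i i′ ≈[ θ + θ ] T i i′
    close i i′ ne = E-≈ μ λ o → ≈-≡ˡ (sym (recentre i i′ o)) (E-≈ space λ x → ≈-*ˡ (bφ o _) (≈-≡ʳ (E-swap (mean U) (M i i′) _)
      (≈-≡ˡ (E-const (mean U) _) (E-≈ (mean U) λ u → let (m , m′ , eq , h , h′) = sp i i′ ne u in ≈-sym (≈-trans
        (≈-≡ˡ (E-cong (M i i′) λ (k , k′) → sym (trans (sh (φ o) x refl) (cong (λ t → φ o (x ⊕ t))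
                 (trans (cong ((at (Diff (W i)) k +ᶻ at (Diff (W i′)) k′) +ᶻ_) eq)
                   (solveᶻ 4 (λ a b m m′ → a ⊞ b ⊞ (m ⊞ m′) ≔ (a ⊞ m) ⊞ (b ⊞ m′)) refl (at (Diff (W i)) k) (at (Diff (W i′)) k′) m m′)))))
          (shift (Inv-Diff {W = W i} h) (λ t → avg (Diff (W i′)) λ t′ → φ o (x ⊕ (t +ᶻ (t′ +ᶻ m′)))) (λ t → E-Bd (mean (Diff (W i′))) λ _ → bφ o _)))
        (E-≈ (mean (Diff (W i))) λ k → shift (Inv-Diff {W = W i′} h′) (λ t′ → φ o (x ⊕ (at (Diff (W i)) k +ᶻ t′))) (λ _ → bφ o _)))))))
    second : ∀ i i′ → T i i′ * T i i′ ≤ D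
    second i i′ = begin
      _ ≤⟨ cauchy-schwarz (μ ⊗ space) (λ (o , x) → φ o (x ⊕ 0ℤ)) (λ (o , x) → 𝔼[ k ∈ M i i′ ] smooth U (φ o) (x ⊕ c i i′ k)) (λ (o , x) → bφ o _) ⟩
      _ ≤⟨ E-mono (μ ⊗ space) (λ (o , x) → jensen (M i i′) λ k → smooth U (φ o) (x ⊕ c i i′ k)) ⟩
      _ ≡⟨ E-cong μ (λ o → trans (sym (E-shift (M i i′) (c i i′) λ x _ → smooth U (φ o) x * smooth U (φ o) x))
             (trans (E-cong space λ x → E-const (M i i′) _) (sym (box₁ U (φ o))))) ⟩
      D ∎

  box-exchange : ∀ U W Ws F → box (U ∷ W ∷ Ws) F ≡ box (W ∷ U ∷ Ws) F
  box-exchange U W Ws F = trans (E-swap (mean U ⊗ mean U) (mean W ⊗ mean W) _)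
    (E-cong (mean W) λ k → E-cong (mean W) λ l → E-cong (mean U) λ i → E-cong (mean U) λ j → box-cong Ws λ x →
      trans (mix _ _ _ _) (cong₂ _*_ (cong₂ _*_ (c x i k) (c x i l)) (cong₂ _*_ (c x j k) (c x j l))))
    where
    c : ∀ x i k → F (x ⊕ at W k ⊕ at U i) ≡ F (x ⊕ at U i ⊕ at W k)
    c x i k = trans (sh F x (solveᶻ 2 (λ a b → a ⊞ b ≔ b ⊞ a) refl (at W k) (at U i))) (sym (sh F x refl))

  box-cong-tail : ∀ W {Ws Ws′} → (∀ F → box Ws F ≡ box Ws′ F) → ∀ F → box (W ∷ Ws) F ≡ box (W ∷ Ws′) F
  box-cong-tail W h F = E-cong (mean W) λ i → E-cong (mean W) λ j → h _

  -- For fixed j the box norm in α i and γ i j is the inner product of a function independent of i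
  -- with a dual function. Cauchy-Schwarz therefore compares dual functions for different i,
  -- `concatenate` trades each such pair for two directions U, and `widen` replaces first α i and
  -- then β j by U.
  globalise : ∀ n (ℒ ℒ♭ U : Win) (α β : Fin (suc n) → ℤ) (γ : Fin (suc n) → Fin (suc n) → ℤ) → 1/suc n ≤ e →
    (∀ i k → Inv θ (Scale (α i) ℒ) (at (Scale (α i) ℒ♭) k)) →
    (∀ i j k → Inv θ (Scale (γ i j) ℒ) (at (Scale (γ i j) ℒ♭) k)) →
    (∀ i i′ j → i ≢ i′ → Splits θ U (Scale (γ i′ j) ℒ♭) (Scale (γ i j) ℒ)) →
    (∀ i i′ j → i ≢ i′ → Splits θ U (Scale (α i′) ℒ♭) (Scale (γ i j) ℒ)) →
    (∀ i i′ → i ≢ i′ → Splits θ U (Scale (α i) ℒ) (Scale (α i′) ℒ)) →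
    (∀ j j′ → j ≢ j′ → Splits θ U (Scale (β j) ℒ) (Scale (β j′) ℒ)) →
    ∀ {f} → Bdd f →
    Chain e globaliseSteps
      (𝔼[ j ∈ uni n ] 𝔼[ i ∈ uni n ] box (Scale (β j) ℒ ∷ Scale (α i) ℒ ∷ Scale (γ i j) ℒ ∷ []) f)
      (box (U ∷ U ∷ U ∷ U ∷ []) f)
  globalise n ℒ ℒ♭ U α β γ small iα iγ sγ sα sαα sββ {f} bf =
    link first
    (E-chain concatSteps (uni n) (λ i → Chain-≡ (E-chain concatSteps (uni n) λ i′ →
       off-case (λ t → Chain e concatSteps t (𝔼[ o ∈ O ] box (U ∷ U ∷ 𝒜 i ∷ []) (F o))) i i′ (ψ i i′)
         (zero-chain sq _ 0≤e (E-0≤ O λ o → 0≤box (U ∷ U ∷ []) (𝒜 i) (F o)))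
         (λ ne → E-chain concatSteps O λ o@(j , _) → concatenate (𝒜 i) (𝒞 i o) (𝒜 i′) (𝒞 i′ o) (Scale (α i′) ℒ♭) (Scale (γ i′ j) ℒ♭) U
            (iα i′) (iγ i′ j) (sγ i i′ j ne) (sα i i′ j ne) (bF o)))
       (E-const (uni n) _))
    ⟫ ≡-Chain (E-swap (uni n) (O ⊗ UU) λ i (o , u) → box (𝒜 i ∷ []) (cube (F o) u))
        (Chain-≡ (widen (O ⊗ UU) n 𝒜 U small sαα (λ (o , u) → cube (F o) u) (λ (o , u) → cube-Bd (bF o) u))
          (E-cong (uni n) λ j → trans (box-exchange (ℬ j) U (U ∷ U ∷ []) f) (box-cong-tail U {ℬ j ∷ U ∷ U ∷ []} {U ∷ U ∷ ℬ j ∷ []} (λ F → trans (box-exchange (ℬ j) U (U ∷ []) F)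
             (box-cong-tail U {ℬ j ∷ U ∷ []} {U ∷ ℬ j ∷ []} (λ F → box-exchange (ℬ j) U [] F) F)) f)))
    ⟫ ≡-Chain (E-swap (uni n) (mean U ⊗ (mean U ⊗ UU)) λ j (k , l , u) → box (ℬ j ∷ []) (cube (pair f (at U k) (at U l)) u))
        (widen (mean U ⊗ (mean U ⊗ UU)) n ℬ U small sββ (λ (k , l , u) → cube (pair f (at U k) (at U l)) u)
          (λ (k , l , u) → cube-Bd (pair-Bd _ _ bf) u)))
    where
    open ℚₚ.≤-Reasoning
    𝒜 ℬ : Fin (suc n) → Win
    𝒜 i = Scale (α i) ℒ
    ℬ j = Scale (β j) ℒ
    O : Mean (Fin (suc n) × Ix ℒ × Ix ℒ)
    O = uni n ⊗ (mean ℒ ⊗ mean ℒ)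
    𝒞 : Fin (suc n) → Fin (suc n) × Ix ℒ × Ix ℒ → Win
    𝒞 i (j , _) = Scale (γ i j) ℒ
    F : Fin (suc n) × Ix ℒ × Ix ℒ → X → ℚ
    F (j , m , m′) = pair f (β j *ᶻ at ℒ m) (β j *ᶻ at ℒ m′)
    bF : ∀ o → Bdd (F o)
    bF o = pair-Bd _ _ bf
    UU : Mean (Ix U × Ix U × Ix U × Ix U)
    UU = mean U ⊗ (mean U ⊗ (mean U ⊗ mean U))
    cube : (X → ℚ) → Ix U × Ix U × Ix U × Ix U → X → ℚ
    cube G (i , j , k , l) = pair (pair G (at U i) (at U j)) (at U k) (at U l)
    cube-Bd : ∀ {G} → Bdd G → ∀ u → Bdd (cube G u)
    cube-Bd b u = pair-Bd _ _ (pair-Bd _ _ b)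
    δ : Fin (suc n) → Fin (suc n) × Ix ℒ × Ix ℒ → X → ℚ
    δ i o = dual (𝒜 i) (𝒞 i o) (F o)
    ψ : Fin (suc n) → Fin (suc n) → ℚ
    ψ i i′ = 𝔼[ o ∈ O ] 𝔼[ x ∈ space ] (δ i o x * δ i′ o x)
    V : ℚ
    V = 𝔼[ j ∈ uni n ] 𝔼[ i ∈ uni n ] box (ℬ j ∷ 𝒜 i ∷ Scale (γ i j) ℒ ∷ []) f
    first : V * V ≤ 𝔼[ i ∈ uni n ] 𝔼[ i′ ∈ uni n ] off i i′ (ψ i i′) + e
    first = begin
      V * V ≡⟨ cong (λ t → t * t) (trans (E-cong (uni n) λ j → E-swap (uni n) (mean ℒ ⊗ mean ℒ) λ i (m , m′) → box (𝒜 i ∷ Scale (γ i j) ℒ ∷ []) (F (j , m , m′)))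
                 (E-cong O λ o → trans (E-cong (uni n) λ i → box-dual (𝒜 i) (𝒞 i o) (F o))
                   (trans (E-swap (uni n) space λ i x → F o (x ⊕ 0ℤ) * δ i o x) (E-cong space λ x → E-*ˡ (uni n) (F o (x ⊕ 0ℤ)) λ i → δ i o x)))) ⟩
      _ ≤⟨ cauchy-schwarz (O ⊗ space) (λ (o , x) → F o (x ⊕ 0ℤ)) (λ (o , x) → 𝔼[ i ∈ uni n ] δ i o x) (λ (o , x) → bF o _) ⟩
      _ ≡⟨ trans (E-cong (O ⊗ space) λ (o , x) → E-sq (uni n) λ i → δ i o x)
             (E-swap (O ⊗ space) (uni n ⊗ uni n) λ (o , x) (i , i′) → δ i o x * δ i′ o x) ⟩
      𝔼[ i ∈ uni n ] 𝔼[ i′ ∈ uni n ] ψ i i′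
        ≤⟨ E-off n ψ (λ i i′ → proj₁ (E-Bd O λ o → E-Bd space λ x → Bd-* (dual-Bd (𝒜 i) (𝒞 i o) (bF o) x) (dual-Bd (𝒜 i′) (𝒞 i′ o) (bF o) x))) ⟩
      _ ≤⟨ +-monoʳ-≤ _ small ⟩
      _ ∎

-- Degree lowering

-- The increment (d + t)² - d², scaled by q.
increment : ℤ → ℤ → ℤ → ℤ
increment q d t = q *ᶻ (2ᶻ *ᶻ d *ᶻ t +ᶻ t *ᶻ t)

halve : ∀ {a b θ} → a ≈[ θ ] b → ½ * (a - b) ≈[ θ ] 0ℚ
halve {a} {b} {θ} (p , r) =
  ≤-by _ (0≤+ (0≤* 0≤½ (0≤b-a p)) (0≤* 0≤½ (0≤θ (p , r)))) (solve 3 (λ a b t → con 0ℚ :+ t := con ½ :* (a :- b) :+ (con ½ :* (b :+ t :- a) :+ con ½ :* t)) refl a b θ) ,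
  ≤-by _ (0≤+ (0≤* 0≤½ (0≤b-a r)) (0≤* 0≤½ (0≤θ (p , r)))) (solve 3 (λ a b t → con ½ :* (a :- b) :+ t := con 0ℚ :+ (con ½ :* (a :+ t :- b) :+ con ½ :* t)) refl a b θ)

half-diff-Bd : ∀ {a b} → Bd a → Bd b → Bd (½ * (a - b))
half-diff-Bd {a} {b} (p , p′) (r , r′) =
  ≤-by _ (0≤* 0≤½ (0≤+ (0≤b-a p) (0≤b-a r′))) (solve 2 (λ a b → con 1ℚ := con ½ :* (a :- b) :+ con ½ :* ((con 1ℚ :- a) :+ (b :- (:- con 1ℚ)))) refl a b) ,
  ≤-by _ (0≤* 0≤½ (0≤+ (0≤b-a p′) (0≤b-a r))) (solve 2 (λ a b → con ½ :* (a :- b) := :- con 1ℚ :+ con ½ :* ((a :- (:- con 1ℚ)) :+ (con 1ℚ :- b))) refl a b)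

module Diagonal {O : Set} (μ : Mean O) (q d₁ d₂ : ℤ) (𝒱 : Win) where

  path₁ path₂ : ℤ → ℤ
  path₁ = increment q d₁
  path₂ = increment q d₂

  energy : (O → ℤ → ℤ → ℚ) → ℚ
  energy ζ = 𝔼[ o ∈ μ ] (avg 𝒱 (λ u → ζ o (path₁ u) (path₂ u)) * avg 𝒱 (λ u → ζ o (path₁ u) (path₂ u)))

  diagonalAverage : Win → (O → ℤ → ℤ → ℚ) → O → ℤ → ℤ → ℚ
  diagonalAverage 𝒯 ζ o m n = avg 𝒯 λ t → ζ o (m +ᶻ t) (n +ᶻ t)

  -- Invariance in the mean over o: what hardly changes along the path is the pair correlations of
  -- ζ, not ζ itself.
  record Stationary (ς : ℚ) (ζ : O → ℤ → ℤ → ℚ) (t : ℤ) : Set where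
    constructor stationary
    field
      drift : ∀ m n m′ n′ →
        𝔼[ o ∈ μ ] (ζ o (m +ᶻ path₁ t) (n +ᶻ path₂ t) * ζ o (m′ +ᶻ path₁ t) (n′ +ᶻ path₂ t)) ≈[ ς ]
        𝔼[ o ∈ μ ] (ζ o m n * ζ o m′ n′)
  open Stationary public

  average-stationary : ∀ {ς} 𝒯 {ζ t} → Stationary ς ζ t → Stationary ς (diagonalAverage 𝒯 ζ) t
  average-stationary {ς} 𝒯 {ζ} {t} h = stationary λ m n m′ n′ →
    ≈-≡ˡ (sym (expand (λ k → m +ᶻ path₁ t +ᶻ k) (λ k → n +ᶻ path₂ t +ᶻ k) (λ k → m′ +ᶻ path₁ t +ᶻ k) (λ k → n′ +ᶻ path₂ t +ᶻ k)))
    (≈-≡ʳ (sym (expand (m +ᶻ_) (n +ᶻ_) (m′ +ᶻ_) (n′ +ᶻ_)))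
    (E-≈ M λ k → E-≈ M λ l → ≈-≡ˡ (E-cong μ λ o → cong₂ _*_
       (cong₂ (ζ o) (c m (path₁ t) (at 𝒯 k)) (c n (path₂ t) (at 𝒯 k))) (cong₂ (ζ o) (c m′ (path₁ t) (at 𝒯 l)) (c n′ (path₂ t) (at 𝒯 l))))
       (drift h (m +ᶻ at 𝒯 k) (n +ᶻ at 𝒯 k) (m′ +ᶻ at 𝒯 l) (n′ +ᶻ at 𝒯 l))))
    where
    M = mean 𝒯
    c : ∀ m p k → m +ᶻ k +ᶻ p ≡ m +ᶻ p +ᶻ k
    c = solveᶻ 3 (λ m p k → m ⊞ k ⊞ p ≔ m ⊞ p ⊞ k) refl
    expand : ∀ (a b a′ b′ : ℤ → ℤ) →
      𝔼[ o ∈ μ ] (avg 𝒯 (λ k → ζ o (a k) (b k)) * avg 𝒯 (λ k → ζ o (a′ k) (b′ k))) ≡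
      𝔼[ k ∈ M ] 𝔼[ l ∈ M ] 𝔼[ o ∈ μ ] (ζ o (a (at 𝒯 k)) (b (at 𝒯 k)) * ζ o (a′ (at 𝒯 l)) (b′ (at 𝒯 l)))
    expand a b a′ b′ = trans (E-cong μ λ o → E-prod M M _ _) (E-swap μ (M ⊗ M) _)

  -- The path (γ₁ , γ₂) is quadratic along the diagonal, so a van der Corput step with a short shift
  -- shows that only the diagonally averaged part of ζ contributes.
  diagonalise : ∀ {ς θ e} n (g : Fin (suc n) → ℤ) (𝒯 : Win) (ζ : O → ℤ → ℤ → ℚ) → (∀ o m n → Bd (ζ o m n)) →
    0ℚ ≤ e → (∀ i → Inv θ 𝒱 (g i)) →
    (∀ u i → Stationary ς ζ (at 𝒱 u +ᶻ g i)) →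
    (∀ i j → i ≢ j → ∀ w → Σ ℤ λ k → at 𝒯 w ≡ 2ᶻ *ᶻ q *ᶻ (g j -ᶻ g i) *ᶻ k × Inv θ 𝒱 k) →
    4ℚ * (((θ + θ) + ς) + (θ + 1/suc n)) ≤ e →
    Chain e (hf ∷ []) (energy ζ) (energy (diagonalAverage 𝒯 ζ))
  diagonalise {ς} {θ} {e} n g 𝒯 ζ bζ 0≤e ig st sp small = step hf (begin
    ½ * energy ζ                   ≤⟨ *-monoˡ 0≤½ split ⟩
    ½ * (2ℚ * energy Πζ + (4ℚ + 4ℚ) * energy η) ≡⟨ solve 2 (λ a b → con ½ :* ((con 1ℚ :+ con 1ℚ) :* a :+ (four :+ four) :* b) := a :+ four :* b) refl (energy Πζ) (energy η) ⟩
    energy Πζ + 4ℚ * energy η      ≤⟨ +-monoʳ-≤ _ (≤-trans (*-monoˡ (0≤+ 0≤2 0≤2) η-small) small) ⟩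
    energy Πζ + e                  ∎)
    where
    open ℚₚ.≤-Reasoning
    four = con 1ℚ :+ con 1ℚ :+ (con 1ℚ :+ con 1ℚ)
    Πζ η : O → ℤ → ℤ → ℚ
    Πζ = diagonalAverage 𝒯 ζ
    η o m n = ½ * (ζ o m n - Πζ o m n)
    bΠ : ∀ o m n → Bd (Πζ o m n)
    bΠ o m n = E-Bd (mean 𝒯) λ _ → bζ o _ _
    bη : ∀ o m n → Bd (η o m n)
    bη o m n = half-diff-Bd (bζ o m n) (bΠ o m n)
    -- ζ = Πζ + 2 η, whence the factors 2 and 8. The factor 1/2 in η keeps it bounded by 1, and
    -- halving the inequality is the loss `hf`.
    split : energy ζ ≤ 2ℚ * energy Πζ + (4ℚ + 4ℚ) * energy η
    split = ≤-trans (E-mono μ λ o → pt (avg 𝒱 λ u → ζ o (path₁ u) (path₂ u)) (avg 𝒱 λ u → Πζ o (path₁ u) (path₂ u)) _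
        (trans (E-*ˡ (mean 𝒱) ½ _) (cong (½ *_) (E-minus (mean 𝒱) _ _))))
      (≤-reflexive (trans (E-+ μ _ _) (cong₂ _+_ (E-*ˡ μ 2ℚ _) (E-*ˡ μ (4ℚ + 4ℚ) _))))
      where
      pt : ∀ a b c → c ≡ ½ * (a - b) → a * a ≤ 2ℚ * (b * b) + (4ℚ + 4ℚ) * (c * c)
      pt a b .(½ * (a - b)) refl = ≤-by _ (0≤sq (a - (b + b)))
        (solve 2 (λ a b → (con 1ℚ :+ con 1ℚ) :* (b :* b) :+ (four :+ four) :* ((con ½ :* (a :- b)) :* (con ½ :* (a :- b)))
           := a :* a :+ (a :- (b :+ b)) :* (a :- (b :+ b))) refl a b)
    quarter : ∀ {a b c d a′ b′ c′ d′} → a ≈[ ς ] a′ → b ≈[ ς ] b′ → c ≈[ ς ] c′ → d ≈[ ς ] d′ →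
      ½ * (½ * ((a - b) - (c - d))) ≈[ ς ] ½ * (½ * ((a′ - b′) - (c′ - d′)))
    quarter {a} {b} {c} {d} {a′} {b′} {c′} {d′} p r s t = one a b c d a′ b′ c′ d′ (proj₁ p) (proj₂ r) (proj₂ s) (proj₁ t) , one a′ b′ c′ d′ a b c d (proj₂ p) (proj₁ r) (proj₁ s) (proj₂ t)
      where
      one : ∀ a b c d a′ b′ c′ d′ → a ≤ a′ + ς → b′ ≤ b + ς → c′ ≤ c + ς → d ≤ d′ + ς →
        ½ * (½ * ((a - b) - (c - d))) ≤ ½ * (½ * ((a′ - b′) - (c′ - d′))) + ς
      one a b c d a′ b′ c′ d′ p r s t = ≤-by _ (0≤* 0≤½ (0≤* 0≤½ (0≤+ (0≤+ (0≤b-a p) (0≤b-a r)) (0≤+ (0≤b-a s) (0≤b-a t)))))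
        (trans (cong (½ * (½ * ((a′ - b′) - (c′ - d′))) +_) (solve 1 (λ s → s := con ½ :* (con ½ :* (s :+ s :+ (s :+ s)))) refl ς))
        (solve 9 (λ a b c d a′ b′ c′ d′ s → con ½ :* (con ½ :* ((a′ :- b′) :- (c′ :- d′))) :+ con ½ :* (con ½ :* (s :+ s :+ (s :+ s)))
          := con ½ :* (con ½ :* ((a :- b) :- (c :- d))) :+ con ½ :* (con ½ :* ((a′ :+ s :- a) :+ (b :+ s :- b′) :+ ((c :+ s :- c′) :+ (d′ :+ s :- d)))))
          refl a b c d a′ b′ c′ d′ ς))
    M = mean 𝒯
    C : ℤ → ℤ → ℤ → ℤ → ℚ
    C m n m′ n′ = 𝔼[ o ∈ μ ] (ζ o m n * ζ o m′ n′)
    product : ∀ m n m′ n′ → 𝔼[ o ∈ μ ] (η o m n * η o m′ n′) ≡ 𝔼[ k ∈ M ] 𝔼[ l ∈ M ]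
      (½ * (½ * ((C m n m′ n′ - C m n (m′ +ᶻ at 𝒯 l) (n′ +ᶻ at 𝒯 l)) - (C (m +ᶻ at 𝒯 k) (n +ᶻ at 𝒯 k) m′ n′ - C (m +ᶻ at 𝒯 k) (n +ᶻ at 𝒯 k) (m′ +ᶻ at 𝒯 l) (n′ +ᶻ at 𝒯 l)))))
    product m n m′ n′ = trans
      (E-cong μ λ o → trans (cong₂ _*_ (spread o m n) (spread o m′ n′)) (E-prod M M _ _))
      (trans (E-swap μ (M ⊗ M) _) (E-cong M λ k → E-cong M λ l → trans
        (E-cong μ λ o → solve 4 (λ a b c d → con ½ :* (a :- b) :* (con ½ :* (c :- d)) := con ½ :* (con ½ :* ((a :* c :- a :* d) :- (b :* c :- b :* d)))) refl
           (ζ o m n) (ζ o (m +ᶻ at 𝒯 k) (n +ᶻ at 𝒯 k)) (ζ o m′ n′) (ζ o (m′ +ᶻ at 𝒯 l) (n′ +ᶻ at 𝒯 l)))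
        (trans (E-*ˡ μ ½ _) (cong (½ *_) (trans (E-*ˡ μ ½ _) (cong (½ *_) (trans (E-minus μ _ _) (cong₂ _-_ (E-minus μ _ _) (E-minus μ _ _)))))))))
      where
      spread : ∀ o m n → η o m n ≡ 𝔼[ k ∈ M ] (½ * (ζ o m n - ζ o (m +ᶻ at 𝒯 k) (n +ᶻ at 𝒯 k)))
      spread o m n = sym (trans (E-*ˡ M ½ _) (cong (½ *_) (trans (E-minus M _ _) (cong (_- Πζ o m n) (E-const M _)))))
    η-stationary : ∀ {t} → Stationary ς ζ t → Stationary ς η t
    η-stationary {t} h = stationary λ m n m′ n′ →
      ≈-≡ˡ (sym (product (m +ᶻ path₁ t) (n +ᶻ path₂ t) (m′ +ᶻ path₁ t) (n′ +ᶻ path₂ t))) (≈-≡ʳ (sym (product m n m′ n′)) (E-≈ M λ k → E-≈ M λ l →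
        quarter (drift h m n m′ n′)
          (≈-≡ˡ (E-cong μ λ o → cong (ζ o (m +ᶻ path₁ t) (n +ᶻ path₂ t) *_) (mv o m′ n′ l)) (drift h m n (m′ +ᶻ at 𝒯 l) (n′ +ᶻ at 𝒯 l)))
          (≈-≡ˡ (E-cong μ λ o → cong (_* ζ o (m′ +ᶻ path₁ t) (n′ +ᶻ path₂ t)) (mv o m n k)) (drift h (m +ᶻ at 𝒯 k) (n +ᶻ at 𝒯 k) m′ n′))
          (≈-≡ˡ (E-cong μ λ o → cong₂ _*_ (mv o m n k) (mv o m′ n′ l)) (drift h (m +ᶻ at 𝒯 k) (n +ᶻ at 𝒯 k) (m′ +ᶻ at 𝒯 l) (n′ +ᶻ at 𝒯 l)))))
      where
      c : ∀ m p k → m +ᶻ k +ᶻ p ≡ m +ᶻ p +ᶻ k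
      c = solveᶻ 3 (λ m p k → m ⊞ k ⊞ p ≔ m ⊞ p ⊞ k) refl
      mv : ∀ o m n k → ζ o (m +ᶻ at 𝒯 k +ᶻ path₁ t) (n +ᶻ at 𝒯 k +ᶻ path₂ t) ≡ ζ o (m +ᶻ path₁ t +ᶻ at 𝒯 k) (n +ᶻ path₂ t +ᶻ at 𝒯 k)
      mv o m n k = cong₂ (ζ o) (c m (path₁ t) (at 𝒯 k)) (c n (path₂ t) (at 𝒯 k))
    Δ : Fin (suc n) → Fin (suc n) → ℤ
    Δ i j = g j -ᶻ g i
    G : Fin (suc n) → Fin (suc n) → ℚ
    G i j = 𝔼[ u ∈ mean 𝒱 ] 𝔼[ o ∈ μ ] (η o (path₁ (at 𝒱 u +ᶻ g i)) (path₂ (at 𝒱 u +ᶻ g i)) * η o (path₁ (at 𝒱 u +ᶻ g j)) (path₂ (at 𝒱 u +ᶻ g j)))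
    χ : O → Ix 𝒱 → Fin (suc n) → ℚ
    χ o u i = η o (path₁ (at 𝒱 u +ᶻ g i)) (path₂ (at 𝒱 u +ᶻ g i))
    η-small : energy η ≤ ((θ + θ) + ς) + (θ + 1/suc n)
    η-small = begin
      energy η ≤⟨ E-mono+ μ (λ o → vdc-pt 𝒱 (uni n) g ig (λ u → η o (path₁ u) (path₂ u)) (λ u → bη o _ _)) ⟩
      _ ≡⟨ cong (_+ (θ + θ)) (trans (E-cong μ λ o → trans (E-cong (mean 𝒱) λ u → E-sq (uni n) (χ o u)) (E-swap (mean 𝒱) (uni n ⊗ uni n) λ u (i , j) → χ o u i * χ o u j))
             (trans (E-swap μ (uni n ⊗ uni n) λ o (i , j) → 𝔼[ u ∈ mean 𝒱 ] (χ o u i * χ o u j)) (E-cong (uni n ⊗ uni n) λ (i , j) → E-swap μ (mean 𝒱) λ o u → χ o u i * χ o u j))) ⟩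
      𝔼[ i ∈ uni n ] 𝔼[ j ∈ uni n ] G i j + (θ + θ)
        ≤⟨ +-monoˡ-≤ _ (E-off n G λ i j → proj₁ (E-Bd (mean 𝒱) λ u → E-Bd μ λ o → Bd-* (bη _ _ _) (bη _ _ _))) ⟩
      𝔼[ i ∈ uni n ] 𝔼[ j ∈ uni n ] off i j (G i j) + 1/suc n + (θ + θ)
        ≤⟨ +-monoˡ-≤ _ (+-monoˡ-≤ _ (E-≤ (uni n) λ i → E-≤ (uni n) λ j → off-case (_≤ ς + θ) i j (G i j) (≤-trans (≤-by _ 0≤ς+θ (sym (+-identityˡ _))) ≤-refl) (offdiag i j))) ⟩
      ς + θ + 1/suc n + (θ + θ)
        ≡⟨ solve 3 (λ s t c → s :+ t :+ c :+ (t :+ t) := t :+ t :+ s :+ (t :+ c)) refl ς θ (1/suc n) ⟩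
      θ + θ + ς + (θ + 1/suc n) ∎
      where
      0≤ς+θ : 0ℚ ≤ ς + θ
      0≤ς+θ = 0≤+ (0≤θ (E-extract₀ st)) (0≤θ (shift (ig zero) (λ _ → 1ℚ) λ _ → Bd-1))
        where
        someIx : ∀ {I} → Mean I → I
        someIx (uni n) = zero
        someIx (μ ⊗ ν) = someIx μ , someIx ν
        E-extract₀ : (∀ u i → Stationary ς ζ (at 𝒱 u +ᶻ g i)) → _
        E-extract₀ st = drift (st (someIx (mean 𝒱)) zero) 0ℤ 0ℤ 0ℤ 0ℤ
      -- Stationarity moves the first point of the pair to the origin. The second then runs through
      -- (`ℓ₁`, `ℓ₂`), whose coordinates have the same slope 2 q (g j - g i). So it moves
      -- diagonally, and the diagonal average has been subtracted from η.
      offdiag : ∀ i j → i ≢ j → G i j ≤ ς + θ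
      offdiag i j ne = begin
        G i j ≤⟨ E-mono+ (mean 𝒱) (λ u → proj₁ (≈-≡ˡ (E-cong μ λ o → cong₂ _*_
                   (cong₂ (η o) (z (path₁ (at 𝒱 u +ᶻ g i))) (z (path₂ (at 𝒱 u +ᶻ g i))))
                   (cong₂ (η o) (line d₁ (at 𝒱 u)) (line d₂ (at 𝒱 u))))
                 (drift (η-stationary (st u i)) 0ℤ 0ℤ (c d₁ +ᶻ 2ᶻ *ᶻ q *ᶻ Δ i j *ᶻ at 𝒱 u) (c d₂ +ᶻ 2ᶻ *ᶻ q *ᶻ Δ i j *ᶻ at 𝒱 u)))) ⟩
        𝔼[ u ∈ mean 𝒱 ] 𝔼[ o ∈ μ ] (η o 0ℤ 0ℤ * η o (ℓ₁ (at 𝒱 u)) (ℓ₂ (at 𝒱 u))) + ς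
              ≡⟨ cong (_+ ς) (trans (E-swap (mean 𝒱) μ _) (E-cong μ λ o → E-*ˡ (mean 𝒱) (η o 0ℤ 0ℤ) _)) ⟩
        𝔼[ o ∈ μ ] (η o 0ℤ 0ℤ * avg 𝒱 (λ u → η o (ℓ₁ u) (ℓ₂ u))) + ς
              ≤⟨ +-monoˡ-≤ _ (E-≤ μ λ o → ≤-trans (proj₁ (≈-*ˡ (bη o 0ℤ 0ℤ) (cancel o))) (≤-reflexive (trans (cong (_+ θ) (zeroʳ _)) (+-identityˡ θ)))) ⟩
        θ + ς ≡⟨ +-comm θ ς ⟩
        ς + θ ∎
        where
        c : ℤ → ℤ
        c d = q *ᶻ (2ᶻ *ᶻ d *ᶻ Δ i j +ᶻ (g j *ᶻ g j -ᶻ g i *ᶻ g i))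
        ℓ₁ ℓ₂ : ℤ → ℤ
        ℓ₁ u = c d₁ +ᶻ 2ᶻ *ᶻ q *ᶻ Δ i j *ᶻ u
        ℓ₂ u = c d₂ +ᶻ 2ᶻ *ᶻ q *ᶻ Δ i j *ᶻ u
        z : ∀ m → 0ℤ +ᶻ m ≡ m
        z = solveᶻ 1 (λ m → # 0ℤ ⊞ m ≔ m) refl
        line : ∀ d u → c d +ᶻ 2ᶻ *ᶻ q *ᶻ Δ i j *ᶻ u +ᶻ increment q d (u +ᶻ g i) ≡ increment q d (u +ᶻ g j)
        line d u = solveᶻ 5 (λ q d u g h →
          q ⊠ (# 2ᶻ ⊠ d ⊠ (h ⊟ g) ⊞ (h ⊠ h ⊟ g ⊠ g)) ⊞ # 2ᶻ ⊠ q ⊠ (h ⊟ g) ⊠ u ⊞ q ⊠ (# 2ᶻ ⊠ d ⊠ (u ⊞ g) ⊞ (u ⊞ g) ⊠ (u ⊞ g))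
          ≔ q ⊠ (# 2ᶻ ⊠ d ⊠ (u ⊞ h) ⊞ (u ⊞ h) ⊠ (u ⊞ h))) refl q d u (g i) (g j)
        cancel : ∀ o → avg 𝒱 (λ u → η o (ℓ₁ u) (ℓ₂ u)) ≈[ θ ] 0ℚ
        cancel o = ≈-≡ˡ (sym (trans (E-*ˡ (mean 𝒱) ½ _) (cong (½ *_) (E-minus (mean 𝒱) _ _))))
          (halve (≈-≡ʳ (sym (E-swap (mean 𝒱) M _)) (≈-≡ˡ (E-const M _) (E-≈ M λ w →
            let (k , eq , h) = sp i j ne w in ≈-sym (≈-≡ˡ (E-cong (mean 𝒱) λ u → cong₂ (ζ o) (mv d₁ (at 𝒱 u) k eq) (mv d₂ (at 𝒱 u) k eq))
              (shift h (λ u → ζ o (ℓ₁ u) (ℓ₂ u)) (λ _ → bζ o _ _)))))))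
          where
          mv : ∀ d u k {t} → t ≡ 2ᶻ *ᶻ q *ᶻ Δ i j *ᶻ k → c d +ᶻ 2ᶻ *ᶻ q *ᶻ Δ i j *ᶻ (u +ᶻ k) ≡ c d +ᶻ 2ᶻ *ᶻ q *ᶻ Δ i j *ᶻ u +ᶻ t
          mv d u k refl = solveᶻ 4 (λ c a u k → c ⊞ a ⊠ (u ⊞ k) ≔ c ⊞ a ⊠ u ⊞ a ⊠ k) refl (c d) (2ᶻ *ᶻ q *ᶻ Δ i j) u k

sqr : ℚ → ℚ
sqr a = a * a

lowerSteps : List Step
lowerSteps = ln ∷ sq ∷ hf ∷ hf ∷ ln ∷ []

module Core (𝒮 : System) (q : ℤ) {θ e : ℚ} (0≤θ : 0ℚ ≤ θ)
  (16θ≤e : 2ℚ * (2ℚ * (2ℚ * (θ + θ))) ≤ e) where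
  open Widening 𝒮 0≤θ 16θ≤e public

  base : ℤ → ℤ
  base d = q *ᶻ (d *ᶻ d) -ᶻ d

  -- Averaged over d, these functions are dual to the counting operator.
  dualTerm : (X → ℚ) → (X → ℚ) → ℤ → X → ℚ
  dualTerm f₀ f₁ d x = f₀ (x ⊕ -ᶻ (q *ᶻ (d *ᶻ d))) * f₁ (x ⊕ (d -ᶻ q *ᶻ (d *ᶻ d)))

  -- The functions v z act as features of points: their kernel, the mean over z of v z x times v z
  -- y, is to be nearly unchanged when x and y move together.
  KernelInv : ∀ {Z} → Mean Z → ℚ → (Z → X → ℚ) → ℤ → Set
  KernelInv ν ω v p = ∀ x y → 𝔼[ z ∈ ν ] (v z (x ⊕ p) * v z (y ⊕ p)) ≈[ ω ] 𝔼[ z ∈ ν ] (v z x * v z y)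

  module Lower {O Z : Set} (μ : Mean O) (ν : Mean Z) (f₀ f₁ : O → X → ℚ) (v : O → Z → X → ℚ)
    (b₀ : ∀ o → Bdd (f₀ o)) (b₁ : ∀ o → Bdd (f₁ o)) (bv : ∀ o z → Bdd (v o z))
    (𝒟 𝒲 𝒱 𝒱′ 𝒯₁ 𝒯₂ : Win) (n : ℕ) (r g₁ g₂ : Fin (suc n) → ℤ) (ω : ℚ)
    (𝒟-𝒱 : ∀ u → Inv θ 𝒟 (at 𝒱 u)) (𝒟-r : ∀ i → Inv θ 𝒟 (r i))
    (𝒲-inv : ∀ d u → Inv θ 𝒲 (increment q (at 𝒟 d) (at 𝒱 u)))
    (𝒱-g₁ : ∀ i → Inv θ 𝒱 (g₁ i)) (𝒱-g₂ : ∀ i → Inv θ 𝒱 (g₂ i)) (𝒱-𝒱′ : ∀ i → Inv θ 𝒱 (at 𝒱′ i))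
    (ker₁ : ∀ o d i u j → KernelInv ν ω (v o) (increment q (at 𝒟 d +ᶻ r i) (at 𝒱 u +ᶻ g₁ j)))
    (ker₂ : ∀ o d i u j → KernelInv ν ω (v o) (increment q (at 𝒟 d +ᶻ r i) (at 𝒱 u +ᶻ g₂ j)))
    (sp₁ : ∀ i j → i ≢ j → ∀ w → Σ ℤ λ k → at 𝒯₁ w ≡ 2ᶻ *ᶻ q *ᶻ (g₁ j -ᶻ g₁ i) *ᶻ k × Inv θ 𝒱 k)
    (sp₂ : ∀ i j → i ≢ j → ∀ w → Σ ℤ λ k → at 𝒯₂ w ≡ 2ᶻ *ᶻ q *ᶻ (g₂ j -ᶻ g₂ i) *ᶻ k × Inv θ 𝒱 k)
    (absorb : ∀ d i u k → Inv θ (win (mean 𝒯₂ ⊗ mean 𝒯₁) λ (t₂ , t₁) → at 𝒯₂ t₂ +ᶻ at 𝒯₁ t₁)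
       (increment q (at 𝒟 d +ᶻ r i +ᶻ at 𝒱 u) (at 𝒱′ k)))
    (small : 4ℚ * (((θ + θ) + (ω + ω)) + (θ + 1/suc n)) ≤ e)
    where

    R : Mean (Fin (suc n))
    R = uni n

    input output V₁ V₂ : ℚ
    input = 𝔼[ o ∈ μ ] 𝔼[ x ∈ space ] 𝔼[ z ∈ ν ]
      sqr (avg 𝒲 λ m → avg 𝒟 λ d → dualTerm (f₀ o) (f₁ o) d (x ⊕ m) * v o z (x ⊕ m))
    V₁ = 𝔼[ o ∈ μ ] 𝔼[ x ∈ space ] 𝔼[ z ∈ ν ] avg 𝒟 λ d →
      sqr (avg 𝒱 λ u → f₁ o (x ⊕ u) * v o z (x ⊕ (base d +ᶻ increment q d u)))
    ξ : O → X → ℤ → ℤ → Z × Z → ℤ → ℤ → ℚ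
    ξ o x d₁ d₂ (z , z′) m n = v o z (x ⊕ (base d₁ +ᶻ m)) * v o z′ (x ⊕ (base d₂ +ᶻ n))
    V₂ = 𝔼[ o ∈ μ ] 𝔼[ x ∈ space ] avg 𝒟 λ d → 𝔼[ i ∈ R ] 𝔼[ j ∈ R ]
      Diagonal.energy (ν ⊗ ν) q (d +ᶻ r i) (d +ᶻ r j) 𝒱 (ξ o x (d +ᶻ r i) (d +ᶻ r j))
    output = 𝔼[ i ∈ R ] 𝔼[ j ∈ R ] 𝔼[ o ∈ μ ] 𝔼[ z ∈ ν ] box (Scale (2ᶻ *ᶻ q *ᶻ (r i -ᶻ r j)) 𝒱′ ∷ []) (v o z)

    -- Shifting n by the increment makes the factor f₀ independent of u.
    remove-f₀ : input ≤ V₁ + ((θ + θ) + (θ + θ))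
    remove-f₀ = begin
      input ≤⟨ E-mono+ μ (λ o → E-mono+ space λ x → E-mono+ ν λ z → pointwise o x z) ⟩
      (𝔼[ o ∈ μ ] 𝔼[ x ∈ space ] 𝔼[ z ∈ ν ] avg 𝒟 λ d → avg 𝒲 λ m → sqr (K o x z d m)) + _
        ≡⟨ cong (_+ _) (E-cong μ λ o → trans
             (E-shifted (ν ⊗ (mean 𝒟 ⊗ mean 𝒲)) (λ (z , d , m) → base (at 𝒟 d) -ᶻ at 𝒲 m) λ x (z , d , m) → cong sqr (E-cong (mean 𝒱) λ u → cong₂ _*_
               (sh (f₁ o) x (solveᶻ 4 (λ q d m u → (q ⊠ (d ⊠ d) ⊟ d ⊟ m) ⊞ (m ⊞ ((d ⊞ u) ⊟ q ⊠ (d ⊠ d))) ≔ u) refl q (at 𝒟 d) (at 𝒲 m) (at 𝒱 u)))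
               (sh (v o z) x (solveᶻ 3 (λ b m s → (b ⊟ m) ⊞ (m ⊞ s) ≔ b ⊞ s) refl (base (at 𝒟 d)) (at 𝒲 m) (increment q (at 𝒟 d) (at 𝒱 u))))))
             (E-cong space λ x → E-cong ν λ z → E-cong (mean 𝒟) λ d → E-const (mean 𝒲) _)) ⟩
      V₁ + ((θ + θ) + (θ + θ)) ∎
      where
      open ℚₚ.≤-Reasoning
      K : O → X → Z → ℤ → ℤ → ℚ
      K o x z d m = avg 𝒱 λ u → f₁ o (x ⊕ (m +ᶻ ((d +ᶻ u) -ᶻ q *ᶻ (d *ᶻ d)))) * v o z (x ⊕ (m +ᶻ increment q d u))
      pointwise : ∀ o x z →
        sqr (avg 𝒲 λ m → avg 𝒟 λ d → dualTerm (f₀ o) (f₁ o) d (x ⊕ m) * v o z (x ⊕ m)) ≤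
        (avg 𝒟 λ d → avg 𝒲 λ m → sqr (K o x z d m)) + ((θ + θ) + (θ + θ))
      pointwise o x z = begin
        _ ≡⟨ cong sqr (E-swap (mean 𝒲) (mean 𝒟) λ m d → t (at 𝒟 d) (at 𝒲 m)) ⟩
        sqr (avg 𝒟 a) ≤⟨ vdc-pt 𝒟 (mean 𝒱) (at 𝒱) 𝒟-𝒱 a (λ d → E-Bd (mean 𝒲) λ m → bt d _) ⟩
        (avg 𝒟 λ d → sqr (avg 𝒱 λ u → a (d +ᶻ u))) + (θ + θ)
          ≤⟨ +-monoˡ-≤ (θ + θ) (E-mono+ (mean 𝒟) λ i → per-d i) ⟩
        (avg 𝒟 λ d → avg 𝒲 λ m → sqr (K o x z d m)) + (θ + θ) + (θ + θ)
          ≡⟨ +-assoc _ (θ + θ) (θ + θ) ⟩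
        _ ∎
        where
        t : ℤ → ℤ → ℚ
        t d m = dualTerm (f₀ o) (f₁ o) d (x ⊕ m) * v o z (x ⊕ m)
        bt : ∀ d m → Bd (t d m)
        bt d m = Bd-* (Bd-* (b₀ o _) (b₁ o _)) (bv o z _)
        a : ℤ → ℚ
        a d = avg 𝒲 λ m → t d m
        c₀ : ℤ → ℤ → ℚ
        c₀ d m = f₀ o (x ⊕ (m -ᶻ q *ᶻ (d *ᶻ d)))
        c₁ : ℤ → ℤ → ℤ → ℚ
        c₁ d u m = f₁ o (x ⊕ (m +ᶻ ((d +ᶻ u) -ᶻ q *ᶻ (d *ᶻ d)))) * v o z (x ⊕ (m +ᶻ increment q d u))
        moved : ∀ d u m → t (d +ᶻ u) (m +ᶻ increment q d u) ≡ c₀ d m * c₁ d u m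
        moved d u m = trans (*-assoc _ _ _) (cong₂ _*_
          (sh (f₀ o) x (solveᶻ 4 (λ q d u m → m ⊞ q ⊠ (# 2ᶻ ⊠ d ⊠ u ⊞ u ⊠ u) ⊞ ⊟ (q ⊠ ((d ⊞ u) ⊠ (d ⊞ u))) ≔ m ⊟ q ⊠ (d ⊠ d)) refl q d u m))
          (cong (_* v o z (x ⊕ (m +ᶻ increment q d u))) (sh (f₁ o) x (solveᶻ 4 (λ q d u m → m ⊞ q ⊠ (# 2ᶻ ⊠ d ⊠ u ⊞ u ⊠ u) ⊞ ((d ⊞ u) ⊟ q ⊠ ((d ⊞ u) ⊠ (d ⊞ u))) ≔ m ⊞ ((d ⊞ u) ⊟ q ⊠ (d ⊠ d))) refl q d u m))))
        bK : ∀ d m → Bd (K o x z d m)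
        bK d m = E-Bd (mean 𝒱) λ u → Bd-* (b₁ o _) (bv o z _)
        per-d : ∀ i → sqr (avg 𝒱 λ u → a (at 𝒟 i +ᶻ u)) ≤ (avg 𝒲 λ m → sqr (K o x z (at 𝒟 i) m)) + (θ + θ)
        per-d i = begin
          _ ≤⟨ ≈-sq (E-Bd (mean 𝒱) λ u → E-Bd (mean 𝒲) λ m → bt _ _) (E-Bd (mean 𝒲) λ m → Bd-* (b₀ o _) (bK d _))
                 (≈-≡ʳ (trans (E-swap (mean 𝒱) (mean 𝒲) _) (E-cong (mean 𝒲) λ m → E-*ˡ (mean 𝒱) (c₀ d (at 𝒲 m)) _))
                   (E-≈ (mean 𝒱) λ u → ≈-≡ʳ (E-cong (mean 𝒲) λ m → moved d (at 𝒱 u) (at 𝒲 m))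
                     (≈-sym (shift (𝒲-inv i u) (t (d +ᶻ at 𝒱 u)) (bt _))))) ⟩
          _ ≤⟨ +-monoˡ-≤ (θ + θ) (cauchy-schwarz (mean 𝒲) (λ m → c₀ d (at 𝒲 m)) (λ m → K o x z d (at 𝒲 m)) (λ m → b₀ o _)) ⟩
          _ ∎
          where
          d = at 𝒟 i

    w : O × X × Ix 𝒱 × Ix 𝒱 → ℤ → ℚ
    w (o , x , u , u′) d = 𝔼[ z ∈ ν ] (v o z (x ⊕ (base d +ᶻ increment q d (at 𝒱 u))) * v o z (x ⊕ (base d +ᶻ increment q d (at 𝒱 u′))))

    -- Once the square over u is expanded, the product of the two copies of f₁ is independent of d.
    -- Van der Corput in d discards it, and pairs of shifts r i, r j produce the two base points d₁,
    -- d₂ of the path.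
    remove-f₁ : V₁ * V₁ ≤ V₂ + (θ + θ)
    remove-f₁ = begin
      V₁ * V₁ ≡⟨ cong sqr (E-cong μ λ o → E-cong space λ x → trans
                   (E-cong ν λ z → E-cong (mean 𝒟) λ d → trans (E-sq (mean 𝒱) _) (E-cong V λ u → E-cong V λ u′ → mix _ _ _ _))
                   (trans (E-swap (ν ⊗ mean 𝒟) (V ⊗ V) λ (z , d) (u , u′) → α (o , x , u , u′) * ww o x z d u u′)
                     (E-cong V λ u → E-cong V λ u′ → trans (E-swap ν (mean 𝒟) _) (trans
                       (E-cong (mean 𝒟) λ d → E-*ˡ ν (α (o , x , u , u′)) λ z → ww o x z d u u′) (E-*ˡ (mean 𝒟) (α (o , x , u , u′)) _))))) ⟩
      _ ≤⟨ vdc (μ ⊗ (space ⊗ (V ⊗ V))) 𝒟 R r 𝒟-r α (λ (o , _) → Bd-* (b₁ o _) (b₁ o _)) w (λ (o , _) d → E-Bd ν λ z → Bd-* (bv o z _) (bv o z _)) ⟩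
      _ ≡⟨ cong (_+ (θ + θ)) (E-cong μ λ o → E-cong space λ x → trans
             (E-swap (V ⊗ V) (mean 𝒟 ⊗ (R ⊗ R)) λ (u , u′) (d , i , j) → w (o , x , u , u′) (at 𝒟 d +ᶻ r i) * w (o , x , u , u′) (at 𝒟 d +ᶻ r j))
             (E-cong (mean 𝒟) λ d → E-cong R λ i → E-cong R λ j → energy≡ o x (at 𝒟 d +ᶻ r i) (at 𝒟 d +ᶻ r j))) ⟩
      V₂ + (θ + θ) ∎
      where
      open ℚₚ.≤-Reasoning
      V = mean 𝒱
      α : O × X × Ix 𝒱 × Ix 𝒱 → ℚ
      α (o , x , u , u′) = f₁ o (x ⊕ at 𝒱 u) * f₁ o (x ⊕ at 𝒱 u′)
      vv : O → X → Z → ℤ → Ix 𝒱 → ℚ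
      vv o x z d u = v o z (x ⊕ (base d +ᶻ increment q d (at 𝒱 u)))
      ww : O → X → Z → Ix 𝒟 → Ix 𝒱 → Ix 𝒱 → ℚ
      ww o x z d u u′ = vv o x z (at 𝒟 d) u * vv o x z (at 𝒟 d) u′
      energy≡ : ∀ o x d₁ d₂ → 𝔼[ u ∈ V ] 𝔼[ u′ ∈ V ] (w (o , x , u , u′) d₁ * w (o , x , u , u′) d₂) ≡
        Diagonal.energy (ν ⊗ ν) q d₁ d₂ 𝒱 (ξ o x d₁ d₂)
      energy≡ o x d₁ d₂ = trans (E-cong V λ u → E-cong V λ u′ → trans (E-prod ν ν _ _) (E-cong ν λ z → E-cong ν λ z′ → mix _ _ _ _))
        (trans (E-swap (V ⊗ V) (ν ⊗ ν) λ (u , u′) (z , z′) → (vv o x z d₁ u * vv o x z′ d₂ u) * (vv o x z d₁ u′ * vv o x z′ d₂ u′))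
          (E-cong ν λ z → E-cong ν λ z′ → sym (E-sq V λ u → vv o x z d₁ u * vv o x z′ d₂ u)))

    module Fixed (o : O) (x : X) (d : Ix 𝒟) (i j : Fin (suc n)) where
      d₁ d₂ : ℤ
      d₁ = at 𝒟 d +ᶻ r i
      d₂ = at 𝒟 d +ᶻ r j
      open Diagonal (ν ⊗ ν) q d₁ d₂ 𝒱 public

      ξ′ : Z × Z → ℤ → ℤ → ℚ
      ξ′ = ξ o x d₁ d₂
      bξ : ∀ k m n → Bd (ξ′ k m n)
      bξ k m n = Bd-* (bv o _ _) (bv o _ _)

      stat : ∀ t → KernelInv ν ω (v o) (path₁ t) → KernelInv ν ω (v o) (path₂ t) → Stationary (ω + ω) ξ′ t
      stat t h₁ h₂ = stationary λ m n m′ n′ → ≈-≡ˡ (sym (split _ _ _ _)) (≈-≡ʳ (sym (split _ _ _ _))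
        (≈-* (E-Bd ν λ z → Bd-* (bv o z _) (bv o z _)) (E-Bd ν λ z → Bd-* (bv o z _) (bv o z _))
          (≈-≡ˡ (E-cong ν λ z → cong₂ _*_ (mv z d₁ m (path₁ t)) (mv z d₁ m′ (path₁ t))) (h₁ (x ⊕ (base d₁ +ᶻ m)) (x ⊕ (base d₁ +ᶻ m′))))
          (≈-≡ˡ (E-cong ν λ z → cong₂ _*_ (mv z d₂ n (path₂ t)) (mv z d₂ n′ (path₂ t))) (h₂ (x ⊕ (base d₂ +ᶻ n)) (x ⊕ (base d₂ +ᶻ n′))))))
        where
        mv : ∀ z d m p → v o z (x ⊕ (base d +ᶻ m) ⊕ p) ≡ v o z (x ⊕ (base d +ᶻ (m +ᶻ p)))
        mv z d m p = sh (v o z) x (solveᶻ 3 (λ b m p → b ⊞ m ⊞ p ≔ b ⊞ (m ⊞ p)) refl (base d) m p)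
        split : ∀ m n m′ n′ → 𝔼[ k ∈ ν ⊗ ν ] (ξ′ k m n * ξ′ k m′ n′) ≡
          𝔼[ z ∈ ν ] (v o z (x ⊕ (base d₁ +ᶻ m)) * v o z (x ⊕ (base d₁ +ᶻ m′))) *
          𝔼[ z ∈ ν ] (v o z (x ⊕ (base d₂ +ᶻ n)) * v o z (x ⊕ (base d₂ +ᶻ n′)))
        split m n m′ n′ = trans (E-cong (ν ⊗ ν) λ k → mix _ _ _ _) (sym (E-prod ν ν _ _))

      ζ₁ ζ₂ : Z × Z → ℤ → ℤ → ℚ
      ζ₁ = diagonalAverage 𝒯₁ ξ′
      ζ₂ = diagonalAverage 𝒯₂ ζ₁

      -- One pass can average only over multiples of shifts that 𝒱 absorbs, which is too short a
      -- range for `absorb`. The second pass, with a coarser step, supplies a higher digit.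
      diagonal : Chain e (hf ∷ hf ∷ []) (energy ξ′) (energy ζ₂)
      diagonal =
        diagonalise n g₁ 𝒯₁ ξ′ bξ 0≤e 𝒱-g₁ (λ u k → stat _ (ker₁ o d i u k) (ker₁ o d j u k)) sp₁ small
        ⟫ diagonalise n g₂ 𝒯₂ ζ₁ (λ k m n → E-Bd (mean 𝒯₁) λ _ → bξ _ _ _) 0≤e 𝒱-g₂
            (λ u k → average-stationary 𝒯₁ (stat _ (ker₂ o d i u k) (ker₂ o d j u k))) sp₂ small

      T : Mean (Ix 𝒯₂ × Ix 𝒯₁)
      T = mean 𝒯₂ ⊗ mean 𝒯₁
      τ : Ix 𝒯₂ × Ix 𝒯₁ → ℤ
      τ (t₂ , t₁) = at 𝒯₂ t₂ +ᶻ at 𝒯₁ t₁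
      step′ : ℤ
      step′ = 2ᶻ *ᶻ q *ᶻ (r i -ᶻ r j)

      -- The average over sums from 𝒯₂ and 𝒯₁ absorbs the increment of the second path. The second
      -- feature is then frozen and discarded, while the first moves by the difference of the two
      -- increments, 2 q (r i - r j) k. This is linear in k, so a single direction remains.
      collapse : energy ζ₂ ≤
        𝔼[ z ∈ ν ] 𝔼[ z′ ∈ ν ] 𝔼[ u ∈ mean 𝒱 ] 𝔼[ t ∈ T ] sqr (smooth (Scale step′ 𝒱′) (v o z) (x ⊕ (base d₁ +ᶻ (path₁ (at 𝒱 u) +ᶻ τ t)))) + ((θ + θ) + (θ + θ))
      collapse = E-mono+ ν λ z → E-mono+ ν λ z′ → pointwise z z′
        where
        open ℚₚ.≤-Reasoning
        pointwise : ∀ z z′ → sqr (avg 𝒱 λ u → ζ₂ (z , z′) (path₁ u) (path₂ u)) ≤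
          𝔼[ u ∈ mean 𝒱 ] 𝔼[ t ∈ T ] sqr (smooth (Scale step′ 𝒱′) (v o z) (x ⊕ (base d₁ +ᶻ (path₁ (at 𝒱 u) +ᶻ τ t)))) + ((θ + θ) + (θ + θ))
        pointwise z z′ = begin
          _ ≤⟨ vdc-pt 𝒱 (mean 𝒱′) (at 𝒱′) 𝒱-𝒱′ a (λ u → bζ (path₁ u) (path₂ u)) ⟩
          (avg 𝒱 λ u → sqr (avg 𝒱′ λ k → a (u +ᶻ k))) + (θ + θ)
            ≤⟨ +-monoˡ-≤ (θ + θ) (E-mono+ (mean 𝒱) λ u → per-u u) ⟩
          _ ≡⟨ +-assoc _ (θ + θ) (θ + θ) ⟩
          _ ∎
          where
          bζ : ∀ m n → Bd (ζ₂ (z , z′) m n)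
          bζ m n = E-Bd (mean 𝒯₂) λ _ → E-Bd (mean 𝒯₁) λ _ → bξ _ _ _
          a : ℤ → ℚ
          a u = ζ₂ (z , z′) (path₁ u) (path₂ u)
          per-u : ∀ u → sqr (avg 𝒱′ λ k → a (at 𝒱 u +ᶻ k)) ≤
            𝔼[ t ∈ T ] sqr (smooth (Scale step′ 𝒱′) (v o z) (x ⊕ (base d₁ +ᶻ (path₁ (at 𝒱 u) +ᶻ τ t)))) + (θ + θ)
          per-u u = begin
            _ ≤⟨ ≈-sq (E-Bd (mean 𝒱′) λ k → bζ (path₁ (at 𝒱 u +ᶻ at 𝒱′ k)) (path₂ (at 𝒱 u +ᶻ at 𝒱′ k))) (E-Bd T λ t → Bd-* (bv o z′ _) (smooth-Bd (Scale step′ 𝒱′) (bv o z) _))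
                   (≈-≡ʳ (trans (E-swap (mean 𝒱′) T λ k t → ψ (at 𝒱′ k) (τ t)) (E-cong T λ t → trans
                        (E-cong (mean 𝒱′) λ k → trans (*-comm _ _) (cong (v o z′ (x ⊕ (base d₂ +ᶻ (path₂ u′ +ᶻ τ t))) *_) (sym (sh (v o z) x
                          (solveᶻ 4 (λ b p t s → b ⊞ (p ⊞ t) ⊞ s ≔ b ⊞ (p ⊞ s ⊞ t)) refl (base d₁) (path₁ u′) (τ t) (step′ *ᶻ at 𝒱′ k))))))
                        (E-*ˡ (mean 𝒱′) (v o z′ (x ⊕ (base d₂ +ᶻ (path₂ u′ +ᶻ τ t)))) _)))
                     (E-≈ (mean 𝒱′) λ k → ≈-≡ˡ (E-cong (mean 𝒯₂) λ t₂ → E-cong (mean 𝒯₁) λ t₁ → cong₂ (ξ′ (z , z′))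
                          (line₁ (at 𝒱′ k) (at 𝒯₂ t₂) (at 𝒯₁ t₁)) (line₂ (at 𝒱′ k) (at 𝒯₂ t₂) (at 𝒯₁ t₁)))
                        (shift (absorb d j u k) (ψ (at 𝒱′ k)) (λ _ → bξ _ _ _)))) ⟩
            _ ≤⟨ +-monoˡ-≤ (θ + θ) (cauchy-schwarz T (λ t → v o z′ (x ⊕ (base d₂ +ᶻ (path₂ u′ +ᶻ τ t))))
                   (λ t → smooth (Scale step′ 𝒱′) (v o z) (x ⊕ (base d₁ +ᶻ (path₁ u′ +ᶻ τ t)))) (λ t → bv o z′ _)) ⟩
            _ ∎
            where
            u′ = at 𝒱 u
            ψ : ℤ → ℤ → ℚ
            ψ k t = ξ′ (z , z′) (path₁ u′ +ᶻ step′ *ᶻ k +ᶻ t) (path₂ u′ +ᶻ t)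
            κ : ℤ → ℤ
            κ k = increment q (d₂ +ᶻ u′) k
            line₁ : ∀ k t₂ t₁ → path₁ u′ +ᶻ step′ *ᶻ k +ᶻ (t₂ +ᶻ t₁ +ᶻ κ k) ≡ path₁ (u′ +ᶻ k) +ᶻ t₂ +ᶻ t₁
            line₁ k t₂ t₁ = solveᶻ 8 (λ q d r r′ u k t₂ t₁ →
              q ⊠ (# 2ᶻ ⊠ (d ⊞ r) ⊠ u ⊞ u ⊠ u) ⊞ # 2ᶻ ⊠ q ⊠ (r ⊟ r′) ⊠ k ⊞ (t₂ ⊞ t₁ ⊞ q ⊠ (# 2ᶻ ⊠ (d ⊞ r′ ⊞ u) ⊠ k ⊞ k ⊠ k))
              ≔ q ⊠ (# 2ᶻ ⊠ (d ⊞ r) ⊠ (u ⊞ k) ⊞ (u ⊞ k) ⊠ (u ⊞ k)) ⊞ t₂ ⊞ t₁) refl q (at 𝒟 d) (r i) (r j) u′ k t₂ t₁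
            line₂ : ∀ k t₂ t₁ → path₂ u′ +ᶻ (t₂ +ᶻ t₁ +ᶻ κ k) ≡ path₂ (u′ +ᶻ k) +ᶻ t₂ +ᶻ t₁
            line₂ k t₂ t₁ = solveᶻ 6 (λ q d u k t₂ t₁ →
              q ⊠ (# 2ᶻ ⊠ d ⊠ u ⊞ u ⊠ u) ⊞ (t₂ ⊞ t₁ ⊞ q ⊠ (# 2ᶻ ⊠ (d ⊞ u) ⊠ k ⊞ k ⊠ k))
              ≔ q ⊠ (# 2ᶻ ⊠ d ⊠ (u ⊞ k) ⊞ (u ⊞ k) ⊠ (u ⊞ k)) ⊞ t₂ ⊞ t₁) refl q d₂ u′ k t₂ t₁

    lower : Chain e lowerSteps input output
    lower =
      link {W = V₁} (≤-trans remove-f₀ (+-monoʳ-≤ _ 4θ≤))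
      (link {W = V₂} (≤-trans remove-f₁ (+-monoʳ-≤ _ 2θ≤))
      (E-chain hh μ (λ o → E-chain hh space λ x → E-chain hh (mean 𝒟) λ d → E-chain hh R λ i → E-chain hh R λ j → Fixed.diagonal o x d i j)
      ⟫ step ln (≤-trans (E-mono+ μ λ o → E-mono+ space λ x → E-mono+ (mean 𝒟) λ d → E-mono+ R λ i → E-mono+ R λ j → Fixed.collapse o x d i j)
         (≤-trans (≤-reflexive (cong (_+ ((θ + θ) + (θ + θ))) recentre)) (+-monoʳ-≤ _ 4θ≤)))))
      where
      hh : List Step
      hh = hf ∷ hf ∷ []
      H : O → Fin (suc n) → Fin (suc n) → Z → X → ℚ
      H o i j z x = sqr (smooth (Scale (2ᶻ *ᶻ q *ᶻ (r i -ᶻ r j)) 𝒱′) (v o z) x)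
      recentre : (𝔼[ o ∈ μ ] 𝔼[ x ∈ space ] 𝔼[ d ∈ mean 𝒟 ] 𝔼[ i ∈ R ] 𝔼[ j ∈ R ] 𝔼[ z ∈ ν ] 𝔼[ z′ ∈ ν ] 𝔼[ u ∈ mean 𝒱 ] 𝔼[ t ∈ mean 𝒯₂ ⊗ mean 𝒯₁ ]
        H o i j z (x ⊕ (base (at 𝒟 d +ᶻ r i) +ᶻ (increment q (at 𝒟 d +ᶻ r i) (at 𝒱 u) +ᶻ (at 𝒯₂ (proj₁ t) +ᶻ at 𝒯₁ (proj₂ t)))))) ≡ output
      recentre = trans
        (E-cong μ λ o → trans
          (sym (E-shift (mean 𝒟 ⊗ (R ⊗ (R ⊗ (ν ⊗ (ν ⊗ (mean 𝒱 ⊗ (mean 𝒯₂ ⊗ mean 𝒯₁)))))))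
            (λ (d , i , j , z , z′ , u , t₂ , t₁) → base (at 𝒟 d +ᶻ r i) +ᶻ (increment q (at 𝒟 d +ᶻ r i) (at 𝒱 u) +ᶻ (at 𝒯₂ t₂ +ᶻ at 𝒯₁ t₁)))
            λ x (d , i , j , z , z′ , u , t₂ , t₁) → H o i j z x))
          (trans (E-cong space λ x → trans (E-const (mean 𝒟) _) (E-cong R λ i → E-cong R λ j → E-cong ν λ z →
             trans (E-const ν _) (trans (E-const (mean 𝒱) _) (trans (E-const (mean 𝒯₂) _) (E-const (mean 𝒯₁) (H o i j z x))))))
            (E-swap space (R ⊗ (R ⊗ ν)) λ x (i , j , z) → H o i j z x)))
        (trans (E-swap μ (R ⊗ R) λ o (i , j) → 𝔼[ z ∈ ν ] 𝔼[ x ∈ space ] H o i j z x)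
          (E-cong R λ i → E-cong R λ j → E-cong μ λ o → E-cong ν λ z →
            sym (box₁ (Scale (2ᶻ *ᶻ q *ᶻ (r i -ᶻ r j)) 𝒱′) (v o z))))

-- Auxiliary windows for one degree-lowering step from the window U to the window U′.
record Ladder (θ : ℚ) (q : ℤ) (𝒟 : Win) (n : ℕ) (U U′ : Win) : Set₁ where
  field
    𝒱 𝒱′ 𝒯₁ 𝒯₂ : Win
    r           : Fin (suc n) → Fin (suc n) → ℤ
    g₁ g₂       : Fin (suc n) → ℤ
    𝒟-𝒱         : ∀ u → Inv θ 𝒟 (at 𝒱 u)
    𝒟-r         : ∀ i a → Inv θ 𝒟 (r i a)
    U-inv       : ∀ d u → Inv θ U (increment q (at 𝒟 d) (at 𝒱 u))
    𝒱-g₁        : ∀ i → Inv θ 𝒱 (g₁ i)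
    𝒱-g₂        : ∀ i → Inv θ 𝒱 (g₂ i)
    𝒱-𝒱′        : ∀ i → Inv θ 𝒱 (at 𝒱′ i)
    U-inv₁      : ∀ d i a u j → Inv θ U (increment q (at 𝒟 d +ᶻ r i a) (at 𝒱 u +ᶻ g₁ j))
    U-inv₂      : ∀ d i a u j → Inv θ U (increment q (at 𝒟 d +ᶻ r i a) (at 𝒱 u +ᶻ g₂ j))
    split₁      : ∀ i j → i ≢ j → ∀ w → Σ ℤ λ k → at 𝒯₁ w ≡ 2ᶻ *ᶻ q *ᶻ (g₁ j -ᶻ g₁ i) *ᶻ k × Inv θ 𝒱 k
    split₂      : ∀ i j → i ≢ j → ∀ w → Σ ℤ λ k → at 𝒯₂ w ≡ 2ᶻ *ᶻ q *ᶻ (g₂ j -ᶻ g₂ i) *ᶻ k × Inv θ 𝒱 k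
    absorb      : ∀ d i a u k → Inv θ (win (mean 𝒯₂ ⊗ mean 𝒯₁) λ (t₂ , t₁) → at 𝒯₂ t₂ +ᶻ at 𝒯₁ t₁)
                    (increment q (at 𝒟 d +ᶻ r i a +ᶻ at 𝒱 u) (at 𝒱′ k))
    spread      : ∀ a a′ → a ≢ a′ → ∀ i i′ → i ≢ i′ →
                    Splits θ U′ (Scale (2ᶻ *ᶻ q *ᶻ (r i a -ᶻ r i a′)) 𝒱′) (Scale (2ᶻ *ᶻ q *ᶻ (r i′ a -ᶻ r i′ a′)) 𝒱′)

descendSteps : List Step
descendSteps = ln ∷ lowerSteps ++ ln ∷ widenSteps

module Descent (𝒮 : System) (q : ℤ) {θ e : ℚ} (0≤θ : 0ℚ ≤ θ)
  (16θ≤e : 2ℚ * (2ℚ * (2ℚ * (θ + θ))) ≤ e)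
  (𝒟 : Win) (n : ℕ) (1/n≤e : 1/suc n ≤ e)
  (small : 4ℚ * (((θ + θ) + ((2ℚ * (θ + θ)) + (2ℚ * (θ + θ)))) + (θ + 1/suc n)) ≤ e) where
  open Core 𝒮 q 0≤θ 16θ≤e public

  -- 4θ, since in `descend₂` the kernel is a product of four kernels of features, each invariant up
  -- to θ.
  ω : ℚ
  ω = 2ℚ * (θ + θ)

  module Descend {U U′ : Win} (𝓁 : Ladder θ q 𝒟 n U U′) where
    open Ladder 𝓁

    -- Each pair (a, a′) yields a direction of its own, 2 q (r i a - r i a′). Letting the shifts
    -- depend on a further index i gives a whole family of directions for every pair, and `widen`
    -- over i replaces it by U′.
    descend : ∀ {O J Z} (μ : Mean O) (Ω : Mean J) (ν : Mean Z) (f₀ f₁ : O → J → X → ℚ) (v : O → Z → X → ℚ) →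
      (∀ o j → Bdd (f₀ o j)) → (∀ o j → Bdd (f₁ o j)) → (∀ o z → Bdd (v o z)) →
      (∀ o p → Inv θ U p → KernelInv ν ω (v o) p) →
      Chain e descendSteps
        (𝔼[ o ∈ μ ] 𝔼[ x ∈ space ] 𝔼[ z ∈ ν ] sqr (avg U λ m → 𝔼[ j ∈ Ω ] avg 𝒟 λ d → dualTerm (f₀ o j) (f₁ o j) d (x ⊕ m) * v o z (x ⊕ m)))
        (𝔼[ o ∈ μ ] 𝔼[ z ∈ ν ] box (U′ ∷ []) (v o z))
    descend {O} {J} {Z} μ Ω ν f₀ f₁ v b₀ b₁ bv ki =
      link {W = In} first
      (≡-Chain (sym (E-const (uni n) In))
      (E-chain lowerSteps (uni n) lower-at
      ⟫ link {W = 𝔼[ a ∈ uni n ] 𝔼[ a′ ∈ uni n ] off a a′ (Out a a′)} second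
        (Chain-≡ (E-chain widenSteps (uni n) λ a → E-chain widenSteps (uni n) λ a′ →
          off-case (λ t → Chain e widenSteps t Final) a a′ (Out a a′)
            (zero-chain sq (ln ∷ sq ∷ []) 0≤e (E-0≤ μ λ o → E-0≤ ν λ z → 0≤box₁ U′ (v o z)))
            λ ne → widen (μ ⊗ ν) n (λ i → Scale (δ i a a′) 𝒱′) U′ 1/n≤e (spread a a′ ne) (λ (o , z) → v o z) (λ (o , z) → bv o z))
          (trans (E-const (uni n) _) (E-const (uni n) Final)))))
      where
      open ℚₚ.≤-Reasoning
      In Final : ℚ
      In = 𝔼[ o ∈ μ ] 𝔼[ j ∈ Ω ] 𝔼[ x ∈ space ] 𝔼[ z ∈ ν ] sqr (avg U λ m → avg 𝒟 λ d → dualTerm (f₀ o j) (f₁ o j) d (x ⊕ m) * v o z (x ⊕ m))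
      Final = 𝔼[ o ∈ μ ] 𝔼[ z ∈ ν ] box (U′ ∷ []) (v o z)
      δ : Fin (suc n) → Fin (suc n) → Fin (suc n) → ℤ
      δ i a a′ = 2ᶻ *ᶻ q *ᶻ (r i a -ᶻ r i a′)
      Out : Fin (suc n) → Fin (suc n) → ℚ
      Out a a′ = 𝔼[ k ∈ μ ⊗ ν ] 𝔼[ i ∈ uni n ] box (Scale (δ i a a′) 𝒱′ ∷ []) (v (proj₁ k) (proj₂ k))
      bOut : ∀ a a′ → Out a a′ ≤ 1ℚ
      bOut a a′ = proj₁ (E-Bd (μ ⊗ ν) λ (o , z) → E-Bd (uni n) λ i → box-Bd (Scale (δ i a a′) 𝒱′ ∷ []) (bv o z))
      first : (𝔼[ o ∈ μ ] 𝔼[ x ∈ space ] 𝔼[ z ∈ ν ] sqr (avg U λ m → 𝔼[ j ∈ Ω ] avg 𝒟 λ d → dualTerm (f₀ o j) (f₁ o j) d (x ⊕ m) * v o z (x ⊕ m))) ≤ In + e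
      first = begin
        _ ≡⟨ E-cong μ (λ o → E-cong space λ x → E-cong ν λ z → cong sqr (E-swap (mean U) Ω λ m j → avg 𝒟 λ d → dualTerm (f₀ o j) (f₁ o j) d (x ⊕ at U m) * v o z (x ⊕ at U m))) ⟩
        _ ≤⟨ E-mono μ (λ o → E-mono space λ x → E-mono ν λ z → jensen Ω (t o x z)) ⟩
        _ ≡⟨ E-cong μ (λ o → E-swap (space ⊗ ν) Ω λ (x , z) j → sqr (t o x z j)) ⟩
        In ≤⟨ ≤-by e 0≤e refl ⟩
        In + e ∎
        where
        t : O → X → Z → J → ℚ
        t o x z j = avg U λ m → avg 𝒟 λ d → dualTerm (f₀ o j) (f₁ o j) d (x ⊕ m) * v o z (x ⊕ m)
      lower-at : ∀ i → Chain e lowerSteps In (𝔼[ a ∈ uni n ] 𝔼[ a′ ∈ uni n ] 𝔼[ o ∈ μ ] 𝔼[ z ∈ ν ] box (Scale (δ i a a′) 𝒱′ ∷ []) (v o z))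
      lower-at i = Chain-≡
        (Lower.lower (μ ⊗ Ω) ν (λ (o , j) → f₀ o j) (λ (o , j) → f₁ o j) (λ (o , _) → v o)
          (λ (o , j) → b₀ o j) (λ (o , j) → b₁ o j) (λ (o , _) → bv o) 𝒟 U 𝒱 𝒱′ 𝒯₁ 𝒯₂ n (r i) g₁ g₂ ω
          𝒟-𝒱 (𝒟-r i) U-inv 𝒱-g₁ 𝒱-g₂ 𝒱-𝒱′ (λ (o , _) d a u j → ki o _ (U-inv₁ d i a u j)) (λ (o , _) d a u j → ki o _ (U-inv₂ d i a u j))
          split₁ split₂ (λ d a u k → absorb d i a u k) small)
        (E-cong (uni n) λ a → E-cong (uni n) λ a′ → E-cong μ λ o → E-const Ω _)
      second : (𝔼[ i ∈ uni n ] 𝔼[ a ∈ uni n ] 𝔼[ a′ ∈ uni n ] 𝔼[ o ∈ μ ] 𝔼[ z ∈ ν ] box (Scale (δ i a a′) 𝒱′ ∷ []) (v o z)) ≤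
        𝔼[ a ∈ uni n ] 𝔼[ a′ ∈ uni n ] off a a′ (Out a a′) + e
      second = begin
        _ ≡⟨ trans (E-swap (uni n) (uni n ⊗ uni n) λ i (a , a′) → 𝔼[ o ∈ μ ] 𝔼[ z ∈ ν ] box (Scale (δ i a a′) 𝒱′ ∷ []) (v o z))
               (E-cong (uni n) λ a → E-cong (uni n) λ a′ → E-swap (uni n) (μ ⊗ ν) λ i (o , z) → box (Scale (δ i a a′) 𝒱′ ∷ []) (v o z)) ⟩
        𝔼[ a ∈ uni n ] 𝔼[ a′ ∈ uni n ] Out a a′ ≤⟨ E-off n Out bOut ⟩
        _ ≤⟨ +-monoʳ-≤ _ 1/n≤e ⟩
        _ ∎

  -- Averages of dual functions, rather than single ones, because this class is closed under `diff`
  -- and degree lowering is applied to differences.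
  record Dual (Φ : X → ℚ) : Set₁ where
    field
      {J}   : Set
      Ω     : Mean J
      h₀ h₁ : J → X → ℚ
      bh₀   : ∀ j → Bdd (h₀ j)
      bh₁   : ∀ j → Bdd (h₁ j)
      expand : ∀ x → Φ x ≡ 𝔼[ j ∈ Ω ] avg 𝒟 λ d → dualTerm (h₀ j) (h₁ j) d x

    dual-Bdd : Bdd Φ
    dual-Bdd x = subst Bd (sym (expand x)) (E-Bd Ω λ j → E-Bd (mean 𝒟) λ d → Bd-* (bh₀ j _) (bh₁ j _))

    g : J × Ix 𝒟 → X → ℚ
    g (j , d) = dualTerm (h₀ j) (h₁ j) (at 𝒟 d)

    bg : ∀ k → Bdd (g k)
    bg (j , d) x = Bd-* (bh₀ j _) (bh₁ j _)

  prodF : ∀ {Z Z′ : Set} → (Z → X → ℚ) → (Z′ → X → ℚ) → Z × Z′ → X → ℚ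
  prodF v w (z , z′) x = v z x * w z′ x

  prodF-inv : ∀ {Z Z′ : Set} (ν : Mean Z) (ν′ : Mean Z′) {v w ς ς′ p} → (∀ z → Bdd (v z)) → (∀ z → Bdd (w z)) →
    KernelInv ν ς v p → KernelInv ν′ ς′ w p → KernelInv (ν ⊗ ν′) (ς + ς′) (prodF v w) p
  prodF-inv ν ν′ {v} {w} bv bw h h′ x y = ≈-≡ˡ (sym (split _ _)) (≈-≡ʳ (sym (split x y))
    (≈-* (E-Bd ν λ z → Bd-* (bv z _) (bv z _)) (E-Bd ν′ λ z → Bd-* (bw z _) (bw z _)) (h x y) (h′ x y)))
    where
    split : ∀ x y → 𝔼[ k ∈ ν ⊗ ν′ ] (prodF v w k x * prodF v w k y) ≡ 𝔼[ z ∈ ν ] (v z x * v z y) * 𝔼[ z ∈ ν′ ] (w z x * w z y)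
    split x y = trans (E-cong ν λ z → E-cong ν′ λ z′ → mix _ _ _ _) (sym (E-prod ν ν′ _ _))

  -- Translates of φ serve as features: their kernel is the correlation of φ at two points averaged
  -- along W, which encodes one direction of the box norm.
  feature : ∀ W → (X → ℚ) → Ix (Diff W) → X → ℚ
  feature W φ m x = φ (x ⊕ at (Diff W) m)

  feature-inv : ∀ W {φ p} → Bdd φ → Inv θ W p → KernelInv (mean (Diff W)) θ (feature W φ) p
  feature-inv W {φ} {p} b h x y = ≈-≡ˡ
    (E-cong (mean (Diff W)) λ m → cong₂ _*_ (mv x (at (Diff W) m)) (mv y (at (Diff W) m)))
    (shift (Inv-Diff {W = W} h) (λ t → φ (x ⊕ t) * φ (y ⊕ t)) (λ t → Bd-* (b _) (b _)))
    where
    mv : ∀ x m → φ (x ⊕ (m +ᶻ p)) ≡ φ (x ⊕ p ⊕ m)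
    mv x m = sym (sh φ x (solveᶻ 2 (λ p m → p ⊞ m ≔ m ⊞ p) refl p m))

  box-kernel : ∀ V W φ → box (V ∷ W ∷ []) φ ≡ 𝔼[ x ∈ space ] 𝔼[ n ∈ mean V ] 𝔼[ n′ ∈ mean V ]
    ((φ (x ⊕ at V n) * φ (x ⊕ at V n′)) * 𝔼[ m ∈ mean (Diff W) ] (feature W φ m (x ⊕ at V n) * feature W φ m (x ⊕ at V n′)))
  box-kernel V W φ = trans (sym (E-swap space ((mean V ⊗ mean V) ⊗ mean (Diff W)) λ x ((i , j) , (k , l)) → pair (pair φ (at V i) (at V j)) (at W k) (at W l) x))
    (trans (E-shifted ((mean V ⊗ mean V) ⊗ mean (Diff W)) (λ (_ , (k , l)) → -ᶻ at W l) λ x ((i , j) , (k , l)) →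
        trans (cong₂ _*_ (cong₂ _*_ (v x i k l) (v x j k l)) (cong₂ _*_ (v₀ x i l) (v₀ x j l))) (*-comm _ _))
      (E-cong space λ x → E-cong (mean V) λ i → E-cong (mean V) λ j → E-*ˡ (mean (Diff W)) (φ (x ⊕ at V i) * φ (x ⊕ at V j))
        λ m → feature W φ m (x ⊕ at V i) * feature W φ m (x ⊕ at V j)))
    where
    v : ∀ x i k l → φ (x ⊕ -ᶻ at W l ⊕ at W k ⊕ at V i) ≡ φ (x ⊕ at V i ⊕ (at W k -ᶻ at W l))
    v x i k l = trans (cong φ (⊕-assoc _ _ _)) (trans (sh φ x (solveᶻ 3 (λ i k l → ⊟ l ⊞ (k ⊞ i) ≔ i ⊞ (k ⊟ l)) refl (at V i) (at W k) (at W l))) (sym (sh φ x refl)))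
    v₀ : ∀ x i l → φ (x ⊕ -ᶻ at W l ⊕ at W l ⊕ at V i) ≡ φ (x ⊕ at V i)
    v₀ x i l = trans (cong φ (⊕-assoc _ _ _)) (sh φ x (solveᶻ 2 (λ i l → ⊟ l ⊞ (l ⊞ i) ≔ i) refl (at V i) (at W l)))

  -- Reads the kernel form backwards: paired with a kernel of features, a product over two points
  -- becomes one square for each feature.
  assemble : ∀ {K Z : Set} (κ : Mean K) (ν : Mean Z) (V : Win) (A : K → X → ℚ) (v : Z → X → ℚ) x →
    𝔼[ n ∈ mean V ] 𝔼[ n′ ∈ mean V ] 𝔼[ k ∈ κ ] 𝔼[ k′ ∈ κ ]
      ((A k (x ⊕ at V n) * A k′ (x ⊕ at V n′)) * 𝔼[ z ∈ ν ] (v z (x ⊕ at V n) * v z (x ⊕ at V n′))) ≡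
    𝔼[ z ∈ ν ] sqr (avg V λ m → 𝔼[ k ∈ κ ] (A k (x ⊕ m) * v z (x ⊕ m)))
  assemble κ ν V A v x = sym (trans
    (E-cong ν λ z → trans (E-sq (mean V) _) (E-cong (mean V) λ n → E-cong (mean V) λ n′ → trans (E-prod κ κ _ _)
      (E-cong κ λ k → E-cong κ λ k′ → mix _ _ _ _)))
    (trans (E-swap ν (mean V ⊗ (mean V ⊗ (κ ⊗ κ))) λ z (n , n′ , k , k′) → (A k (x ⊕ at V n) * A k′ (x ⊕ at V n′)) * (v z (x ⊕ at V n) * v z (x ⊕ at V n′)))
      (E-cong (mean V) λ n → E-cong (mean V) λ n′ → E-cong κ λ k → E-cong κ λ k′ →
        E-*ˡ ν (A k (x ⊕ at V n) * A k′ (x ⊕ at V n′)) λ z → v z (x ⊕ at V n) * v z (x ⊕ at V n′))))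

  pair-cong : ∀ {F G : X → ℚ} → (∀ x → F x ≡ G x) → ∀ a b x → pair F a b x ≡ pair G a b x
  pair-cong h a b x = cong₂ _*_ (h _) (h _)

  pair-dualTerm : ∀ f₀ f₁ d a b x → pair (dualTerm f₀ f₁ d) a b x ≡ dualTerm (pair f₀ a b) (pair f₁ a b) d x
  pair-dualTerm f₀ f₁ d a b x = trans (mix _ _ _ _) (cong₂ _*_ (cong₂ _*_ (c f₀ a _) (c f₀ b _)) (cong₂ _*_ (c f₁ a _) (c f₁ b _)))
    where
    c : ∀ f a t → f (x ⊕ a ⊕ t) ≡ f (x ⊕ t ⊕ a)
    c f a t = trans (sh f x (solveᶻ 2 (λ a t → a ⊞ t ≔ t ⊞ a) refl a t)) (sym (sh f x refl))

  module DescendDual {U U′ : Win} (𝓁 : Ladder θ q 𝒟 n U U′) {Φ : X → ℚ} (δ : Dual Φ) where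
    open Descend 𝓁
    open Dual δ

    K : Mean (J × Ix 𝒟)
    K = Ω ⊗ mean 𝒟

    bΦ : Bdd Φ
    bΦ = dual-Bdd

    ΦΦ : ∀ a a′ → Φ a * Φ a′ ≡ 𝔼[ k ∈ K ] 𝔼[ k′ ∈ K ] (g k a * g k′ a′)
    ΦΦ a a′ = trans (cong₂ _*_ (expand a) (expand a′)) (E-prod K K (λ k → g k a) (λ k → g k a′))

    𝒩 : Mean (Ix (Diff U))
    𝒩 = mean (Diff U)

    θ≤ω : θ ≤ ω
    θ≤ω = ≤-by (2ℚ * θ + θ) (0≤+ (0≤* 0≤2 0≤θ) 0≤θ) (solve 1 (λ t → (con 1ℚ :+ con 1ℚ) :* (t :+ t) := t :+ ((con 1ℚ :+ con 1ℚ) :* t :+ t)) refl θ)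

    2θ≤ω : θ + θ ≤ ω
    2θ≤ω = ≤-by (θ + θ) (0≤+ 0≤θ 0≤θ) (solve 1 (λ t → (con 1ℚ :+ con 1ℚ) :* (t :+ t) := (t :+ t) :+ (t :+ t)) refl θ)

    weaken : ∀ {Z} {ν : Mean Z} {ς v p} → ς ≤ ω → KernelInv ν ς v p → KernelInv ν ω v p
    weaken h k x y = ≈-weaken h (k x y)

    -- In kernel form the two copies of Φ outside the kernel are expanded into dual functions, and
    -- the kernel supplies features invariant along U. These are translates of Φ, so the resulting
    -- norm is that of Φ.
    descend₀ : Chain e descendSteps (box (U ∷ U ∷ []) Φ) (box (U′ ∷ []) Φ)
    descend₀ = ≡-Chain start (Chain-≡
      (descend (uni 0) Ω 𝒩 (λ _ → h₀) (λ _ → h₁) (λ _ → feature U Φ) (λ _ → bh₀) (λ _ → bh₁) (λ _ z x → bΦ _)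
        (λ _ p h → weaken {ν = 𝒩} {v = feature U Φ} θ≤ω (feature-inv U bΦ h)))
      (trans (E-const (uni 0) _) (trans (E-cong 𝒩 λ m → box-translate (U′ ∷ []) Φ (at (Diff U) m)) (E-const 𝒩 _))))
      where
      start : box (U ∷ U ∷ []) Φ ≡ 𝔼[ _ ∈ uni 0 ] 𝔼[ x ∈ space ] 𝔼[ z ∈ 𝒩 ]
        sqr (avg U λ m → 𝔼[ k ∈ K ] (g k (x ⊕ m) * feature U Φ z (x ⊕ m)))
      start = trans (trans (box-kernel U U Φ) (E-cong space λ x → trans
          (E-cong (mean U) λ n → E-cong (mean U) λ n′ → trans (cong (_* ker x n n′) (ΦΦ _ _))
            (sym (E-*ʳ (K ⊗ K) (ker x n n′) λ (k , k′) → g k (x ⊕ at U n) * g k′ (x ⊕ at U n′))))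
          (assemble K 𝒩 U g (feature U Φ) x)))
        (sym (E-const (uni 0) _))
        where
        ker : X → Ix U → Ix U → ℚ
        ker x n n′ = 𝔼[ m ∈ 𝒩 ] (feature U Φ m (x ⊕ at U n) * feature U Φ m (x ⊕ at U n′))

    -- Dual-difference interchange: differences along W have to act on the functions inside the dual
    -- function rather than on Φ. Doubling p by Cauchy-Schwarz achieves this and discards the copies
    -- of Φ at l outside the kernel. Afterwards `unravel` isolates two copies of Φ at p, which
    -- restores the direction W.
    descend₁ : ∀ W → Chain e (sq ∷ descendSteps ++ sq ∷ []) (box (W ∷ U ∷ U ∷ []) Φ) (box (U′ ∷ W ∷ []) Φ)
    descend₁ W = link {W = In} interchange
      (descend (M ⊗ (M ⊗ M)) Ω (𝒩 ⊗ 𝒩) (λ (l , p , p′) j → pair (h₀ j) (a p) (a p′)) (λ (l , p , p′) j → pair (h₁ j) (a p) (a p′)) v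
        (λ _ j → pair-Bd _ _ (bh₀ j)) (λ _ j → pair-Bd _ _ (bh₁ j)) bv
        (λ (l , p , p′) s h → weaken {ν = 𝒩 ⊗ 𝒩} {v = v (l , p , p′)} 2θ≤ω (prodF-inv 𝒩 𝒩 {v = feature U (φ l p)} {w = feature U (φ l p′)} (λ z x → bφ l p _) (λ z x → bφ l p′ _) (feature-inv U (bφ l p) h) (feature-inv U (bφ l p′) h)))
      ⟫ step sq unravel)
      where
      open ℚₚ.≤-Reasoning
      M : Mean (Ix W)
      M = mean W
      a : Ix W → ℤ
      a = at W
      φ : Ix W → Ix W → X → ℚ
      φ l p = pair Φ (a p) (a l)
      bφ : ∀ l p → Bdd (φ l p)
      bφ l p = pair-Bd _ _ bΦ
      v : Ix W × Ix W × Ix W → Ix (Diff U) × Ix (Diff U) → X → ℚ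
      v (l , p , p′) = prodF (feature U (φ l p)) (feature U (φ l p′))
      bv : ∀ o z → Bdd (v o z)
      bv (l , p , p′) z x = Bd-* (bφ l p _) (bφ l p′ _)
      H : Ix W → Ix W → X → X → ℚ
      H l p y y′ = 𝔼[ m ∈ 𝒩 ] (feature U (φ l p) m y * feature U (φ l p) m y′)
      In Out : ℚ
      In = 𝔼[ o ∈ M ⊗ (M ⊗ M) ] 𝔼[ x ∈ space ] 𝔼[ z ∈ 𝒩 ⊗ 𝒩 ] sqr (avg U λ m → 𝔼[ j ∈ Ω ] avg 𝒟 λ d →
        dualTerm (pair (h₀ j) (a (proj₁ (proj₂ o))) (a (proj₂ (proj₂ o)))) (pair (h₁ j) (a (proj₁ (proj₂ o))) (a (proj₂ (proj₂ o)))) d (x ⊕ m) * v o z (x ⊕ m))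
      Out = 𝔼[ o ∈ M ⊗ (M ⊗ M) ] 𝔼[ z ∈ 𝒩 ⊗ 𝒩 ] box (U′ ∷ []) (v o z)
      interchange : box (W ∷ U ∷ U ∷ []) Φ * box (W ∷ U ∷ U ∷ []) Φ ≤ In + e
      interchange = begin
        _ ≡⟨ cong sqr (trans
               (E-cong M λ p → E-cong M λ l → trans (box-kernel U U (φ l p)) (E-cong space λ x → E-cong (mean U) λ n → E-cong (mean U) λ n′ →
                 trans (cong (_* H l p (x ⊕ at U n) (x ⊕ at U n′)) (trans (mix (Φ (x ⊕ at U n ⊕ a p)) (Φ (x ⊕ at U n ⊕ a l)) (Φ (x ⊕ at U n′ ⊕ a p)) (Φ (x ⊕ at U n′ ⊕ a l)))
                    (cong (_* (Φ (x ⊕ at U n ⊕ a l) * Φ (x ⊕ at U n′ ⊕ a l))) (ΦΦ (x ⊕ at U n ⊕ a p) (x ⊕ at U n′ ⊕ a p)))))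
                 (trans (solve 3 (λ s t u → s :* t :* u := s :* (t :* u)) refl (𝔼[ k ∈ K ] 𝔼[ k′ ∈ K ] (g k (x ⊕ at U n ⊕ a p) * g k′ (x ⊕ at U n′ ⊕ a p))) (Φ (x ⊕ at U n ⊕ a l) * Φ (x ⊕ at U n′ ⊕ a l)) (H l p (x ⊕ at U n) (x ⊕ at U n′)))
                 (trans (sym (E-*ʳ (K ⊗ K) (Φ (x ⊕ at U n ⊕ a l) * Φ (x ⊕ at U n′ ⊕ a l) * H l p (x ⊕ at U n) (x ⊕ at U n′)) λ (k , k′) → g k (x ⊕ at U n ⊕ a p) * g k′ (x ⊕ at U n′ ⊕ a p)))
                   (E-cong (K ⊗ K) λ (k , k′) → solve 3 (λ s t u → s :* (t :* u) := t :* (s :* u)) refl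
                      (g k (x ⊕ at U n ⊕ a p) * g k′ (x ⊕ at U n′ ⊕ a p)) (Φ (x ⊕ at U n ⊕ a l) * Φ (x ⊕ at U n′ ⊕ a l)) (H l p (x ⊕ at U n) (x ⊕ at U n′)))))))
               (trans (E-swap M O λ p o → α o * G o p) (E-cong O λ o → E-*ˡ M (α o) (G o)))) ⟩
        _ ≤⟨ cauchy-schwarz O α (λ o → E M (G o)) (λ _ → Bd-* (bΦ _) (bΦ _)) ⟩
        _ ≡⟨ E-cong M (λ l → trans
               (E-cong (space ⊗ (mean U ⊗ (mean U ⊗ (K ⊗ K)))) λ (x , n , n′ , k , k′) → E-sq M (G (l , x , n , n′ , k , k′)))
               (trans (E-swap (space ⊗ (mean U ⊗ (mean U ⊗ (K ⊗ K)))) (M ⊗ M) λ (x , n , n′ , k , k′) (p , p′) → G (l , x , n , n′ , k , k′) p * G (l , x , n , n′ , k , k′) p′)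
                 (E-cong M λ p → E-cong M λ p′ → E-cong space λ x → trans
                   (E-cong (mean U) λ n → E-cong (mean U) λ n′ → E-cong K λ k → E-cong K λ k′ → rearrange l p p′ x n n′ k k′)
                   (trans (assemble K (𝒩 ⊗ 𝒩) U (λ k → pair (g k) (a p) (a p′)) (v (l , p , p′)) x)
                     (E-cong (𝒩 ⊗ 𝒩) λ z → cong sqr (E-cong (mean U) λ m → E-cong Ω λ j → E-cong (mean 𝒟) λ d →
                       cong (_* v (l , p , p′) z (x ⊕ at U m)) (pair-dualTerm (h₀ j) (h₁ j) (at 𝒟 d) (a p) (a p′) (x ⊕ at U m)))))))) ⟩
        In ≤⟨ ≤-by e 0≤e refl ⟩
        In + e ∎
        where
        O : Mean (Ix W × X × Ix U × Ix U × (J × Ix 𝒟) × (J × Ix 𝒟))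
        O = M ⊗ (space ⊗ (mean U ⊗ (mean U ⊗ (K ⊗ K))))
        α : Ix W × X × Ix U × Ix U × (J × Ix 𝒟) × (J × Ix 𝒟) → ℚ
        α (l , x , n , n′ , _) = Φ (x ⊕ at U n ⊕ a l) * Φ (x ⊕ at U n′ ⊕ a l)
        G : Ix W × X × Ix U × Ix U × (J × Ix 𝒟) × (J × Ix 𝒟) → Ix W → ℚ
        G (l , x , n , n′ , k , k′) p = (g k (x ⊕ at U n ⊕ a p) * g k′ (x ⊕ at U n′ ⊕ a p)) * H l p (x ⊕ at U n) (x ⊕ at U n′)
        rearrange : ∀ l p p′ x n n′ k k′ → G (l , x , n , n′ , k , k′) p * G (l , x , n , n′ , k , k′) p′ ≡
          (pair (g k) (a p) (a p′) (x ⊕ at U n) * pair (g k′) (a p) (a p′) (x ⊕ at U n′)) * 𝔼[ z ∈ 𝒩 ⊗ 𝒩 ] (v (l , p , p′) z (x ⊕ at U n) * v (l , p , p′) z (x ⊕ at U n′))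
        rearrange l p p′ x n n′ k k′ = trans (mix _ _ _ _) (cong₂ _*_ (mix _ _ _ _)
          (trans (E-prod 𝒩 𝒩 _ _) (E-cong (𝒩 ⊗ 𝒩) λ _ → mix _ _ _ _)))
      unravel : Out * Out ≤ box (U′ ∷ W ∷ []) Φ + e
      unravel = begin
        _ ≡⟨ cong sqr (E-cong M λ l → trans (E-swap M (M ⊗ R) λ p (p′ , r) → val l p p′ r)
               (E-cong (M ⊗ R) λ (p′ , r) → trans (E-cong M λ p → rearrange l p p′ r) (E-*ˡ M (α (l , p′ , r)) (G (l , p′ , r))))) ⟩
        _ ≤⟨ cauchy-schwarz O α (λ o → E M (G o)) (λ _ → Bd-* (Bd-* (bΦ _) (bφ _ _ _)) (Bd-* (bΦ _) (bφ _ _ _))) ⟩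
        _ ≡⟨ trans (E-const M _) (trans (E-const M _) (trans
               (E-cong 𝒩 λ m → trans (E-const 𝒩 _) (E-cong (mean U′) λ u → E-cong (mean U′) λ u′ → trans
                 (E-cong space λ x → trans (E-sq M _) (E-cong M λ p → E-cong M λ p′ → cong₂ _*_ (cong₂ _*_ (c x u m p) (c x u′ m p)) (cong₂ _*_ (c x u m p′) (c x u′ m p′))))
                 (trans (E-inv (λ x → 𝔼[ p ∈ M ] 𝔼[ p′ ∈ M ] pair (pair Φ (at U′ u) (at U′ u′)) (a p) (a p′) x) (at (Diff U) m)) (E-swap space (M ⊗ M) _))))
               (E-const 𝒩 _))) ⟩
        _ ≤⟨ ≤-by e 0≤e refl ⟩
        _ ∎
        where
        R : Mean (Ix (Diff U) × Ix (Diff U) × Ix U′ × Ix U′ × X)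
        R = 𝒩 ⊗ (𝒩 ⊗ (mean U′ ⊗ (mean U′ ⊗ space)))
        O : Mean (Ix W × Ix W × Ix (Diff U) × Ix (Diff U) × Ix U′ × Ix U′ × X)
        O = M ⊗ (M ⊗ R)
        val : Ix W → Ix W → Ix W → Ix (Diff U) × Ix (Diff U) × Ix U′ × Ix U′ × X → ℚ
        val l p p′ (m , m′ , u , u′ , x) = v (l , p , p′) (m , m′) (x ⊕ at U′ u) * v (l , p , p′) (m , m′) (x ⊕ at U′ u′)
        α : Ix W × Ix W × Ix (Diff U) × Ix (Diff U) × Ix U′ × Ix U′ × X → ℚ
        α (l , p′ , m , m′ , u , u′ , x) = (Φ (x ⊕ at U′ u ⊕ at (Diff U) m ⊕ a l) * φ l p′ (x ⊕ at U′ u ⊕ at (Diff U) m′))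
          * (Φ (x ⊕ at U′ u′ ⊕ at (Diff U) m ⊕ a l) * φ l p′ (x ⊕ at U′ u′ ⊕ at (Diff U) m′))
        G : Ix W × Ix W × Ix (Diff U) × Ix (Diff U) × Ix U′ × Ix U′ × X → Ix W → ℚ
        G (l , p′ , m , m′ , u , u′ , x) p = Φ (x ⊕ at U′ u ⊕ at (Diff U) m ⊕ a p) * Φ (x ⊕ at U′ u′ ⊕ at (Diff U) m ⊕ a p)
        rearrange : ∀ l p p′ r → val l p p′ r ≡ α (l , p′ , r) * G (l , p′ , r) p
        rearrange l p p′ (m , m′ , u , u′ , x) = solve 6 (λ a b c d e f → (a :* b) :* c :* ((d :* e) :* f) := (b :* c) :* (e :* f) :* (a :* d)) refl
          (Φ (x ⊕ at U′ u ⊕ at (Diff U) m ⊕ a p)) (Φ (x ⊕ at U′ u ⊕ at (Diff U) m ⊕ a l)) (φ l p′ (x ⊕ at U′ u ⊕ at (Diff U) m′))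
          (Φ (x ⊕ at U′ u′ ⊕ at (Diff U) m ⊕ a p)) (Φ (x ⊕ at U′ u′ ⊕ at (Diff U) m ⊕ a l)) (φ l p′ (x ⊕ at U′ u′ ⊕ at (Diff U) m′))
        c : ∀ x u m p → Φ (x ⊕ at U′ u ⊕ at (Diff U) m ⊕ a p) ≡ Φ (x ⊕ at (Diff U) m ⊕ a p ⊕ at U′ u)
        c x u m p = trans (cong Φ (⊕-assoc (x ⊕ at U′ u) _ _)) (trans (sh Φ x (solveᶻ 3 (λ u m p → u ⊞ (m ⊞ p) ≔ (m ⊞ p) ⊞ u) refl (at U′ u) (at (Diff U) m) (a p)))
          (trans (sym (sh Φ x refl)) (cong (λ y → Φ (y ⊕ at U′ u)) (sym (⊕-assoc x _ _)))))

    -- The same interchange in two directions at once: p and q are doubled together by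
    -- `box-cauchy-schwarz`, and the kernel becomes a product of four.
    descend₂ : ∀ W₁ W₂ → Chain e (sq ∷ sq ∷ descendSteps ++ sq ∷ sq ∷ []) (box (W₁ ∷ W₂ ∷ U ∷ U ∷ []) Φ) (box (U′ ∷ W₁ ∷ W₂ ∷ []) Φ)
    descend₂ W₁ W₂ = _⟫_ {S = sq ∷ sq ∷ []} (twice 0≤e interchange)
      (descend P Ω (𝒩𝒩 ⊗ 𝒩𝒩) (λ o j → square o (h₀ j)) (λ o j → square o (h₁ j)) v
        (λ (_ , _ , p , p′ , q , q′) j → pair-Bd _ _ (pair-Bd _ _ (bh₀ j))) (λ (_ , _ , p , p′ , q , q′) j → pair-Bd _ _ (pair-Bd _ _ (bh₁ j))) bv
        (λ (l , k , p , p′ , q , q′) s h → weaken {ν = 𝒩𝒩 ⊗ 𝒩𝒩} {v = v (l , k , p , p′ , q , q′)} 4θ≤ω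
          (prodF-inv 𝒩𝒩 𝒩𝒩 {v = prodF (f l k p q) (f l k p′ q)} {w = prodF (f l k p q′) (f l k p′ q′)} (λ _ _ → Bd-* (bφ l k p q _) (bφ l k p′ q _)) (λ _ _ → Bd-* (bφ l k p q′ _) (bφ l k p′ q′ _))
            (prodF-inv 𝒩 𝒩 {v = f l k p q} {w = f l k p′ q} (λ _ _ → bφ l k p q _) (λ _ _ → bφ l k p′ q _) (feature-inv U (bφ l k p q) h) (feature-inv U (bφ l k p′ q) h))
            (prodF-inv 𝒩 𝒩 {v = f l k p q′} {w = f l k p′ q′} (λ _ _ → bφ l k p q′ _) (λ _ _ → bφ l k p′ q′ _) (feature-inv U (bφ l k p q′) h) (feature-inv U (bφ l k p′ q′) h))))
      ⟫ twice 0≤e unravel)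
      where
      open ℚₚ.≤-Reasoning
      M₁ : Mean (Ix W₁)
      M₁ = mean W₁
      M₂ : Mean (Ix W₂)
      M₂ = mean W₂
      a : Ix W₁ → ℤ
      a = at W₁
      b : Ix W₂ → ℤ
      b = at W₂
      𝒩𝒩 : Mean (Ix (Diff U) × Ix (Diff U))
      𝒩𝒩 = 𝒩 ⊗ 𝒩
      Par : Set
      Par = Ix W₁ × Ix W₂ × Ix W₁ × Ix W₁ × Ix W₂ × Ix W₂
      P : Mean Par
      P = M₁ ⊗ (M₂ ⊗ (M₁ ⊗ (M₁ ⊗ (M₂ ⊗ M₂))))
      square : Par → (X → ℚ) → X → ℚ
      square (_ , _ , p , p′ , q , q′) h = pair (pair h (a p) (a p′)) (b q) (b q′)
      4θ≤ω : (θ + θ) + (θ + θ) ≤ ω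
      4θ≤ω = ≤-reflexive (solve 1 (λ t → (t :+ t) :+ (t :+ t) := (con 1ℚ :+ con 1ℚ) :* (t :+ t)) refl θ)
      c : X → Ix W₁ → Ix W₂ → ℚ
      c y p q = Φ (y ⊕ b q ⊕ a p)
      φ : Ix W₁ → Ix W₂ → Ix W₁ → Ix W₂ → X → ℚ
      φ l k p q = pair (pair Φ (a p) (a l)) (b q) (b k)
      bφ : ∀ l k p q → Bdd (φ l k p q)
      bφ l k p q = pair-Bd _ _ (pair-Bd _ _ bΦ)
      f : Ix W₁ → Ix W₂ → Ix W₁ → Ix W₂ → Ix (Diff U) → X → ℚ
      f l k p q = feature U (φ l k p q)
      v : Par → (Ix (Diff U) × Ix (Diff U)) × (Ix (Diff U) × Ix (Diff U)) → X → ℚ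
      v (l , k , p , p′ , q , q′) = prodF (prodF (f l k p q) (f l k p′ q)) (prodF (f l k p q′) (f l k p′ q′))
      bv : ∀ o z → Bdd (v o z)
      bv (l , k , p , p′ , q , q′) z x = Bd-* (Bd-* (bφ l k p q _) (bφ l k p′ q _)) (Bd-* (bφ l k p q′ _) (bφ l k p′ q′ _))
      H : Ix W₁ → Ix W₂ → Ix W₁ → Ix W₂ → X → X → ℚ
      H l k p q y y′ = 𝔼[ m ∈ 𝒩 ] (f l k p q m y * f l k p q m y′)
      In Out V : ℚ
      V = box (W₁ ∷ W₂ ∷ U ∷ U ∷ []) Φ
      In = 𝔼[ o ∈ P ] 𝔼[ x ∈ space ] 𝔼[ z ∈ 𝒩𝒩 ⊗ 𝒩𝒩 ] sqr (avg U λ m → 𝔼[ j ∈ Ω ] avg 𝒟 λ d →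
        dualTerm (square o (h₀ j)) (square o (h₁ j)) d (x ⊕ m) * v o z (x ⊕ m))
      Out = 𝔼[ o ∈ P ] 𝔼[ z ∈ 𝒩𝒩 ⊗ 𝒩𝒩 ] box (U′ ∷ []) (v o z)
      interchange : (V * V) * (V * V) ≤ In
      interchange = begin
        _ ≡⟨ cong (λ t → (t * t) * (t * t)) (trans
               (trans (E-swap M₁ M₁ λ p l → 𝔼[ q ∈ M₂ ] 𝔼[ k ∈ M₂ ] box (U ∷ U ∷ []) (φ l k p q))
                 (E-cong M₁ λ l → E-swap (M₁ ⊗ M₂) M₂ λ (p , q) k → box (U ∷ U ∷ []) (φ l k p q)))
               (E-cong M₁ λ l → E-cong M₂ λ k → trans (E-cong M₁ λ p → E-cong M₂ λ q → expansion l k p q)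
                 (E-swap (M₁ ⊗ M₂) R λ (p , q) r → α (l , k , r) p * (β (l , k , r) q * G (l , k , r) p q)))) ⟩
        _ ≤⟨ box-cauchy-schwarz O M₁ M₂ α β G (λ _ p → Bd-* (Bd-* (bΦ _) (bΦ _)) (Bd-* (bΦ _) (bΦ _))) (λ _ q → Bd-* (bΦ _) (bΦ _)) ⟩
        _ ≡⟨ E-cong M₁ (λ l → E-cong M₂ λ k → trans
               (E-swap R (M₁ ⊗ (M₁ ⊗ (M₂ ⊗ M₂))) λ r (p , p′ , q , q′) → (G (l , k , r) p q * G (l , k , r) p′ q) * (G (l , k , r) p q′ * G (l , k , r) p′ q′))
               (E-cong M₁ λ p → E-cong M₁ λ p′ → E-cong M₂ λ q → E-cong M₂ λ q′ → E-cong space λ x → trans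
                 (E-cong (mean U) λ n → E-cong (mean U) λ n′ → E-cong K λ κ → E-cong K λ κ′ → rearrange l k p p′ q q′ x n n′ κ κ′)
                 (trans (assemble K (𝒩𝒩 ⊗ 𝒩𝒩) U (λ κ → square (l , k , p , p′ , q , q′) (g κ)) (v (l , k , p , p′ , q , q′)) x)
                   (E-cong (𝒩𝒩 ⊗ 𝒩𝒩) λ z → cong sqr (E-cong (mean U) λ m → E-cong Ω λ j → E-cong (mean 𝒟) λ d →
                     cong (_* v (l , k , p , p′ , q , q′) z (x ⊕ at U m)) (trans
                       (pair-cong (pair-dualTerm (h₀ j) (h₁ j) (at 𝒟 d) (a p) (a p′)) (b q) (b q′) (x ⊕ at U m))
                       (pair-dualTerm (pair (h₀ j) (a p) (a p′)) (pair (h₁ j) (a p) (a p′)) (at 𝒟 d) (b q) (b q′) (x ⊕ at U m)))))))) ⟩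
        In ∎
        where
        Rest : Set
        Rest = X × Ix U × Ix U × (J × Ix 𝒟) × (J × Ix 𝒟)
        R : Mean Rest
        R = space ⊗ (mean U ⊗ (mean U ⊗ (K ⊗ K)))
        O : Mean (Ix W₁ × Ix W₂ × Rest)
        O = M₁ ⊗ (M₂ ⊗ R)
        α : Ix W₁ × Ix W₂ × Rest → Ix W₁ → ℚ
        α (l , k , x , n , n′ , _) p = (c (x ⊕ at U n) p k * c (x ⊕ at U n) l k) * (c (x ⊕ at U n′) p k * c (x ⊕ at U n′) l k)
        β : Ix W₁ × Ix W₂ × Rest → Ix W₂ → ℚ
        β (l , k , x , n , n′ , _) q = c (x ⊕ at U n) l q * c (x ⊕ at U n′) l q
        gg : Rest → Ix W₁ → Ix W₂ → ℚ
        gg (x , n , n′ , κ , κ′) p q = g κ (x ⊕ at U n ⊕ b q ⊕ a p) * g κ′ (x ⊕ at U n′ ⊕ b q ⊕ a p)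
        G : Ix W₁ × Ix W₂ × Rest → Ix W₁ → Ix W₂ → ℚ
        G (l , k , r@(x , n , n′ , _)) p q = gg r p q * H l k p q (x ⊕ at U n) (x ⊕ at U n′)
        expansion : ∀ l k p q → box (U ∷ U ∷ []) (φ l k p q) ≡ 𝔼[ r ∈ R ] (α (l , k , r) p * (β (l , k , r) q * G (l , k , r) p q))
        expansion l k p q = trans (box-kernel U U (φ l k p q)) (E-cong space λ x → E-cong (mean U) λ n → E-cong (mean U) λ n′ → trans
          (solve 9 (λ s t u w s′ t′ u′ w′ h → ((s :* t) :* (u :* w)) :* ((s′ :* t′) :* (u′ :* w′)) :* h :=
              (s :* s′) :* ((((u :* w) :* (u′ :* w′)) :* (t :* t′)) :* h)) refl
            (c (x ⊕ at U n) p q) (c (x ⊕ at U n) l q) (c (x ⊕ at U n) p k) (c (x ⊕ at U n) l k)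
            (c (x ⊕ at U n′) p q) (c (x ⊕ at U n′) l q) (c (x ⊕ at U n′) p k) (c (x ⊕ at U n′) l k) (H l k p q (x ⊕ at U n) (x ⊕ at U n′)))
          (trans (cong (_* (α′ x n n′ * β′ x n n′ * H l k p q (x ⊕ at U n) (x ⊕ at U n′))) (ΦΦ (x ⊕ at U n ⊕ b q ⊕ a p) (x ⊕ at U n′ ⊕ b q ⊕ a p)))
          (trans (sym (E-*ʳ (K ⊗ K) (α′ x n n′ * β′ x n n′ * H l k p q (x ⊕ at U n) (x ⊕ at U n′)) λ (κ , κ′) → gg (x , n , n′ , κ , κ′) p q))
            (E-cong (K ⊗ K) λ (κ , κ′) → solve 4 (λ s α β h → s :* (α :* β :* h) := α :* (β :* (s :* h))) refl
              (gg (x , n , n′ , κ , κ′) p q) (α′ x n n′) (β′ x n n′) (H l k p q (x ⊕ at U n) (x ⊕ at U n′))))))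
          where
          α′ β′ : X → Ix U → Ix U → ℚ
          α′ x n n′ = (c (x ⊕ at U n) p k * c (x ⊕ at U n) l k) * (c (x ⊕ at U n′) p k * c (x ⊕ at U n′) l k)
          β′ x n n′ = c (x ⊕ at U n) l q * c (x ⊕ at U n′) l q
        rearrange : ∀ l k p p′ q q′ x n n′ κ κ′ → let r = (l , k , x , n , n′ , κ , κ′) ; o = (l , k , p , p′ , q , q′) in
          (G r p q * G r p′ q) * (G r p q′ * G r p′ q′) ≡
          (square o (g κ) (x ⊕ at U n) * square o (g κ′) (x ⊕ at U n′)) * 𝔼[ z ∈ 𝒩𝒩 ⊗ 𝒩𝒩 ] (v o z (x ⊕ at U n) * v o z (x ⊕ at U n′))
        rearrange l k p p′ q q′ x n n′ κ κ′ = trans (cong₂ _*_ (mix _ _ _ _) (mix _ _ _ _)) (trans (mix _ _ _ _)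
          (cong₂ _*_ (trans (cong₂ _*_ (mix _ _ _ _) (mix _ _ _ _)) (mix _ _ _ _))
            (trans (cong₂ _*_ (two p p′ q q) (two p p′ q′ q′)) (trans (E-prod 𝒩𝒩 𝒩𝒩 _ _) (E-cong (𝒩𝒩 ⊗ 𝒩𝒩) λ _ → mix _ _ _ _)))))
          where
          two : ∀ p p′ q q′ → H l k p q (x ⊕ at U n) (x ⊕ at U n′) * H l k p′ q′ (x ⊕ at U n) (x ⊕ at U n′) ≡
            𝔼[ z ∈ 𝒩𝒩 ] (prodF (f l k p q) (f l k p′ q′) z (x ⊕ at U n) * prodF (f l k p q) (f l k p′ q′) z (x ⊕ at U n′))
          two p p′ q q′ = trans (E-prod 𝒩 𝒩 _ _) (E-cong 𝒩𝒩 λ _ → mix _ _ _ _)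
      unravel : (Out * Out) * (Out * Out) ≤ box (U′ ∷ W₁ ∷ W₂ ∷ []) Φ
      unravel = begin
        _ ≡⟨ cong (λ t → (t * t) * (t * t)) (E-cong M₁ λ l → E-cong M₂ λ k → trans
               (E-cong M₁ λ p → trans (E-cong M₁ λ p′ → E-swap M₂ M₂ λ q q′ → E R (val l k p p′ q q′))
                 (E-swap (M₁ ⊗ M₂) M₂ λ (p′ , q′) q → E R (val l k p p′ q q′)))
               (trans (E-swap (M₁ ⊗ M₂) (M₁ ⊗ (M₂ ⊗ R)) λ (p , q) (p′ , q′ , r) → val l k p p′ q q′ r)
                 (E-cong (M₁ ⊗ (M₂ ⊗ R)) λ (p′ , q′ , r) → E-cong M₁ λ p → E-cong M₂ λ q → rearrange l k p p′ q q′ r))) ⟩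
        _ ≤⟨ box-cauchy-schwarz O M₁ M₂ α β G
               (λ (l , k , p′ , q′ , m , ms , u , u′ , x) p → Bd-* (bA l k p′ q′ (m , ms , x ⊕ at U′ u) p) (bA l k p′ q′ (m , ms , x ⊕ at U′ u′) p))
               (λ (l , k , p′ , q′ , m , ms , u , u′ , x) q → Bd-* (bB l k p′ q′ (m , ms , x ⊕ at U′ u) q) (bB l k p′ q′ (m , ms , x ⊕ at U′ u′) q)) ⟩
        _ ≡⟨ trans (E-const M₁ _) (trans (E-const M₂ _) (trans (E-const M₁ _) (trans (E-const M₂ _) (trans
               (E-cong 𝒩 λ m → trans (E-const (𝒩 ⊗ 𝒩𝒩) _) (E-cong (mean U′) λ u → E-cong (mean U′) λ u′ → trans
                 (E-cong space λ x → E-cong M₁ λ p → E-cong M₁ λ p′ → E-cong M₂ λ q → E-cong M₂ λ q′ →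
                   cong₂ _*_ (cong₂ _*_ (cong₂ _*_ (move x u m p q) (move x u′ m p q)) (cong₂ _*_ (move x u m p′ q) (move x u′ m p′ q)))
                             (cong₂ _*_ (cong₂ _*_ (move x u m p q′) (move x u′ m p q′)) (cong₂ _*_ (move x u m p′ q′) (move x u′ m p′ q′))))
                 (trans (E-inv (λ x → 𝔼[ p ∈ M₁ ] 𝔼[ p′ ∈ M₁ ] 𝔼[ q ∈ M₂ ] 𝔼[ q′ ∈ M₂ ] pair (pair (pair Φ (at U′ u) (at U′ u′)) (a p) (a p′)) (b q) (b q′) x) (at (Diff U) m))
                   (E-swap space (M₁ ⊗ (M₁ ⊗ (M₂ ⊗ M₂))) λ x (p , p′ , q , q′) → pair (pair (pair Φ (at U′ u) (at U′ u′)) (a p) (a p′)) (b q) (b q′) x))))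
               (E-const 𝒩 _))))) ⟩
        _ ∎
        where
        D : Set
        D = Ix (Diff U)
        Rest : Set
        Rest = D × (D × (D × D)) × Ix U′ × Ix U′ × X
        S : Mean ((D × D) × (D × D))
        S = 𝒩𝒩 ⊗ 𝒩𝒩
        R : Mean Rest
        R = 𝒩 ⊗ ((𝒩 ⊗ 𝒩𝒩) ⊗ (mean U′ ⊗ (mean U′ ⊗ space)))
        O : Mean (Ix W₁ × Ix W₂ × Ix W₁ × Ix W₂ × Rest)
        O = M₁ ⊗ (M₂ ⊗ (M₁ ⊗ (M₂ ⊗ R)))
        val : Ix W₁ → Ix W₂ → Ix W₁ → Ix W₁ → Ix W₂ → Ix W₂ → Rest → ℚ
        val l k p p′ q q′ (m₁ , (m₂ , m₃ , m₄) , u , u′ , x) =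
          v (l , k , p , p′ , q , q′) ((m₁ , m₂) , (m₃ , m₄)) (x ⊕ at U′ u) * v (l , k , p , p′ , q , q′) ((m₁ , m₂) , (m₃ , m₄)) (x ⊕ at U′ u′)
        infixl 6 _◃_
        _◃_ : X → D → X
        y ◃ m = y ⊕ at (Diff U) m
        A : Ix W₁ → Ix W₂ → Ix W₁ → Ix W₂ → D × (D × D × D) × X → Ix W₁ → ℚ
        A l k p′ q′ (m₁ , (m₂ , m₃ , m₄) , y) p = (c (y ◃ m₁) p k * c (y ◃ m₁) l k) * (φ l k p q′ (y ◃ m₃) * φ l k p′ q′ (y ◃ m₄))
        bA : ∀ l k p′ q′ r p → Bd (A l k p′ q′ r p)
        bA l k p′ q′ r p = Bd-* (Bd-* (bΦ _) (bΦ _)) (Bd-* (bφ l k p q′ _) (bφ l k p′ q′ _))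
        B : Ix W₁ → Ix W₂ → Ix W₁ → Ix W₂ → D × (D × D × D) × X → Ix W₂ → ℚ
        B l k p′ q′ (m₁ , (m₂ , m₃ , m₄) , y) q = c (y ◃ m₁) l q * φ l k p′ q (y ◃ m₂)
        bB : ∀ l k p′ q′ r q → Bd (B l k p′ q′ r q)
        bB l k p′ q′ r q = Bd-* (bΦ _) (bφ l k p′ q _)
        α : Ix W₁ × Ix W₂ × Ix W₁ × Ix W₂ × Rest → Ix W₁ → ℚ
        α (l , k , p′ , q′ , m₁ , ms , u , u′ , x) p = A l k p′ q′ (m₁ , ms , x ⊕ at U′ u) p * A l k p′ q′ (m₁ , ms , x ⊕ at U′ u′) p
        β : Ix W₁ × Ix W₂ × Ix W₁ × Ix W₂ × Rest → Ix W₂ → ℚ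
        β (l , k , p′ , q′ , m₁ , ms , u , u′ , x) q = B l k p′ q′ (m₁ , ms , x ⊕ at U′ u) q * B l k p′ q′ (m₁ , ms , x ⊕ at U′ u′) q
        G : Ix W₁ × Ix W₂ × Ix W₁ × Ix W₂ × Rest → Ix W₁ → Ix W₂ → ℚ
        G (l , k , p′ , q′ , m₁ , ms , u , u′ , x) p q = c (x ⊕ at U′ u ◃ m₁) p q * c (x ⊕ at U′ u′ ◃ m₁) p q
        rearrange : ∀ l k p p′ q q′ r → val l k p p′ q q′ r ≡ α (l , k , p′ , q′ , r) p * (β (l , k , p′ , q′ , r) q * G (l , k , p′ , q′ , r) p q)
        rearrange l k p p′ q q′ (m₁ , (m₂ , m₃ , m₄) , u , u′ , x) = trans (cong₂ _*_ (one (x ⊕ at U′ u)) (one (x ⊕ at U′ u′)))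
          (solve 6 (λ α β g α′ β′ g′ → (α :* (β :* g)) :* (α′ :* (β′ :* g′)) := (α :* α′) :* ((β :* β′) :* (g :* g′))) refl
             (A l k p′ q′ (m₁ , (m₂ , m₃ , m₄) , x ⊕ at U′ u) p) (B l k p′ q′ (m₁ , (m₂ , m₃ , m₄) , x ⊕ at U′ u) q) (c (x ⊕ at U′ u ◃ m₁) p q)
             (A l k p′ q′ (m₁ , (m₂ , m₃ , m₄) , x ⊕ at U′ u′) p) (B l k p′ q′ (m₁ , (m₂ , m₃ , m₄) , x ⊕ at U′ u′) q) (c (x ⊕ at U′ u′ ◃ m₁) p q))
          where
          one : ∀ y → v (l , k , p , p′ , q , q′) ((m₁ , m₂) , (m₃ , m₄)) y ≡
            A l k p′ q′ (m₁ , (m₂ , m₃ , m₄) , y) p * (B l k p′ q′ (m₁ , (m₂ , m₃ , m₄) , y) q * c (y ◃ m₁) p q)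
          one y = solve 7 (λ s t u w x₂ x₃ x₄ → (((s :* t) :* (u :* w)) :* x₂) :* (x₃ :* x₄) := ((u :* w) :* (x₃ :* x₄)) :* ((t :* x₂) :* s)) refl
            (c (y ◃ m₁) p q) (c (y ◃ m₁) l q) (c (y ◃ m₁) p k) (c (y ◃ m₁) l k) (φ l k p′ q (y ◃ m₂)) (φ l k p q′ (y ◃ m₃)) (φ l k p′ q′ (y ◃ m₄))
        move : ∀ x u m p q → c (x ⊕ at U′ u ◃ m) p q ≡ Φ (x ◃ m ⊕ b q ⊕ a p ⊕ at U′ u)
        move x u m p q = trans (cong (λ y → Φ (y ⊕ b q ⊕ a p)) (trans (⊕-assoc x _ _) (trans (cong (x ⊕_) (solveᶻ 2 (λ u m → u ⊞ m ≔ m ⊞ u) refl (at U′ u) (at (Diff U) m))) (sym (⊕-assoc x _ _)))))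
          (trans (cong Φ (trans (cong (_⊕ a p) (⊕-assoc (x ◃ m) _ _)) (⊕-assoc (x ◃ m) _ _)))
          (trans (cong (λ t → Φ (x ◃ m ⊕ t)) (solveᶻ 3 (λ u q p → u ⊞ q ⊞ p ≔ q ⊞ p ⊞ u) refl (at U′ u) (b q) (a p)))
            (cong Φ (trans (sym (⊕-assoc (x ◃ m) _ _)) (cong (_⊕ at U′ u) (sym (⊕-assoc (x ◃ m) _ _)))))))

-- The inverse theorem

-- Windows for the linearisation; h i σ and k j τ are the van der Corput shifts.
record Start (θ : ℚ) (q : ℤ) (𝒟 : Win) (n : ℕ) (U : Win) : Set₁ where
  field
    ℒ ℒ♭  : Win
    h k   : Fin (suc n) → Fin (suc n) → ℤ
    𝒟-h   : ∀ i σ → Inv θ 𝒟 (h i σ)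
    𝒟-k   : ∀ j τ → Inv θ 𝒟 (k j τ)
    𝒟-ℒ   : ∀ l → Inv θ 𝒟 (at ℒ l)
    ℒ-ℒ♭  : ∀ l → Inv θ ℒ (at ℒ♭ l)

  α : Fin (suc n) → Fin (suc n) → Fin (suc n) → ℤ
  α σ σ′ i = 2ᶻ *ᶻ q *ᶻ (h i σ′ -ᶻ h i σ)

  β : Fin (suc n) → Fin (suc n) → Fin (suc n) → ℤ
  β τ τ′ j = 2ᶻ *ᶻ q *ᶻ (k j τ′ -ᶻ k j τ)

  γ : (σ σ′ τ τ′ i j : Fin (suc n)) → ℤ
  γ σ σ′ τ τ′ i j = 2ᶻ *ᶻ q *ᶻ ((h i σ′ -ᶻ h i σ) +ᶻ (k j τ′ -ᶻ k j τ))

  field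
    splitγγ : ∀ {σ σ′ τ τ′} → σ ≢ σ′ → τ ≢ τ′ → ∀ i i′ j → i ≢ i′ → Splits θ U (Scale (γ σ σ′ τ τ′ i′ j) ℒ♭) (Scale (γ σ σ′ τ τ′ i j) ℒ)
    splitαγ : ∀ {σ σ′ τ τ′} → σ ≢ σ′ → τ ≢ τ′ → ∀ i i′ j → i ≢ i′ → Splits θ U (Scale (α σ σ′ i′) ℒ♭) (Scale (γ σ σ′ τ τ′ i j) ℒ)
    splitαα : ∀ {σ σ′} → σ ≢ σ′ → ∀ i i′ → i ≢ i′ → Splits θ U (Scale (α σ σ′ i) ℒ) (Scale (α σ σ′ i′) ℒ)
    splitββ : ∀ {τ τ′} → τ ≢ τ′ → ∀ j j′ → j ≢ j′ → Splits θ U (Scale (β τ τ′ j) ℒ) (Scale (β τ τ′ j′) ℒ)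

Inv-Scale : ∀ {θ W s} c → Inv θ W s → Inv θ (Scale c W) (c *ᶻ s)
Inv-Scale {W = W} {s} c h = inv λ φ b → ≈-≡ˡ
  (E-cong (mean W) λ i → cong φ (solveᶻ 3 (λ c w s → c ⊠ (w ⊞ s) ≔ c ⊠ w ⊞ c ⊠ s) refl c (at W i) s))
  (shift h (λ m → φ (c *ᶻ m)) (λ m → b _))

startSteps : List Step
startSteps = sq ∷ sq ∷ ln ∷ ln ∷ sq ∷ sq ∷ sq ∷ globaliseSteps

inverseSteps : List Step
inverseSteps = startSteps ++ (sq ∷ sq ∷ descendSteps ++ sq ∷ sq ∷ []) ++ (sq ∷ descendSteps ++ sq ∷ []) ++ descendSteps

module Inverse (𝒮 : System) (q : ℤ) {θ e : ℚ} (0≤θ : 0ℚ ≤ θ)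
  (16θ≤e : 2ℚ * (2ℚ * (2ℚ * (θ + θ))) ≤ e)
  (𝒟 : Win) (n : ℕ) (1/n≤e : 1/suc n ≤ e)
  (small : 4ℚ * (((θ + θ) + ((2ℚ * (θ + θ)) + (2ℚ * (θ + θ)))) + (θ + 1/suc n)) ≤ e) where
  open Descent 𝒮 q 0≤θ 16θ≤e 𝒟 n 1/n≤e small public
  open Count 𝒮 q public using (Λ; linearise; fourForm; fourForm-box; factor; intercept)

  module Begin {U : Win} (𝓈 : Start θ q 𝒟 n U) where
    open Start 𝓈

    begin-chain : ∀ {f₀ f₁ f} → Bdd f₀ → Bdd f₁ → Bdd f → Chain e startSteps (Λ 𝒟 f₀ f₁ f) (box (U ∷ U ∷ U ∷ U ∷ []) f)
    begin-chain {f₀} {f₁} {f} b₀ b₁ b =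
      -- Dummy averages over j and i: linearisation is valid for every choice of shifts, and
      -- `globalise` needs the whole family.
      ≡-Chain (sym (trans (E-const N _) (E-const N _)))
      (_⟫_ {S = sq ∷ sq ∷ []} (E-chain (sq ∷ sq ∷ []) (N ⊗ N) λ (j , i) → linearise 𝒟 N (h i) N (k j) (𝒟-h i) (𝒟-k j) 2θ≤ b₀ b₁ b)
      (≡-Chain (trans (E-swap (N ⊗ N) (N ⊗ (N ⊗ (N ⊗ N))) λ (j , i) (σ , σ′ , τ , τ′) → Q σ σ′ τ τ′ j i) refl)
      (link (≤-trans (E-off n ψ (λ σ σ′ → proj₁ (E-Bd (N ⊗ N) λ (τ , τ′) → E-Bd (N ⊗ N) λ (j , i) → bQ σ σ′ τ τ′ j i))) (+-monoʳ-≤ _ 1/n≤e))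
      (Chain-≡ (E-chain _ N λ σ → E-chain _ N λ σ′ → off-case (λ t → Chain e later t Goal) σ σ′ (ψ σ σ′)
          (zero-chain ln _ 0≤e 0≤Goal) λ σ≢σ′ →
        link (≤-trans (E-off n (ψ₂ σ σ′) (λ τ τ′ → proj₁ (E-Bd (N ⊗ N) λ (j , i) → bQ σ σ′ τ τ′ j i))) (+-monoʳ-≤ _ 1/n≤e))
        (Chain-≡ (E-chain _ N λ τ → E-chain _ N λ τ′ → off-case (λ t → Chain e last t Goal) τ τ′ (ψ₂ σ σ′ τ τ′)
            (zero-chain sq _ 0≤e 0≤Goal) λ τ≢τ′ →
          _⟫_ {S = sq ∷ sq ∷ sq ∷ []} (E-chain (sq ∷ sq ∷ sq ∷ []) (N ⊗ N) λ (j , i) → fourForm-box 𝒟 ℒ 𝒟-ℒ 2θ≤ b (h i σ) (h i σ′) (k j τ) (k j τ′) refl refl)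
            (globalise n ℒ ℒ♭ U (α σ σ′) (β τ τ′) (γ σ σ′ τ τ′) 1/n≤e (λ i l → Inv-Scale {W = ℒ} (α σ σ′ i) (ℒ-ℒ♭ l)) (λ i j l → Inv-Scale {W = ℒ} (γ σ σ′ τ τ′ i j) (ℒ-ℒ♭ l))
              (splitγγ σ≢σ′ τ≢τ′) (splitαγ σ≢σ′ τ≢τ′) (splitαα σ≢σ′) (splitββ τ≢τ′) b))
          (trans (E-const N _) (E-const N Goal))))
        (trans (E-const N _) (E-const N Goal))))))
      where
      last later : List Step
      last = sq ∷ sq ∷ sq ∷ globaliseSteps
      later = ln ∷ last
      N : Mean (Fin (suc n))
      N = uni n
      Goal : ℚ
      Goal = box (U ∷ U ∷ U ∷ U ∷ []) f
      0≤Goal : 0ℚ ≤ Goal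
      0≤Goal = 0≤box (U ∷ U ∷ U ∷ []) U f
      Q : (σ σ′ τ τ′ j i : Fin (suc n)) → ℚ
      Q σ σ′ τ τ′ j i = fourForm 𝒟 f (h i σ) (h i σ′) (k j τ) (k j τ′)
      bQ : ∀ σ σ′ τ τ′ j i → Bd (Q σ σ′ τ τ′ j i)
      bQ σ σ′ τ τ′ j i = E-Bd space λ x → E-Bd (mean 𝒟) λ d → lin-Bd (bF (h i σ′) (k j τ) ◂ bF (h i σ) (k j τ′) ◂ bF (h i σ) (k j τ) ◂ bF (h i σ′) (k j τ′) ◂ nil) x (at 𝒟 d)
        where
        bF : ∀ s t → Bdd (proj₁ (factor f s t))
        bF s t y = b (y ⊕ intercept s t)
      ψ : Fin (suc n) → Fin (suc n) → ℚ
      ψ σ σ′ = 𝔼[ τ ∈ N ] 𝔼[ τ′ ∈ N ] 𝔼[ j ∈ N ] 𝔼[ i ∈ N ] Q σ σ′ τ τ′ j i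
      ψ₂ : (σ σ′ τ τ′ : Fin (suc n)) → ℚ
      ψ₂ σ σ′ τ τ′ = 𝔼[ j ∈ N ] 𝔼[ i ∈ N ] Q σ σ′ τ τ′ j i

  -- The number of directions drops from four to three, two and one. Each descent trades a pair of
  -- equal directions, so the first ladder serves twice, for the two pairs U₀, and the second ladder
  -- trades the resulting pair U₁.
  inverse-chain : ∀ {U₀ U₁ U₂} → Start θ q 𝒟 n U₀ → Ladder θ q 𝒟 n U₀ U₁ → Ladder θ q 𝒟 n U₁ U₂ →
    ∀ {f₀ f₁ Φ} → Bdd f₀ → Bdd f₁ → Dual Φ → Chain e inverseSteps (Λ 𝒟 f₀ f₁ Φ) (box (U₂ ∷ []) Φ)
  inverse-chain {U₀} {U₁} 𝓈 𝓁 𝓁′ {Φ = Φ} b₀ b₁ δ =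
    Begin.begin-chain 𝓈 b₀ b₁ (Dual.dual-Bdd δ) ⟫ DescendDual.descend₂ 𝓁 δ U₀ U₀ ⟫ DescendDual.descend₁ 𝓁 δ U₁ ⟫ DescendDual.descend₀ 𝓁′ δ

square-≤ : ∀ {a b} → 0ℚ ≤ b → a * a ≤ b * b → a ≈[ b ] 0ℚ
square-≤ {a} {b} 0≤b h = ≤-trans (one a h) (≤-reflexive (sym (+-identityˡ b))) ,
  ≤-trans (≤-by _ (0≤b-a (one (- a) (≤-trans (≤-reflexive (solve 1 (λ a → (:- a) :* (:- a) := a :* a) refl a)) h)))
    (solve 2 (λ a b → a :+ b := con 0ℚ :+ (b :- (:- a))) refl a b)) ≤-refl
  where
  one : ∀ a → a * a ≤ b * b → a ≤ b
  one a h with a ℚₚ.≤? b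
  ... | yes p = p
  ... | no ¬p = *-cancelʳ-pos {c = a + b} 0<a+b (≤-by _ (0≤b-a h) (solve 2 (λ a b → b :* (a :+ b) := a :* (a :+ b) :+ (b :* b :- a :* a)) refl a b))
    where
    0<a+b : 0ℚ < a + b
    0<a+b = ℚₚ.<-≤-trans (ℚₚ.≤-<-trans 0≤b (ℚₚ.≰⇒> ¬p)) (≤-by b 0≤b refl)

module Smoothing (𝒮 : System) where
  open Invariance 𝒮 public

  inner : (X → ℚ) → (X → ℚ) → ℚ
  inner F G = 𝔼[ x ∈ space ] (F x * G x)

  -- A substitute for conditional expectation: bounded and self-adjoint, though not a true
  -- projection.
  proj : Win → (X → ℚ) → X → ℚ
  proj W = smooth (Diff W)

  proj-Bd : ∀ W {F} → Bdd F → Bdd (proj W F)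
  proj-Bd W = smooth-Bd (Diff W)

  proj-symmetric : ∀ W F G → inner (proj W F) G ≡ inner F (proj W G)
  proj-symmetric W F G = begin
    inner (proj W F) G
      ≡⟨ E-cong space (λ x → sym (E-*ʳ M (G x) λ k → F (x ⊕ at (Diff W) k))) ⟩
    𝔼[ x ∈ space ] 𝔼[ k ∈ M ] (F (x ⊕ at (Diff W) k) * G x)
      ≡⟨ E-shifted M (λ k → -ᶻ at (Diff W) k) (λ x (i , j) → cong₂ _*_
           (trans (sh F x (solveᶻ 1 (λ a → ⊟ a ⊞ a ≔ # 0ℤ) refl (at (Diff W) (i , j)))) (cong F (⊕-zero x)))
           (cong (λ t → G (x ⊕ t)) (solveᶻ 2 (λ a b → ⊟ (a ⊟ b) ≔ b ⊟ a) refl (at W i) (at W j)))) ⟩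
    𝔼[ x ∈ space ] 𝔼[ i ∈ mean W ] 𝔼[ j ∈ mean W ] (F x * G (x ⊕ (at W j -ᶻ at W i)))
      ≡⟨ E-cong space (λ x → trans (E-*ˡ (mean W ⊗ mean W) (F x) λ (i , j) → G (x ⊕ (at W j -ᶻ at W i)))
           (cong (F x *_) (E-swap (mean W) (mean W) λ i j → G (x ⊕ (at W j -ᶻ at W i))))) ⟩
    inner F (proj W G) ∎
    where
    open ≡-Reasoning
    M = mean (Diff W)

  diff : Win → (X → ℚ) → X → ℚ
  diff W F x = ½ * (F x - proj W F x)

  diff-Bd : ∀ W {F} → Bdd F → Bdd (diff W F)
  diff-Bd W b x = half-diff-Bd (b x) (proj-Bd W b x)

  inner-half : ∀ F G H → 𝔼[ x ∈ space ] (½ * (F x - G x) * H x) ≡ ½ * (inner F H - inner G H)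
  inner-half F G H = trans (E-cong space λ x → solve 3 (λ f g h → con ½ :* (f :- g) :* h := con ½ :* (f :* h :- g :* h)) refl (F x) (G x) (H x))
    (trans (E-*ˡ space ½ _) (cong (½ *_) (E-minus space _ _)))

  inner-comm : ∀ F G → inner F G ≡ inner G F
  inner-comm F G = E-cong space λ x → *-comm (F x) (G x)

  diff-symmetric : ∀ W F G → inner (diff W F) G ≡ inner F (diff W G)
  diff-symmetric W F G = trans (inner-half F (proj W F) G)
    (trans (cong (½ *_) (cong₂ _-_ (inner-comm F G) (trans (proj-symmetric W F G) (inner-comm F (proj W G)))))
      (trans (sym (inner-half G (proj W G) F)) (inner-comm (diff W G) F)))

  box-diff : ∀ {θ} U W G → Bdd G → (∀ k → Inv θ U (at (Diff W) k)) → box (U ∷ []) (diff W G) ≤ 0ℚ + (θ + θ)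
  box-diff {θ} U W G bG h = ≤-trans (≤-reflexive (box₁ U (diff W G))) (E-≤ space λ x →
    ≤-trans (≈-sq (smooth-Bd U (diff-Bd W bG) x) (Bd-01 ≤-refl 0≤1) (small x)) (≤-reflexive (cong (_+ (θ + θ)) (zeroˡ 0ℚ))))
    where
    M = mean (Diff W)
    small : ∀ x → smooth U (diff W G) x ≈[ θ ] 0ℚ
    small x = ≈-≡ˡ (sym (trans (E-*ˡ (mean U) ½ _) (cong (½ *_) (E-minus (mean U) _ _))))
      (halve (≈-≡ʳ (E-swap M (mean U) _) (≈-≡ˡ (E-const M _) (E-≈ M λ k → ≈-sym (≈-≡ˡ
        (E-cong (mean U) λ u → sym (sh G x refl)) (shift (h k) (λ t → G (x ⊕ t)) (λ _ → bG _)))))))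

finalSteps : List Step
finalSteps = inverseSteps ++ ln ∷ []

module InverseTheorem (𝒮 : System) (q : ℤ) {θ e : ℚ} (0≤θ : 0ℚ ≤ θ)
  (16θ≤e : 2ℚ * (2ℚ * (2ℚ * (θ + θ))) ≤ e)
  (𝒟 : Win) (n : ℕ) (1/n≤e : 1/suc n ≤ e)
  (small : 4ℚ * (((θ + θ) + ((2ℚ * (θ + θ)) + (2ℚ * (θ + θ)))) + (θ + 1/suc n)) ≤ e) where
  open Inverse 𝒮 q 0≤θ 16θ≤e 𝒟 n 1/n≤e small public
  open Smoothing 𝒮 public using (inner; proj; proj-Bd; proj-symmetric; diff; diff-Bd; inner-half; inner-comm; diff-symmetric; box-diff)

  dualFunction : (X → ℚ) → (X → ℚ) → X → ℚ
  dualFunction f₀ f₁ x = avg 𝒟 λ d → dualTerm f₀ f₁ d x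

  Λ-inner : ∀ f₀ f₁ f → Λ 𝒟 f₀ f₁ f ≡ inner (dualFunction f₀ f₁) f
  Λ-inner f₀ f₁ f = begin
    Λ 𝒟 f₀ f₁ f
      ≡⟨ E-cong space (λ x → sym (E-*ˡ (mean 𝒟) (f₀ x) λ d → f₁ (x ⊕ at 𝒟 d) * f (x ⊕ q *ᶻ (at 𝒟 d *ᶻ at 𝒟 d)))) ⟩
    𝔼[ x ∈ space ] avg 𝒟 (λ d → f₀ x * (f₁ (x ⊕ d) * f (x ⊕ q *ᶻ (d *ᶻ d))))
      ≡⟨ E-shifted (mean 𝒟) (λ k → -ᶻ (q *ᶻ (at 𝒟 k *ᶻ at 𝒟 k))) (λ x k → trans (sym (*-assoc _ _ _)) (cong₂ _*_ (cong₂ _*_ refl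
           (sh f₁ x (solveᶻ 2 (λ a d → ⊟ a ⊞ d ≔ d ⊟ a) refl (q *ᶻ (at 𝒟 k *ᶻ at 𝒟 k)) (at 𝒟 k))))
           (trans (sh f x (solveᶻ 1 (λ a → ⊟ a ⊞ a ≔ # 0ℤ) refl (q *ᶻ (at 𝒟 k *ᶻ at 𝒟 k)))) (cong f (⊕-zero x))))) ⟩
    𝔼[ x ∈ space ] avg 𝒟 (λ d → dualTerm f₀ f₁ d x * f x)
      ≡⟨ E-cong space (λ x → E-*ʳ (mean 𝒟) (f x) λ k → dualTerm f₀ f₁ (at 𝒟 k) x) ⟩
    inner (dualFunction f₀ f₁) f ∎
    where open ≡-Reasoning

  dual-Dual : ∀ {f₀ f₁} → Bdd f₀ → Bdd f₁ → Dual (dualFunction f₀ f₁)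
  dual-Dual {f₀} {f₁} b₀ b₁ = record
    { Ω = uni 0 ; h₀ = λ _ → f₀ ; h₁ = λ _ → f₁ ; bh₀ = λ _ → b₀ ; bh₁ = λ _ → b₁ ; expand = λ x → sym (E-const (uni 0) _) }

  sign : Fin 2 → ℚ
  sign zero    = 1ℚ
  sign (suc _) = - 1ℚ

  sign-Bd : ∀ b → Bd (sign b)
  sign-Bd zero    = Bd-1
  sign-Bd (suc _) = ≤-trans (proj₂ Bd-1) ≤-refl , ≤-refl

  mul : Fin 2 → ℤ → ℤ
  mul zero    n = 0ℤ
  mul (suc _) n = n

  diff-signed : ∀ W F x → diff W F x ≡ 𝔼[ b ∈ uni 1 ] avg (Diff W) λ n → sign b * F (x ⊕ mul b n)
  diff-signed W F x = sym (trans (average-def 1 _) (trans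
    (cong (λ t → t * ½) (cong₂ (λ s t → s + (t + 0ℚ)) (trans (E-const M _) (trans (*-identityˡ _) (cong F (⊕-zero x)))) (E-*ˡ M (- 1ℚ) _)))
    (solve 2 (λ a b → (a :+ ((:- con 1ℚ) :* b :+ con 0ℚ)) :* con ½ := con ½ :* (a :- b)) refl (F x) (proj W F x))))
    where M = mean (Diff W)

  -- Translating h₀ and h₁ together translates a dual function, and a sign is absorbed into h₀. So
  -- `diff` is an average over two signs and the difference window.
  diff-Dual : ∀ W {Φ} → Dual Φ → Dual (diff W Φ)
  diff-Dual W {Φ} δ = record
    { Ω = uni 1 ⊗ (mean (Diff W) ⊗ Ω)
    ; h₀ = λ (b , k , j) x → sign b * h₀ j (x ⊕ mul b (at (Diff W) k))
    ; h₁ = λ (b , k , j) x → h₁ j (x ⊕ mul b (at (Diff W) k))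
    ; bh₀ = λ (b , k , j) x → Bd-* (sign-Bd b) (bh₀ j _)
    ; bh₁ = λ (b , k , j) x → bh₁ j _
    ; expand = λ x → trans (diff-signed W Φ x) (E-cong (uni 1) λ b → E-cong (mean (Diff W)) λ k → trans
        (cong (sign b *_) (expand (x ⊕ mul b (at (Diff W) k)))) (trans (sym (E-*ˡ Ω (sign b) _)) (E-cong Ω λ j →
          trans (sym (E-*ˡ (mean 𝒟) (sign b) _)) (E-cong (mean 𝒟) λ d → trans (sym (*-assoc _ _ _))
            (cong₂ _*_ (cong (sign b *_) (comm (h₀ j) x _ _)) (comm (h₁ j) x _ _))))))
    }
    where
    open Dual δ
    comm : ∀ f x m t → f (x ⊕ m ⊕ t) ≡ f (x ⊕ t ⊕ m)
    comm f x m t = trans (sh f x (solveᶻ 2 (λ a b → a ⊞ b ≔ b ⊞ a) refl m t)) (sym (sh f x refl))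

  module _ {κ : ℚ} (0<κ : 0ℚ < κ) (κ≤½ : κ ≤ ½) where
    open Threshold (ℚₚ.<⇒≤ 0<κ) κ≤½

    -- A large difference Φ − 𝒫Φ would correlate with the counting operator, hence have a large box norm
    -- along U₂; but differences along 𝒫 average to zero over U₂.
    inverse-theorem : ∀ {U₀ U₁ U₂} m → e ≤ κ ^^ nexts finalSteps (m ℕ.+ m) →
      Start θ q 𝒟 n U₀ → Ladder θ q 𝒟 n U₀ U₁ → Ladder θ q 𝒟 n U₁ U₂ →
      ∀ W → (∀ k → Inv θ U₂ (at (Diff W) k)) →
      ∀ {f₀ f₁ f} → Bdd f₀ → Bdd f₁ → Bdd f →
      Λ 𝒟 f₀ f₁ f ≈[ κ ^^ m + κ ^^ m ] Λ 𝒟 f₀ f₁ (proj W f)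
    inverse-theorem {U₂ = U₂} m e≤ 𝓈 𝓁 𝓁′ W invW {f₀} {f₁} {f} b₀ b₁ b =
      ≈-≡ˡ (sym (Λ-inner f₀ f₁ f)) (≈-≡ʳ (sym (Λ-inner f₀ f₁ (proj W f)))
        (unhalve (≈-≡ˡ (trans (diff-symmetric W F f) (trans (inner-comm F (diff W f)) (trans (inner-half f (proj W f) F) (cong (½ *_) (cong₂ _-_ (inner-comm f F) (inner-comm (proj W f) F))))))
          (square-≤ (0≤^ m) (≤-trans (≤-reflexive (cong (λ t → t * t) (inner-comm G f))) (≤-trans (cauchy-schwarz space f G b) (≤-trans G-small (≤-reflexive (^-+ m m)))))))))
      where
      F G : X → ℚ
      F = dualFunction f₀ f₁
      G = diff W F
      bF : Bdd F
      bF = Dual.dual-Bdd (dual-Dual b₀ b₁)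
      unhalve : ∀ {a b t} → ½ * (a - b) ≈[ t ] 0ℚ → a ≈[ t + t ] b
      unhalve {a} {b} {t} (p , r) =
        ≤-by _ (0≤+ (0≤b-a p) (0≤b-a p)) (solve 3 (λ a b t → b :+ (t :+ t) := a :+ ((con 0ℚ :+ t :- con ½ :* (a :- b)) :+ (con 0ℚ :+ t :- con ½ :* (a :- b)))) refl a b t) ,
        ≤-by _ (0≤+ (0≤b-a r) (0≤b-a r)) (solve 3 (λ a b t → a :+ (t :+ t) := b :+ ((con ½ :* (a :- b) :+ t :- con 0ℚ) :+ (con ½ :* (a :- b) :+ t :- con 0ℚ))) refl a b t)
      -- Self-adjointness moves one `diff` across: the energy of G becomes a counting form whose
      -- third function, a double difference of F, still lies in `Dual`.
      correlation : Λ 𝒟 f₀ f₁ (diff W G) ≡ inner G G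
      correlation = trans (Λ-inner f₀ f₁ (diff W G)) (sym (diff-symmetric W F G))
      chain : Chain e finalSteps (inner G G) 0ℚ
      chain = ≡-Chain (sym correlation) (inverse-chain 𝓈 𝓁 𝓁′ b₀ b₁ (diff-Dual W (diff-Dual W (dual-Dual b₀ b₁))) ⟫
        step ln (≤-trans (box-diff U₂ W G (diff-Bd W bF) invW) (+-monoʳ-≤ 0ℚ 2θ≤)))
      G-small : inner G G ≤ κ ^^ (m ℕ.+ m)
      G-small with inner G G ℚₚ.≤? κ ^^ (m ℕ.+ m)
      ... | yes p = p
      ... | no ¬p = contradiction (ℚₚ.<-≤-trans (0<^ 0<κ (nexts finalSteps (m ℕ.+ m)))
              (reach finalSteps (m ℕ.+ m) chain e≤ (ℚₚ.<⇒≤ (ℚₚ.≰⇒> ¬p)))) (ℚₚ.<-irrefl refl)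

-- Arithmetic progressions

Inv-+ : ∀ {θ θ′ W s s′} → Inv θ W s → Inv θ′ W s′ → Inv (θ + θ′) W (s +ᶻ s′)
Inv-+ {θ} {θ′} {W} {s} {s′} h h′ = inv λ φ b → ≈-trans
  (≈-≡ˡ (E-cong (mean W) λ i → cong φ (solveᶻ 3 (λ w s t → w ⊞ s ⊞ t ≔ w ⊞ (s ⊞ t)) refl (at W i) s s′)) (shift h (λ m → φ (m +ᶻ s′)) (λ _ → b _)))
  (shift h′ φ b)

Inv-neg : ∀ {θ W s} → Inv θ W s → Inv θ W (-ᶻ s)
Inv-neg {W = W} {s} h = inv λ φ b → ≈-sym (≈-≡ˡ
  (E-cong (mean W) λ i → cong φ (solveᶻ 2 (λ w s → w ⊞ s ⊞ ⊟ s ≔ w) refl (at W i) s)) (shift h (λ m → φ (m +ᶻ -ᶻ s)) (λ _ → b _)))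

Inv-weaken : ∀ {θ θ′ W s} → θ ≤ θ′ → Inv θ W s → Inv θ′ W s
Inv-weaken p h = inv λ φ b → ≈-weaken p (shift h φ b)

Inv-≡ : ∀ {θ W s s′} → s ≡ s′ → Inv θ W s → Inv θ W s′
Inv-≡ refl h = h

Inv-translate : ∀ {θ W s} c → Inv θ W s → Inv θ (win (mean W) λ i → at W i +ᶻ c) s
Inv-translate {W = W} {s} c h = inv λ φ b → ≈-≡ˡ
  (E-cong (mean W) λ i → cong φ (solveᶻ 3 (λ w s c → w ⊞ s ⊞ c ≔ w ⊞ c ⊞ s) refl (at W i) s c)) (shift h (λ m → φ (m +ᶻ c)) (λ _ → b _))

Inv-sum : ∀ {θ θ′ V W s s′} → Inv θ V s → Inv θ′ W s′ →
  Inv (θ + θ′) (win (mean V ⊗ mean W) λ (i , j) → at V i +ᶻ at W j) (s +ᶻ s′)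
Inv-sum {V = V} {W} {s} {s′} h h′ = inv λ φ b → ≈-trans
  (≈-≡ˡ (E-cong (mean V) λ i → E-cong (mean W) λ j → cong φ (solveᶻ 4 (λ v w s t → v ⊞ s ⊞ (w ⊞ t) ≔ v ⊞ w ⊞ (s ⊞ t)) refl (at V i) (at W j) s s′))
    (shift h (λ m → avg W λ k → φ (m +ᶻ (k +ᶻ s′))) (λ _ → E-Bd (mean W) λ _ → b _)))
  (E-≈ (mean V) λ i → shift h′ (λ k → φ (at V i +ᶻ k)) (λ _ → b _))

⟦_⟧ : ∀ {n} → Fin n → ℤ
⟦ i ⟧ = ℤ.+ toℕ i

prog : ℤ → ℕ → Win
prog c L = win (uni L) λ i → c *ᶻ ⟦ i ⟧

telescope : ∀ n (φ : ℕ → ℚ) → sumF n (λ i → φ (suc (toℕ i))) + φ 0 ≡ sumF n (λ i → φ (toℕ i)) + φ n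
telescope zero    φ = refl
telescope (suc n) φ = trans (solve 3 (λ a s b → a :+ s :+ b := s :+ a :+ b) refl (φ 1) (sumF n (λ i → φ (suc (suc (toℕ i))))) (φ 0))
  (trans (cong (_+ φ 0) (telescope n (φ ∘ suc)))
    (solve 3 (λ s c b → s :+ c :+ b := b :+ s :+ c) refl (sumF n (λ i → φ (suc (toℕ i)))) (φ (suc n)) (φ 0)))

opaque
  unfolding _+ᶻ_
  +ᶻ-suc : ∀ n → ℤ.+ suc n ≡ ℤ.+ n +ᶻ ℤ.1ℤ
  +ᶻ-suc n = ℤₚ.+-comm (ℤ.+ 1) (ℤ.+ n)

  ∣+∣ : ∀ a b → ℤ.∣ a +ᶻ b ∣ ℕ.≤ ℤ.∣ a ∣ ℕ.+ ℤ.∣ b ∣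
  ∣+∣ = ℤₚ.∣i+j∣≤∣i∣+∣j∣

  ∣*∣ : ∀ a b → ℤ.∣ a *ᶻ b ∣ ≡ ℤ.∣ a ∣ ℕ.* ℤ.∣ b ∣
  ∣*∣ = ℤₚ.∣i*j∣≡∣i∣*∣j∣

  ∣-∣ : ∀ a → ℤ.∣ -ᶻ a ∣ ≡ ℤ.∣ a ∣
  ∣-∣ = ℤₚ.∣-i∣≡∣i∣

  sign-cases : ∀ m → Σ ℕ λ k → (m ≡ ℤ.+ k ⊎ m ≡ -ᶻ ℤ.+ k) × ℤ.∣ m ∣ ≡ k
  sign-cases (ℤ.+ k)      = k , inj₁ refl , refl
  sign-cases ℤ.-[1+ k ]   = suc k , inj₂ refl , refl

-- A shift by the step changes only the two end points, each of weight 1/(L+1).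
Inv-prog₁ : ∀ c L → Inv (2ℚ * 1/suc L) (prog c L) c
Inv-prog₁ c L = inv λ φ b →
  let S  = sumF (suc L) λ i → φ (c *ᶻ ⟦ i ⟧)
      S′ = sumF (suc L) λ i → φ (c *ᶻ ⟦ i ⟧ +ᶻ c)
      e : S′ + φ (c *ᶻ ℤ.+ 0) ≡ S + φ (c *ᶻ ℤ.+ suc L)
      e = trans (cong (_+ φ (c *ᶻ ℤ.+ 0)) (sumF-cong (suc L) λ i → cong φ (trans
            (solveᶻ 2 (λ c k → c ⊠ k ⊞ c ≔ c ⊠ (k ⊞ # ℤ.1ℤ)) refl c ⟦ i ⟧) (cong (c *ᶻ_) (sym (+ᶻ-suc (toℕ i)))))))
          (telescope (suc L) (λ k → φ (c *ᶻ ℤ.+ k)))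
  in ≈-≡ˡ (sym (average-def L _)) (≈-≡ʳ (sym (average-def L _))
       (bound S′ S (φ (c *ᶻ ℤ.+ 0)) (φ (c *ᶻ ℤ.+ suc L)) (b _) (b _) e , bound S S′ (φ (c *ᶻ ℤ.+ suc L)) (φ (c *ᶻ ℤ.+ 0)) (b _) (b _) (sym e)))
  where
  bound : ∀ S S′ x y → Bd x → Bd y → S + x ≡ S′ + y → S * 1/suc L ≤ S′ * 1/suc L + 2ℚ * 1/suc L
  bound S S′ x y (_ , x′) (y′ , _) e = ≤-trans (*-monoʳ (0≤1/suc L) (≤-by _ (0≤+ (0≤b-a y′) (0≤b-a x′))
      (trans (solve 3 (λ s x y → s :+ (con 1ℚ :+ con 1ℚ) := (s :+ y) :+ ((con 1ℚ :- y) :+ con 1ℚ)) refl S′ x y)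
      (trans (cong (_+ ((1ℚ - y) + 1ℚ)) (sym e)) (solve 3 (λ s x y → s :+ x :+ ((con 1ℚ :- y) :+ con 1ℚ) := s :+ ((con 1ℚ :- y) :+ (x :- (:- con 1ℚ)))) refl S x y)))))
    (≤-reflexive (distribʳ (1/suc L) S′ 2ℚ))

private
  Inv-prog-ℕ : ∀ c L k → Inv (fromℕ k * (2ℚ * 1/suc L)) (prog c L) (c *ᶻ ℤ.+ k)
  Inv-prog-ℕ c L zero = inv λ φ b → ≈-≡ˡ (E-cong (uni L) λ i → cong φ (solveᶻ 2 (λ w c → w ≔ w ⊞ c ⊠ # 0ℤ) refl (c *ᶻ ⟦ i ⟧) c))
    (≈-refl (≤-reflexive (sym (zeroˡ _))))
  Inv-prog-ℕ c L (suc k) = Inv-weaken (≤-reflexive (solve 2 (λ k t → k :* t :+ t := (con 1ℚ :+ k) :* t) refl (fromℕ k) (2ℚ * 1/suc L)))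
    (Inv-≡ (trans (solveᶻ 2 (λ c k → c ⊠ k ⊞ c ≔ c ⊠ (k ⊞ # ℤ.1ℤ)) refl c (ℤ.+ k)) (cong (c *ᶻ_) (sym (+ᶻ-suc k))))
      (Inv-+ (Inv-prog-ℕ c L k) (Inv-prog₁ c L)))

Inv-prog : ∀ c L m → Inv (fromℕ ℤ.∣ m ∣ * (2ℚ * 1/suc L)) (prog c L) (c *ᶻ m)
Inv-prog c L m with sign-cases m
... | k , inj₁ refl , refl = Inv-prog-ℕ c L k
... | k , inj₂ refl , e = subst (λ t → Inv (fromℕ t * (2ℚ * 1/suc L)) (prog c L) (c *ᶻ (-ᶻ ℤ.+ k))) (sym e)
      (Inv-≡ (solveᶻ 2 (λ c k → ⊟ (c ⊠ k) ≔ c ⊠ ⊟ k) refl c (ℤ.+ k)) (Inv-neg (Inv-prog-ℕ c L k)))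

fromℕ-+ : ∀ m n → fromℕ (m ℕ.+ n) ≡ fromℕ m + fromℕ n
fromℕ-+ zero    n = sym (+-identityˡ _)
fromℕ-+ (suc m) n = trans (cong (1ℚ +_) (fromℕ-+ m n)) (sym (+-assoc 1ℚ _ _))

fromℕ-* : ∀ m n → fromℕ (m ℕ.* n) ≡ fromℕ m * fromℕ n
fromℕ-* zero    n = sym (zeroˡ _)
fromℕ-* (suc m) n = trans (fromℕ-+ n (m ℕ.* n)) (trans (cong (λ t → fromℕ n + t) (fromℕ-* m n))
  (solve 2 (λ m n → n :+ m :* n := (con 1ℚ :+ m) :* n) refl (fromℕ m) (fromℕ n)))

fromℕ-mono : ∀ {m n} → m ℕ.≤ n → fromℕ m ≤ fromℕ n
fromℕ-mono {n = n} ℕ.z≤n = 0≤fromℕ n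
fromℕ-mono (ℕ.s≤s p) = +-monoʳ-≤ 1ℚ (fromℕ-mono p)

-- Half of the tolerance 1/(n+1), so that a sum of two windows, as in `absorb`, stays within it.
Inv-prog-½ : ∀ n c L m → ℤ.∣ m ∣ ℕ.* (4 ℕ.* suc n) ℕ.≤ suc L → Inv (½ * 1/suc n) (prog c L) (c *ᶻ m)
Inv-prog-½ n c L m h = Inv-weaken bound (Inv-prog c L m)
  where
  open ℚₚ.≤-Reasoning
  a x y : ℚ
  a = fromℕ ℤ.∣ m ∣
  x = 1/suc L
  y = 1/suc n
  bound : a * (2ℚ * x) ≤ ½ * y
  bound = begin
    a * (2ℚ * x)                                  ≡⟨ solve 2 (λ a x → a :* ((con 1ℚ :+ con 1ℚ) :* x) := a :* ((con 1ℚ :+ con 1ℚ) :* x) :* con 1ℚ) refl a x ⟩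
    a * (2ℚ * x) * 1ℚ                             ≡⟨ cong (a * (2ℚ * x) *_) (sym (suc*1/suc n)) ⟩
    a * (2ℚ * x) * (fromℕ (suc n) * y)            ≡⟨ solve 4 (λ a x s y → a :* ((con 1ℚ :+ con 1ℚ) :* x) :* (s :* y) :=
                                                      con ½ :* ((a :* ((con 1ℚ :+ (con 1ℚ :+ (con 1ℚ :+ (con 1ℚ :+ con 0ℚ)))) :* s)) :* (x :* y))) refl a x (fromℕ (suc n)) y ⟩
    ½ * ((a * (fromℕ 4 * fromℕ (suc n))) * (x * y)) ≡⟨ cong (λ t → ½ * (t * (x * y))) (sym (trans (fromℕ-* ℤ.∣ m ∣ _) (cong (a *_) (fromℕ-* 4 (suc n))))) ⟩
    ½ * (fromℕ (ℤ.∣ m ∣ ℕ.* (4 ℕ.* suc n)) * (x * y)) ≤⟨ *-monoˡ 0≤½ (*-monoʳ (0≤* (0≤1/suc L) (0≤1/suc n)) (fromℕ-mono h)) ⟩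
    ½ * (fromℕ (suc L) * (x * y))                 ≡⟨ cong (½ *_) (trans (sym (*-assoc _ _ _)) (trans (cong (_* y) (suc*1/suc L)) (*-identityˡ y))) ⟩
    ½ * y                                         ∎

opaque
  unfolding _+ᶻ_
  euclid : ∀ ν d .⦃ _ : ℕ.NonZero d ⦄ → ν ≡ ℤ.+ d *ᶻ (ν ℤᵈ./ℕ d) +ᶻ ℤ.+ (ν ℤᵈ.%ℕ d)
  euclid ν d = trans (ℤᵈ.a≡a%ℕn+[a/ℕn]*n ν d) (trans (ℤₚ.+-comm (ℤ.+ (ν ℤᵈ.%ℕ d)) ((ν ℤᵈ./ℕ d) ℤ.* ℤ.+ d))
    (cong (ℤ._+ ℤ.+ (ν ℤᵈ.%ℕ d)) (ℤₚ.*-comm (ν ℤᵈ./ℕ d) (ℤ.+ d))))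

x∙yz≡y∙xz : ∀ x y z → x ℕ.* (y ℕ.* z) ≡ y ℕ.* (x ℕ.* z)
x∙yz≡y∙xz x y z = trans (sym (ℕₚ.*-assoc x y z)) (trans (cong (ℕ._* z) (ℕₚ.*-comm x y)) (ℕₚ.*-assoc y x z))

module Scaling (T : ℕ) (2≤T : 2 ℕ.≤ T) where

  instance
    T-nonZero : ℕ.NonZero T
    T-nonZero = ℕ.>-nonZero (ℕₚ.≤-trans (ℕ.s≤s ℕ.z≤n) 2≤T)

  1≤T^ : ∀ a → 1 ℕ.≤ T ℕ.^ a
  1≤T^ a = ℕₚ.m^n>0 T a

  T^-mono : ∀ {a b} → a ℕ.≤ b → T ℕ.^ a ℕ.≤ T ℕ.^ b
  T^-mono = ℕₚ.^-monoʳ-≤ T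

  record Size (a : ℕ) (m : ℤ) : Set where
    constructor size
    field bound : ℤ.∣ m ∣ ℕ.≤ T ℕ.^ a
  open Size public

  -- The exponent s is a reserve. Adding two such numbers, or multiplying one by a number of size T,
  -- uses up one unit, and one unit has to remain for near invariance.
  record Slack (l s : ℕ) (m : ℤ) : Set where
    constructor slack
    field fits : ℤ.∣ m ∣ ℕ.* T ℕ.^ s ℕ.≤ T ℕ.^ l
  open Slack public

  Size-up : ∀ {a b m} → a ℕ.≤ b → Size a m → Size b m
  Size-up p h = size (ℕₚ.≤-trans (bound h) (T^-mono p))

  Size-* : ∀ {a b m n} → Size a m → Size b n → Size (a ℕ.+ b) (m *ᶻ n)
  Size-* {a} {b} {m} {n} h k = size (begin
    ℤ.∣ m *ᶻ n ∣            ≡⟨ ∣*∣ m n ⟩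
    ℤ.∣ m ∣ ℕ.* ℤ.∣ n ∣     ≤⟨ ℕₚ.*-mono-≤ (bound h) (bound k) ⟩
    T ℕ.^ a ℕ.* T ℕ.^ b     ≡⟨ sym (ℕₚ.^-distribˡ-+-* T a b) ⟩
    T ℕ.^ (a ℕ.+ b)         ∎)
    where open ℕₚ.≤-Reasoning

  double-≤ : ∀ {x y z} → x ℕ.≤ z → y ℕ.≤ z → x ℕ.+ y ℕ.≤ T ℕ.* z
  double-≤ {x} {y} {z} p r = begin
    x ℕ.+ y          ≤⟨ ℕₚ.+-mono-≤ p r ⟩
    z ℕ.+ z          ≡⟨ cong (z ℕ.+_) (sym (ℕₚ.+-identityʳ z)) ⟩
    2 ℕ.* z          ≤⟨ ℕₚ.*-monoˡ-≤ z 2≤T ⟩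
    T ℕ.* z          ∎
    where open ℕₚ.≤-Reasoning

  Size-+ : ∀ {a m n} → Size a m → Size a n → Size (suc a) (m +ᶻ n)
  Size-+ {m = m} {n} h k = size (ℕₚ.≤-trans (∣+∣ m n) (double-≤ (bound h) (bound k)))

  Size-neg : ∀ {a m} → Size a m → Size a (-ᶻ m)
  Size-neg {m = m} h = size (subst (ℕ._≤ _) (sym (∣-∣ m)) (bound h))

  Slack-size : ∀ {a l s m} → Size a m → a ℕ.+ s ℕ.≤ l → Slack l s m
  Slack-size {a} {l} {s} {m} h p = slack (begin
    ℤ.∣ m ∣ ℕ.* T ℕ.^ s  ≤⟨ ℕₚ.*-monoˡ-≤ (T ℕ.^ s) (bound h) ⟩
    T ℕ.^ a ℕ.* T ℕ.^ s  ≡⟨ sym (ℕₚ.^-distribˡ-+-* T a s) ⟩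
    T ℕ.^ (a ℕ.+ s)      ≤⟨ T^-mono p ⟩
    T ℕ.^ l              ∎)
    where open ℕₚ.≤-Reasoning

  Slack-* : ∀ {a b l s m n} → Size a m → Size b n → a ℕ.+ b ℕ.+ s ℕ.≤ l → Slack l s (m *ᶻ n)
  Slack-* h k = Slack-size (Size-* h k)

  Slack-+ : ∀ {l s m n} → Slack l (suc s) m → Slack l (suc s) n → Slack l s (m +ᶻ n)
  Slack-+ {l} {s} {m} {n} h k = slack (ℕₚ.*-cancelˡ-≤ T (begin
    T ℕ.* (ℤ.∣ m +ᶻ n ∣ ℕ.* t)                      ≡⟨ x∙yz≡y∙xz T ℤ.∣ m +ᶻ n ∣ t ⟩
    ℤ.∣ m +ᶻ n ∣ ℕ.* (T ℕ.* t)                      ≤⟨ ℕₚ.*-monoˡ-≤ (T ℕ.* t) (∣+∣ m n) ⟩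
    (ℤ.∣ m ∣ ℕ.+ ℤ.∣ n ∣) ℕ.* (T ℕ.* t)             ≡⟨ ℕₚ.*-distribʳ-+ (T ℕ.* t) ℤ.∣ m ∣ ℤ.∣ n ∣ ⟩
    ℤ.∣ m ∣ ℕ.* (T ℕ.* t) ℕ.+ ℤ.∣ n ∣ ℕ.* (T ℕ.* t) ≤⟨ double-≤ (fits h) (fits k) ⟩
    T ℕ.* T ℕ.^ l                                   ∎))
    where
    open ℕₚ.≤-Reasoning
    t = T ℕ.^ s

  Slack-scale : ∀ {l s c m} → Size 1 c → Slack l (suc s) m → Slack l s (c *ᶻ m)
  Slack-scale {l} {s} {c} {m} h k = slack (begin
    ℤ.∣ c *ᶻ m ∣ ℕ.* t             ≡⟨ cong (ℕ._* t) (trans (∣*∣ c m) (ℕₚ.*-comm ℤ.∣ c ∣ ℤ.∣ m ∣)) ⟩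
    ℤ.∣ m ∣ ℕ.* ℤ.∣ c ∣ ℕ.* t      ≡⟨ ℕₚ.*-assoc ℤ.∣ m ∣ ℤ.∣ c ∣ t ⟩
    ℤ.∣ m ∣ ℕ.* (ℤ.∣ c ∣ ℕ.* t)    ≤⟨ ℕₚ.*-monoʳ-≤ ℤ.∣ m ∣ (ℕₚ.*-monoˡ-≤ t (ℕₚ.≤-trans (bound h) (ℕₚ.≤-reflexive (ℕₚ.*-identityʳ T)))) ⟩
    ℤ.∣ m ∣ ℕ.* (T ℕ.* t)          ≤⟨ fits k ⟩
    T ℕ.^ l                        ∎)
    where
    open ℕₚ.≤-Reasoning
    t = T ℕ.^ s

  Slack-down : ∀ {l s s′ m} → s′ ℕ.≤ s → Slack l s m → Slack l s′ m
  Slack-down {m = m} p h = slack (ℕₚ.≤-trans (ℕₚ.*-monoʳ-≤ ℤ.∣ m ∣ (T^-mono p)) (fits h))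

  Slack-≤ : ∀ {l s m n} → ℤ.∣ n ∣ ℕ.≤ ℤ.∣ m ∣ → Slack l s m → Slack l s n
  Slack-≤ p h = slack (ℕₚ.≤-trans (ℕₚ.*-monoˡ-≤ _ p) (fits h))

  point : ∀ {l} (i : Fin (suc (T ℕ.^ l))) → Size l ⟦ i ⟧
  point i = size (ℕ.s≤s⁻¹ (Finₚ.toℕ<n i))

  -- Dividing by e removes a factor |e| ≥ T^ρ, so a number of size nearly T^(ρ+w) has a quotient
  -- that a window of length T^w absorbs.
  divide : ∀ e {ρ w s ν} → T ℕ.^ ρ ℕ.≤ ℤ.∣ e ∣ → Slack (ρ ℕ.+ w) (suc s) ν → T ℕ.^ suc s ℕ.≤ T ℕ.^ w →
    Σ ℤ λ Q → Σ ℤ λ r → ν ≡ e *ᶻ Q +ᶻ r × Slack w s Q × ℤ.∣ r ∣ ℕ.≤ ℤ.∣ e ∣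
  divide e {ρ} {w} {s} {ν} ρ≤ h sw with sign-cases e
  ... | _ , e≡ , refl = let (Q , r , eq , r<) = quotient e≡ in Q , r , eq , slack (fit Q r eq r<) , r<
    where
    open ℕₚ.≤-Reasoning
    t = T ℕ.^ s
    instance
      k-nonZero : ℕ.NonZero ℤ.∣ e ∣
      k-nonZero = ℕ.>-nonZero (ℕₚ.≤-trans (1≤T^ ρ) ρ≤)
    k : ℕ
    k = ℤ.∣ e ∣
    Q₀ r₀ : ℤ
    Q₀ = ν ℤᵈ./ℕ k
    r₀ = ℤ.+ (ν ℤᵈ.%ℕ k)
    quotient : (e ≡ ℤ.+ k) ⊎ (e ≡ -ᶻ ℤ.+ k) → Σ ℤ λ Q → Σ ℤ λ r → ν ≡ e *ᶻ Q +ᶻ r × ℤ.∣ r ∣ ℕ.≤ k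
    quotient (inj₁ p) = Q₀ , r₀ , trans (euclid ν k) (cong (λ z → z *ᶻ Q₀ +ᶻ r₀) (sym p)) , ℕₚ.<⇒≤ (ℤᵈ.n%ℕd<d ν k)
    quotient (inj₂ p) = -ᶻ Q₀ , r₀ , trans (euclid ν k) (trans
      (solveᶻ 3 (λ d q r → d ⊠ q ⊞ r ≔ (⊟ d) ⊠ (⊟ q) ⊞ r) refl (ℤ.+ k) Q₀ r₀) (cong (λ z → z *ᶻ (-ᶻ Q₀) +ᶻ r₀) (sym p))) , ℕₚ.<⇒≤ (ℤᵈ.n%ℕd<d ν k)
    fit : ∀ Q r → ν ≡ e *ᶻ Q +ᶻ r → ℤ.∣ r ∣ ℕ.≤ ℤ.∣ e ∣ → ℤ.∣ Q ∣ ℕ.* t ℕ.≤ T ℕ.^ w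
    fit Q r eq r≤ = ℕₚ.*-cancelˡ-≤ T (ℕₚ.*-cancelˡ-≤ ℤ.∣ e ∣ (begin
      ℤ.∣ e ∣ ℕ.* (T ℕ.* (ℤ.∣ Q ∣ ℕ.* t))
        ≡⟨ cong (ℤ.∣ e ∣ ℕ.*_) (x∙yz≡y∙xz T ℤ.∣ Q ∣ t) ⟩
      ℤ.∣ e ∣ ℕ.* (ℤ.∣ Q ∣ ℕ.* (T ℕ.* t))
        ≡⟨ trans (sym (ℕₚ.*-assoc ℤ.∣ e ∣ _ _)) (cong (ℕ._* (T ℕ.* t)) (sym (∣*∣ e Q))) ⟩
      ℤ.∣ e *ᶻ Q ∣ ℕ.* (T ℕ.* t)
        ≡⟨ cong (λ z → ℤ.∣ z ∣ ℕ.* (T ℕ.* t)) (trans (solveᶻ 2 (λ a r → a ≔ a ⊞ r ⊟ r) refl (e *ᶻ Q) r) (cong (_-ᶻ r) (sym eq))) ⟩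
      ℤ.∣ ν -ᶻ r ∣ ℕ.* (T ℕ.* t)
        ≤⟨ ℕₚ.*-monoˡ-≤ (T ℕ.* t) (ℕₚ.≤-trans (∣+∣ ν (-ᶻ r)) (ℕₚ.+-monoʳ-≤ ℤ.∣ ν ∣ (ℕₚ.≤-trans (ℕₚ.≤-reflexive (∣-∣ r)) r≤))) ⟩
      (ℤ.∣ ν ∣ ℕ.+ ℤ.∣ e ∣) ℕ.* (T ℕ.* t)
        ≡⟨ ℕₚ.*-distribʳ-+ (T ℕ.* t) ℤ.∣ ν ∣ ℤ.∣ e ∣ ⟩
      ℤ.∣ ν ∣ ℕ.* (T ℕ.* t) ℕ.+ ℤ.∣ e ∣ ℕ.* (T ℕ.* t)
        ≤⟨ double-≤ (ℕₚ.≤-trans (fits h) (ℕₚ.≤-trans (ℕₚ.≤-reflexive (ℕₚ.^-distribˡ-+-* T ρ w)) (ℕₚ.*-monoˡ-≤ (T ℕ.^ w) ρ≤))) (ℕₚ.*-monoʳ-≤ ℤ.∣ e ∣ sw) ⟩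
      T ℕ.* (ℤ.∣ e ∣ ℕ.* T ℕ.^ w)
        ≡⟨ x∙yz≡y∙xz T ℤ.∣ e ∣ (T ℕ.^ w) ⟩
      ℤ.∣ e ∣ ℕ.* (T ℕ.* T ℕ.^ w) ∎))

module Progressions (T n : ℕ) (4n≤T : 4 ℕ.* suc n ℕ.≤ T) where

  2≤T : 2 ℕ.≤ T
  2≤T = ℕₚ.≤-trans (ℕₚ.≤-trans (ℕ.s≤s (ℕ.s≤s ℕ.z≤n)) (ℕₚ.m≤m*n 4 (suc n))) 4n≤T

  open Scaling T 2≤T public

  θ : ℚ
  θ = 1/suc n

  Inv-½ : ∀ {c l m} → Slack l 1 m → Inv (½ * θ) (prog c (T ℕ.^ l)) (c *ᶻ m)
  Inv-½ {c} {l} {m} h = Inv-prog-½ n c (T ℕ.^ l) m (ℕₚ.m≤n⇒m≤1+n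
    (ℕₚ.≤-trans (ℕₚ.*-monoʳ-≤ ℤ.∣ m ∣ (ℕₚ.≤-trans 4n≤T (ℕₚ.≤-reflexive (sym (ℕₚ.*-identityʳ T))))) (fits h)))

  0≤θ′ : 0ℚ ≤ θ
  0≤θ′ = 0≤1/suc n

  half≤ : ½ * θ ≤ θ
  half≤ = ≤-by (½ * θ) (0≤* 0≤½ 0≤θ′) (solve 1 (λ t → t := con ½ :* t :+ con ½ :* t) refl θ)

  Inv-T : ∀ {c l m} → Slack l 1 m → Inv θ (prog c (T ℕ.^ l)) (c *ᶻ m)
  Inv-T h = Inv-weaken half≤ (Inv-½ h)

  -- If α e₁ + β e₂ = τ divides λ̂, then λ̂ x = τ ν is a combination of e₁ and e₂,
  -- and the coefficient of e₁ may be reduced modulo e₂.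
  splits : ∀ {c g λ̂ e₁ e₂ α β τ τ′ c₁ c₂ u ρ w₁ w₂ o} → c₁ ≡ c *ᶻ e₁ → c₂ ≡ c *ᶻ e₂ → u ≡ c *ᶻ g *ᶻ λ̂ →
    α *ᶻ e₁ +ᶻ β *ᶻ e₂ ≡ τ → λ̂ ≡ τ *ᶻ τ′ → Size 1 α → Size 1 β → Size 1 τ → Size 1 τ′ →
    T ℕ.^ ρ ℕ.≤ ℤ.∣ e₂ ∣ → Slack w₁ 5 e₂ → Slack w₂ 5 e₂ → o ℕ.+ 5 ℕ.≤ ρ ℕ.+ w₂ →
    Splits θ (prog u (T ℕ.^ o)) (Scale c₁ (prog g (T ℕ.^ w₁))) (Scale c₂ (prog g (T ℕ.^ w₂)))
  splits {c} {g} {λ̂} {e₁} {e₂} {α} {β} {τ} {τ′} {c₁} {c₂} {u} {ρ} {w₁} {w₂} {o} c₁≡ c₂≡ u≡ comb λ≡ sα sβ sτ sτ′ ρ≤ h₁ h₂ o≤ i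
    with divide e₂ {ρ} {w₂} {3} ρ≤ (Slack-* sτ′ (point i) (ℕₚ.≤-trans (ℕₚ.≤-reflexive (sym (ℕₚ.+-suc o 4))) o≤))
           (ℕₚ.≤-trans (T^-mono (ℕₚ.n≤1+n 4)) (ℕₚ.≤-trans (ℕₚ.≤-trans (ℕₚ.≤-reflexive (sym (ℕₚ.*-identityˡ _))) (ℕₚ.*-monoˡ-≤ (T ℕ.^ 5) (ℕₚ.≤-trans (1≤T^ ρ) ρ≤))) (fits h₂)))
  ... | Q , r , eq , sQ , r≤ =
    c₁ *ᶻ (g *ᶻ (α *ᶻ r)) , c₂ *ᶻ (g *ᶻ (τ *ᶻ Q +ᶻ β *ᶻ r)) , identity ,
    Inv-Scale {W = prog g (T ℕ.^ w₁)} c₁ (Inv-T (Slack-down (ℕ.s≤s ℕ.z≤n) (Slack-scale {s = 4} sα (Slack-≤ r≤ h₁)))) ,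
    Inv-Scale {W = prog g (T ℕ.^ w₂)} c₂ (Inv-T (Slack-+ (Slack-scale sτ sQ) (Slack-down (ℕ.s≤s (ℕ.s≤s ℕ.z≤n)) (Slack-scale {s = 4} sβ (Slack-≤ r≤ h₂)))))
    where
    open ≡-Reasoning
    identity : u *ᶻ ⟦ i ⟧ ≡ c₁ *ᶻ (g *ᶻ (α *ᶻ r)) +ᶻ c₂ *ᶻ (g *ᶻ (τ *ᶻ Q +ᶻ β *ᶻ r))
    identity = begin
      u *ᶻ ⟦ i ⟧                    ≡⟨ cong (_*ᶻ ⟦ i ⟧) (trans u≡ (cong (c *ᶻ g *ᶻ_) λ≡)) ⟩
      c *ᶻ g *ᶻ (τ *ᶻ τ′) *ᶻ ⟦ i ⟧  ≡⟨ solveᶻ 5 (λ c g t s x → c ⊠ g ⊠ (t ⊠ s) ⊠ x ≔ c ⊠ g ⊠ t ⊠ (s ⊠ x)) refl c g τ τ′ ⟦ i ⟧ ⟩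
      c *ᶻ g *ᶻ τ *ᶻ (τ′ *ᶻ ⟦ i ⟧)  ≡⟨ cong (c *ᶻ g *ᶻ τ *ᶻ_) eq ⟩
      c *ᶻ g *ᶻ τ *ᶻ (e₂ *ᶻ Q +ᶻ r) ≡⟨ solveᶻ 6 (λ c g t e q r → c ⊠ g ⊠ t ⊠ (e ⊠ q ⊞ r) ≔ c ⊠ g ⊠ (e ⊠ t ⊠ q) ⊞ c ⊠ g ⊠ (t ⊠ r)) refl c g τ e₂ Q r ⟩
      c *ᶻ g *ᶻ (e₂ *ᶻ τ *ᶻ Q) +ᶻ c *ᶻ g *ᶻ (τ *ᶻ r)
        ≡⟨ cong (λ z → c *ᶻ g *ᶻ (e₂ *ᶻ τ *ᶻ Q) +ᶻ c *ᶻ g *ᶻ (z *ᶻ r)) (sym comb) ⟩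
      c *ᶻ g *ᶻ (e₂ *ᶻ τ *ᶻ Q) +ᶻ c *ᶻ g *ᶻ ((α *ᶻ e₁ +ᶻ β *ᶻ e₂) *ᶻ r)
        ≡⟨ solveᶻ 9 (λ c g e f t q a b r → c ⊠ g ⊠ (f ⊠ t ⊠ q) ⊞ c ⊠ g ⊠ ((a ⊠ e ⊞ b ⊠ f) ⊠ r) ≔ c ⊠ e ⊠ (g ⊠ (a ⊠ r)) ⊞ c ⊠ f ⊠ (g ⊠ (t ⊠ q ⊞ b ⊠ r))) refl c g e₁ e₂ τ Q α β r ⟩
      c *ᶻ e₁ *ᶻ (g *ᶻ (α *ᶻ r)) +ᶻ c *ᶻ e₂ *ᶻ (g *ᶻ (τ *ᶻ Q +ᶻ β *ᶻ r))
        ≡⟨ cong₂ (λ y z → y *ᶻ (g *ᶻ (α *ᶻ r)) +ᶻ z *ᶻ (g *ᶻ (τ *ᶻ Q +ᶻ β *ᶻ r))) (sym c₁≡) (sym c₂≡) ⟩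
      c₁ *ᶻ (g *ᶻ (α *ᶻ r)) +ᶻ c₂ *ᶻ (g *ᶻ (τ *ᶻ Q +ᶻ β *ᶻ r)) ∎

-- Choice of windows

-- The exponents of successive windows are 10 apart, and the bounded losses of any one estimate add
-- up to at most 10; the latter is decided by computation.
pack₁ : ∀ j k {a b} {_ : True (j ℕ.+ k ℕ.≤? 10)} → a ℕ.+ 10 ℕ.≤ b → (j ℕ.+ a) ℕ.+ k ℕ.≤ b
pack₁ j k {a} {_} {p} h = ℕₚ.≤-trans (ℕₚ.≤-reflexive (eq j a k)) (ℕₚ.≤-trans (ℕₚ.+-monoʳ-≤ a (toWitness p)) h)
  where
  eq : ∀ j a k → (j ℕ.+ a) ℕ.+ k ≡ a ℕ.+ (j ℕ.+ k)
  eq = solve-∀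

pack₂ : ∀ i j k {a b c} {_ : True (i ℕ.+ j ℕ.+ k ℕ.≤? 10)} → a ℕ.+ b ℕ.+ 10 ℕ.≤ c → (i ℕ.+ a) ℕ.+ (j ℕ.+ b) ℕ.+ k ℕ.≤ c
pack₂ i j k {a} {b} {_} {p} h = ℕₚ.≤-trans (ℕₚ.≤-reflexive (eq i j k a b)) (ℕₚ.≤-trans (ℕₚ.+-monoʳ-≤ (a ℕ.+ b) (toWitness p)) h)
  where
  eq : ∀ i j k a b → (i ℕ.+ a) ℕ.+ (j ℕ.+ b) ℕ.+ k ≡ a ℕ.+ b ℕ.+ (i ℕ.+ j ℕ.+ k)
  eq = solve-∀

below : ∀ k {a b} {_ : True (k ℕ.≤? 10)} → a ℕ.+ 10 ℕ.≤ b → k ℕ.≤ b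
below k {a} {_} {p} h = ℕₚ.≤-trans (toWitness p) (ℕₚ.≤-trans (ℕₚ.m≤n+m 10 a) h)

opaque
  unfolding _+ᶻ_
  ∣nonneg+nonneg∣ : ∀ m n → ℤ.∣ ℤ.+ m +ᶻ ℤ.+ n ∣ ≡ m ℕ.+ n
  ∣nonneg+nonneg∣ m n = refl

  *ᶻ-nonzero : ∀ {a b} → a ≢ 0ℤ → b ≢ 0ℤ → a *ᶻ b ≢ 0ℤ
  *ᶻ-nonzero {a} {b} p r e with ℤₚ.i*j≡0⇒i≡0∨j≡0 a e
  ... | inj₁ x = p x
  ... | inj₂ x = r x

  1≤∣∣ : ∀ {a} → a ≢ 0ℤ → 1 ℕ.≤ ℤ.∣ a ∣
  1≤∣∣ {ℤ.+ zero}     p = contradiction refl p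
  1≤∣∣ {ℤ.+ suc n}    p = ℕ.s≤s ℕ.z≤n
  1≤∣∣ {ℤ.-[1+ n ]}   p = ℕ.s≤s ℕ.z≤n

  ∣⟦⟧-⟦⟧∣ : ∀ {n} (i j : Fin (suc n)) → ℤ.∣ ⟦ i ⟧ -ᶻ ⟦ j ⟧ ∣ ℕ.≤ n
  ∣⟦⟧-⟦⟧∣ i j = ℕₚ.≤-trans (ℕₚ.≤-reflexive (cong ℤ.∣_∣ (ℤₚ.[+m]-[+n]≡m⊖n (toℕ i) (toℕ j))))
    (ℕₚ.≤-trans (ℤₚ.∣m⊝n∣≤m⊔n (toℕ i) (toℕ j)) (ℕₚ.⊔-lub (ℕ.s≤s⁻¹ (Finₚ.toℕ<n i)) (ℕ.s≤s⁻¹ (Finₚ.toℕ<n j))))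

  ⟦⟧-injective : ∀ {n} {i j : Fin n} → i ≢ j → ⟦ i ⟧ -ᶻ ⟦ j ⟧ ≢ 0ℤ
  ⟦⟧-injective ne e = ne (Finₚ.toℕ-injective (ℤₚ.+-injective (ℤₚ.i-j≡0⇒i≡j _ _ e)))

pos-* : ∀ a b → ℤ.+ (a ℕ.* b) ≡ (ℤ.+ a) *ᶻ (ℤ.+ b)
pos-* a b = trans (ℤₚ.pos-* a b) (*ᶻ-def (ℤ.+ a) (ℤ.+ b))

PositiveInteger : ℤ → Set
PositiveInteger z = Σ ℕ λ l → z ≡ ℤ.+ l × 1 ℕ.≤ l

positive-* : ∀ {a b} → PositiveInteger a → PositiveInteger b → PositiveInteger (a *ᶻ b)
positive-* (k , refl , 1≤k) (l , refl , 1≤l) = k ℕ.* l , sym (pos-* k l) , ℕₚ.*-mono-≤ 1≤k 1≤l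

-- λ̂ is divisible by all small integers, and T dominates every other constant, so that windows
-- of length T^a are nearly invariant under shifts of size T^b with b < a.
record Scales : Set where
  field
    T n       : ℕ
    ĥ         : ℤ
    4n≤T      : 4 ℕ.* suc n ℕ.≤ T
    4≤n       : 4 ℕ.≤ suc n
    n⁹≤T      : suc n ℕ.^ 9 ℕ.≤ T
    ĥ-positive : PositiveInteger ĥ

  λ̂ : ℤ
  λ̂ = 2ᶻ *ᶻ ĥ

  field
    2≤λ̂       : 2 ℕ.≤ ℤ.∣ λ̂ ∣
    λ̂≤T       : ℤ.∣ λ̂ ∣ ℕ.^ 12 ℕ.≤ T
    divisible : ∀ τ → τ ≢ 0ℤ → ℤ.∣ τ ∣ ℕ.≤ suc n ℕ.^ 9 → Σ ℤ λ τ′ → λ̂ ≡ τ *ᶻ τ′ × ℤ.∣ τ′ ∣ ℕ.≤ T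

module Windows (scales : Scales) (q : ℤ) where
  open Scales scales
  open Progressions T n 4n≤T public
  open module Small = Scaling (suc n) (ℕₚ.≤-trans (ℕ.s≤s (ℕ.s≤s ℕ.z≤n)) 4≤n) using () renaming
    (Size to SizeH; Size-+ to SizeH-+; Size-* to SizeH-*; Size-neg to SizeH-neg; Size-up to SizeH-up) public

  Size-1 : ∀ {m} → ℤ.∣ m ∣ ℕ.≤ T → Size 1 m
  Size-1 h = size (ℕₚ.≤-trans h (ℕₚ.≤-reflexive (sym (ℕₚ.*-identityʳ T))))

  -- Powers of n + 1 up to the ninth are at most T, so the small integers formed from indices count
  -- as a single factor T.
  fromH : ∀ {k m} {_ : True (k ℕ.≤? 9)} → SizeH k m → Size 1 m
  fromH {_} {_} {p} h = Size-1 (ℕₚ.≤-trans (Small.bound (SizeH-up (toWitness p) h)) n⁹≤T)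

  finH : (i : Fin (suc n)) → SizeH 1 ⟦ i ⟧
  finH i = Small.size (ℕₚ.≤-trans (ℕₚ.<⇒≤ (Finₚ.toℕ<n i)) (ℕₚ.≤-reflexive (sym (ℕₚ.*-identityʳ (suc n)))))

  diffH : (i j : Fin (suc n)) → SizeH 1 (⟦ i ⟧ -ᶻ ⟦ j ⟧)
  diffH i j = Small.size (ℕₚ.≤-trans (∣⟦⟧-⟦⟧∣ i j) (ℕₚ.≤-trans (ℕₚ.n≤1+n n) (ℕₚ.≤-reflexive (sym (ℕₚ.*-identityʳ (suc n))))))

  Size-one : Size 1 ℤ.1ℤ
  Size-one = size (1≤T^ 1)

  Size-minus-one : Size 1 (-ᶻ ℤ.1ℤ)
  Size-minus-one = Size-neg Size-one

  divisor : ∀ {τ} → τ ≢ 0ℤ → SizeH 9 τ → Σ ℤ λ τ′ → λ̂ ≡ τ *ᶻ τ′ × Size 1 τ′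
  divisor {τ} p h = let (τ′ , e , b) = divisible τ p (Small.bound h) in τ′ , e , Size-1 b

  -- Starts at 1, because the difference d must not vanish.
  Times : ℕ → Win
  Times m = win (uni (T ℕ.^ m)) λ i → at (prog ℤ.1ℤ (T ℕ.^ m)) i +ᶻ ℤ.1ℤ

  Times-inv : ∀ {m s} → Slack m 1 s → Inv θ (Times m) s
  Times-inv {m} {s} h = Inv-translate {W = prog ℤ.1ℤ (T ℕ.^ m)} ℤ.1ℤ (Inv-≡ (solveᶻ 1 (λ s → # ℤ.1ℤ ⊠ s ≔ s) refl s) (Inv-T h))

  Times-size : ∀ {m} d → Size (suc m) (at (Times m) d)
  Times-size {m} d = Size-+ (subst (Size m) (solveᶻ 1 (λ s → s ≔ # ℤ.1ℤ ⊠ s) refl ⟦ d ⟧) (point d)) (Size-up ℕ.z≤n (size {0} ℕₚ.≤-refl))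

  power : ∀ a → Size a (ℤ.+ (T ℕ.^ a))
  power a = size ℕₚ.≤-refl

  -- 𝒱 has length T^u, 𝒯₁ and 𝒯₂ have length T^w with steps in the ratio R = T^ρ, and 𝒱′ has length
  -- T^v. The shifts a (A + i) give directions (a - a′) (A + i); for i ≠ i′ two of them differ by (a
  -- - a′) (i - i′), which is free of A. In λ₁ = λ₀ λ₀ λ̂ one λ₀ comes from the shifts g, one from
  -- the step of 𝒱, and λ̂ makes j - i a divisor.
  make-ladder : ∀ m l u w ρ v α o (h₀ : ℤ) → let λ₀ = 2ᶻ *ᶻ h₀ ; λ₁ = λ₀ *ᶻ λ₀ *ᶻ λ̂ in
    Size 1 h₀ → Size 1 λ₀ → Size 1 (λ₀ *ᶻ λ̂) → Size 1 (h₀ *ᶻ λ₀ *ᶻ λ̂) →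
    m ℕ.+ u ℕ.+ 10 ℕ.≤ l → u ℕ.+ u ℕ.+ 10 ℕ.≤ l → u ℕ.+ 10 ℕ.≤ m → w ℕ.+ 10 ℕ.≤ u → ρ ℕ.+ 10 ℕ.≤ w → v ℕ.+ 10 ℕ.≤ u →
    m ℕ.+ v ℕ.+ 10 ℕ.≤ ρ ℕ.+ w → v ℕ.+ v ℕ.+ 10 ℕ.≤ ρ ℕ.+ w → α ℕ.+ 10 ℕ.≤ v → o ℕ.+ 10 ℕ.≤ α ℕ.+ v →
    Ladder θ q (Times m) n (prog (2ᶻ *ᶻ q *ᶻ λ₀) (T ℕ.^ l)) (prog (2ᶻ *ᶻ q *ᶻ (λ₁ *ᶻ λ̂)) (T ℕ.^ o))
  make-ladder m l u w ρ v α o h₀ sh₀ sλ₀ sλ₀λ̂ sh₁ mu uu um wu ρw vu mv vv αv oα = record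
    { 𝒱 = 𝒱 ; 𝒱′ = 𝒱′ ; 𝒯₁ = 𝒯₁ ; 𝒯₂ = 𝒯₂ ; r = r ; g₁ = g₁ ; g₂ = g₂
    ; 𝒟-𝒱 = λ x → Times-inv (Slack-scale sλ₀ (Slack-size (point x) (pack₁ 0 2 um)))
    ; 𝒟-r = λ i a → Times-inv (Slack-size (r-size i a) (pack₁ 3 1 αm))
    ; U-inv = λ d x → U-increment (Size-up (ℕₚ.n≤1+n _) (Times-size d)) (Size-up (ℕₚ.n≤1+n _) (point x))
    ; 𝒱-g₁ = λ i → Inv-T (Slack-size (fromH (finH i)) (below 2 wu))
    ; 𝒱-g₂ = λ i → Inv-T (Slack-size (Ri-size i) (pack₁ 1 1 ρu))
    ; 𝒱-𝒱′ = λ k → Inv-≡ (solveᶻ 3 (λ a b k → a ⊠ (a ⊠ b ⊠ k) ≔ a ⊠ a ⊠ b ⊠ k) refl λ₀ λ̂ ⟦ k ⟧)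
        (Inv-T (Slack-scale {s = 1} sλ₀λ̂ (Slack-size (point k) (pack₁ 0 2 vu))))
    ; U-inv₁ = λ d i a x j → Inv-≡ (cong (increment q _) (distr λ₀ ⟦ x ⟧ ⟦ j ⟧))
        (U-increment (dr-size d i a) (Size-+ (point x) (Size-up (below 1 wu) (fromH (finH j)))))
    ; U-inv₂ = λ d i a x j → Inv-≡ (cong (increment q _) (distr λ₀ ⟦ x ⟧ (R *ᶻ ⟦ j ⟧)))
        (U-increment (dr-size d i a) (Size-+ (point x) (Size-up (ℕₚ.≤-trans (ℕₚ.m≤m+n (suc ρ) 0) (pack₁ 1 0 ρu)) (Ri-size j))))
    ; split₁ = λ i j ne x → let (τ′ , e , s) = divisor (⟦⟧-injective (ne ∘ sym)) (SizeH-up (ℕ.s≤s ℕ.z≤n) (diffH j i)) in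
        λ₀ *ᶻ (τ′ *ᶻ ⟦ x ⟧) ,
        trans (cong (λ l → 2ᶻ *ᶻ q *ᶻ (λ₀ *ᶻ λ₀ *ᶻ l) *ᶻ ⟦ x ⟧) e)
          (solveᶻ 6 (λ q l i j t x → # 2ᶻ ⊠ q ⊠ (l ⊠ l ⊠ ((j ⊟ i) ⊠ t)) ⊠ x ≔ # 2ᶻ ⊠ q ⊠ (l ⊠ j ⊟ l ⊠ i) ⊠ (l ⊠ (t ⊠ x))) refl q λ₀ ⟦ i ⟧ ⟦ j ⟧ τ′ ⟦ x ⟧) ,
        Inv-T (Slack-scale s (Slack-size (point x) (pack₁ 0 2 wu)))
    ; split₂ = λ i j ne x → let (τ′ , e , s) = divisor (⟦⟧-injective (ne ∘ sym)) (SizeH-up (ℕ.s≤s ℕ.z≤n) (diffH j i)) in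
        λ₀ *ᶻ (τ′ *ᶻ ⟦ x ⟧) ,
        trans (cong (λ l → 2ᶻ *ᶻ q *ᶻ (R *ᶻ (λ₀ *ᶻ λ₀ *ᶻ l)) *ᶻ ⟦ x ⟧) e)
          (solveᶻ 7 (λ q l i j t x r → # 2ᶻ ⊠ q ⊠ (r ⊠ (l ⊠ l ⊠ ((j ⊟ i) ⊠ t))) ⊠ x ≔ # 2ᶻ ⊠ q ⊠ (l ⊠ (r ⊠ j) ⊟ l ⊠ (r ⊠ i)) ⊠ (l ⊠ (t ⊠ x))) refl q λ₀ ⟦ i ⟧ ⟦ j ⟧ τ′ ⟦ x ⟧ R) ,
        Inv-T (Slack-scale s (Slack-size (point x) (pack₁ 0 2 wu)))
    ; absorb = absorb
    ; spread = λ a a′ a≢ i i′ i≢ → let (τ′ , e , s) = divisor (*ᶻ-nonzero (⟦⟧-injective a≢) (⟦⟧-injective i≢)) (SizeH-up (ℕ.s≤s (ℕ.s≤s ℕ.z≤n)) (SizeH-* (diffH a a′) (diffH i i′))) in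
        splits {c = 2ᶻ *ᶻ q} {g = λ₁} {α = ℤ.1ℤ} {β = -ᶻ ℤ.1ℤ}
          (factor-r a a′ i) (factor-r a a′ i′) (solveᶻ 3 (λ q a b → # 2ᶻ ⊠ q ⊠ (a ⊠ b) ≔ # 2ᶻ ⊠ q ⊠ a ⊠ b) refl q λ₁ λ̂)
          (solveᶻ 4 (λ d A i j → # ℤ.1ℤ ⊠ (d ⊠ (A ⊞ i)) ⊞ (⊟ # ℤ.1ℤ) ⊠ (d ⊠ (A ⊞ j)) ≔ d ⊠ (i ⊟ j)) refl (⟦ a ⟧ -ᶻ ⟦ a′ ⟧) A ⟦ i ⟧ ⟦ i′ ⟧)
          e Size-one Size-minus-one (fromH (SizeH-* (diffH a a′) (diffH i i′))) s
          (large a a′ a≢ i′) (e-slack a a′ i′) (e-slack a a′ i′) (ℕₚ.≤-trans (ℕₚ.+-monoʳ-≤ o (ℕₚ.m≤m+n 5 5)) oα)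
    }
    where
    λ₀ λ₁ R A : ℤ
    λ₀ = 2ᶻ *ᶻ h₀
    λ₁ = λ₀ *ᶻ λ₀ *ᶻ λ̂
    R = ℤ.+ (T ℕ.^ ρ)
    A = ℤ.+ (T ℕ.^ α)
    𝒱 𝒱′ 𝒯₁ 𝒯₂ : Win
    𝒱  = prog λ₀ (T ℕ.^ u)
    𝒱′ = prog λ₁ (T ℕ.^ v)
    𝒯₁ = prog (2ᶻ *ᶻ q *ᶻ λ₁) (T ℕ.^ w)
    𝒯₂ = prog (2ᶻ *ᶻ q *ᶻ (R *ᶻ λ₁)) (T ℕ.^ w)
    r : Fin (suc n) → Fin (suc n) → ℤ
    r i a = ⟦ a ⟧ *ᶻ (A +ᶻ ⟦ i ⟧)
    g₁ g₂ : Fin (suc n) → ℤ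
    g₁ i = λ₀ *ᶻ ⟦ i ⟧
    g₂ i = λ₀ *ᶻ (R *ᶻ ⟦ i ⟧)
    ρu : ρ ℕ.+ 10 ℕ.≤ u
    ρu = ℕₚ.≤-trans ρw (ℕₚ.≤-trans (ℕₚ.m≤m+n w 10) wu)
    αm : α ℕ.+ 10 ℕ.≤ m
    αm = ℕₚ.≤-trans αv (ℕₚ.≤-trans (ℕₚ.m≤m+n v 10) (ℕₚ.≤-trans vu (ℕₚ.≤-trans (ℕₚ.m≤m+n u 10) um)))
    distr : ∀ a x y → a *ᶻ (x +ᶻ y) ≡ a *ᶻ x +ᶻ a *ᶻ y
    distr = solveᶻ 3 (λ a x y → a ⊠ (x ⊞ y) ≔ a ⊠ x ⊞ a ⊠ y) refl
    A-size : ∀ i → Size (2 ℕ.+ α) (A +ᶻ ⟦ i ⟧)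
    A-size i = Size-+ (Size-up (ℕₚ.n≤1+n α) (power α)) (Size-up (ℕ.s≤s ℕ.z≤n) (fromH (finH i)))
    r-size : ∀ i a → Size (3 ℕ.+ α) (r i a)
    r-size i a = Size-* (fromH (finH a)) (A-size i)
    dr-size : ∀ d i a → Size (2 ℕ.+ m) (at (Times m) d +ᶻ r i a)
    dr-size d i a = Size-+ (Times-size d) (Size-up (ℕₚ.≤-trans (ℕₚ.≤-trans (ℕₚ.m≤m+n (3 ℕ.+ α) 0) (pack₁ 3 0 αm)) (ℕₚ.n≤1+n m)) (r-size i a))
    Ri-size : ∀ i → Size (1 ℕ.+ ρ) (R *ᶻ ⟦ i ⟧)
    Ri-size i = subst (λ k → Size k (R *ᶻ ⟦ i ⟧)) (ℕₚ.+-comm ρ 1) (Size-* (power ρ) (fromH (finH i)))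
    -- This is where λ₀ has to be even: (λ₀ y)² = 2 λ₀ h₀ y² is a multiple of 2 λ₀.
    U-increment : ∀ {D y} → Size (2 ℕ.+ m) D → Size (1 ℕ.+ u) y → Inv θ (prog (2ᶻ *ᶻ q *ᶻ λ₀) (T ℕ.^ l)) (increment q D (λ₀ *ᶻ y))
    U-increment {D} {y} sD sy = Inv-≡
      (solveᶻ 4 (λ q d h y → # 2ᶻ ⊠ q ⊠ (# 2ᶻ ⊠ h) ⊠ (d ⊠ y ⊞ h ⊠ (y ⊠ y)) ≔ q ⊠ (# 2ᶻ ⊠ d ⊠ (# 2ᶻ ⊠ h ⊠ y) ⊞ (# 2ᶻ ⊠ h ⊠ y) ⊠ (# 2ᶻ ⊠ h ⊠ y))) refl q D h₀ y)
      (Inv-T (Slack-+ (Slack-* sD sy (pack₂ 2 1 2 mu)) (Slack-scale sh₀ (Slack-* sy sy (pack₂ 1 1 3 uu)))))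
    absorb : ∀ d i a x k → Inv θ (win (mean 𝒯₂ ⊗ mean 𝒯₁) λ (t₂ , t₁) → at 𝒯₂ t₂ +ᶻ at 𝒯₁ t₁)
      (increment q (at (Times m) d +ᶻ r i a +ᶻ at 𝒱 x) (at 𝒱′ k))
    -- The increment is 2 q λ₁ times D k + h₀ λ₀ λ̂ k². Dividing this number by R gives its two
    -- digits: the quotient is absorbed by 𝒯₂ and the remainder by 𝒯₁.
    absorb d i a x k with divide R {ρ} {w} {1} {D *ᶻ ⟦ k ⟧ +ᶻ h₀ *ᶻ λ₀ *ᶻ λ̂ *ᶻ (⟦ k ⟧ *ᶻ ⟦ k ⟧)} ℕₚ.≤-refl
        (Slack-+ (Slack-* D-size (point {v} k) (pack₂ 3 0 3 {m} {v} mv)) (Slack-scale sh₁ (Slack-* (point {v} k) (point {v} k) (pack₂ 0 0 4 {v} {v} vv))))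
        (T^-mono (below 2 ρw))
      where
      D : ℤ
      D = at (Times m) d +ᶻ r i a +ᶻ at 𝒱 x
      D-size : Size (3 ℕ.+ m) D
      D-size = Size-+ (dr-size d i a) (Size-up (ℕₚ.≤-trans (ℕₚ.≤-trans (ℕₚ.m≤m+n (1 ℕ.+ u) 0) (pack₁ 1 0 um)) (ℕₚ.m≤n+m m 2)) (Size-* sλ₀ (point x)))
    ... | Q , s , eq , sQ , s≤ = Inv-≡ (trans
          (solveᶻ 5 (λ q l r Q s → # 2ᶻ ⊠ q ⊠ (r ⊠ l) ⊠ Q ⊞ # 2ᶻ ⊠ q ⊠ l ⊠ s ≔ # 2ᶻ ⊠ q ⊠ l ⊠ (r ⊠ Q ⊞ s)) refl q λ₁ R Q s)
          (trans (cong (2ᶻ *ᶻ q *ᶻ λ₁ *ᶻ_) (sym eq))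
            (solveᶻ 5 (λ q D h l k → let a = # 2ᶻ ⊠ h ; b = a ⊠ a ⊠ l ⊠ k in
               # 2ᶻ ⊠ q ⊠ (a ⊠ a ⊠ l) ⊠ (D ⊠ k ⊞ h ⊠ a ⊠ l ⊠ (k ⊠ k)) ≔ q ⊠ (# 2ᶻ ⊠ D ⊠ b ⊞ b ⊠ b)) refl q
               (at (Times m) d +ᶻ r i a +ᶻ at 𝒱 x) h₀ λ̂ ⟦ k ⟧)))
        (Inv-weaken (≤-reflexive (solve 1 (λ t → con ½ :* t :+ con ½ :* t := t) refl θ))
          (Inv-sum {V = 𝒯₂} {W = 𝒯₁} (Inv-½ sQ) (Inv-½ (Slack-≤ s≤ (Slack-size (power ρ) (pack₁ 0 1 ρw))))))
    factor-r : ∀ a a′ i → 2ᶻ *ᶻ q *ᶻ (r i a -ᶻ r i a′) ≡ 2ᶻ *ᶻ q *ᶻ ((⟦ a ⟧ -ᶻ ⟦ a′ ⟧) *ᶻ (A +ᶻ ⟦ i ⟧))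
    factor-r a a′ i = solveᶻ 4 (λ q a b c → # 2ᶻ ⊠ q ⊠ (a ⊠ c ⊟ b ⊠ c) ≔ # 2ᶻ ⊠ q ⊠ ((a ⊟ b) ⊠ c)) refl q ⟦ a ⟧ ⟦ a′ ⟧ (A +ᶻ ⟦ i ⟧)
    large : ∀ a a′ → a ≢ a′ → ∀ i → T ℕ.^ α ℕ.≤ ℤ.∣ (⟦ a ⟧ -ᶻ ⟦ a′ ⟧) *ᶻ (A +ᶻ ⟦ i ⟧) ∣
    large a a′ ne i = begin
      T ℕ.^ α                                        ≤⟨ ℕₚ.m≤m+n _ _ ⟩
      T ℕ.^ α ℕ.+ toℕ i                              ≡⟨ sym (∣nonneg+nonneg∣ (T ℕ.^ α) (toℕ i)) ⟩
      ℤ.∣ A +ᶻ ⟦ i ⟧ ∣                               ≡⟨ sym (ℕₚ.*-identityˡ _) ⟩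
      1 ℕ.* ℤ.∣ A +ᶻ ⟦ i ⟧ ∣                         ≤⟨ ℕₚ.*-monoˡ-≤ _ (1≤∣∣ (⟦⟧-injective ne)) ⟩
      ℤ.∣ ⟦ a ⟧ -ᶻ ⟦ a′ ⟧ ∣ ℕ.* ℤ.∣ A +ᶻ ⟦ i ⟧ ∣     ≡⟨ sym (∣*∣ _ _) ⟩
      ℤ.∣ (⟦ a ⟧ -ᶻ ⟦ a′ ⟧) *ᶻ (A +ᶻ ⟦ i ⟧) ∣        ∎
      where open ℕₚ.≤-Reasoning
    e-slack : ∀ a a′ i → Slack v 5 ((⟦ a ⟧ -ᶻ ⟦ a′ ⟧) *ᶻ (A +ᶻ ⟦ i ⟧))
    e-slack a a′ i = Slack-size (Size-* (fromH (diffH a a′)) (A-size i)) (pack₁ 3 5 αv)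

  -- Up to the factor 2 q the directions are s a i, t b j and their sum, with s = σ′ - σ and t = H
  -- (τ′ - τ). The factor H separates the sizes of s and t, so that s + t ≠ 0 and the sum keeps its
  -- leading term in A. The combinations in the four splittings are chosen to cancel A.
  make-start : ∀ m l l♭ ρ o → 1 ℕ.≤ ρ → l ℕ.+ 10 ℕ.≤ m → l♭ ℕ.+ 10 ℕ.≤ l → ρ ℕ.+ 10 ℕ.≤ l♭ → o ℕ.+ 10 ℕ.≤ ρ ℕ.+ l♭ →
    Start θ q (Times m) n (prog (2ᶻ *ᶻ q *ᶻ λ̂) (T ℕ.^ o))
  make-start m l l♭ ρ o 1≤ρ lm l♭l ρl♭ oρ = record
    { ℒ = prog ℤ.1ℤ (T ℕ.^ l) ; ℒ♭ = prog ℤ.1ℤ (T ℕ.^ l♭)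
    ; h = λ i σ → ⟦ σ ⟧ *ᶻ a i ; k = λ j τ → H *ᶻ ⟦ τ ⟧ *ᶻ b j
    ; 𝒟-h = λ i σ → Times-inv (Slack-size (Size-* (fromH (finH σ)) (a-size i)) (pack₁ 3 1 ρm))
    ; 𝒟-k = λ j τ → Times-inv (Slack-size (Size-* (fromH (SizeH-* H-size (finH τ))) (b-size j)) (pack₁ 3 1 ρm))
    ; 𝒟-ℒ = λ x → Times-inv (Slack-size (one* x) (pack₁ 0 1 lm))
    ; ℒ-ℒ♭ = λ x → Inv-T (Slack-size (point x) (pack₁ 0 1 l♭l))
    ; splitγγ = λ {σ} {σ′} {τ} {τ′} σ≢ τ≢ i i′ j i≢ →
        let s = ⟦ σ′ ⟧ -ᶻ ⟦ σ ⟧ ; t = H *ᶻ (⟦ τ′ ⟧ -ᶻ ⟦ τ ⟧)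
            (d , e , z) = divisor (*ᶻ-nonzero (⟦⟧-injective (σ≢ ∘ sym)) (⟦⟧-injective (i≢ ∘ sym))) (SizeH-up (ℕ.s≤s (ℕ.s≤s ℕ.z≤n)) (SizeH-* (diffH σ′ σ) (diffH i′ i)))
        in splits {c = 2ᶻ *ᶻ q} {g = ℤ.1ℤ} {e₁ = s *ᶻ a i′ +ᶻ t *ᶻ b j} {e₂ = s *ᶻ a i +ᶻ t *ᶻ b j} {α = ℤ.1ℤ} {β = -ᶻ ℤ.1ℤ} {ρ = ρ}
          (γ≡ σ σ′ τ τ′ i′ j) (γ≡ σ σ′ τ τ′ i j) unit
          (solveᶻ 5 (λ s A i j y → # ℤ.1ℤ ⊠ (s ⊠ (A ⊞ i) ⊞ y) ⊞ (⊟ # ℤ.1ℤ) ⊠ (s ⊠ (A ⊞ j) ⊞ y) ≔ s ⊠ (i ⊟ j)) refl s A ⟦ i′ ⟧ ⟦ i ⟧ (t *ᶻ b j))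
          e Size-one Size-minus-one (fromH (SizeH-* (diffH σ′ σ) (diffH i′ i))) z (γ-large σ σ′ τ τ′ i j τ≢)
          (γ-slack l♭ ρl♭ σ σ′ τ τ′ i j) (γ-slack l ρl σ σ′ τ τ′ i j) oρl
    ; splitαγ = λ {σ} {σ′} {τ} {τ′} σ≢ τ≢ i i′ j i≢ →
        let s = ⟦ σ′ ⟧ -ᶻ ⟦ σ ⟧ ; t = H *ᶻ (⟦ τ′ ⟧ -ᶻ ⟦ τ ⟧)
            (d , e , z) = divisor (*ᶻ-nonzero (⟦⟧-injective (σ≢ ∘ sym)) (mixed σ σ′ τ τ′ i i′ j τ≢)) (SizeH-up (ℕₚ.m≤m+n 8 1) (mixed-size σ σ′ τ τ′ i i′ j))
        in splits {c = 2ᶻ *ᶻ q} {g = ℤ.1ℤ} {e₁ = s *ᶻ a i′} {e₂ = s *ᶻ a i +ᶻ t *ᶻ b j} {α = s +ᶻ t} {β = -ᶻ s} {ρ = ρ}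
          (α≡ σ σ′ i′) (γ≡ σ σ′ τ τ′ i j) unit
          (solveᶻ 6 (λ s t A i i′ y → (s ⊞ t) ⊠ (s ⊠ (A ⊞ i′)) ⊞ (⊟ s) ⊠ (s ⊠ (A ⊞ i) ⊞ t ⊠ (A ⊞ y)) ≔ s ⊠ ((s ⊞ t) ⊠ i′ ⊟ s ⊠ i ⊟ t ⊠ y)) refl s t A ⟦ i ⟧ ⟦ i′ ⟧ (H′ *ᶻ (⟦ j ⟧ +ᶻ ℤ.1ℤ)))
          e (fromH (st-size σ σ′ τ τ′)) (Size-neg (fromH (diffH σ′ σ))) (fromH (mixed-size σ σ′ τ τ′ i i′ j)) z (γ-large σ σ′ τ τ′ i j τ≢)
          (γ-slack l♭ ρl♭ σ σ′ τ τ′ i j) (γ-slack l ρl σ σ′ τ τ′ i j) oρl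
    ; splitαα = λ {σ} {σ′} σ≢ i i′ i≢ →
        let s = ⟦ σ′ ⟧ -ᶻ ⟦ σ ⟧
            (d , e , z) = divisor (*ᶻ-nonzero (⟦⟧-injective (σ≢ ∘ sym)) (⟦⟧-injective i≢)) (SizeH-up (ℕ.s≤s (ℕ.s≤s ℕ.z≤n)) (SizeH-* (diffH σ′ σ) (diffH i i′)))
        in splits {c = 2ᶻ *ᶻ q} {g = ℤ.1ℤ} {e₁ = s *ᶻ a i} {e₂ = s *ᶻ a i′} {α = ℤ.1ℤ} {β = -ᶻ ℤ.1ℤ} {ρ = ρ}
          (α≡ σ σ′ i) (α≡ σ σ′ i′) unit
          (solveᶻ 4 (λ s A i j → # ℤ.1ℤ ⊠ (s ⊠ (A ⊞ i)) ⊞ (⊟ # ℤ.1ℤ) ⊠ (s ⊠ (A ⊞ j)) ≔ s ⊠ (i ⊟ j)) refl s A ⟦ i ⟧ ⟦ i′ ⟧)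
          e Size-one Size-minus-one (fromH (SizeH-* (diffH σ′ σ) (diffH i i′))) z
          (scaled-large (1≤∣∣ (⟦⟧-injective (σ≢ ∘ sym))) (a-large i′))
          (Slack-size (Size-* (fromH (diffH σ′ σ)) (a-size i′)) (pack₁ 3 5 ρl)) (Slack-size (Size-* (fromH (diffH σ′ σ)) (a-size i′)) (pack₁ 3 5 ρl)) oρl
    ; splitββ = λ {τ} {τ′} τ≢ j j′ j≢ →
        let t = H *ᶻ (⟦ τ′ ⟧ -ᶻ ⟦ τ ⟧)
            t≢ = *ᶻ-nonzero H-nonzero (⟦⟧-injective (τ≢ ∘ sym))
            sz = SizeH-* (SizeH-* (SizeH-* H-size (diffH τ′ τ)) H′-size) (diffH j j′)
            (d , e , z) = divisor (*ᶻ-nonzero (*ᶻ-nonzero t≢ (*ᶻ-nonzero four-nonzero H-nonzero)) (⟦⟧-injective j≢)) (SizeH-up (ℕₚ.m≤m+n 5 4) sz)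
        in splits {c = 2ᶻ *ᶻ q} {g = ℤ.1ℤ} {e₁ = t *ᶻ b j} {e₂ = t *ᶻ b j′} {α = ℤ.1ℤ} {β = -ᶻ ℤ.1ℤ} {ρ = ρ}
          (β≡ τ τ′ j) (β≡ τ τ′ j′) unit
          (solveᶻ 5 (λ t A h i j → # ℤ.1ℤ ⊠ (t ⊠ (A ⊞ h ⊠ (i ⊞ # ℤ.1ℤ))) ⊞ (⊟ # ℤ.1ℤ) ⊠ (t ⊠ (A ⊞ h ⊠ (j ⊞ # ℤ.1ℤ))) ≔ t ⊠ h ⊠ (i ⊟ j)) refl t A H′ ⟦ j ⟧ ⟦ j′ ⟧)
          e Size-one Size-minus-one (fromH sz) z
          (scaled-large (1≤∣∣ t≢) (b-large j′))
          (Slack-size (Size-* (fromH (SizeH-* H-size (diffH τ′ τ))) (b-size j′)) (pack₁ 3 5 ρl)) (Slack-size (Size-* (fromH (SizeH-* H-size (diffH τ′ τ))) (b-size j′)) (pack₁ 3 5 ρl)) oρl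
    }
    where
    A H H′ : ℤ
    A = ℤ.+ (T ℕ.^ suc ρ)
    H = ℤ.+ suc n
    H′ = ℤ.+ 4 *ᶻ H
    a b : Fin (suc n) → ℤ
    a i = A +ᶻ ⟦ i ⟧
    b j = A +ᶻ H′ *ᶻ (⟦ j ⟧ +ᶻ ℤ.1ℤ)
    ρl : ρ ℕ.+ 10 ℕ.≤ l
    ρl = ℕₚ.≤-trans ρl♭ (ℕₚ.≤-trans (ℕₚ.m≤m+n l♭ 10) l♭l)
    ρm : ρ ℕ.+ 10 ℕ.≤ m
    ρm = ℕₚ.≤-trans ρl (ℕₚ.≤-trans (ℕₚ.m≤m+n l 10) lm)
    oρl : o ℕ.+ 5 ℕ.≤ ρ ℕ.+ l
    oρl = ℕₚ.≤-trans (ℕₚ.+-monoʳ-≤ o (ℕₚ.m≤m+n 5 5)) (ℕₚ.≤-trans oρ (ℕₚ.+-monoʳ-≤ ρ (ℕₚ.≤-trans (ℕₚ.m≤m+n l♭ 10) l♭l)))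
    one* : ∀ {k} (x : Fin (suc (T ℕ.^ k))) → Size k (ℤ.1ℤ *ᶻ ⟦ x ⟧)
    one* x = subst (Size _) (solveᶻ 1 (λ s → s ≔ # ℤ.1ℤ ⊠ s) refl ⟦ x ⟧) (point x)
    H-size : SizeH 1 H
    H-size = Small.size (ℕₚ.≤-reflexive (sym (ℕₚ.*-identityʳ (suc n))))
    H′-size : SizeH 2 H′
    H′-size = SizeH-* {1} (Small.size (ℕₚ.≤-trans 4≤n (ℕₚ.≤-reflexive (sym (ℕₚ.*-identityʳ (suc n)))))) H-size
    H-nonzero : H ≢ 0ℤ
    H-nonzero ()
    four-nonzero : ℤ.+ 4 ≢ 0ℤ
    four-nonzero ()
    y-size : ∀ j → SizeH 4 (H′ *ᶻ (⟦ j ⟧ +ᶻ ℤ.1ℤ))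
    y-size j = SizeH-* H′-size (SizeH-+ (finH j) (SizeH-up (ℕ.z≤n {1}) (Small.size {0} ℕₚ.≤-refl)))
    a-size : ∀ i → Size (2 ℕ.+ ρ) (a i)
    a-size i = Size-+ (power (suc ρ)) (Size-up (ℕ.s≤s ℕ.z≤n) (fromH (finH i)))
    b-size : ∀ j → Size (2 ℕ.+ ρ) (b j)
    b-size j = Size-+ (power (suc ρ)) (Size-up (ℕ.s≤s ℕ.z≤n) (fromH (y-size j)))
    unit : 2ᶻ *ᶻ q *ᶻ λ̂ ≡ 2ᶻ *ᶻ q *ᶻ ℤ.1ℤ *ᶻ λ̂
    unit = solveᶻ 2 (λ q l → # 2ᶻ ⊠ q ⊠ l ≔ # 2ᶻ ⊠ q ⊠ # ℤ.1ℤ ⊠ l) refl q λ̂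
    α≡ : ∀ σ σ′ i → 2ᶻ *ᶻ q *ᶻ (⟦ σ′ ⟧ *ᶻ a i -ᶻ ⟦ σ ⟧ *ᶻ a i) ≡ 2ᶻ *ᶻ q *ᶻ ((⟦ σ′ ⟧ -ᶻ ⟦ σ ⟧) *ᶻ a i)
    α≡ σ σ′ i = solveᶻ 4 (λ q x y a → # 2ᶻ ⊠ q ⊠ (y ⊠ a ⊟ x ⊠ a) ≔ # 2ᶻ ⊠ q ⊠ ((y ⊟ x) ⊠ a)) refl q ⟦ σ ⟧ ⟦ σ′ ⟧ (a i)
    β≡ : ∀ τ τ′ j → 2ᶻ *ᶻ q *ᶻ (H *ᶻ ⟦ τ′ ⟧ *ᶻ b j -ᶻ H *ᶻ ⟦ τ ⟧ *ᶻ b j) ≡ 2ᶻ *ᶻ q *ᶻ (H *ᶻ (⟦ τ′ ⟧ -ᶻ ⟦ τ ⟧) *ᶻ b j)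
    β≡ τ τ′ j = solveᶻ 5 (λ q h x y a → # 2ᶻ ⊠ q ⊠ (h ⊠ y ⊠ a ⊟ h ⊠ x ⊠ a) ≔ # 2ᶻ ⊠ q ⊠ (h ⊠ (y ⊟ x) ⊠ a)) refl q H ⟦ τ ⟧ ⟦ τ′ ⟧ (b j)
    γ≡ : ∀ σ σ′ τ τ′ i j → 2ᶻ *ᶻ q *ᶻ ((⟦ σ′ ⟧ *ᶻ a i -ᶻ ⟦ σ ⟧ *ᶻ a i) +ᶻ (H *ᶻ ⟦ τ′ ⟧ *ᶻ b j -ᶻ H *ᶻ ⟦ τ ⟧ *ᶻ b j)) ≡
      2ᶻ *ᶻ q *ᶻ ((⟦ σ′ ⟧ -ᶻ ⟦ σ ⟧) *ᶻ a i +ᶻ H *ᶻ (⟦ τ′ ⟧ -ᶻ ⟦ τ ⟧) *ᶻ b j)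
    γ≡ σ σ′ τ τ′ i j = solveᶻ 8 (λ q h x y z w a b → # 2ᶻ ⊠ q ⊠ ((y ⊠ a ⊟ x ⊠ a) ⊞ (h ⊠ w ⊠ b ⊟ h ⊠ z ⊠ b)) ≔ # 2ᶻ ⊠ q ⊠ ((y ⊟ x) ⊠ a ⊞ h ⊠ (w ⊟ z) ⊠ b)) refl
      q H ⟦ σ ⟧ ⟦ σ′ ⟧ ⟦ τ ⟧ ⟦ τ′ ⟧ (a i) (b j)
    γ-slack : ∀ k → ρ ℕ.+ 10 ℕ.≤ k → ∀ σ σ′ τ τ′ i j → Slack k 5 ((⟦ σ′ ⟧ -ᶻ ⟦ σ ⟧) *ᶻ a i +ᶻ H *ᶻ (⟦ τ′ ⟧ -ᶻ ⟦ τ ⟧) *ᶻ b j)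
    γ-slack k p σ σ′ τ τ′ i j = Slack-size (Size-+ (Size-* (fromH (diffH σ′ σ)) (a-size i)) (Size-* (fromH (SizeH-* H-size (diffH τ′ τ))) (b-size j))) (pack₁ 4 5 p)
    st-size : ∀ σ σ′ τ τ′ → SizeH 3 ((⟦ σ′ ⟧ -ᶻ ⟦ σ ⟧) +ᶻ H *ᶻ (⟦ τ′ ⟧ -ᶻ ⟦ τ ⟧))
    st-size σ σ′ τ τ′ = SizeH-+ (SizeH-up (ℕ.s≤s ℕ.z≤n) (diffH σ′ σ)) (SizeH-* H-size (diffH τ′ τ))
    mixed-value : (σ σ′ τ τ′ i i′ j : Fin (suc n)) → ℤ
    mixed-value σ σ′ τ τ′ i i′ j = let s = ⟦ σ′ ⟧ -ᶻ ⟦ σ ⟧ ; t = H *ᶻ (⟦ τ′ ⟧ -ᶻ ⟦ τ ⟧) in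
      (s +ᶻ t) *ᶻ ⟦ i′ ⟧ -ᶻ s *ᶻ ⟦ i ⟧ -ᶻ t *ᶻ (H′ *ᶻ (⟦ j ⟧ +ᶻ ℤ.1ℤ))
    mixed-size : ∀ σ σ′ τ τ′ i i′ j → SizeH 8 ((⟦ σ′ ⟧ -ᶻ ⟦ σ ⟧) *ᶻ mixed-value σ σ′ τ τ′ i i′ j)
    mixed-size σ σ′ τ τ′ i i′ j = SizeH-* (diffH σ′ σ) (SizeH-+ (SizeH-up (ℕₚ.n≤1+n 5)
      (SizeH-+ (SizeH-* (st-size σ σ′ τ τ′) (finH i′)) (SizeH-up (ℕₚ.m≤m+n 2 2) (SizeH-neg (SizeH-* (diffH σ′ σ) (finH i))))))
      (SizeH-neg (SizeH-* (SizeH-* H-size (diffH τ′ τ)) (y-size j))))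
    ∣H∣* : ∀ x → ℤ.∣ H *ᶻ x ∣ ≡ suc n ℕ.* ℤ.∣ x ∣
    ∣H∣* x = ∣*∣ H x
    s<t : ∀ σ σ′ {τ τ′} → τ ≢ τ′ → ℤ.∣ ⟦ σ′ ⟧ -ᶻ ⟦ σ ⟧ ∣ ℕ.< ℤ.∣ H *ᶻ (⟦ τ′ ⟧ -ᶻ ⟦ τ ⟧) ∣
    s<t σ σ′ {τ} {τ′} ne = ℕₚ.≤-trans (ℕ.s≤s (∣⟦⟧-⟦⟧∣ σ′ σ)) (ℕₚ.≤-trans (ℕₚ.≤-reflexive (sym (ℕₚ.*-identityʳ (suc n))))
      (ℕₚ.≤-trans (ℕₚ.*-monoʳ-≤ (suc n) (1≤∣∣ (⟦⟧-injective (ne ∘ sym)))) (ℕₚ.≤-reflexive (sym (∣H∣* _)))))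
    -- |s| < H ≤ |t|, so s + t ≠ 0.
    st-nonzero : ∀ σ σ′ {τ τ′} → τ ≢ τ′ → (⟦ σ′ ⟧ -ᶻ ⟦ σ ⟧) +ᶻ H *ᶻ (⟦ τ′ ⟧ -ᶻ ⟦ τ ⟧) ≢ 0ℤ
    st-nonzero σ σ′ {τ} {τ′} ne e = ℕₚ.<-irrefl (cong ℤ.∣_∣ s≡) (ℕₚ.<-≤-trans (s<t σ σ′ ne) (ℕₚ.≤-reflexive (sym (∣-∣ t))))
      where
      s t : ℤ
      s = ⟦ σ′ ⟧ -ᶻ ⟦ σ ⟧
      t = H *ᶻ (⟦ τ′ ⟧ -ᶻ ⟦ τ ⟧)
      s≡ : s ≡ -ᶻ t
      s≡ = trans (solveᶻ 2 (λ s t → s ≔ (s ⊞ t) ⊟ t) refl s t) (trans (cong (_-ᶻ t) e) (solveᶻ 1 (λ t → # 0ℤ ⊟ t ≔ ⊟ t) refl t))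
    -- The step H′ = 4H of b makes t H′ (j + 1) dominate the other two terms.
    mixed : ∀ σ σ′ τ τ′ i i′ j → τ ≢ τ′ → mixed-value σ σ′ τ τ′ i i′ j ≢ 0ℤ
    mixed σ σ′ τ τ′ i i′ j ne e = ℕₚ.<-irrefl refl (begin-strict
      ∣t∣ ℕ.* (4 ℕ.* suc n)                     ≤⟨ ℕₚ.*-monoʳ-≤ ∣t∣ (ℕₚ.≤-trans (ℕₚ.m≤m*n (4 ℕ.* suc n) (toℕ j ℕ.+ 1) ⦃ ℕ.>-nonZero (ℕₚ.m≤n+m 1 (toℕ j)) ⦄)
                                                     (ℕₚ.≤-reflexive (sym (trans (∣*∣ H′ _) (cong₂ ℕ._*_ (∣*∣ (ℤ.+ 4) H) (∣nonneg+nonneg∣ (toℕ j) 1)))))) ⟩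
      ∣t∣ ℕ.* ℤ.∣ y ∣                           ≡⟨ sym (∣*∣ t y) ⟩
      ℤ.∣ t *ᶻ y ∣                              ≡⟨ cong ℤ.∣_∣ ty≡ ⟩
      ℤ.∣ (s +ᶻ t) *ᶻ ⟦ i′ ⟧ +ᶻ -ᶻ (s *ᶻ ⟦ i ⟧) ∣ ≤⟨ ℕₚ.≤-trans (∣+∣ _ _) (ℕₚ.+-mono-≤ (ℕₚ.≤-reflexive (∣*∣ (s +ᶻ t) ⟦ i′ ⟧)) (ℕₚ.≤-reflexive (trans (∣-∣ _) (∣*∣ s ⟦ i ⟧)))) ⟩
      ℤ.∣ s +ᶻ t ∣ ℕ.* toℕ i′ ℕ.+ ℤ.∣ s ∣ ℕ.* toℕ i ≤⟨ ℕₚ.+-mono-≤ (ℕₚ.*-mono-≤ (ℕₚ.≤-trans (∣+∣ s t) (ℕₚ.+-monoˡ-≤ ∣t∣ s≤t)) (i≤ i′)) (ℕₚ.*-mono-≤ s≤t (i≤ i)) ⟩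
      (∣t∣ ℕ.+ ∣t∣) ℕ.* suc n ℕ.+ ∣t∣ ℕ.* suc n <⟨ ℕₚ.m<m+n _ (ℕₚ.≤-trans (ℕₚ.≤-trans (ℕ.s≤s ℕ.z≤n) (s<t σ σ′ ne)) (ℕₚ.m≤m*n ∣t∣ (suc n))) ⟩
      (∣t∣ ℕ.+ ∣t∣) ℕ.* suc n ℕ.+ ∣t∣ ℕ.* suc n ℕ.+ ∣t∣ ℕ.* suc n ≡⟨ collect ∣t∣ (suc n) ⟩
      ∣t∣ ℕ.* (4 ℕ.* suc n) ∎)
      where
      open ℕₚ.≤-Reasoning
      s t y : ℤ
      s = ⟦ σ′ ⟧ -ᶻ ⟦ σ ⟧
      t = H *ᶻ (⟦ τ′ ⟧ -ᶻ ⟦ τ ⟧)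
      y = H′ *ᶻ (⟦ j ⟧ +ᶻ ℤ.1ℤ)
      ∣t∣ : ℕ
      ∣t∣ = ℤ.∣ t ∣
      i≤ : (i : Fin (suc n)) → toℕ i ℕ.≤ suc n
      i≤ i = ℕₚ.<⇒≤ (Finₚ.toℕ<n i)
      s≤t : ℤ.∣ s ∣ ℕ.≤ ∣t∣
      s≤t = ℕₚ.<⇒≤ (s<t σ σ′ ne)
      ty≡ : t *ᶻ y ≡ (s +ᶻ t) *ᶻ ⟦ i′ ⟧ +ᶻ -ᶻ (s *ᶻ ⟦ i ⟧)
      ty≡ = trans (solveᶻ 2 (λ a b → b ≔ a ⊟ (a ⊟ b)) refl ((s +ᶻ t) *ᶻ ⟦ i′ ⟧ +ᶻ -ᶻ (s *ᶻ ⟦ i ⟧)) (t *ᶻ y))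
        (trans (cong (λ z → (s +ᶻ t) *ᶻ ⟦ i′ ⟧ +ᶻ -ᶻ (s *ᶻ ⟦ i ⟧) -ᶻ z) e) (solveᶻ 1 (λ a → a ⊟ # 0ℤ ≔ a) refl ((s +ᶻ t) *ᶻ ⟦ i′ ⟧ +ᶻ -ᶻ (s *ᶻ ⟦ i ⟧))))
      collect : ∀ t h → (t ℕ.+ t) ℕ.* h ℕ.+ t ℕ.* h ℕ.+ t ℕ.* h ≡ t ℕ.* (4 ℕ.* h)
      collect = solve-∀
    scaled-large : ∀ {x y} → 1 ℕ.≤ ℤ.∣ x ∣ → T ℕ.^ ρ ℕ.≤ ℤ.∣ y ∣ → T ℕ.^ ρ ℕ.≤ ℤ.∣ x *ᶻ y ∣
    scaled-large {x} {y} p r = ℕₚ.≤-trans r (ℕₚ.≤-trans (ℕₚ.≤-reflexive (sym (ℕₚ.*-identityˡ ℤ.∣ y ∣)))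
      (ℕₚ.≤-trans (ℕₚ.*-monoˡ-≤ ℤ.∣ y ∣ p) (ℕₚ.≤-reflexive (sym (∣*∣ x y)))))
    -- |x A + y| ≥ |A| − |y| ≥ T^{ρ+1} − T ≥ T^ρ.
    dominate : ∀ {x y} → 1 ℕ.≤ ℤ.∣ x ∣ → Size 1 y → T ℕ.^ ρ ℕ.≤ ℤ.∣ x *ᶻ A +ᶻ y ∣
    dominate {x} {y} p h = ℕₚ.+-cancelˡ-≤ (T ℕ.^ 1) (T ℕ.^ ρ) _ (begin
      T ℕ.^ 1 ℕ.+ T ℕ.^ ρ                    ≤⟨ double-≤ (T^-mono 1≤ρ) ℕₚ.≤-refl ⟩
      T ℕ.^ suc ρ                            ≤⟨ ℕₚ.≤-trans (ℕₚ.≤-reflexive (sym (ℕₚ.*-identityˡ _))) (ℕₚ.*-monoˡ-≤ (T ℕ.^ suc ρ) p) ⟩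
      ℤ.∣ x ∣ ℕ.* T ℕ.^ suc ρ                ≡⟨ sym (∣*∣ x A) ⟩
      ℤ.∣ x *ᶻ A ∣                           ≡⟨ cong ℤ.∣_∣ (solveᶻ 2 (λ a y → a ≔ ⊟ y ⊞ (a ⊞ y)) refl (x *ᶻ A) y) ⟩
      ℤ.∣ -ᶻ y +ᶻ (x *ᶻ A +ᶻ y) ∣            ≤⟨ ∣+∣ _ _ ⟩
      ℤ.∣ -ᶻ y ∣ ℕ.+ ℤ.∣ x *ᶻ A +ᶻ y ∣       ≤⟨ ℕₚ.+-monoˡ-≤ _ (bound (Size-neg h)) ⟩
      T ℕ.^ 1 ℕ.+ ℤ.∣ x *ᶻ A +ᶻ y ∣          ∎)
      where open ℕₚ.≤-Reasoning
    a-large : ∀ i → T ℕ.^ ρ ℕ.≤ ℤ.∣ a i ∣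
    a-large i = subst (λ z → T ℕ.^ ρ ℕ.≤ ℤ.∣ z +ᶻ ⟦ i ⟧ ∣) (solveᶻ 1 (λ A → # ℤ.1ℤ ⊠ A ≔ A) refl A) (dominate {ℤ.1ℤ} ℕₚ.≤-refl (fromH (finH i)))
    b-large : ∀ j → T ℕ.^ ρ ℕ.≤ ℤ.∣ b j ∣
    b-large j = subst (λ z → T ℕ.^ ρ ℕ.≤ ℤ.∣ z +ᶻ H′ *ᶻ (⟦ j ⟧ +ᶻ ℤ.1ℤ) ∣) (solveᶻ 1 (λ A → # ℤ.1ℤ ⊠ A ≔ A) refl A) (dominate {ℤ.1ℤ} ℕₚ.≤-refl (fromH (y-size j)))
    γ-large : ∀ σ σ′ τ τ′ i j → τ ≢ τ′ → T ℕ.^ ρ ℕ.≤ ℤ.∣ (⟦ σ′ ⟧ -ᶻ ⟦ σ ⟧) *ᶻ a i +ᶻ H *ᶻ (⟦ τ′ ⟧ -ᶻ ⟦ τ ⟧) *ᶻ b j ∣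
    γ-large σ σ′ τ τ′ i j ne = subst (λ z → T ℕ.^ ρ ℕ.≤ ℤ.∣ z ∣)
      (solveᶻ 5 (λ s t A i y → (s ⊞ t) ⊠ A ⊞ (s ⊠ i ⊞ t ⊠ y) ≔ s ⊠ (A ⊞ i) ⊞ t ⊠ (A ⊞ y)) refl (⟦ σ′ ⟧ -ᶻ ⟦ σ ⟧) (H *ᶻ (⟦ τ′ ⟧ -ᶻ ⟦ τ ⟧)) A ⟦ i ⟧ (H′ *ᶻ (⟦ j ⟧ +ᶻ ℤ.1ℤ)))
      (dominate (1≤∣∣ (st-nonzero σ σ′ ne)) (fromH {7} (SizeH-+ (SizeH-up (ℕₚ.m≤m+n 2 4) (SizeH-* (diffH σ′ σ) (finH i))) (SizeH-* (SizeH-* H-size (diffH τ′ τ)) (y-size j)))))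

-- Energies

difference-≈ : ∀ {a b t} → a - b ≈[ t ] 0ℚ → a ≈[ t ] b
difference-≈ {a} {b} {t} (p , r) =
  ≤-by _ (0≤b-a p) (solve 3 (λ a b t → b :+ t := a :+ (con 0ℚ :+ t :- (a :- b))) refl a b t) ,
  ≤-by _ (0≤b-a r) (solve 3 (λ a b t → a :+ t := b :+ (a :- b :+ t :- con 0ℚ)) refl a b t)

module Energies (𝒮 : System) where
  open Smoothing 𝒮 public

  energy : Win → (X → ℚ) → ℚ
  energy W f = box (W ∷ []) f

  energy-inner : ∀ W f → energy W f ≡ inner f (proj W f)
  energy-inner W f = trans (box₁-diff W f) (E-cong space λ x → cong (λ y → f y * proj W f x) (⊕-zero x))

  proj-inv : ∀ {θ W m f} → Bdd f → Inv θ W m → AlmostInv θ (proj W f) m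
  proj-inv {W = W} b h = smooth-inv b (Inv-Diff {W = W} h)

  proj-fixes : ∀ {ς V G} → (∀ k k′ → AlmostInv ς G (at V k -ᶻ at V k′)) → ∀ x → proj V G x ≈[ ς ] G x
  proj-fixes {V = V} h x = ≈-≡ʳ (E-const (mean (Diff V)) _) (E-≈ (mean (Diff V)) λ (i , j) → near (h i j) x)

  -- Averaging along the difference window is averaging along V followed by a second average, which
  -- only decreases the mean square.
  proj-contracts : ∀ V f → inner (proj V f) (proj V f) ≤ energy V f
  proj-contracts V f = begin
    inner (proj V f) (proj V f)
      ≡⟨ E-cong space (λ x → cong (λ t → t * t) (trans (E-swap (mean V) (mean V) _) (E-cong (mean V) λ j → E-cong (mean V) λ i →
           sym (sh f x (solveᶻ 2 (λ a b → ⊟ b ⊞ a ≔ a ⊟ b) refl (at V i) (at V j)))))) ⟩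
    𝔼[ x ∈ space ] ((𝔼[ j ∈ mean V ] smooth V f (x ⊕ -ᶻ at V j)) * (𝔼[ j ∈ mean V ] smooth V f (x ⊕ -ᶻ at V j)))
      ≤⟨ E-mono space (λ x → jensen (mean V) _) ⟩
    𝔼[ x ∈ space ] 𝔼[ j ∈ mean V ] (smooth V f (x ⊕ -ᶻ at V j) * smooth V f (x ⊕ -ᶻ at V j))
      ≡⟨ trans (sym (E-shift (mean V) (λ j → -ᶻ at V j) λ x _ → smooth V f x * smooth V f x)) (trans (E-cong space λ x → E-const (mean V) _) (sym (box₁ V f))) ⟩
    energy V f ∎
    where open ℚₚ.≤-Reasoning

  distance : (X → ℚ) → (X → ℚ) → ℚ
  distance F G = 𝔼[ x ∈ space ] ((F x - G x) * (F x - G x))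

  0≤distance : ∀ F G → 0ℚ ≤ distance F G
  0≤distance F G = E-0≤ space λ x → 0≤sq _

  -- Pythagoras up to errors: an average along W is nearly invariant under shifts in V, so the inner
  -- product of the two projections is nearly the energy along W.
  energy-gap : ∀ {θ} V W {f} → Bdd f → (∀ k → Inv θ W (at V k)) →
    distance (proj V f) (proj W f) ≤ energy V f - energy W f + ((θ + θ) + (θ + θ))
  energy-gap {θ} V W {f} b h = begin
    distance P R                    ≡⟨ trans (E-cong space λ x → solve 2 (λ a b → (a :- b) :* (a :- b) := a :* a :- (a :* b :+ a :* b) :+ b :* b) refl (P x) (R x))
                                         (trans (E-+ space _ _) (cong (_+ inner R R) (trans (E-minus space _ _) (cong (λ t → inner P P - t) (E-+ space _ _))))) ⟩
    inner P P - (inner P R + inner P R) + inner R R ≤⟨ +-mono-≤ (+-mono-≤ (proj-contracts V f) (neg-mono (+-mono-≤ correlated correlated))) (proj-contracts W f) ⟩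
    energy V f - ((energy W f - (θ + θ)) + (energy W f - (θ + θ))) + energy W f
                                    ≡⟨ solve 3 (λ a b t → a :- ((b :- (t :+ t)) :+ (b :- (t :+ t))) :+ b := a :- b :+ (t :+ t :+ (t :+ t))) refl (energy V f) (energy W f) θ ⟩
    energy V f - energy W f + ((θ + θ) + (θ + θ)) ∎
    where
    open ℚₚ.≤-Reasoning
    P R : X → ℚ
    P = proj V f
    R = proj W f
    neg-mono : ∀ {a b} → a ≤ b → - b ≤ - a
    neg-mono {a} {b} p = ≤-by _ (0≤b-a p) (solve 2 (λ a b → :- a := :- b :+ (b :- a)) refl a b)
    close : inner P R ≈[ θ + θ ] energy W f
    close = ≈-≡ˡ (sym (proj-symmetric V f R)) (≈-≡ʳ (sym (energy-inner W f)) (E-≈ space λ x → ≈-*ˡ (b x)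
      (proj-fixes {V = V} {G = R} (λ k k′ → proj-inv {W = W} b (Inv-+ (h k) (Inv-neg (h k′)))) x)))
    correlated : energy W f - (θ + θ) ≤ inner P R
    correlated = ≤-by _ (0≤b-a (proj₂ close)) (solve 3 (λ a b t → a := b :- t :+ (a :+ t :- b)) refl (inner P R) (energy W f) (θ + θ))

  energy-refines : ∀ {θ} V W {f} → Bdd f → (∀ k → Inv θ W (at V k)) → energy W f ≤ energy V f + ((θ + θ) + (θ + θ))
  energy-refines {θ} V W {f} b h = ≤-by _ (≤-trans (0≤distance (proj V f) (proj W f)) (energy-gap V W b h))
    (solve 3 (λ a b t → a :+ t := b :+ (a :- b :+ t)) refl (energy V f) (energy W f) ((θ + θ) + (θ + θ)))

  inner-close : ∀ {F G R η} → 0ℚ ≤ η → Bdd R → distance F G ≤ η * η → inner F R ≈[ η ] inner G R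
  inner-close {F} {G} {R} {η} 0≤η bR h = difference-≈ (square-≤ 0≤η (begin
    (inner F R - inner G R) * (inner F R - inner G R)
      ≡⟨ cong (λ t → t * t) (trans (sym (E-minus space _ _)) (E-cong space λ x → solve 3 (λ f g r → f :* r :- g :* r := r :* (f :- g)) refl (F x) (G x) (R x))) ⟩
    _ ≤⟨ cauchy-schwarz space R (λ x → F x - G x) bR ⟩
    distance F G ≤⟨ h ⟩
    η * η ∎))
    where open ℚₚ.≤-Reasoning

-- Counting at a single scale

module StageCount (𝒮 : System) (q : ℤ) where
  open Energies 𝒮 public
  open Count 𝒮 q public using (Λ)

  module _ (𝒟 : Win) where

    Λ-flat : ∀ f₀ f₁ f₂ → Λ 𝒟 f₀ f₁ f₂ ≡ 𝔼[ x ∈ space ] avg 𝒟 λ d → f₀ x * (f₁ (x ⊕ d) * f₂ (x ⊕ q *ᶻ (d *ᶻ d)))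
    Λ-flat f₀ f₁ f₂ = E-cong space λ x → sym (E-*ˡ (mean 𝒟) (f₀ x) λ d → f₁ (x ⊕ at 𝒟 d) * f₂ (x ⊕ q *ᶻ (at 𝒟 d *ᶻ at 𝒟 d)))

    -- Cauchy-Schwarz discards A, and translation by s d reduces the rest to the mean square of F -
    -- G.
    replace : ∀ {A : X → Ix 𝒟 → ℚ} {F G : X → ℚ} {η} (s : Ix 𝒟 → ℤ) → 0ℚ ≤ η → (∀ x d → Bd (A x d)) → distance F G ≤ η * η →
      (𝔼[ x ∈ space ] 𝔼[ d ∈ mean 𝒟 ] (A x d * F (x ⊕ s d))) ≈[ η ] (𝔼[ x ∈ space ] 𝔼[ d ∈ mean 𝒟 ] (A x d * G (x ⊕ s d)))
    replace {A} {F} {G} {η} s 0≤η bA h = difference-≈ (square-≤ 0≤η (begin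
      _ ≡⟨ cong (λ t → t * t) (trans (sym (E-minus (space ⊗ mean 𝒟) (λ (x , d) → A x d * F (x ⊕ s d)) (λ (x , d) → A x d * G (x ⊕ s d))))
             (E-cong (space ⊗ mean 𝒟) λ (x , d) → solve 3 (λ a f g → a :* f :- a :* g := a :* (f :- g)) refl (A x d) (F (x ⊕ s d)) (G (x ⊕ s d)))) ⟩
      _ ≤⟨ cauchy-schwarz (space ⊗ mean 𝒟) (λ (x , d) → A x d) (λ (x , d) → F (x ⊕ s d) - G (x ⊕ s d)) (λ (x , d) → bA x d) ⟩
      _ ≡⟨ trans (sym (E-shift (mean 𝒟) s λ x _ → (F x - G x) * (F x - G x))) (E-cong space λ x → E-const (mean 𝒟) _) ⟩
      distance F G ≤⟨ h ⟩
      η * η ∎))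
      where open ℚₚ.≤-Reasoning

    replace₁ : ∀ {f₀ F G f₂ η} → 0ℚ ≤ η → Bdd f₀ → Bdd f₂ → distance F G ≤ η * η → Λ 𝒟 f₀ F f₂ ≈[ η ] Λ 𝒟 f₀ G f₂
    replace₁ {f₀} {F} {G} {f₂} 0≤η b₀ b₂ h = ≈-≡ˡ (sym (flat F)) (≈-≡ʳ (sym (flat G)) (replace {F = F} {G} (at 𝒟) 0≤η (λ x d → Bd-* (b₀ x) (b₂ (x ⊕ q *ᶻ (at 𝒟 d *ᶻ at 𝒟 d)))) h))
      where
      flat : ∀ F → Λ 𝒟 f₀ F f₂ ≡ 𝔼[ x ∈ space ] 𝔼[ d ∈ mean 𝒟 ] (f₀ x * f₂ (x ⊕ q *ᶻ (at 𝒟 d *ᶻ at 𝒟 d)) * F (x ⊕ at 𝒟 d))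
      flat F = trans (Λ-flat f₀ F f₂) (E-cong space λ x → E-cong (mean 𝒟) λ d → solve 3 (λ a b c → a :* (b :* c) := a :* c :* b) refl (f₀ x) (F (x ⊕ at 𝒟 d)) (f₂ (x ⊕ q *ᶻ (at 𝒟 d *ᶻ at 𝒟 d))))

    replace₂ : ∀ {f₀ f₁ F G η} → 0ℚ ≤ η → Bdd f₀ → Bdd f₁ → distance F G ≤ η * η → Λ 𝒟 f₀ f₁ F ≈[ η ] Λ 𝒟 f₀ f₁ G
    replace₂ {f₀} {f₁} {F} {G} 0≤η b₀ b₁ h = ≈-≡ˡ (sym (flat F)) (≈-≡ʳ (sym (flat G)) (replace {F = F} {G} (λ d → q *ᶻ (at 𝒟 d *ᶻ at 𝒟 d)) 0≤η (λ x d → Bd-* (b₀ x) (b₁ (x ⊕ at 𝒟 d))) h))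
      where
      flat : ∀ F → Λ 𝒟 f₀ f₁ F ≡ 𝔼[ x ∈ space ] 𝔼[ d ∈ mean 𝒟 ] (f₀ x * f₁ (x ⊕ at 𝒟 d) * F (x ⊕ q *ᶻ (at 𝒟 d *ᶻ at 𝒟 d)))
      flat F = trans (Λ-flat f₀ f₁ F) (E-cong space λ x → E-cong (mean 𝒟) λ d → sym (*-assoc _ _ _))

    -- If f₂ is almost invariant under (d + v)² − d², then d may be replaced by d + v, which smooths f₁.
    smooth-middle : ∀ {θ} V {f₀ f₁ f₂} → Bdd f₀ → Bdd f₁ → Bdd f₂ → (∀ k → Inv θ 𝒟 (at (Diff V) k)) →
      (∀ d k → AlmostInv θ f₂ (increment q (at 𝒟 d) (at (Diff V) k))) →
      Λ 𝒟 f₀ f₁ f₂ ≈[ θ + θ ] Λ 𝒟 f₀ (proj V f₁) f₂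
    smooth-middle {θ} V {f₀} {f₁} {f₂} b₀ b₁ b₂ i𝒟 i₂ = E-≈ space λ x → ≈-*ˡ (b₀ x) (≈-trans
      (avg-in 𝒟 (mean (Diff V)) (at (Diff V)) i𝒟 (a x) (λ _ → Bd-* (b₁ _) (b₂ _)))
      (E-≈ (mean 𝒟) λ d → ≈-≡ʳ (E-*ʳ (mean (Diff V)) (f₂ (x ⊕ q *ᶻ (at 𝒟 d *ᶻ at 𝒟 d))) _) (E-≈ (mean (Diff V)) λ k →
        ≈-≡ˡ (cong₂ _*_ (sh f₁ x refl) (sh f₂ x (solveᶻ 3 (λ q d v → q ⊠ (d ⊠ d) ⊞ q ⊠ (# 2ᶻ ⊠ d ⊠ v ⊞ v ⊠ v) ≔ q ⊠ ((d ⊞ v) ⊠ (d ⊞ v))) refl q (at 𝒟 d) (at (Diff V) k))))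
          (≈-*ˡ (b₁ _) (near (i₂ d k) (x ⊕ q *ᶻ (at 𝒟 d *ᶻ at 𝒟 d)))))))
      where
      a : X → ℤ → ℚ
      a x d = f₁ (x ⊕ d) * f₂ (x ⊕ q *ᶻ (d *ᶻ d))

    -- Once G₁ and G₂ ignore the shifts by d and q d², all three functions are evaluated at the same
    -- point.
    decouple : ∀ {θ f₀ G₁ G₂} → Bdd f₀ → Bdd G₁ → Bdd G₂ → (∀ d → AlmostInv θ G₁ (at 𝒟 d)) → (∀ d → AlmostInv θ G₂ (q *ᶻ (at 𝒟 d *ᶻ at 𝒟 d))) →
      Λ 𝒟 f₀ G₁ G₂ ≈[ θ + θ ] (𝔼[ x ∈ space ] (f₀ x * (G₁ x * G₂ x)))
    decouple b₀ b₁ b₂ i₁ i₂ = E-≈ space λ x → ≈-*ˡ (b₀ x) (≈-≡ʳ (E-const (mean 𝒟) _) (E-≈ (mean 𝒟) λ d →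
      ≈-* (b₁ _) (b₂ _) (near (i₁ d) x) (near (i₂ d) x)))

-- The pointwise inequality and the lower bound

opaque
  unfolding _*_
  reciprocal : ∀ t → 0ℚ < t → Σ ℚ λ r → 0ℚ ≤ r × r * t ≡ 1ℚ
  reciprocal t 0<t = r , ℚₚ.<⇒≤ (ℚₚ.positive⁻¹ r ⦃ ℚₚ.1/pos⇒pos t ⦄) , ℚₚ.*-inverseˡ t
    where
    instance
      t-pos : ℚ.Positive t
      t-pos = ℚ.positive 0<t
      t-nonzero : ℚ.NonZero t
      t-nonzero = ℚₚ.pos⇒nonZero t
    r : ℚ
    r = ℚ.1/ t

-- (p₁p₂ − δ²)² ≥ δ²(p₁ − δ)(p₂ − δ) for nonnegative p₁ and p₂; expanded, this is the inequality below.
am-gm : ∀ {δ a b} → 0ℚ ≤ δ → 0ℚ ≤ a → 0ℚ ≤ b →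
  (δ * δ + δ * δ + δ * δ) * (a * b) ≤ (a * b) * (a * b) + (δ * δ * δ) * (a + b)
am-gm {δ} {a} {b} 0≤δ 0≤a 0≤b = ≤-by _ (0≤b-a key)
  (solve 3 (λ d a b → (a :* b) :* (a :* b) :+ (d :* d :* d) :* (a :+ b) :=
     (d :* d :+ d :* d :+ d :* d) :* (a :* b) :+ ((a :* b :- d :* d) :* (a :* b :- d :* d) :- d :* (a :- d) :* (d :* (b :- d)))) refl δ a b)
  where
  D : ℚ
  D = a * b - δ * δ
  key : δ * (a - δ) * (δ * (b - δ)) ≤ D * D
  key with ℚₚ.≤-total δ a | ℚₚ.≤-total δ b
  ... | inj₁ p | inj₁ r = *-mono (0≤* 0≤δ (0≤b-a p)) (≤-trans (0≤* 0≤δ (0≤b-a p)) left) left right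
    where
    left : δ * (a - δ) ≤ D
    left = ≤-by _ (0≤* 0≤a (0≤b-a r)) (solve 3 (λ d a b → a :* b :- d :* d := d :* (a :- d) :+ a :* (b :- d)) refl δ a b)
    right : δ * (b - δ) ≤ D
    right = ≤-by _ (0≤* 0≤b (0≤b-a p)) (solve 3 (λ d a b → a :* b :- d :* d := d :* (b :- d) :+ b :* (a :- d)) refl δ a b)
  ... | inj₂ p | inj₂ r = ≤-trans (≤-reflexive (solve 3 (λ d a b → d :* (a :- d) :* (d :* (b :- d)) := d :* (d :- a) :* (d :* (d :- b))) refl δ a b))
      (≤-trans (*-mono (0≤* 0≤δ (0≤b-a p)) (≤-trans (0≤* 0≤δ (0≤b-a p)) left) left right) (≤-reflexive (solve 1 (λ D → (:- D) :* (:- D) := D :* D) refl D)))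
    where
    left : δ * (δ - a) ≤ - D
    left = ≤-by _ (0≤* 0≤a (0≤b-a r)) (solve 3 (λ d a b → :- (a :* b :- d :* d) := d :* (d :- a) :+ a :* (d :- b)) refl δ a b)
    right : δ * (δ - b) ≤ - D
    right = ≤-by _ (0≤* 0≤b (0≤b-a p)) (solve 3 (λ d a b → :- (a :* b :- d :* d) := d :* (d :- b) :+ b :* (d :- a)) refl δ a b)
  ... | inj₁ p | inj₂ r = ≤-trans (≤-by _ (0≤* (0≤* 0≤δ (0≤b-a p)) (0≤* 0≤δ (0≤b-a r)))
      (solve 3 (λ d a b → con 0ℚ := d :* (a :- d) :* (d :* (b :- d)) :+ d :* (a :- d) :* (d :* (d :- b))) refl δ a b)) (0≤sq D)
  ... | inj₂ p | inj₁ r = ≤-trans (≤-by _ (0≤* (0≤* 0≤δ (0≤b-a p)) (0≤* 0≤δ (0≤b-a r)))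
      (solve 3 (λ d a b → con 0ℚ := d :* (a :- d) :* (d :* (b :- d)) :+ d :* (d :- a) :* (d :* (b :- d))) refl δ a b)) (0≤sq D)

-- The quotient c / t, given by the properties through which it is used.
record Ratio (c t : ℚ) : Set where
  field
    ratio : ℚ
    0≤ratio : 0ℚ ≤ ratio
    ratio≤1 : ratio ≤ 1ℚ
    ratio-* : ratio * t ≡ c
open Ratio

make-ratio : ∀ {c t} → 0ℚ < c → c ≤ t → Ratio c t
make-ratio {c} {t} 0<c c≤t = let (r , 0≤r , e) = reciprocal t (ℚₚ.<-≤-trans 0<c c≤t) in record
  { ratio = r * c ; 0≤ratio = 0≤* 0≤r (ℚₚ.<⇒≤ 0<c)
  ; ratio≤1 = ≤-trans (*-monoˡ 0≤r c≤t) (≤-reflexive e)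
  ; ratio-* = trans (solve 3 (λ r c t → r :* c :* t := r :* t :* c) refl r c t) (trans (cong (_* c) e) (*-identityˡ c)) }

-- For t ≥ c the function c² / t has derivative at most 1 in absolute value.
ratio-close : ∀ {c t t′ θ} → 0ℚ < c → c ≤ t → c ≤ t′ → (R : Ratio c t) (R′ : Ratio c t′) → t ≈[ θ ] t′ → c * ratio R ≈[ θ ] c * ratio R′
ratio-close {c} {t} {t′} {θ} 0<c c≤t c≤t′ R R′ h@(p , p′) = one R R′ c≤t p′ , one R′ R c≤t′ p
  where
  0≤c = ℚₚ.<⇒≤ 0<c
  one : ∀ {t t′} (R : Ratio c t) (R′ : Ratio c t′) → c ≤ t → t′ ≤ t + θ → c * ratio R ≤ c * ratio R′ + θ
  one {t} {t′} R R′ c≤t p with ℚₚ.≤-total (ratio R) (ratio R′)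
  ... | inj₁ r≤ = ≤-trans (*-monoˡ 0≤c r≤) (≤-by _ (0≤θ h) refl)
  ... | inj₂ r≥ = begin
    c * r                        ≡⟨ solve 3 (λ c r s → c :* r := c :* s :+ c :* (r :- s)) refl c r s ⟩
    c * s + c * (r - s)          ≤⟨ +-monoʳ-≤ (c * s) (*-monoʳ (0≤b-a r≥) c≤t) ⟩
    c * s + t * (r - s)          ≡⟨ cong (c * s +_) (trans (solve 3 (λ t r s → t :* (r :- s) := r :* t :- s :* t) refl t r s) (cong (_- s * t) (trans (ratio-* R) (sym (ratio-* R′))))) ⟩
    c * s + (s * t′ - s * t)     ≤⟨ +-monoʳ-≤ (c * s) (≤-by _ (0≤* (0≤ratio R′) (0≤b-a p)) (solve 4 (λ s t t′ θ → s :* θ := (s :* t′ :- s :* t) :+ s :* (t :+ θ :- t′)) refl s t t′ θ)) ⟩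
    c * s + s * θ                ≤⟨ +-monoʳ-≤ (c * s) (≤-trans (*-monoʳ (0≤θ h) (ratio≤1 R′)) (≤-reflexive (*-identityˡ θ))) ⟩
    c * s + θ                    ∎
    where
    open ℚₚ.≤-Reasoning
    r s : ℚ
    r = ratio R
    s = ratio R′

module LowerBound (𝒮 : System) {θ η c : ℚ} (0≤η : 0ℚ ≤ η) (0<c : 0ℚ < c) (c≤1 : c ≤ 1ℚ) where
  open Energies 𝒮 public

  0≤c : 0ℚ ≤ c
  0≤c = ℚₚ.<⇒≤ 0<c

  module Weight {f : X → ℚ} (0≤f : ∀ x → 0ℚ ≤ f x) (f≤1 : ∀ x → f x ≤ 1ℚ) (V W : Win)
    (W-V : ∀ k → Inv θ W (at V k)) (close : distance (proj V f) (proj W f) ≤ η * η) where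

    bf : Bdd f
    bf x = Bd-01 (0≤f x) (f≤1 x)

    G : X → ℚ
    G = proj W f

    0≤G : ∀ x → 0ℚ ≤ G x
    0≤G x = E-0≤ (mean (Diff W)) λ k → 0≤f _

    G≤1 : ∀ x → G x ≤ 1ℚ
    G≤1 x = E-≤ (mean (Diff W)) λ k → f≤1 _

    c≤ : ∀ x → c ≤ G x + c
    c≤ x = ≤-by (G x) (0≤G x) (+-comm (G x) c)

    R : ∀ x → Ratio c (G x + c)
    R x = make-ratio 0<c (c≤ x)

    -- The weight 1 / (G + c) times c², which makes it bounded and 1-Lipschitz in G; the summand c
    -- keeps the denominator away from zero.
    w : X → ℚ
    w x = c * ratio (R x)

    bw : Bdd w
    bw x = Bd-* (Bd-01 0≤c c≤1) (Bd-01 (0≤ratio (R x)) (ratio≤1 (R x)))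

    w-inv : ∀ k k′ → AlmostInv (θ + θ) w (at V k -ᶻ at V k′)
    w-inv k k′ = almost λ x → ratio-close 0<c (c≤ _) (c≤ _) (R _) (R _)
      (let (p , r) = near (proj-inv {W = W} bf (Inv-+ (W-V k) (Inv-neg (W-V k′)))) x in
        ≤-trans (+-monoˡ-≤ c p) (≤-reflexive (solve 3 (λ g t c → g :+ t :+ c := g :+ c :+ t) refl (G x) (θ + θ) c)) ,
        ≤-trans (+-monoˡ-≤ c r) (≤-reflexive (solve 3 (λ g t c → g :+ t :+ c := g :+ c :+ t) refl (G (x ⊕ (at V k -ᶻ at V k′))) (θ + θ) c)))

    -- The weight is invariant along V, so f may be replaced by its projection, and then by G ≤ G + c.
    weight-bound : inner f w ≤ c * c + (η + (θ + θ))
    weight-bound = begin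
      inner f w                          ≤⟨ proj₂ (E-≈ space λ x → ≈-*ˡ (bf x) (proj-fixes {V = V} {G = w} w-inv x)) ⟩
      inner f (proj V w) + (θ + θ)       ≡⟨ cong (_+ (θ + θ)) (sym (proj-symmetric V f w)) ⟩
      inner (proj V f) w + (θ + θ)       ≤⟨ +-monoˡ-≤ (θ + θ) (proj₁ (inner-close {proj V f} {G} 0≤η bw close)) ⟩
      inner G w + η + (θ + θ)            ≤⟨ +-monoˡ-≤ (θ + θ) (+-monoˡ-≤ η (E-≤ space λ x → ≤-trans
                                              (≤-by (ratio (R x) * c * c) (0≤* (0≤* (0≤ratio (R x)) 0≤c) 0≤c)
                                                (solve 3 (λ g r c → c :* (r :* (g :+ c)) := g :* (c :* r) :+ r :* c :* c) refl (G x) (ratio (R x)) c))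
                                              (≤-reflexive (cong (c *_) (ratio-* (R x)))))) ⟩
      c * c + η + (θ + θ)                ≡⟨ +-assoc (c * c) η (θ + θ) ⟩
      c * c + (η + (θ + θ))              ∎
      where open ℚₚ.≤-Reasoning

  -- `am-gm` at p₁ = G₁ + c and p₂ = G₂ + c is divided by p₁ p₂, multiplied by c² f and averaged.
  -- After removal of c², the left side is at least 3 δ³, and by `weight-bound` the two terms with
  -- δ³ on the right account for about 2 δ³. Passing from Gᵢ + c to Gᵢ costs 3 c; the errors of the
  -- weights are at most c³, which becomes another c.
  lower-bound : ∀ {f} (0≤f : ∀ x → 0ℚ ≤ f x) (f≤1 : ∀ x → f x ≤ 1ℚ) V₁ W₁ V₂ W₂ →
    (∀ k → Inv θ W₁ (at V₁ k)) → (∀ k → Inv θ W₂ (at V₂ k)) →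
    distance (proj V₁ f) (proj W₁ f) ≤ η * η → distance (proj V₂ f) (proj W₂ f) ≤ η * η →
    ∀ {δ} → 0ℚ ≤ δ → δ ≤ 1ℚ → δ ≤ E space f →
    (η + (θ + θ)) + (η + (θ + θ)) ≤ c * c * c →
    δ * δ * δ ≤ (𝔼[ x ∈ space ] (f x * (proj W₁ f x * proj W₂ f x))) + 4ℚ * c
  lower-bound {f} 0≤f f≤1 V₁ W₁ V₂ W₂ i₁ i₂ d₁ d₂ {δ} 0≤δ δ≤1 δ≤ small = *-cancelʳ-pos {c = c * c} 0<cc (begin
    δ * δ * δ * (c * c)
      ≡⟨ solve 2 (λ d c → d :* d :* d :* (c :* c) := (d :* d :+ d :* d :+ d :* d) :* (c :* c) :* d :- d :* d :* d :* ((c :* c) :+ (c :* c))) refl δ c ⟩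
    Q * δ - δ³ * (c * c + c * c)
      ≤⟨ +-monoˡ-≤ _ (*-monoˡ (0≤* (0≤+ (0≤+ (0≤sq δ) (0≤sq δ)) (0≤sq δ)) (0≤sq c)) δ≤) ⟩
    Q * E space f - δ³ * (c * c + c * c)
      ≤⟨ +-monoˡ-≤ _ averaged ⟩
    (c * c) * (S + 3c) + δ³ * (inner f w₁ + inner f w₂) - δ³ * (c * c + c * c)
      ≤⟨ +-monoˡ-≤ _ (+-monoʳ-≤ _ (*-monoˡ 0≤δ³ (+-mono-≤ F₁.weight-bound F₂.weight-bound))) ⟩
    (c * c) * (S + 3c) + δ³ * ((c * c + t) + (c * c + t)) - δ³ * (c * c + c * c)
      ≡⟨ solve 4 (λ a d t c → a :+ d :* ((c :+ t) :+ (c :+ t)) :- d :* (c :+ c) := a :+ d :* (t :+ t)) refl ((c * c) * (S + 3c)) δ³ t (c * c) ⟩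
    (c * c) * (S + 3c) + δ³ * (t + t)
      ≤⟨ +-monoʳ-≤ _ (*-mono 0≤δ³ 0≤c³ δ³≤1 small) ⟩
    (c * c) * (S + 3c) + 1ℚ * (c * c * c)
      ≡⟨ solve 2 (λ S c → (c :* c) :* (S :+ (c :+ c :+ c)) :+ con 1ℚ :* (c :* c :* c) := (S :+ (con 1ℚ :+ con 1ℚ :+ (con 1ℚ :+ con 1ℚ)) :* c) :* (c :* c)) refl S c ⟩
    (S + 4ℚ * c) * (c * c) ∎)
    where
    open ℚₚ.≤-Reasoning
    module F₁ = Weight 0≤f f≤1 V₁ W₁ i₁ d₁
    module F₂ = Weight 0≤f f≤1 V₂ W₂ i₂ d₂
    w₁ w₂ : X → ℚ
    w₁ = F₁.w
    w₂ = F₂.w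
    S 3c Q δ³ t : ℚ
    S = 𝔼[ x ∈ space ] (f x * (F₁.G x * F₂.G x))
    3c = c + c + c
    Q = (δ * δ + δ * δ + δ * δ) * (c * c)
    δ³ = δ * δ * δ
    t = η + (θ + θ)
    0≤δ³ : 0ℚ ≤ δ³
    0≤δ³ = 0≤* (0≤sq δ) 0≤δ
    0≤c³ : 0ℚ ≤ c * c * c
    0≤c³ = 0≤* (0≤sq c) 0≤c
    δ³≤1 : δ³ ≤ 1ℚ
    δ³≤1 = proj₁ (Bd-* (Bd-* (Bd-01 0≤δ δ≤1) (Bd-01 0≤δ δ≤1)) (Bd-01 0≤δ δ≤1))
    0<cc : 0ℚ < c * c
    0<cc = *-pos 0<c 0<c
    pointwise : ∀ x → Q ≤ (c * c) * (F₁.G x * F₂.G x + 3c) + δ³ * (w₁ x + w₂ x)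
    pointwise x = begin
      Q ≡⟨ cong₂ (λ s u → (δ * δ + δ * δ + δ * δ) * (s * u)) (sym (ratio-* (F₁.R x))) (sym (ratio-* (F₂.R x))) ⟩
      (δ * δ + δ * δ + δ * δ) * ((r₁ * p₁) * (r₂ * p₂))
        ≡⟨ solve 5 (λ d r s p q → d :* ((r :* p) :* (s :* q)) := d :* (p :* q) :* (r :* s)) refl (δ * δ + δ * δ + δ * δ) r₁ r₂ p₁ p₂ ⟩
      (δ * δ + δ * δ + δ * δ) * (p₁ * p₂) * (r₁ * r₂)
        ≤⟨ *-monoʳ (0≤* (0≤ratio (F₁.R x)) (0≤ratio (F₂.R x))) (am-gm 0≤δ (≤-trans 0≤c (F₁.c≤ x)) (≤-trans 0≤c (F₂.c≤ x))) ⟩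
      ((p₁ * p₂) * (p₁ * p₂) + δ³ * (p₁ + p₂)) * (r₁ * r₂)
        ≡⟨ solve 5 (λ d r s p q → ((p :* q) :* (p :* q) :+ d :* (p :+ q)) :* (r :* s) := (r :* p) :* (s :* q) :* (p :* q) :+ d :* ((r :* p) :* s :+ (s :* q) :* r)) refl δ³ r₁ r₂ p₁ p₂ ⟩
      (r₁ * p₁) * (r₂ * p₂) * (p₁ * p₂) + δ³ * ((r₁ * p₁) * r₂ + (r₂ * p₂) * r₁)
        ≡⟨ cong₂ (λ s u → s * u * (p₁ * p₂) + δ³ * (s * r₂ + u * r₁)) (ratio-* (F₁.R x)) (ratio-* (F₂.R x)) ⟩
      c * c * (p₁ * p₂) + δ³ * (c * r₂ + c * r₁)
        ≤⟨ +-mono-≤ (*-monoˡ (0≤sq c) (≤-by _ (0≤+ (0≤+ (0≤* 0≤c (0≤b-a (F₁.G≤1 x))) (0≤* 0≤c (0≤b-a (F₂.G≤1 x)))) (0≤* 0≤c (0≤b-a c≤1)))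
             (solve 3 (λ g h c → g :* h :+ (c :+ c :+ c) := (g :+ c) :* (h :+ c) :+ (c :* (con 1ℚ :- g) :+ c :* (con 1ℚ :- h) :+ c :* (con 1ℚ :- c))) refl (F₁.G x) (F₂.G x) c)))
             (≤-reflexive (cong (δ³ *_) (+-comm (c * r₂) (c * r₁)))) ⟩
      (c * c) * (F₁.G x * F₂.G x + 3c) + δ³ * (w₁ x + w₂ x) ∎
      where
      r₁ r₂ p₁ p₂ : ℚ
      r₁ = ratio (F₁.R x)
      r₂ = ratio (F₂.R x)
      p₁ = F₁.G x + c
      p₂ = F₂.G x + c
    averaged : Q * E space f ≤ (c * c) * (S + 3c) + δ³ * (inner f w₁ + inner f w₂)
    averaged = begin
      Q * E space f ≡⟨ sym (E-*ˡ space Q f) ⟩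
      𝔼[ x ∈ space ] (Q * f x)
        ≤⟨ E-mono space (λ x → ≤-trans (*-monoʳ (0≤f x) (pointwise x)) (≤-trans (≤-reflexive
             (solve 7 (λ g k t d u v f → (k :* (g :+ t) :+ d :* (u :+ v)) :* f := k :* (f :* g) :+ f :* (k :* t) :+ (d :* (f :* u) :+ d :* (f :* v))) refl
                (F₁.G x * F₂.G x) (c * c) 3c δ³ (w₁ x) (w₂ x) (f x)))
             (+-monoˡ-≤ _ (+-monoʳ-≤ _ (≤-trans (*-monoʳ (0≤* (0≤sq c) (0≤+ (0≤+ 0≤c 0≤c) 0≤c)) (f≤1 x)) (≤-reflexive (*-identityˡ _))))))) ⟩
      𝔼[ x ∈ space ] ((c * c) * (f x * (F₁.G x * F₂.G x)) + (c * c) * 3c + (δ³ * (f x * w₁ x) + δ³ * (f x * w₂ x)))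
        ≡⟨ trans (E-+ space _ _) (cong₂ _+_ (trans (E-+ᶜ space _ _) (cong (_+ (c * c) * 3c) (E-*ˡ space (c * c) _)))
             (trans (E-+ space _ _) (cong₂ _+_ (E-*ˡ space δ³ _) (E-*ˡ space δ³ _)))) ⟩
      (c * c) * S + (c * c) * 3c + (δ³ * inner f w₁ + δ³ * inner f w₂)
        ≡⟨ cong₂ _+_ (sym (distribˡ (c * c) S 3c)) (sym (distribˡ δ³ (inner f w₁) (inner f w₂))) ⟩
      (c * c) * (S + 3c) + δ³ * (inner f w₁ + inner f w₂) ∎

-- The sequence of scales

-- For differences Q d the square is Q (Q d²), so in the accelerated action the pattern is x, x + d,
-- x + q d² with q = Q.
scaled : System → ℤ → System
scaled 𝒮 Q = record
  { X = X ; space = space ; _⊕_ = λ x n → x ⊕ Q *ᶻ n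
  ; ⊕-assoc = λ x m n → trans (⊕-assoc x (Q *ᶻ m) (Q *ᶻ n)) (cong (x ⊕_) (solveᶻ 3 (λ q m n → q ⊠ m ⊞ q ⊠ n ≔ q ⊠ (m ⊞ n)) refl Q m n))
  ; ⊕-zero = λ x → trans (cong (x ⊕_) (solveᶻ 1 (λ q → q ⊠ # 0ℤ ≔ # 0ℤ) refl Q)) (⊕-zero x)
  ; E-inv = λ φ n → E-inv φ (Q *ᶻ n) }
  where open System 𝒮

lin : ∀ i x s y {b} {_ : True (i ℕ.+ x ℕ.+ s ℕ.≤? y)} → (i ℕ.+ (b ℕ.+ x)) ℕ.+ s ℕ.≤ b ℕ.+ y
lin i x s y {b} {p} = ℕₚ.≤-trans (ℕₚ.≤-reflexive (eq i x s b)) (ℕₚ.+-monoʳ-≤ b (toWitness p))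
  where
  eq : ∀ i x s b → (i ℕ.+ (b ℕ.+ x)) ℕ.+ s ≡ b ℕ.+ (i ℕ.+ x ℕ.+ s)
  eq = solve-∀

lin² : ∀ i x j y s z {b} {_ : True (i ℕ.+ x ℕ.+ (j ℕ.+ y) ℕ.+ s ℕ.≤? z)} → (i ℕ.+ (b ℕ.+ x)) ℕ.+ (j ℕ.+ (b ℕ.+ y)) ℕ.+ s ℕ.≤ b ℕ.+ b ℕ.+ z
lin² i x j y s z {b} {p} = ℕₚ.≤-trans (ℕₚ.≤-reflexive (eq i x j y s b)) (ℕₚ.+-monoʳ-≤ (b ℕ.+ b) (toWitness p))
  where
  eq : ∀ i x j y s b → (i ℕ.+ (b ℕ.+ x)) ℕ.+ (j ℕ.+ (b ℕ.+ y)) ℕ.+ s ≡ b ℕ.+ b ℕ.+ (i ℕ.+ x ℕ.+ (j ℕ.+ y) ℕ.+ s)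
  eq = solve-∀

join : ∀ x y {b} → b ℕ.+ b ℕ.+ (x ℕ.+ y) ≡ (b ℕ.+ x) ℕ.+ (b ℕ.+ y)
join x y {b} = eq x y b
  where
  eq : ∀ x y b → b ℕ.+ b ℕ.+ (x ℕ.+ y) ≡ (b ℕ.+ x) ℕ.+ (b ℕ.+ y)
  eq = solve-∀

module Constants (scales : Scales) where
  open Scales scales

  -- Each ladder turns a step λ₀ = 2 h₀ into λ₀² λ̂². Starting from λ̂, this gives 2 h₁ and then λ₂,
  -- whose size is at most the twelfth power of λ̂.
  h₁ h₂ λ₂ : ℤ
  h₁ = ĥ *ᶻ λ̂ *ᶻ λ̂ *ᶻ λ̂
  h₂ = h₁ *ᶻ (2ᶻ *ᶻ h₁) *ᶻ λ̂ *ᶻ λ̂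
  λ₂ = 2ᶻ *ᶻ h₂

  module Stage (q : ℤ) (b : ℕ) where
    open Windows scales q public
    open module Medium = Scaling ℤ.∣ λ̂ ∣ 2≤λ̂ using () renaming (Size to SizeL; Size-* to SizeL-*; Size-up to SizeL-up) public

    fromL : ∀ {k m} {_ : True (k ℕ.≤? 12)} → SizeL k m → Size 1 m
    fromL {_} {_} {p} h = Size-1 (ℕₚ.≤-trans (Medium.bound (SizeL-up (toWitness p) h)) λ̂≤T)

    λ̂L : SizeL 1 λ̂
    λ̂L = Medium.size (ℕₚ.≤-reflexive (sym (ℕₚ.*-identityʳ _)))

    ĥL : SizeL 1 ĥ
    ĥL = Medium.size (ℕₚ.≤-trans (ℕₚ.m≤n*m ℤ.∣ ĥ ∣ 2) (ℕₚ.≤-trans (ℕₚ.≤-reflexive (sym (∣*∣ 2ᶻ ĥ))) (Medium.bound λ̂L)))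

    2L : SizeL 1 2ᶻ
    2L = Medium.size (ℕₚ.≤-trans 2≤λ̂ (Medium.bound λ̂L))

    h₁L : SizeL 4 h₁
    h₁L = SizeL-* {3} (SizeL-* {2} (SizeL-* {1} ĥL λ̂L) λ̂L) λ̂L

    h₂L : SizeL 11 h₂
    h₂L = SizeL-* {10} (SizeL-* {9} (SizeL-* {4} h₁L (SizeL-* {1} 2L h₁L)) λ̂L) λ̂L

    λ₂L : SizeL 12 λ₂
    λ₂L = SizeL-* {1} 2L h₂L

    -- On the way from 𝒟 down to V₁ each exponent is the largest multiple of 10 that the constraints
    -- permit. The choice 1700 leaves V₁ the exponent b + 20, just above b + 10, which is the
    -- exponent of W₁ in the following stage, where the base is smaller by 1700.
    m : ℕ
    m = b ℕ.+ 1700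

    𝒟 U₀ U₁ U₂ V₁ V₂ W₁ W₂ : Win
    𝒟  = Times m
    U₀ = prog (2ᶻ *ᶻ q *ᶻ λ̂) (T ℕ.^ (b ℕ.+ b ℕ.+ 3340))
    U₁ = prog (2ᶻ *ᶻ q *ᶻ (2ᶻ *ᶻ h₁)) (T ℕ.^ (b ℕ.+ b ℕ.+ 3020))
    U₂ = prog (2ᶻ *ᶻ q *ᶻ λ₂) (T ℕ.^ (b ℕ.+ b ℕ.+ 1740))
    V₁ = prog λ₂ (T ℕ.^ (b ℕ.+ 20))
    V₂ = prog (2ᶻ *ᶻ q *ᶻ λ₂) (T ℕ.^ (b ℕ.+ b ℕ.+ 1730))
    W₁ = prog ℤ.1ℤ (T ℕ.^ (b ℕ.+ 1710))
    W₂ = prog q (T ℕ.^ (b ℕ.+ b ℕ.+ 3410))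

    lin₁ : ∀ i x s y {_ : True (i ℕ.+ x ℕ.+ s ℕ.≤? y)} → (i ℕ.+ (b ℕ.+ x)) ℕ.+ s ℕ.≤ b ℕ.+ y
    lin₁ i x s y {p} = lin i x s y {b} {p}

    lin₂ : ∀ i x s y {_ : True (i ℕ.+ x ℕ.+ s ℕ.≤? y)} → (i ℕ.+ (b ℕ.+ b ℕ.+ x)) ℕ.+ s ℕ.≤ b ℕ.+ b ℕ.+ y
    lin₂ i x s y {p} = lin i x s y {b ℕ.+ b} {p}

    lin₃ : ∀ i x j y s z {_ : True (i ℕ.+ x ℕ.+ (j ℕ.+ y) ℕ.+ s ℕ.≤? z)} → (i ℕ.+ (b ℕ.+ x)) ℕ.+ (j ℕ.+ (b ℕ.+ y)) ℕ.+ s ℕ.≤ b ℕ.+ b ℕ.+ z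
    lin₃ i x j y s z {p} = lin² i x j y s z {b} {p}

    start : Start θ q 𝒟 n U₀
    start = make-start m (b ℕ.+ 1690) (b ℕ.+ 1680) (b ℕ.+ 1670) (b ℕ.+ b ℕ.+ 3340)
      (ℕₚ.≤-trans (ℕ.s≤s ℕ.z≤n) (ℕₚ.m≤n+m 1670 b)) (lin₁ 0 1690 10 1700) (lin₁ 0 1680 10 1690) (lin₁ 0 1670 10 1680)
      (ℕₚ.≤-reflexive (trans (ℕₚ.+-assoc (b ℕ.+ b) 3340 10) (join 1670 1680 {b})))

    ladder₁ : Ladder θ q 𝒟 n U₀ U₁
    ladder₁ = subst (λ z → Ladder θ q 𝒟 n U₀ (prog (2ᶻ *ᶻ q *ᶻ z) (T ℕ.^ (b ℕ.+ b ℕ.+ 3020))))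
      (solveᶻ 1 (λ h → let l = # 2ᶻ ⊠ h in l ⊠ l ⊠ l ⊠ l ≔ # 2ᶻ ⊠ (h ⊠ l ⊠ l ⊠ l)) refl ĥ)
      (make-ladder m (b ℕ.+ b ℕ.+ 3340) (b ℕ.+ 1630) (b ℕ.+ 1620) (b ℕ.+ 1610) (b ℕ.+ 1520) (b ℕ.+ 1510) (b ℕ.+ b ℕ.+ 3020) ĥ
        (fromL ĥL) (fromL λ̂L) (fromL (SizeL-* {1} λ̂L λ̂L)) (fromL (SizeL-* {2} (SizeL-* {1} ĥL λ̂L) λ̂L))
        (lin₃ 0 1700 0 1630 10 3340) (lin₃ 0 1630 0 1630 10 3340) (lin₁ 0 1630 10 1700) (lin₁ 0 1620 10 1630) (lin₁ 0 1610 10 1620) (lin₁ 0 1520 10 1630)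
        (ℕₚ.≤-trans (lin₃ 0 1700 0 1520 10 3230) (ℕₚ.≤-reflexive (join 1610 1620 {b}))) (ℕₚ.≤-trans (lin₃ 0 1520 0 1520 10 3230) (ℕₚ.≤-reflexive (join 1610 1620 {b})))
        (lin₁ 0 1510 10 1520) (ℕₚ.≤-reflexive (trans (ℕₚ.+-assoc (b ℕ.+ b) 3020 10) (join 1510 1520 {b}))))

    ladder₂ : Ladder θ q 𝒟 n U₁ U₂
    ladder₂ = subst (λ z → Ladder θ q 𝒟 n U₁ (prog (2ᶻ *ᶻ q *ᶻ z) (T ℕ.^ (b ℕ.+ b ℕ.+ 1740))))
      (solveᶻ 2 (λ h l → let a = # 2ᶻ ⊠ h in a ⊠ a ⊠ l ⊠ l ≔ # 2ᶻ ⊠ (h ⊠ a ⊠ l ⊠ l)) refl h₁ λ̂)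
      (make-ladder m (b ℕ.+ b ℕ.+ 3020) (b ℕ.+ 1310) (b ℕ.+ 1300) (b ℕ.+ 1290) (b ℕ.+ 880) (b ℕ.+ 870) (b ℕ.+ b ℕ.+ 1740) h₁
        (fromL h₁L) (fromL (SizeL-* {1} 2L h₁L)) (fromL (SizeL-* {5} (SizeL-* {1} 2L h₁L) λ̂L)) (fromL (SizeL-* {9} (SizeL-* {4} h₁L (SizeL-* {1} 2L h₁L)) λ̂L))
        (lin₃ 0 1700 0 1310 10 3020) (lin₃ 0 1310 0 1310 10 3020) (lin₁ 0 1310 10 1700) (lin₁ 0 1300 10 1310) (lin₁ 0 1290 10 1300) (lin₁ 0 880 10 1310)
        (ℕₚ.≤-trans (lin₃ 0 1700 0 880 10 2590) (ℕₚ.≤-reflexive (join 1290 1300 {b}))) (ℕₚ.≤-trans (lin₃ 0 880 0 880 10 2590) (ℕₚ.≤-reflexive (join 1290 1300 {b})))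
        (lin₁ 0 870 10 880) (ℕₚ.≤-reflexive (trans (ℕₚ.+-assoc (b ℕ.+ b) 1740 10) (join 870 880 {b}))))

    difference : ∀ l (i j : Fin (suc (T ℕ.^ l))) → Size (suc l) (⟦ i ⟧ -ᶻ ⟦ j ⟧)
    difference l i j = Size-+ (point {l} i) (Size-neg (point {l} j))

    factor-prog : ∀ c x y → c *ᶻ (x -ᶻ y) ≡ c *ᶻ x -ᶻ c *ᶻ y
    factor-prog = solveᶻ 3 (λ c x y → c ⊠ (x ⊟ y) ≔ c ⊠ x ⊟ c ⊠ y) refl

    U₂-V₂ : ∀ k → Inv θ U₂ (at (Diff V₂) k)
    U₂-V₂ (i , j) = Inv-≡ (factor-prog (2ᶻ *ᶻ q *ᶻ λ₂) ⟦ i ⟧ ⟦ j ⟧) (Inv-T (Slack-size (difference (b ℕ.+ b ℕ.+ 1730) i j) (lin₂ 1 1730 1 1740)))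

    𝒟-V₁ : ∀ k → Inv θ 𝒟 (at (Diff V₁) k)
    𝒟-V₁ (i , j) = Times-inv (subst (Slack m 1) (factor-prog λ₂ ⟦ i ⟧ ⟦ j ⟧) (Slack-scale (fromL λ₂L) (Slack-size (difference (b ℕ.+ 20) i j) (lin₁ 1 20 2 1700))))

    V₂-increment : ∀ d k → Inv θ V₂ (increment q (at 𝒟 d) (at (Diff V₁) k))
    V₂-increment d (i , j) = Inv-≡ (trans
        (solveᶻ 4 (λ q d h y → # 2ᶻ ⊠ q ⊠ (# 2ᶻ ⊠ h) ⊠ (d ⊠ y ⊞ h ⊠ (y ⊠ y)) ≔ q ⊠ (# 2ᶻ ⊠ d ⊠ (# 2ᶻ ⊠ h ⊠ y) ⊞ (# 2ᶻ ⊠ h ⊠ y) ⊠ (# 2ᶻ ⊠ h ⊠ y))) refl q (at 𝒟 d) h₂ (⟦ i ⟧ -ᶻ ⟦ j ⟧))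
        (cong (increment q (at 𝒟 d)) (factor-prog λ₂ ⟦ i ⟧ ⟦ j ⟧)))
      (Inv-T (Slack-+ (Slack-* (Times-size {m} d) (difference (b ℕ.+ 20) i j) (lin₃ 1 1700 1 20 2 1730))
        (Slack-scale (fromL h₂L) (Slack-* (difference (b ℕ.+ 20) i j) (difference (b ℕ.+ 20) i j) (lin₃ 1 20 1 20 3 1730)))))

    W₁-𝒟 : ∀ d → Inv θ W₁ (at 𝒟 d)
    W₁-𝒟 d = Inv-≡ (solveᶻ 1 (λ s → # ℤ.1ℤ ⊠ s ≔ s) refl (at 𝒟 d)) (Inv-T (Slack-size (Times-size {m} d) (lin₁ 1 1700 1 1710)))

    W₂-𝒟 : ∀ d → Inv θ W₂ (q *ᶻ (at 𝒟 d *ᶻ at 𝒟 d))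
    W₂-𝒟 d = Inv-T (Slack-* (Times-size {m} d) (Times-size {m} d) (lin₃ 1 1700 1 1700 1 3410))

    W₁-V₁ : ∀ k → Inv θ W₁ (at V₁ k)
    W₁-V₁ k = Inv-≡ (solveᶻ 1 (λ s → # ℤ.1ℤ ⊠ s ≔ s) refl (λ₂ *ᶻ ⟦ k ⟧)) (Inv-T (Slack-scale (fromL λ₂L) (Slack-size (point {b ℕ.+ 20} k) (lin₁ 0 20 2 1710))))

    W₂-V₂ : ∀ k → Inv θ W₂ (at V₂ k)
    W₂-V₂ k = Inv-≡ (solveᶻ 3 (λ q l k → q ⊠ (# 2ᶻ ⊠ (l ⊠ k)) ≔ # 2ᶻ ⊠ q ⊠ l ⊠ k) refl q λ₂ ⟦ k ⟧)
      (Inv-T (Slack-scale (fromL 2L) (Slack-scale (fromL λ₂L) (Slack-size (point {b ℕ.+ b ℕ.+ 1730} k) (lin₂ 0 1730 3 3410)))))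

    module Result (𝒮 : System) {e κ : ℚ}
      (16θ≤e : 2ℚ * (2ℚ * (2ℚ * (θ + θ))) ≤ e) (θ≤e : θ ≤ e)
      (small : 4ℚ * (((θ + θ) + ((2ℚ * (θ + θ)) + (2ℚ * (θ + θ)))) + (θ + θ)) ≤ e)
      (0<κ : 0ℚ < κ) (κ≤½ : κ ≤ ½) (p : ℕ) (e≤ : e ≤ κ ^^ nexts finalSteps (p ℕ.+ p))
      {η c : ℚ} (0≤η : 0ℚ ≤ η) (0<c : 0ℚ < c) (c≤1 : c ≤ 1ℚ) (ηθc : (η + (θ + θ)) + (η + (θ + θ)) ≤ c * c * c) where
      open StageCount 𝒮 q
      open LowerBound 𝒮 {θ} {η} {c} 0≤η 0<c c≤1 using (lower-bound)

      stage-count : ∀ {f} → (∀ x → 0ℚ ≤ f x) → (∀ x → f x ≤ 1ℚ) →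
        distance (proj V₁ f) (proj W₁ f) ≤ η * η → distance (proj V₂ f) (proj W₂ f) ≤ η * η →
        ∀ {δ} → 0ℚ ≤ δ → δ ≤ 1ℚ → δ ≤ E space f →
        δ * δ * δ ≤ Λ 𝒟 f f f + ((κ ^^ p + κ ^^ p) + ((θ + θ) + (η + (η + (θ + θ)))) + 4ℚ * c)
      stage-count {f} 0≤f f≤1 d₁ d₂ {δ} 0≤δ δ≤1 δ≤ = ≤-trans
        (lower-bound 0≤f f≤1 V₁ W₁ V₂ W₂ W₁-V₁ W₂-V₂ d₁ d₂ 0≤δ δ≤1 δ≤ ηθc)
        (≤-trans (+-monoˡ-≤ (4ℚ * c) (proj₂ close)) (≤-reflexive (+-assoc _ _ _)))
        where
        bf : Bdd f
        bf x = Bd-01 (0≤f x) (f≤1 x)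
        close : Λ 𝒟 f f f ≈[ (κ ^^ p + κ ^^ p) + ((θ + θ) + (η + (η + (θ + θ)))) ] (𝔼[ x ∈ space ] (f x * (proj W₁ f x * proj W₂ f x)))
        close =
          ≈-trans (InverseTheorem.inverse-theorem 𝒮 q 0≤θ′ 16θ≤e 𝒟 n θ≤e small 0<κ κ≤½ p e≤ start ladder₁ ladder₂ V₂ U₂-V₂ bf bf bf)
          (≈-trans (smooth-middle 𝒟 V₁ bf bf (proj-Bd V₂ bf) 𝒟-V₁ (λ d k → proj-inv {W = V₂} bf (V₂-increment d k)))
          (≈-trans (replace₁ 𝒟 0≤η bf (proj-Bd V₂ bf) d₁)
          (≈-trans (replace₂ 𝒟 0≤η bf (proj-Bd W₁ bf) d₂)
            (decouple 𝒟 bf (proj-Bd W₁ bf) (proj-Bd W₂ bf) (λ d → proj-inv {W = W₁} bf (W₁-𝒟 d)) (λ d → proj-inv {W = W₂} bf (W₂-𝒟 d))))))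

-- Opaque, to keep the exponents folded.
opaque
  base : ℕ → ℕ
  base zero    = 0
  base (suc r) = base r ℕ.+ 1700

  base-suc : ∀ r → base (suc r) ≡ base r ℕ.+ 1700
  base-suc r = refl

  base≤ : ∀ r → base r ℕ.≤ r ℕ.* 1700
  base≤ zero    = ℕ.z≤n
  base≤ (suc r) = ℕₚ.≤-trans (ℕₚ.≤-reflexive (ℕₚ.+-comm (base r) 1700)) (ℕₚ.+-monoʳ-≤ 1700 (base≤ r))

-- Accounting for the energy increment: a failed stage raises the energy by more than τ - 2x, and
-- the energy cannot exceed 2.
last-term : ∀ {f c τ x} → ¬ f - c + x ≤ τ → f ≤ 2ℚ → 0ℚ ≤ x → fromℕ 1 * (τ - (x + x)) ≤ 2ℚ - c
last-term {f} {c} {τ} {x} ¬p f≤2 0≤x = ≤-by _ (0≤+ (0≤+ (0≤b-a (ℚₚ.<⇒≤ (ℚₚ.≰⇒> ¬p))) (0≤b-a f≤2)) 0≤x)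
  (solve 4 (λ f c t x → (con 1ℚ :+ con 1ℚ) :- c := (con 1ℚ :+ con 0ℚ) :* (t :- (x :+ x)) :+ ((f :- c :+ x :- t) :+ ((con 1ℚ :+ con 1ℚ) :- f) :+ x)) refl f c τ x)

next-term : ∀ {s f c c′ τ x} → ¬ f - c + x ≤ τ → f ≤ c′ + x → s * (τ - (x + x)) ≤ 2ℚ - c′ → (1ℚ + s) * (τ - (x + x)) ≤ 2ℚ - c
next-term {s} {f} {c} {c′} {τ} {x} ¬p f≤ h = ≤-by _ (0≤+ (0≤+ (0≤b-a (ℚₚ.<⇒≤ (ℚₚ.≰⇒> ¬p))) (0≤b-a h)) (0≤b-a f≤))
  (solve 6 (λ s f c c′ t x → (con 1ℚ :+ con 1ℚ) :- c := (con 1ℚ :+ s) :* (t :- (x :+ x)) :+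
     (((f :- c :+ x) :- t) :+ ((con 1ℚ :+ con 1ℚ) :- c′ :- s :* (t :- (x :+ x))) :+ (c′ :+ x :- f))) refl s f c c′ τ x)

module Search (scales : Scales) (𝒮 : System) {f : System.X 𝒮 → ℚ} (0≤f : ∀ x → 0ℚ ≤ f x) (f≤1 : ∀ x → f x ≤ 1ℚ) where
  open Scales scales
  open Constants scales public
  open Energies 𝒮 using (energy; energy-refines; 0≤box₁; box-Bd)

  ϑ : ℚ
  ϑ = 1/suc n

  4ϑ 8ϑ : ℚ
  4ϑ = (ϑ + ϑ) + (ϑ + ϑ)
  8ϑ = 4ϑ + 4ϑ

  bf : ∀ x → Bd (f x)
  bf x = Bd-01 (0≤f x) (f≤1 x)

  module At (Q : ℤ) (r : ℕ) where
    open Stage Q (base r) public using (V₁; V₂; W₁; W₂; W₁-V₁; W₂-V₂)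

    -- The gap bounds both distances at once: the sum of two energy differences, each corrected by
    -- 4ϑ, dominates either of them because the other is nonnegative.
    coarse fine gap : ℚ
    coarse = energy (Scale Q W₁) f + energy (Scale Q W₂) f
    fine   = energy (Scale Q V₁) f + energy (Scale Q V₂) f
    gap    = fine - coarse + 8ϑ

    0≤coarse : 0ℚ ≤ coarse
    0≤coarse = 0≤+ (0≤box₁ (Scale Q W₁) f) (0≤box₁ (Scale Q W₂) f)

    fine≤2 : fine ≤ 2ℚ
    fine≤2 = +-mono-≤ (proj₁ (box-Bd (Scale Q V₁ ∷ []) bf)) (proj₁ (box-Bd (Scale Q V₂ ∷ []) bf))

    open Energies (scaled 𝒮 Q) using (distance; 0≤distance; energy-gap; proj)

    distance₁ : distance (proj V₁ f) (proj W₁ f) ≤ gap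
    distance₁ = ≤-trans (energy-gap V₁ W₁ bf W₁-V₁) (≤-by _ (≤-trans (0≤distance (proj V₂ f) (proj W₂ f)) (energy-gap V₂ W₂ bf W₂-V₂))
      (solve 5 (λ a b c d t → (a :+ c) :- (b :+ d) :+ (t :+ t) := (a :- b :+ t) :+ (c :- d :+ t)) refl
        (energy (Scale Q V₁) f) (energy (Scale Q W₁) f) (energy (Scale Q V₂) f) (energy (Scale Q W₂) f) 4ϑ))

    distance₂ : distance (proj V₂ f) (proj W₂ f) ≤ gap
    distance₂ = ≤-trans (energy-gap V₂ W₂ bf W₂-V₂) (≤-by _ (≤-trans (0≤distance (proj V₁ f) (proj W₁ f)) (energy-gap V₁ W₁ bf W₁-V₁))
      (solve 5 (λ a b c d t → (a :+ c) :- (b :+ d) :+ (t :+ t) := (c :- d :+ t) :+ (a :- b :+ t)) refl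
        (energy (Scale Q V₁) f) (energy (Scale Q W₁) f) (energy (Scale Q V₂) f) (energy (Scale Q W₂) f) 4ϑ))

  -- The coarse windows of the next stage refine the fine windows of this one.
  descend-stage : ∀ Q r → At.fine Q (suc r) ≤ At.coarse (Q *ᶻ (2ᶻ *ᶻ λ₂)) r + 8ϑ
  descend-stage Q r = ≤-trans
    (+-mono-≤ (energy-refines (Scale Q′ N.W₁) (Scale Q S.V₁) bf refine₁) (energy-refines (Scale Q′ N.W₂) (Scale Q S.V₂) bf refine₂))
    (≤-reflexive (solve 3 (λ a b t → (a :+ t) :+ (b :+ t) := (a :+ b) :+ (t :+ t)) refl (energy (Scale Q′ N.W₁) f) (energy (Scale Q′ N.W₂) f) 4ϑ))
    where
    Q′ : ℤ
    Q′ = Q *ᶻ (2ᶻ *ᶻ λ₂)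
    b : ℕ
    b = base r
    module S = Stage Q (base (suc r))
    module N = Stage Q′ b
    open Stage Q (base (suc r)) using (Inv-T; Slack; Slack-scale; Slack-size; Size; point; fromL; 2L; λ₂L)
    refine₁ : ∀ k → Inv ϑ (Scale Q S.V₁) (at (Scale Q′ N.W₁) k)
    refine₁ k = Inv-≡ (solveᶻ 3 (λ q l x → q ⊠ (l ⊠ (# 2ᶻ ⊠ x)) ≔ q ⊠ (# 2ᶻ ⊠ l) ⊠ (# ℤ.1ℤ ⊠ x)) refl Q λ₂ ⟦ k ⟧)
      (Inv-Scale {W = S.V₁} Q (Inv-T (Slack-scale (fromL 2L) (Slack-size (point {b ℕ.+ 1710} k)
        (ℕₚ.≤-trans (lin 0 1710 2 1720 {b}) (ℕₚ.≤-reflexive (trans (sym (ℕₚ.+-assoc b 1700 20)) (cong (ℕ._+ 20) (sym (base-suc r))))))))))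
    refine₂ : ∀ k → Inv ϑ (Scale Q S.V₂) (at (Scale Q′ N.W₂) k)
    refine₂ k = Inv-≡ (solveᶻ 3 (λ q l x → q ⊠ (# 2ᶻ ⊠ q ⊠ l ⊠ (# 2ᶻ ⊠ (l ⊠ x))) ≔ q ⊠ (# 2ᶻ ⊠ l) ⊠ (q ⊠ (# 2ᶻ ⊠ l) ⊠ x)) refl Q λ₂ ⟦ k ⟧)
      (Inv-Scale {W = S.V₂} Q (Inv-T (Slack-scale (fromL 2L) (Slack-scale (fromL λ₂L) (Slack-size (point {b ℕ.+ b ℕ.+ 3410} k)
        (ℕₚ.≤-trans (lin 0 3410 3 5130 {b ℕ.+ b}) (ℕₚ.≤-reflexive (trans (eq b) (cong (λ t → t ℕ.+ t ℕ.+ 1730) (sym (base-suc r)))))))))))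
      where
      eq : ∀ b → b ℕ.+ b ℕ.+ 5130 ≡ (b ℕ.+ 1700) ℕ.+ (b ℕ.+ 1700) ℕ.+ 1730
      eq b = trans (cong (b ℕ.+ b ℕ.+_) refl) (trans (sym (ℕₚ.+-assoc (b ℕ.+ b) 3400 1730)) (cong (ℕ._+ 1730) (join 1700 1700 {b})))

  0≤8ϑ : 0ℚ ≤ 8ϑ
  0≤8ϑ = let t = 0≤1/suc n in 0≤+ (0≤+ (0≤+ t t) (0≤+ t t)) (0≤+ (0≤+ t t) (0≤+ t t))

  module _ (ℓ : ℕ) (λ₂≡ : λ₂ ≡ ℤ.+ ℓ) (1≤ℓ : 1 ℕ.≤ ℓ) where

    record Found (M R : ℕ) (τ : ℚ) : Set where
      field
        k r  : ℕ
        1≤k  : 1 ℕ.≤ k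
        k≤   : k ℕ.≤ M
        r≤   : r ℕ.≤ R
        gap≤ : At.gap (ℤ.+ k) r ≤ τ

    widen-found : ∀ {M R τ} → Found M R τ → Found M (suc R) τ
    widen-found x = record { k = k ; r = r ; 1≤k = 1≤k ; k≤ = k≤ ; r≤ = ℕₚ.m≤n⇒m≤1+n r≤ ; gap≤ = gap≤ }
      where open Found x

    Outcome : ℕ → ℚ → ℕ → ℕ → Set
    Outcome M τ r k = Found M r τ ⊎ fromℕ (suc r) * (τ - (8ϑ + 8ϑ)) ≤ 2ℚ - At.coarse (ℤ.+ k) r

    -- From one stage to the next k is multiplied by 2 ℓ and r decreases: steps become coarser and
    -- windows shorter, so energies increase up to small errors. If every stage fails, each
    -- contributes an increment to the second alternative.
    search : ∀ {M} τ r k → 1 ℕ.≤ k → k ℕ.* (2 ℕ.* ℓ) ℕ.^ r ℕ.≤ M → Outcome M τ r k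
    search {M} τ r k 1≤k k≤ = decide r k≤ (At.gap (ℤ.+ k) r ℚₚ.≤? τ)
      where
      nz : ∀ r → ℕ.NonZero ((2 ℕ.* ℓ) ℕ.^ r)
      nz r = ℕ.>-nonZero (ℕₚ.m^n>0 (2 ℕ.* ℓ) ⦃ ℕ.>-nonZero (ℕₚ.≤-trans 1≤ℓ (ℕₚ.m≤n*m ℓ 2)) ⦄ r)
      k≡ : (ℤ.+ k) *ᶻ (2ᶻ *ᶻ λ₂) ≡ ℤ.+ (k ℕ.* (2 ℕ.* ℓ))
      k≡ = sym (trans (pos-* k (2 ℕ.* ℓ)) (cong ((ℤ.+ k) *ᶻ_) (trans (pos-* 2 ℓ) (cong (2ᶻ *ᶻ_) (sym λ₂≡)))))
      extend : ∀ r → ¬ At.gap (ℤ.+ k) (suc r) ≤ τ → Outcome M τ r (k ℕ.* (2 ℕ.* ℓ)) → Outcome M τ (suc r) k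
      extend r ¬p (inj₁ x) = inj₁ (widen-found x)
      extend r ¬p (inj₂ h) = inj₂ (next-term {fromℕ (suc r)} {At.fine (ℤ.+ k) (suc r)} ¬p (subst (λ z → At.fine (ℤ.+ k) (suc r) ≤ At.coarse z r + 8ϑ) k≡ (descend-stage (ℤ.+ k) r)) h)
      decide : ∀ r → k ℕ.* (2 ℕ.* ℓ) ℕ.^ r ℕ.≤ M → Dec (At.gap (ℤ.+ k) r ≤ τ) → Outcome M τ r k
      decide r k≤ (yes p) = inj₁ (record { k = k ; r = r ; 1≤k = 1≤k ; k≤ = ℕₚ.≤-trans (ℕₚ.m≤m*n k ((2 ℕ.* ℓ) ℕ.^ r) ⦃ nz r ⦄) k≤ ; r≤ = ℕₚ.≤-refl ; gap≤ = p })
      decide zero k≤ (no ¬p) = inj₂ (last-term {At.fine (ℤ.+ k) 0} ¬p (At.fine≤2 (ℤ.+ k) 0) 0≤8ϑ)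
      decide (suc r) k≤ (no ¬p) = extend r ¬p (search τ r (k ℕ.* (2 ℕ.* ℓ)) (ℕₚ.*-mono-≤ 1≤k (ℕₚ.≤-trans 1≤ℓ (ℕₚ.m≤n*m ℓ 2)))
        (ℕₚ.≤-trans (ℕₚ.≤-reflexive (ℕₚ.*-assoc k (2 ℕ.* ℓ) _)) k≤))

-- The cyclic group

module Cyclic (N′ : ℕ) where

  N : ℤ
  N = ℤ.+ suc N′

  opaque
    class : ℤ → Fin (suc N′)
    class a = Fin.fromℕ< (ℤᵈ.n%ℕd<d a (suc N′))

    class-spec : ∀ a → Σ ℤ λ Q → a ≡ N *ᶻ Q +ᶻ ⟦ class a ⟧
    class-spec a = (a ℤᵈ./ℕ suc N′) , trans (euclid a (suc N′))
      (cong (λ t → N *ᶻ (a ℤᵈ./ℕ suc N′) +ᶻ ℤ.+ t) (sym (Finₚ.toℕ-fromℕ< (ℤᵈ.n%ℕd<d a (suc N′)))))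

  residue-unique : ∀ {Q Q′} (i j : Fin (suc N′)) → N *ᶻ Q +ᶻ ⟦ i ⟧ ≡ N *ᶻ Q′ +ᶻ ⟦ j ⟧ → i ≡ j
  residue-unique {Q} {Q′} i j e with i Fin.≟ j
  ... | yes p = p
  ... | no ¬p = contradiction (ℕₚ.≤-<-trans bound (ℕ.s≤s (∣⟦⟧-⟦⟧∣ i j))) (ℕₚ.<-irrefl refl)
    where
    split : ⟦ i ⟧ -ᶻ ⟦ j ⟧ ≡ N *ᶻ (Q′ -ᶻ Q)
    split = trans (solveᶻ 4 (λ n q i j → i ⊟ j ≔ (n ⊠ q ⊞ i) ⊟ n ⊠ q ⊟ j) refl N Q ⟦ i ⟧ ⟦ j ⟧)
      (trans (cong (λ t → t -ᶻ N *ᶻ Q -ᶻ ⟦ j ⟧) e) (solveᶻ 4 (λ n q r j → (n ⊠ r ⊞ j) ⊟ n ⊠ q ⊟ j ≔ n ⊠ (r ⊟ q)) refl N Q Q′ ⟦ j ⟧))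
    Q≢ : Q′ -ᶻ Q ≢ 0ℤ
    Q≢ z = ⟦⟧-injective ¬p (trans split (trans (cong (N *ᶻ_) z) (solveᶻ 1 (λ n → n ⊠ # 0ℤ ≔ # 0ℤ) refl N)))
    bound : suc N′ ℕ.≤ ℤ.∣ ⟦ i ⟧ -ᶻ ⟦ j ⟧ ∣
    bound = ℕₚ.≤-trans (ℕₚ.≤-trans (ℕₚ.≤-reflexive (sym (ℕₚ.*-identityʳ (suc N′)))) (ℕₚ.*-monoʳ-≤ (suc N′) (1≤∣∣ Q≢)))
      (ℕₚ.≤-reflexive (sym (trans (cong ℤ.∣_∣ split) (∣*∣ N (Q′ -ᶻ Q)))))

  class-≡ : ∀ {a} Q i → a ≡ N *ᶻ Q +ᶻ ⟦ i ⟧ → class a ≡ i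
  class-≡ {a} Q i e = let (Q′ , e′) = class-spec a in residue-unique (class a) i (trans (sym e′) e)

  class-index : ∀ i → class ⟦ i ⟧ ≡ i
  class-index i = class-≡ 0ℤ i (solveᶻ 2 (λ n x → x ≔ n ⊠ # 0ℤ ⊞ x) refl N ⟦ i ⟧)

  infixl 6 _⊕_
  _⊕_ : Fin (suc N′) → ℤ → Fin (suc N′)
  x ⊕ n = class (⟦ x ⟧ +ᶻ n)

  ⊕-assoc : ∀ x m n → x ⊕ m ⊕ n ≡ x ⊕ (m +ᶻ n)
  ⊕-assoc x m n = let (Q , e) = class-spec (⟦ x ⟧ +ᶻ m) ; (Q′ , e′) = class-spec (⟦ x ⊕ m ⟧ +ᶻ n) in
    sym (class-≡ (Q +ᶻ Q′) (x ⊕ m ⊕ n) (trans (solveᶻ 3 (λ x m n → x ⊞ (m ⊞ n) ≔ x ⊞ m ⊞ n) refl ⟦ x ⟧ m n)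
      (trans (cong (_+ᶻ n) e) (trans (solveᶻ 4 (λ N q c n → N ⊠ q ⊞ c ⊞ n ≔ N ⊠ q ⊞ (c ⊞ n)) refl N Q ⟦ x ⊕ m ⟧ n)
        (trans (cong (N *ᶻ Q +ᶻ_) e′) (solveᶻ 4 (λ N q r c → N ⊠ q ⊞ (N ⊠ r ⊞ c) ≔ N ⊠ (q ⊞ r) ⊞ c) refl N Q Q′ ⟦ x ⊕ m ⊕ n ⟧))))))

  ⊕-zero : ∀ x → x ⊕ 0ℤ ≡ x
  ⊕-zero x = trans (cong class (solveᶻ 1 (λ x → x ⊞ # 0ℤ ≔ x) refl ⟦ x ⟧)) (class-index x)

  -- Telescoping: rotation exchanges the term at 0 for the term at N, and these belong to the same
  -- class.
  E-rotate : ∀ (φ : Fin (suc N′) → ℚ) → E (uni N′) (φ ∘ (_⊕ ℤ.1ℤ)) ≡ E (uni N′) φ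
  E-rotate φ = trans (average-def N′ _) (trans (cong (_* 1/suc N′) sums) (sym (average-def N′ φ)))
    where
    ψ : ℕ → ℚ
    ψ k = φ (class (ℤ.+ k))
    wrap : ψ (suc N′) ≡ ψ 0
    wrap = cong φ (trans (class-≡ ℤ.1ℤ zero (solveᶻ 1 (λ n → n ≔ n ⊠ # ℤ.1ℤ ⊞ # 0ℤ) refl N)) (sym (class-index zero)))
    cancel : ∀ {a b c} → a + c ≡ b + c → a ≡ b
    cancel {a} {b} {c} e = trans (solve 2 (λ a c → a := a :+ c :- c) refl a c) (trans (cong (_- c) e) (solve 2 (λ b c → b :+ c :- c := b) refl b c))
    sums : sumF (suc N′) (φ ∘ (_⊕ ℤ.1ℤ)) ≡ sumF (suc N′) φ
    sums = trans (sumF-cong (suc N′) λ i → cong (φ ∘ class) (sym (+ᶻ-suc (toℕ i))))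
      (trans (cancel (trans (telescope (suc N′) ψ) (cong (sumF (suc N′) (ψ ∘ toℕ) +_) wrap)))
        (sumF-cong (suc N′) λ i → cong φ (class-index i)))

  E-shift-ℕ : ∀ φ k → E (uni N′) (φ ∘ (_⊕ ℤ.+ k)) ≡ E (uni N′) φ
  E-shift-ℕ φ zero    = E-cong (uni N′) λ x → cong φ (⊕-zero x)
  E-shift-ℕ φ (suc k) = trans (E-cong (uni N′) λ x → cong φ (trans (cong (x ⊕_) (trans (+ᶻ-suc k) (solveᶻ 2 (λ k o → k ⊞ o ≔ o ⊞ k) refl (ℤ.+ k) ℤ.1ℤ))) (sym (⊕-assoc x ℤ.1ℤ (ℤ.+ k)))))
    (trans (E-rotate (φ ∘ (_⊕ ℤ.+ k))) (E-shift-ℕ φ k))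

  cyclic : System
  cyclic = record
    { X = Fin (suc N′) ; space = uni N′ ; _⊕_ = _⊕_ ; ⊕-assoc = ⊕-assoc ; ⊕-zero = ⊕-zero ; E-inv = λ φ n → invariance φ n (sign-cases n) }
    where
    invariance : ∀ φ n → (Σ ℕ λ k → (n ≡ ℤ.+ k ⊎ n ≡ -ᶻ ℤ.+ k) × ℤ.∣ n ∣ ≡ k) → E (uni N′) (φ ∘ (_⊕ n)) ≡ E (uni N′) φ
    invariance φ n (k , inj₁ refl , _) = E-shift-ℕ φ k
    invariance φ n (k , inj₂ refl , _) = trans (sym (E-shift-ℕ (φ ∘ (_⊕ (-ᶻ ℤ.+ k))) k))
      (E-cong (uni N′) λ x → cong φ (trans (⊕-assoc x (ℤ.+ k) (-ᶻ ℤ.+ k)) (trans (cong (x ⊕_) (solveᶻ 1 (λ k → k ⊟ k ≔ # 0ℤ) refl (ℤ.+ k))) (⊕-zero x))))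

-- From the cyclic group back to the interval

indicator : Bool → ℚ
indicator true  = 1ℚ
indicator false = 0ℚ

0≤indicator : ∀ b → 0ℚ ≤ indicator b
0≤indicator true  = 0≤1
0≤indicator false = ≤-refl

indicator≤1 : ∀ b → indicator b ≤ 1ℚ
indicator≤1 true  = ≤-refl
indicator≤1 false = 0≤1

count-applyUpTo : ∀ (P : ℕ → Bool) h n → fromℕ (length (filterᵇ P (map suc (applyUpTo h n)))) ≡ sumF n (λ i → indicator (P (suc (h (toℕ i)))))
count-applyUpTo P h zero    = refl
count-applyUpTo P h (suc n) with P (suc (h 0))
... | true  = cong (1ℚ +_) (count-applyUpTo P (h ∘ suc) n)
... | false = trans (count-applyUpTo P (h ∘ suc) n) (sym (+-identityˡ _))

count-sum : ∀ N P → fromℕ (count N P) ≡ sumF N (λ i → indicator (P (suc (toℕ i))))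
count-sum N P = count-applyUpTo P id N

sumF-mono+ : ∀ n {φ ψ χ : Fin n → ℚ} → (∀ i → φ i ≤ ψ i + χ i) → sumF n φ ≤ sumF n ψ + sumF n χ
sumF-mono+ n {φ} {ψ} {χ} h = ≤-trans (sumF-mono n h) (≤-reflexive (sumF-+ n ψ χ))

-- Only the last D positions can wrap around.
overflow : ∀ n D → sumF n (λ i → indicator (n ℕ.≤ᵇ toℕ i ℕ.+ D)) ≤ fromℕ D
overflow zero    D = 0≤fromℕ D
overflow (suc n) D with suc n ℕₚ.≤? D
... | yes p = ≤-trans (sumF-mono (suc n) {ψ = λ _ → 1ℚ} λ i → indicator≤1 (suc n ℕ.≤ᵇ toℕ i ℕ.+ D))
                (≤-trans (≤-reflexive (trans (sumF-const (suc n) 1ℚ) (trans (*-comm _ 1ℚ) (*-identityˡ _)))) (fromℕ-mono p))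
... | no ¬p = ≤-trans (≤-reflexive (cong₂ (λ b s → indicator b + s) first (sumF-cong n λ i → cong indicator (step-≤ᵇ n (toℕ i ℕ.+ D)))))
                (≤-trans (≤-reflexive (+-identityˡ _)) (overflow n D))
  where
  first : (suc n ℕ.≤ᵇ D) ≡ false
  first with suc n ℕ.≤ᵇ D in eq
  ... | false = refl
  ... | true  = contradiction (ℕₚ.≤ᵇ⇒≤ (suc n) D (subst (λ b → Bool.T b) (sym eq) _)) ¬p
  step-≤ᵇ : ∀ a b → (suc a ℕ.≤ᵇ suc b) ≡ (a ℕ.≤ᵇ b)
  step-≤ᵇ zero    b = refl
  step-≤ᵇ (suc a) b = refl

module Counting (N′ : ℕ) (A : ℕ → Bool) where
  open Cyclic N′

  f : Fin (suc N′) → ℚ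
  f x = indicator (A (suc (toℕ x)))

  mean-f : E (uni N′) f ≡ fromℕ (count (suc N′) A) * 1/suc N′
  mean-f = trans (average-def N′ f) (cong (_* 1/suc N′) (sym (count-sum (suc N′) A)))

  opaque
    unfolding _+ᶻ_
    translate : ∀ (x : Fin (suc N′)) D → toℕ x ℕ.+ D ℕ.< suc N′ → f (x ⊕ ℤ.+ D) ≡ indicator ((ℤ.+ suc (toℕ x) ℤ.+ ℤ.+ D) ∈ℤ A)
    translate x D p = trans (cong f (trans (cong (λ t → class (ℤ.+ t)) (sym (Finₚ.toℕ-fromℕ< p))) (class-index (Fin.fromℕ< p))))
      (cong (λ t → indicator (A (suc t))) (Finₚ.toℕ-fromℕ< p))

  -- Position x stands for the integer x + 1. As D ≤ D², a position whose shift by D² stays in range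
  -- does not wrap around at all; the exceptions are charged to D².
  pattern-bound : ∀ D → 1 ℕ.≤ D →
    sumF (suc N′) (λ x → f x * (f (x ⊕ ℤ.+ D) * f (x ⊕ ℤ.+ (D ℕ.* D)))) ≤ fromℕ (patternCount (suc N′) A (ℤ.+ D)) + fromℕ (D ℕ.* D)
  pattern-bound D 1≤D = ≤-trans (sumF-mono+ (suc N′) pointwise)
    (+-mono-≤ (≤-reflexive (sym (count-sum (suc N′) shape)))
      (overflow (suc N′) (D ℕ.* D)))
    where
    shape : ℕ → Bool
    shape x = A x ∧ ((ℤ.+ x ℤ.+ ℤ.+ D) ∈ℤ A) ∧ ((ℤ.+ x ℤ.+ ℤ.+ D ℤ.* ℤ.+ D) ∈ℤ A)
    ∧-indicator : ∀ a b → indicator a * indicator b ≡ indicator (a ∧ b)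
    ∧-indicator true  b = *-identityˡ _
    ∧-indicator false b = zeroˡ _
    pointwise : ∀ x → f x * (f (x ⊕ ℤ.+ D) * f (x ⊕ ℤ.+ (D ℕ.* D))) ≤
      indicator (shape (suc (toℕ x))) + indicator (suc N′ ℕ.≤ᵇ toℕ x ℕ.+ D ℕ.* D)
    pointwise x with suc N′ ℕ.≤ᵇ toℕ x ℕ.+ D ℕ.* D in eq
    ... | true  = ≤-trans (proj₁ (Bd-* (b x) (Bd-* (b _) (b _)))) (≤-by _ (0≤indicator (shape (suc (toℕ x)))) (+-comm _ 1ℚ))
      where
      b : ∀ x → Bd (f x)
      b x = Bd-01 (0≤indicator (A (suc (toℕ x)))) (indicator≤1 (A (suc (toℕ x))))
    ... | false = ≤-reflexive (trans (trans (cong (f x *_) (trans (cong₂ _*_ (translate x D (ℕₚ.≤-<-trans (ℕₚ.+-monoʳ-≤ (toℕ x) D≤) in-range))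
          (trans (translate x (D ℕ.* D) in-range) (cong (λ t → indicator ((ℤ.+ suc (toℕ x) ℤ.+ t) ∈ℤ A)) (ℤₚ.pos-* D D))))
          (∧-indicator ((ℤ.+ suc (toℕ x) ℤ.+ ℤ.+ D) ∈ℤ A) ((ℤ.+ suc (toℕ x) ℤ.+ ℤ.+ D ℤ.* ℤ.+ D) ∈ℤ A))))
        (∧-indicator (A (suc (toℕ x))) (((ℤ.+ suc (toℕ x) ℤ.+ ℤ.+ D) ∈ℤ A) ∧ ((ℤ.+ suc (toℕ x) ℤ.+ ℤ.+ D ℤ.* ℤ.+ D) ∈ℤ A)))) (sym (+-identityʳ _)))
      where
      D≤ : D ℕ.≤ D ℕ.* D
      D≤ = ℕₚ.m≤m*n D D ⦃ ℕ.>-nonZero 1≤D ⦄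
      in-range : toℕ x ℕ.+ D ℕ.* D ℕ.< suc N′
      in-range = ℕₚ.≰⇒> λ h → absurd (trans (sym eq) (≤⇒true h))
        where
        absurd : ¬ false ≡ true
        absurd ()
        ≤⇒true : ∀ {a b} → a ℕ.≤ b → (a ℕ.≤ᵇ b) ≡ true
        ≤⇒true {a} {b} h with a ℕ.≤ᵇ b | ℕₚ.≤⇒≤ᵇ h
        ... | true | _ = refl

base-mono : ∀ {r R} → r ℕ.≤ R → base r ℕ.≤ base R
base-mono {R = R} ℕ.z≤n = ℕₚ.≤-trans (base≤ 0) ℕ.z≤n
base-mono (ℕ.s≤s p) = subst₂ ℕ._≤_ (sym (base-suc _)) (sym (base-suc _)) (ℕₚ.+-monoˡ-≤ 1700 (base-mono p))

-- The error budget and the popular difference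

module Pattern (scales : Scales) {κ : ℚ} (0<κ : 0ℚ < κ) (κ≤½ : κ ≤ ½) (θ≤ : 1/suc (Scales.n scales) ≤ κ ^^ (42 ℕ.+ nexts finalSteps 12))
  (R : ℕ) (stages : 1ℚ ≤ fromℕ (suc R) * κ ^^ 39)
  (N′ : ℕ) (N-large : fromℕ (Scales.T scales ℕ.^ (R ℕ.+ R ℕ.+ (base R ℕ.+ 1701)) ℕ.* Scales.T scales ℕ.^ (R ℕ.+ R ℕ.+ (base R ℕ.+ 1701))) ≤ κ ^^ 3 * fromℕ (suc N′))
  (A : ℕ → Bool) {δ : ℚ} (0≤δ : 0ℚ ≤ δ) (δ≤1 : δ ≤ 1ℚ) (dense : δ * fromℕ (suc N′) ≤ fromℕ (count (suc N′) A)) where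

  open Scales scales
  open Threshold (ℚₚ.<⇒≤ 0<κ) κ≤½
  open Cyclic N′ using (cyclic; _⊕_)
  open Counting N′ A
  open Search scales cyclic {f} (λ x → 0≤indicator (A (suc (toℕ x)))) (λ x → indicator≤1 (A (suc (toℕ x))))

  -- All errors must fit into κ. With c = κ⁵ the loss 4 c is at most κ³, which is also what wrapping
  -- around may cost; the lower bound needs η well below c³ = κ¹⁵; and the inverse theorem is used
  -- at level κ⁶, whence 12 = 6 + 6 in e.
  e η c : ℚ
  e = κ ^^ nexts finalSteps 12
  η = κ ^^ 18
  c = κ ^^ 5

  double : ∀ {x} m → x ≤ κ ^^ suc m → x + x ≤ κ ^^ m
  double m h = ≤-trans (+-mono-≤ h h) (^-half m)

  0≤ϑ : 0ℚ ≤ ϑ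
  0≤ϑ = 0≤1/suc n

  64ϑ≤e : let d = λ x → x + x in d (d (d (d (d (d ϑ))))) ≤ e
  64ϑ≤e = let N₀ = nexts finalSteps 12 in
    double N₀ (double (1 ℕ.+ N₀) (double (2 ℕ.+ N₀) (double (3 ℕ.+ N₀) (double (4 ℕ.+ N₀) (double (5 ℕ.+ N₀)
      (≤-trans θ≤ (^-anti {6 ℕ.+ N₀} {42 ℕ.+ N₀} (ℕₚ.+-monoˡ-≤ N₀ (ℕₚ.m≤m+n 6 36)))))))))

  ϑ≤^ : ∀ {m} → m ℕ.≤ 42 → ϑ ≤ κ ^^ m
  ϑ≤^ {m} p = ≤-trans θ≤ (^-anti {m} {42 ℕ.+ nexts finalSteps 12} (ℕₚ.≤-trans p (ℕₚ.m≤m+n 42 (nexts finalSteps 12))))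

  six : (ϑ + ϑ) + (η + (η + (ϑ + ϑ))) ≤ κ ^^ 15
  six = ≤-trans (≤-by (κ ^^ 17) (0≤^ 17) refl) (≤-trans
    (+-monoˡ-≤ (κ ^^ 17) (≤-trans (≤-reflexive (cong ((ϑ + ϑ) +_) (sym (+-assoc η η (ϑ + ϑ))))) (+-mono-≤ y≤ (+-mono-≤ (^-half 17) y≤))))
    (≤-trans (≤-reflexive (solve 1 (λ y → y :+ (y :+ y) :+ y := (y :+ y) :+ (y :+ y)) refl (κ ^^ 17))) (double 15 (^-half 16))))
    where
    y≤ : ϑ + ϑ ≤ κ ^^ 17
    y≤ = double 17 (ϑ≤^ (ℕₚ.m≤m+n 18 24))

  gap-constant : (η + (ϑ + ϑ)) + (η + (ϑ + ϑ)) ≤ c * c * c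
  gap-constant = ≤-trans (≤-reflexive (solve 2 (λ e t → (e :+ (t :+ t)) :+ (e :+ (t :+ t)) := (t :+ t) :+ (e :+ (e :+ (t :+ t)))) refl η ϑ))
    (≤-trans six (≤-reflexive (trans (^-+ 10 5) (cong (_* c) (^-+ 5 5)))))

  total-error : ℚ
  total-error = (κ ^^ 6 + κ ^^ 6) + ((ϑ + ϑ) + (η + (η + (ϑ + ϑ)))) + 4ℚ * c

  total-error≤ : total-error + κ ^^ 3 ≤ κ
  total-error≤ = ≤-trans (+-monoˡ-≤ (κ ^^ 3) (+-mono-≤ (+-mono-≤ (≤-trans (^-half 5) (^-anti (ℕₚ.m≤m+n 3 2))) (≤-trans six (^-anti (ℕₚ.m≤m+n 3 12))))
      (≤-trans (≤-reflexive (solve 1 (λ c → (con 1ℚ :+ con 1ℚ :+ (con 1ℚ :+ con 1ℚ)) :* c := (c :+ c) :+ (c :+ c)) refl c)) (double 3 (^-half 4)))))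
    (≤-trans (≤-reflexive (solve 1 (λ y → y :+ y :+ y :+ y := (y :+ y) :+ (y :+ y)) refl (κ ^^ 3)))
      (≤-trans (double 1 (^-half 2)) (≤-reflexive (solve 1 (λ k → k :* con 1ℚ := k) refl κ))))

  -- Of η² = κ³⁶ at least κ³⁷ is left after the errors, and κ³⁷ ≥ 4 κ³⁹. As (R + 1) κ³⁹ ≥ 1, the
  -- increments of R + 1 failed stages would add up to 4.
  many-stages : 2ℚ < fromℕ (suc R) * (η * η - (8ϑ + 8ϑ))
  many-stages = ℚₚ.<-≤-trans 2<4 (≤-trans four (*-monoˡ (0≤fromℕ (suc R)) margin))
    where
    opaque
      unfolding _+_
      2<4 : 2ℚ < 4ℚ
      2<4 = ℚ.*<* (ℤ.+<+ (ℕ.s≤s (ℕ.s≤s (ℕ.s≤s ℕ.z≤n))))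
    margin : κ ^^ 37 ≤ η * η - (8ϑ + 8ϑ)
    margin = ≤-by _ (0≤+ (0≤b-a (^-half 36)) (0≤b-a 16ϑ≤)) (trans (cong (_- (8ϑ + 8ϑ)) (sym (^-+ 18 18)))
      (solve 3 (λ a b t → a :- t := b :+ ((a :- (b :+ b)) :+ (b :- t))) refl (κ ^^ 36) (κ ^^ 37) (8ϑ + 8ϑ)))
      where
      16ϑ≤ : 8ϑ + 8ϑ ≤ κ ^^ 37
      16ϑ≤ = double 37 (double 38 (double 39 (double 40 (ϑ≤^ (ℕₚ.m≤m+n 41 1)))))
    s : ℚ
    s = fromℕ (suc R)
    four : 4ℚ ≤ s * κ ^^ 37
    four = begin
      4ℚ                         ≡⟨ sym (trans (*-comm 4ℚ 1ℚ) (*-identityˡ 4ℚ)) ⟩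
      4ℚ * 1ℚ                    ≤⟨ *-monoˡ (0≤+ 0≤2 0≤2) stages ⟩
      4ℚ * (s * κ ^^ 39)         ≤⟨ *-monoˡ (0≤+ 0≤2 0≤2) (*-monoˡ (0≤fromℕ (suc R)) (≤-trans (*-mono (ℚₚ.<⇒≤ 0<κ) (0≤* 0≤½ (0≤^ 37)) κ≤½ (*-monoʳ (0≤^ 37) κ≤½)) ≤-refl)) ⟩
      4ℚ * (s * (½ * (½ * κ ^^ 37))) ≡⟨ solve 2 (λ s k → (con 1ℚ :+ con 1ℚ :+ (con 1ℚ :+ con 1ℚ)) :* (s :* (con ½ :* (con ½ :* k))) := s :* k) refl s (κ ^^ 37) ⟩
      s * κ ^^ 37                ∎
      where open ℚₚ.≤-Reasoning

  λ₂-positive : PositiveInteger λ₂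
  λ₂-positive = positive-* two (positive-* (positive-* (positive-* h₁-positive (positive-* two h₁-positive)) λ̂-positive) λ̂-positive)
    where
    two : PositiveInteger 2ᶻ
    two = 2 , refl , ℕ.s≤s ℕ.z≤n
    λ̂-positive : PositiveInteger λ̂
    λ̂-positive = positive-* two ĥ-positive
    h₁-positive : PositiveInteger h₁
    h₁-positive = positive-* (positive-* (positive-* ĥ-positive λ̂-positive) λ̂-positive) λ̂-positive

  module Extract (ℓ : ℕ) (λ₂≡ : λ₂ ≡ ℤ.+ ℓ) (1≤ℓ : 1 ℕ.≤ ℓ) where
    -- The arguments are placeholders: only facts about T and λ₂ are drawn from this instance.
    open Stage 0ℤ 0 using (2≤T; 1≤T^; T^-mono; bound; fromL; λ₂L)

    Q-bound : (2 ℕ.* ℓ) ℕ.^ R ℕ.≤ T ℕ.^ (R ℕ.+ R)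
    Q-bound = ℕₚ.≤-trans (ℕₚ.^-monoˡ-≤ R (ℕₚ.*-mono-≤ 2≤T (ℕₚ.≤-trans (ℕₚ.≤-reflexive (sym (cong ℤ.∣_∣ λ₂≡))) (bound (fromL λ₂L)))))
      (ℕₚ.≤-reflexive (trans (ℕₚ.^-*-assoc T 2 R) (cong (λ t → T ℕ.^ (R ℕ.+ t)) (ℕₚ.+-identityʳ R))))

    found : Found ℓ λ₂≡ 1≤ℓ (T ℕ.^ (R ℕ.+ R)) R (η * η)
    found = choose (search ℓ λ₂≡ 1≤ℓ (η * η) R 1 ℕₚ.≤-refl (ℕₚ.≤-trans (ℕₚ.≤-reflexive (ℕₚ.*-identityˡ _)) Q-bound))
      where
      choose : Outcome ℓ λ₂≡ 1≤ℓ (T ℕ.^ (R ℕ.+ R)) (η * η) R 1 → Found ℓ λ₂≡ 1≤ℓ (T ℕ.^ (R ℕ.+ R)) R (η * η)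
      choose (inj₁ x) = x
      choose (inj₂ h) = contradiction (ℚₚ.<-≤-trans many-stages (≤-trans h
        (≤-by _ (At.0≤coarse (ℤ.+ 1) R) (solve 2 (λ t c → t := t :- c :+ c) refl 2ℚ (At.coarse (ℤ.+ 1) R))))) (ℚₚ.<-irrefl refl)

    open Found found
    private
      module S = Stage (ℤ.+ k) (base r)
      module 𝒞 = StageCount (scaled cyclic (ℤ.+ k)) (ℤ.+ k)

    δ≤mean : δ ≤ E (uni N′) f
    δ≤mean = ≤-trans (≤-reflexive (trans (trans (sym (*-identityˡ δ)) (*-comm 1ℚ δ)) (trans (cong (δ *_) (sym (suc*1/suc N′))) (sym (*-assoc δ _ _)))))
      (≤-trans (*-monoʳ (0≤1/suc N′) dense) (≤-reflexive (sym mean-f)))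

    16ϑ≤e : 2ℚ * (2ℚ * (2ℚ * (ϑ + ϑ))) ≤ e
    16ϑ≤e = ≤-trans (≤-by (k48 * ϑ) (0≤* (0≤fromℕ 48) 0≤ϑ) (expand ϑ)) 64ϑ≤e
      where
      k48 : ℚ
      k48 = fromℕ 48
      opaque
        unfolding _+_
        expand : ∀ t → let d = λ x → x + x in d (d (d (d (d (d t))))) ≡ (1ℚ + 1ℚ) * ((1ℚ + 1ℚ) * ((1ℚ + 1ℚ) * (t + t))) + fromℕ 48 * t
        expand t = solve 1 (λ t → let d = λ x → x :+ x ; two = con 1ℚ :+ con 1ℚ in
          d (d (d (d (d (d t))))) := two :* (two :* (two :* (t :+ t))) :+ con (fromℕ 48) :* t) refl t

    small : 4ℚ * (((ϑ + ϑ) + ((2ℚ * (ϑ + ϑ)) + (2ℚ * (ϑ + ϑ)))) + (ϑ + ϑ)) ≤ e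
    small = ≤-trans (≤-by (fromℕ 16 * ϑ) (0≤* (0≤fromℕ 16) 0≤ϑ) (expand ϑ)) 64ϑ≤e
      where
      opaque
        unfolding _+_
        expand : ∀ t → let d = λ x → x + x in d (d (d (d (d (d t))))) ≡ 4ℚ * (((t + t) + ((2ℚ * (t + t)) + (2ℚ * (t + t)))) + (t + t)) + fromℕ 16 * t
        expand t = solve 1 (λ t → let d = λ x → x :+ x ; two = con 1ℚ :+ con 1ℚ in
          d (d (d (d (d (d t))))) := (two :+ two) :* (((t :+ t) :+ (two :* (t :+ t) :+ two :* (t :+ t))) :+ (t :+ t)) :+ con (fromℕ 16) :* t) refl t

    ϑ≤e : ϑ ≤ e
    ϑ≤e = ≤-trans θ≤ (^-anti {nexts finalSteps 12} (ℕₚ.m≤n+m (nexts finalSteps 12) 42))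

    counted : δ * δ * δ ≤ 𝒞.Λ S.𝒟 f f f + total-error
    counted = S.Result.stage-count (scaled cyclic (ℤ.+ k)) 16ϑ≤e ϑ≤e small 0<κ κ≤½ 6 ≤-refl (0≤^ 18) (0<^ 0<κ 5) c≤1 gap-constant
      (λ x → 0≤indicator (A (suc (toℕ x)))) (λ x → indicator≤1 (A (suc (toℕ x))))
      (≤-trans (At.distance₁ (ℤ.+ k) r) gap≤) (≤-trans (At.distance₂ (ℤ.+ k) r) gap≤) 0≤δ δ≤1 δ≤mean
      where
      c≤1 : c ≤ 1ℚ
      c≤1 = ^-anti {0} {5} ℕ.z≤n

    step-of : Ix S.𝒟 → ℕ
    step-of i = k ℕ.* (toℕ i ℕ.+ 1)

    step-≡ : ∀ i → (ℤ.+ k) *ᶻ at S.𝒟 i ≡ ℤ.+ step-of i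
    step-≡ i = trans (cong ((ℤ.+ k) *ᶻ_) (trans (cong (_+ᶻ ℤ.1ℤ) (solveᶻ 1 (λ x → # ℤ.1ℤ ⊠ x ≔ x) refl ⟦ i ⟧)) (plus-one (toℕ i)))) (sym (pos-* k (toℕ i ℕ.+ 1)))
      where
      opaque
        unfolding _+ᶻ_
        plus-one : ∀ m → ℤ.+ m +ᶻ ℤ.1ℤ ≡ ℤ.+ (m ℕ.+ 1)
        plus-one m = refl

    square-≡ : ∀ i → (ℤ.+ k) *ᶻ ((ℤ.+ k) *ᶻ (at S.𝒟 i *ᶻ at S.𝒟 i)) ≡ ℤ.+ (step-of i ℕ.* step-of i)
    square-≡ i = trans (solveᶻ 2 (λ k d → k ⊠ (k ⊠ (d ⊠ d)) ≔ (k ⊠ d) ⊠ (k ⊠ d)) refl (ℤ.+ k) (at S.𝒟 i))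
      (trans (cong₂ _*ᶻ_ (step-≡ i) (step-≡ i)) (sym (pos-* (step-of i) (step-of i))))

    step-bound : ∀ i → step-of i ℕ.≤ T ℕ.^ (R ℕ.+ R ℕ.+ (base R ℕ.+ 1701))
    step-bound i = ℕₚ.≤-trans (ℕₚ.*-mono-≤ k≤ (ℕₚ.≤-trans (ℕₚ.≤-trans (ℕₚ.+-mono-≤ (ℕ.s≤s⁻¹ (Finₚ.toℕ<n i)) (1≤T^ (base r ℕ.+ 1700)))
        (ℕₚ.≤-trans (ℕₚ.≤-reflexive (cong (T ℕ.^ (base r ℕ.+ 1700) ℕ.+_) (sym (ℕₚ.+-identityʳ _)))) (ℕₚ.*-monoˡ-≤ (T ℕ.^ (base r ℕ.+ 1700)) 2≤T)))
        (T^-mono (ℕₚ.≤-trans (ℕₚ.≤-reflexive (sym (ℕₚ.+-suc (base r) 1700))) (ℕₚ.+-monoˡ-≤ 1701 (base-mono r≤))))))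
      (ℕₚ.≤-reflexive (sym (ℕₚ.^-distribˡ-+-* T (R ℕ.+ R) (base R ℕ.+ 1701))))

    1≤step : ∀ i → 1 ℕ.≤ step-of i
    1≤step i = ℕₚ.*-mono-≤ 1≤k (ℕₚ.m≤n+m 1 (toℕ i))

    term : Ix S.𝒟 → ℚ
    term i = 𝔼[ x ∈ uni N′ ] (f x * (f (x ⊕ ℤ.+ step-of i) * f (x ⊕ ℤ.+ (step-of i ℕ.* step-of i))))

    Λ-terms : 𝒞.Λ S.𝒟 f f f ≡ E (mean S.𝒟) term
    Λ-terms = trans (𝒞.Λ-flat S.𝒟 f f f) (trans (E-swap (uni N′) (mean S.𝒟) _) (E-cong (mean S.𝒟) λ i → E-cong (uni N′) λ x →
      cong (f x *_) (cong₂ (λ a b → f (x ⊕ a) * f (x ⊕ b)) (step-≡ i) (square-≡ i))))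

    popular : 0ℚ < δ * δ * δ - total-error → ∃ λ i → δ * δ * δ - total-error ≤ term i
    popular p = E-extract (mean S.𝒟) term p (≤-by _ (0≤b-a counted) (trans (sym Λ-terms)
      (solve 3 (λ l d t → l := (d :- t) :+ (l :+ t :- d)) refl (𝒞.Λ S.𝒟 f f f) (δ * δ * δ) total-error)))

  conclusion : ∃ λ D → 1 ℕ.≤ D × (δ * δ * δ - κ) * fromℕ (suc N′) ≤ fromℕ (patternCount (suc N′) A (ℤ.+ D))
  conclusion = cases (δ * δ * δ - κ ℚₚ.≤? 0ℚ)
    where
    ν : ℚ
    ν = fromℕ (suc N′)
    cases : Dec (δ * δ * δ - κ ≤ 0ℚ) → ∃ λ D → 1 ℕ.≤ D × (δ * δ * δ - κ) * ν ≤ fromℕ (patternCount (suc N′) A (ℤ.+ D))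
    -- If δ³ ≤ κ, the bound is trivial and d = 1 will do. Otherwise the threshold in `popular` is
    -- positive, as `E-extract` requires.
    cases (yes p) = 1 , ℕₚ.≤-refl , ≤-trans (*-monoʳ (0≤fromℕ (suc N′)) p) (≤-trans (≤-reflexive (zeroˡ ν)) (0≤fromℕ (patternCount (suc N′) A (ℤ.+ 1))))
    cases (no ¬p) = let (i , h) = X.popular (ℚₚ.<-≤-trans (ℚₚ.≰⇒> ¬p) larger) in X.step-of i , X.1≤step i , finish (X.step-of i) (X.1≤step i) (X.step-bound i) h
      where
      module X = Extract (proj₁ λ₂-positive) (proj₁ (proj₂ λ₂-positive)) (proj₂ (proj₂ λ₂-positive))
      larger : δ * δ * δ - κ ≤ δ * δ * δ - total-error
      larger = ≤-by _ (0≤+ (0≤b-a total-error≤) (0≤^ 3)) (solve 4 (λ d k t y → d :- t := (d :- k) :+ ((k :- (t :+ y)) :+ y)) refl (δ * δ * δ) κ total-error (κ ^^ 3))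
      L : ℕ
      L = T ℕ.^ (R ℕ.+ R ℕ.+ (base R ℕ.+ 1701))
      finish : ∀ D → 1 ℕ.≤ D → D ℕ.≤ L → δ * δ * δ - total-error ≤ 𝔼[ x ∈ uni N′ ] (f x * (f (x ⊕ ℤ.+ D) * f (x ⊕ ℤ.+ (D ℕ.* D)))) →
        (δ * δ * δ - κ) * ν ≤ fromℕ (patternCount (suc N′) A (ℤ.+ D))
      finish D 1≤D D≤L h = begin
        (δ * δ * δ - κ) * ν
          ≤⟨ *-monoʳ (0≤fromℕ (suc N′)) (≤-by _ (0≤b-a total-error≤) (solve 4 (λ d k t y → d :- t :- y := (d :- k) :+ (k :- (t :+ y))) refl (δ * δ * δ) κ total-error (κ ^^ 3))) ⟩
        (δ * δ * δ - total-error - κ ^^ 3) * ν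
          ≡⟨ solve 3 (λ a y n → (a :- y) :* n := a :* n :- y :* n) refl (δ * δ * δ - total-error) (κ ^^ 3) ν ⟩
        (δ * δ * δ - total-error) * ν - κ ^^ 3 * ν
          ≤⟨ +-monoˡ-≤ (- (κ ^^ 3 * ν)) (*-monoʳ (0≤fromℕ (suc N′)) h) ⟩
        E (uni N′) φ * ν - κ ^^ 3 * ν
          ≡⟨ cong (_- κ ^^ 3 * ν) (trans (cong (_* ν) (average-def N′ φ)) (trans (solve 3 (λ s i n → s :* i :* n := s :* (n :* i)) refl (sumF (suc N′) φ) (1/suc N′) ν)
               (trans (cong (sumF (suc N′) φ *_) (suc*1/suc N′)) (trans (*-comm _ 1ℚ) (*-identityˡ _))))) ⟩
        sumF (suc N′) φ - κ ^^ 3 * ν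
          ≤⟨ +-monoˡ-≤ (- (κ ^^ 3 * ν)) (pattern-bound D 1≤D) ⟩
        P + fromℕ (D ℕ.* D) - κ ^^ 3 * ν
          ≤⟨ +-monoˡ-≤ (- (κ ^^ 3 * ν)) (+-monoʳ-≤ P (≤-trans (fromℕ-mono (ℕₚ.*-mono-≤ D≤L D≤L)) N-large)) ⟩
        P + κ ^^ 3 * ν - κ ^^ 3 * ν
          ≡⟨ solve 2 (λ p y → p :+ y :- y := p) refl P (κ ^^ 3 * ν) ⟩
        P ∎
        where
        open ℚₚ.≤-Reasoning
        P : ℚ
        P = fromℕ (patternCount (suc N′) A (ℤ.+ D))
        φ : Fin (suc N′) → ℚ
        φ x = f x * (f (x ⊕ ℤ.+ D) * f (x ⊕ ℤ.+ (D ℕ.* D)))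

-- Choice of parameters

n≤2^n : ∀ n → n ℕ.≤ 2 ℕ.^ n
n≤2^n zero    = ℕ.z≤n
n≤2^n (suc n) = ℕₚ.≤-trans (ℕₚ.+-mono-≤ (ℕₚ.m^n>0 2 n) (n≤2^n n)) (ℕₚ.+-monoʳ-≤ (2 ℕ.^ n) (ℕₚ.≤-reflexive (sym (ℕₚ.+-identityʳ _))))

n!≤2^n² : ∀ n → n ! ℕ.≤ 2 ℕ.^ (n ℕ.* n)
n!≤2^n² zero    = ℕₚ.≤-refl
n!≤2^n² (suc n) = ℕₚ.≤-trans (ℕₚ.*-mono-≤ (n≤2^n (suc n)) (n!≤2^n² n)) (ℕₚ.≤-trans
  (ℕₚ.≤-reflexive (sym (ℕₚ.^-distribˡ-+-* 2 (suc n) (n ℕ.* n)))) (ℕₚ.^-monoʳ-≤ 2 (ℕₚ.+-monoʳ-≤ (suc n) (ℕₚ.*-monoʳ-≤ n (ℕₚ.n≤1+n n)))))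

-- Twice B! is divisible by every integer up to B = (n+1)⁹. The crude bound B! ≤ 2^(B²) gives λ̂ ≤
-- 2^s, so T = 2^(12 s) is at least λ̂¹², while log T remains polynomial in n.
module Tower (n B : ℕ) (B≡ : B ≡ suc n ℕ.^ 9) (4≤n : 4 ℕ.≤ suc n) where

  F : ℕ
  F = B !

  opaque
    s T : ℕ
    s = 1 ℕ.+ B ℕ.* B
    T = 2 ℕ.^ (s ℕ.* 12)

    s-def : s ≡ 1 ℕ.+ B ℕ.* B
    s-def = refl

    T-def : T ≡ 2 ℕ.^ (s ℕ.* 12)
    T-def = refl

    2^s : 2 ℕ.* 2 ℕ.^ (B ℕ.* B) ≡ 2 ℕ.^ s
    2^s = refl

  ĥ : ℤ
  ĥ = ℤ.+ F

  λ̂-size : ℤ.∣ 2ᶻ *ᶻ ĥ ∣ ≡ 2 ℕ.* F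
  λ̂-size = ∣*∣ 2ᶻ ĥ

  λ̂≤ : ℤ.∣ 2ᶻ *ᶻ ĥ ∣ ℕ.≤ 2 ℕ.^ s
  λ̂≤ = ℕₚ.≤-trans (ℕₚ.≤-reflexive λ̂-size) (ℕₚ.≤-trans (ℕₚ.*-monoʳ-≤ 2 (n!≤2^n² B)) (ℕₚ.≤-reflexive 2^s))

  λ̂≤T : ℤ.∣ 2ᶻ *ᶻ ĥ ∣ ℕ.^ 12 ℕ.≤ T
  λ̂≤T = ℕₚ.≤-trans (ℕₚ.^-monoˡ-≤ 12 λ̂≤) (ℕₚ.≤-reflexive (trans (ℕₚ.^-*-assoc 2 s 12) (sym T-def)))

  2^≤T : ∀ {a} → a ℕ.≤ s → 2 ℕ.^ a ℕ.≤ T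
  2^≤T p = ℕₚ.≤-trans (ℕₚ.^-monoʳ-≤ 2 (ℕₚ.≤-trans p (ℕₚ.m≤m*n s 12))) (ℕₚ.≤-reflexive (sym T-def))

  1≤B : 1 ℕ.≤ B
  1≤B = subst (1 ℕ.≤_) (sym B≡) (ℕₚ.m^n>0 (suc n) 9)

  B≤T : B ℕ.≤ T
  B≤T = ℕₚ.≤-trans (n≤2^n B) (2^≤T (ℕₚ.≤-trans (ℕₚ.m≤n⇒m≤1+n (ℕₚ.m≤m*n B B ⦃ ℕ.>-nonZero 1≤B ⦄)) (ℕₚ.≤-reflexive (sym s-def))))

  n⁹≤T : suc n ℕ.^ 9 ℕ.≤ T
  n⁹≤T = subst (ℕ._≤ T) B≡ B≤T

  4n≤T : 4 ℕ.* suc n ℕ.≤ T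
  4n≤T = ℕₚ.≤-trans (ℕₚ.≤-trans (ℕₚ.*-monoˡ-≤ (suc n) 4≤n) (ℕₚ.≤-trans (ℕₚ.≤-reflexive (cong (suc n ℕ.*_) (sym (ℕₚ.*-identityʳ (suc n))))) (ℕₚ.^-monoʳ-≤ (suc n) {2} {9} (ℕₚ.m≤m+n 2 7)))) n⁹≤T

  2≤λ̂ : 2 ℕ.≤ ℤ.∣ 2ᶻ *ᶻ ĥ ∣
  2≤λ̂ = ℕₚ.≤-trans (ℕₚ.*-monoʳ-≤ 2 (ℕₚ.1≤n! B)) (ℕₚ.≤-reflexive (sym λ̂-size))

  ∣-factorial : ∀ {m} → 1 ℕ.≤ m → m ℕ.≤ B → m ∣ F
  ∣-factorial {suc m} _ m≤B = ∣-trans (m∣m*n (m !)) (m≤n⇒m!∣n! m≤B)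

  divisible : ∀ τ → τ ≢ 0ℤ → ℤ.∣ τ ∣ ℕ.≤ suc n ℕ.^ 9 → Σ ℤ λ τ′ → 2ᶻ *ᶻ ĥ ≡ τ *ᶻ τ′ × ℤ.∣ τ′ ∣ ℕ.≤ T
  divisible τ τ≢ h with sign-cases τ | ∣-factorial (1≤∣∣ τ≢) (subst (ℤ.∣ τ ∣ ℕ.≤_) (sym B≡) h)
  ... | k , s , refl | divides c F≡ = quotient s
    where
    ĥ≡ : ĥ ≡ (ℤ.+ c) *ᶻ (ℤ.+ k)
    ĥ≡ = trans (cong ℤ.+_ F≡) (pos-* c k)
    2c≤T : 2 ℕ.* c ℕ.≤ T
    2c≤T = ℕₚ.≤-trans (ℕₚ.≤-trans (ℕₚ.*-monoʳ-≤ 2 (ℕₚ.≤-trans (ℕₚ.m≤m*n c k ⦃ ℕ.>-nonZero (1≤∣∣ τ≢) ⦄) (ℕₚ.≤-reflexive (sym F≡)))) (ℕₚ.≤-trans (ℕₚ.≤-reflexive (sym λ̂-size)) λ̂≤)) (2^≤T ℕₚ.≤-refl)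
    quotient : (τ ≡ ℤ.+ k ⊎ τ ≡ -ᶻ ℤ.+ k) → Σ ℤ λ τ′ → 2ᶻ *ᶻ ĥ ≡ τ *ᶻ τ′ × ℤ.∣ τ′ ∣ ℕ.≤ T
    quotient (inj₁ e) = 2ᶻ *ᶻ ℤ.+ c , trans (cong (2ᶻ *ᶻ_) ĥ≡) (trans (solveᶻ 2 (λ c k → # 2ᶻ ⊠ (c ⊠ k) ≔ k ⊠ (# 2ᶻ ⊠ c)) refl (ℤ.+ c) (ℤ.+ k)) (cong (_*ᶻ (2ᶻ *ᶻ ℤ.+ c)) (sym e))) ,
      ℕₚ.≤-trans (ℕₚ.≤-reflexive (∣*∣ 2ᶻ (ℤ.+ c))) 2c≤T
    quotient (inj₂ e) = -ᶻ (2ᶻ *ᶻ ℤ.+ c) , trans (cong (2ᶻ *ᶻ_) ĥ≡) (trans (solveᶻ 2 (λ c k → # 2ᶻ ⊠ (c ⊠ k) ≔ (⊟ k) ⊠ (⊟ (# 2ᶻ ⊠ c))) refl (ℤ.+ c) (ℤ.+ k)) (cong (_*ᶻ (-ᶻ (2ᶻ *ᶻ ℤ.+ c))) (sym e))) ,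
      ℕₚ.≤-trans (ℕₚ.≤-reflexive (trans (∣-∣ (2ᶻ *ᶻ ℤ.+ c)) (∣*∣ 2ᶻ (ℤ.+ c)))) 2c≤T

  ĥ-positive : PositiveInteger ĥ
  ĥ-positive = F , refl , ℕₚ.1≤n! B

  scales : Scales
  scales = record
    { T = T ; n = n ; ĥ = ĥ ; 4n≤T = 4n≤T ; 4≤n = 4≤n ; n⁹≤T = n⁹≤T ; ĥ-positive = ĥ-positive
    ; 2≤λ̂ = 2≤λ̂ ; λ̂≤T = λ̂≤T ; divisible = divisible }

opaque
  -- What the inverse theorem requires of e at level 12, plus the 42 that the error budget asks of
  -- 1/(n+1).
  E₀ : ℕ
  E₀ = 42 ℕ.+ nexts finalSteps 12

  E₀-def : E₀ ≡ 42 ℕ.+ nexts finalSteps 12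
  E₀-def = refl

  -- Collects the bounds for k = 12 s X in `Parameters`: s ≤ K^(1 + 18 E₀), 12 ≤ K⁴ and X ≤ K^(12 +
  -- 39).
  Ê : ℕ
  Ê = 1 ℕ.+ (E₀ ℕ.* 9 ℕ.+ E₀ ℕ.* 9) ℕ.+ 4 ℕ.+ (12 ℕ.+ 39)

  Ê-def : Ê ≡ 1 ℕ.+ (E₀ ℕ.* 9 ℕ.+ E₀ ℕ.* 9) ℕ.+ 4 ℕ.+ (12 ℕ.+ 39)
  Ê-def = refl

  1≤Ê : 1 ℕ.≤ Ê
  1≤Ê = ℕ.s≤s ℕ.z≤n

-- K is tied to `suc K′` by an equation, as are n, B and R below to powers, so that huge numbers
-- stay unevaluated.
module PowerReciprocal (K′ K : ℕ) (K≡ : K ≡ suc K′) where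

  κ : ℚ
  κ = 1/suc K′

  K*κ : fromℕ K * κ ≡ 1ℚ
  K*κ = trans (cong (λ m → fromℕ m * κ) K≡) (suc*1/suc K′)

  pow-inverse : ∀ j → fromℕ (K ^ j) * κ ^^ j ≡ 1ℚ
  pow-inverse zero    = solve 0 ((con 1ℚ :+ con 0ℚ) :* con 1ℚ := con 1ℚ) refl
  pow-inverse (suc j) = trans (cong (_* κ ^^ suc j) (fromℕ-* K (K ^ j)))
    (trans (solve 4 (λ a b c d → a :* b :* (c :* d) := (a :* c) :* (b :* d)) refl (fromℕ K) (fromℕ (K ^ j)) κ (κ ^^ j))
      (trans (cong₂ _*_ K*κ (pow-inverse j)) (*-identityˡ 1ℚ)))

  reciprocal-power : ∀ {n} j → suc n ≡ K ^ j → 1/suc n ≡ κ ^^ j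
  reciprocal-power {n} j e = begin
    1/suc n                                ≡⟨ sym (trans (*-comm _ 1ℚ) (*-identityˡ _)) ⟩
    1/suc n * 1ℚ                           ≡⟨ cong (1/suc n *_) (sym (pow-inverse j)) ⟩
    1/suc n * (fromℕ (K ^ j) * κ ^^ j)     ≡⟨ cong (λ m → 1/suc n * (fromℕ m * κ ^^ j)) (sym e) ⟩
    1/suc n * (fromℕ (suc n) * κ ^^ j)     ≡⟨ solve 3 (λ a b c → a :* (b :* c) := b :* a :* c) refl (1/suc n) (fromℕ (suc n)) (κ ^^ j) ⟩
    fromℕ (suc n) * 1/suc n * κ ^^ j       ≡⟨ trans (cong (_* κ ^^ j) (suc*1/suc n)) (*-identityˡ _) ⟩
    κ ^^ j                                 ∎
    where open ≡-Reasoning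

  0<κ : 0ℚ < κ
  0<κ = ℚₚ.positive⁻¹ κ ⦃ ℚₚ.normalize-pos 1 (suc K′) ⦄

  κ≤½ : 2 ℕ.≤ K → κ ≤ ½
  κ≤½ h = ≤-trans (≤-reflexive (solve 1 (λ k → k := con ½ :* ((con 1ℚ :+ (con 1ℚ :+ con 0ℚ)) :* k)) refl κ))
    (≤-trans (*-monoˡ 0≤½ (≤-trans (*-monoʳ (0≤1/suc K′) (fromℕ-mono h)) (≤-reflexive K*κ))) (≤-reflexive (trans (*-comm ½ 1ℚ) (*-identityˡ ½))))

  κ≤ : ∀ {ε} → 1ℚ ≤ fromℕ K * ε → κ ≤ ε
  κ≤ {ε} h = ≤-trans (≤-reflexive (sym (trans (*-comm κ 1ℚ) (*-identityˡ κ)))) (≤-trans (*-monoˡ (0≤1/suc K′) h)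
    (≤-reflexive (trans (solve 3 (λ k K e → k :* (K :* e) := K :* k :* e) refl κ (fromℕ K) ε) (trans (cong (_* ε) K*κ) (*-identityˡ ε)))))

private
  1≤den*ε : ∀ ε → 0ℚ < ε → ∃ λ m → 1ℚ ≤ fromℕ (suc m) * ε
  1≤den*ε ε@(ℚ.mkℚ (ℤ.+ zero) d c) 0<ε = contradiction (ℚₚ.drop-*<* 0<ε) λ { (ℤ.+<+ ()) }
  1≤den*ε ε@(ℚ.mkℚ ℤ.-[1+ p ] d c) 0<ε = contradiction (ℚₚ.drop-*<* 0<ε) λ ()
  1≤den*ε ε@(ℚ.mkℚ (ℤ.+ suc p) d c) 0<ε = d , ≤-trans (≤-reflexive (sym (suc*1/suc d))) (*-monoˡ (0≤fromℕ (suc d)) 1/d≤)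
    where
    1/d≤ : 1/suc d ≤ ε
    1/d≤ = ℚₚ.toℚᵘ-cancel-≤ (ℚᵘₚ.≤-trans (ℚᵘₚ.≤-reflexive (ℚₚ.toℚᵘ-fromℚᵘ (ℚᵘ.mkℚᵘ (ℤ.+ 1) d)))
      (ℚᵘ.*≤* (ℤₚ.*-monoʳ-≤-nonNeg (ℤ.+ suc d) {ℤ.+ 1} {ℤ.+ suc p} (ℤ.+≤+ (ℕ.s≤s (ℕ.z≤n {p}))))))

  least : ∀ {ε} m → 1ℚ ≤ fromℕ (suc m) * ε → ∃ λ K′ → 1ℚ ≤ fromℕ (suc K′) * ε × fromℕ K′ * ε ≤ 1ℚ
  least {ε} zero    h = 0 , h , ≤-trans (≤-reflexive (zeroˡ ε)) 0≤1
  least {ε} (suc m) h with 1ℚ ℚₚ.≤? fromℕ (suc m) * ε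
  ... | yes p = least m p
  ... | no ¬p = suc m , h , ℚₚ.<⇒≤ (ℚₚ.≰⇒> ¬p)

-- K is the least integer with K ε ≥ 1, so that 1/K ≤ ε. Minimality gives (K - 1) ε ≤ 1, and with ε
-- ≤ 1/2 this yields K ε² ≤ 1.
scale-for : ∀ ε → 0ℚ < ε → ε ≤ ½ → ∃ λ K′ → 2 ℕ.≤ suc K′ × 1ℚ ≤ fromℕ (suc K′) * ε × fromℕ (suc K′) * (ε * ε) ≤ 1ℚ
scale-for ε 0<ε ε≤½ = let (m , h) = 1≤den*ε ε 0<ε ; (K′ , p , r) = least m h in K′ , large K′ p , p , bounded K′ r
  where
  0≤ε : 0ℚ ≤ ε
  0≤ε = ℚₚ.<⇒≤ 0<ε
  ½<1 : ½ < 1ℚ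
  ½<1 = ℚ.*<* (ℤ.+<+ (ℕ.s≤s (ℕ.s≤s ℕ.z≤n)))
  large : ∀ K′ → 1ℚ ≤ fromℕ (suc K′) * ε → 2 ℕ.≤ suc K′
  large zero    p = contradiction (ℚₚ.≤-<-trans (≤-trans p (≤-trans (≤-reflexive (solve 1 (λ e → (con 1ℚ :+ con 0ℚ) :* e := e) refl ε)) ε≤½)) ½<1) (ℚₚ.<-irrefl refl)
  large (suc _) p = ℕ.s≤s (ℕ.s≤s ℕ.z≤n)
  bounded : ∀ K′ → fromℕ K′ * ε ≤ 1ℚ → fromℕ (suc K′) * (ε * ε) ≤ 1ℚ
  bounded K′ r = begin
    fromℕ (suc K′) * (ε * ε)            ≡⟨ solve 2 (λ k e → (con 1ℚ :+ k) :* (e :* e) := e :* e :+ (k :* e) :* e) refl (fromℕ K′) ε ⟩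
    ε * ε + (fromℕ K′ * ε) * ε          ≤⟨ +-mono-≤ (*-mono 0≤ε 0≤1 ε≤½ (≤-trans ε≤½ (ℚₚ.<⇒≤ ½<1))) (*-mono (0≤* (0≤fromℕ K′) 0≤ε) 0≤½ r ε≤½) ⟩
    ½ * 1ℚ + 1ℚ * ½                     ≡⟨ solve 0 (con ½ :* con 1ℚ :+ con 1ℚ :* con ½ := con 1ℚ) refl ⟩
    1ℚ                                  ∎
    where open ℚₚ.≤-Reasoning

^ℚ-^^ : ∀ ε j → ε ^ℚ j ≡ ε ^^ j
^ℚ-^^ ε zero    = refl
^ℚ-^^ ε (suc j) = trans (*-coeff ε (ε ^ℚ j)) (cong (ε *_) (^ℚ-^^ ε j))

-- As K ε² ≤ 1, a bound polynomial in K is polynomial in 1/ε.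
polynomial-bound : ∀ {ε} K → 0ℚ ≤ ε → fromℕ K * (ε * ε) ≤ 1ℚ → ∀ j → fromℕ (K ^ j) * ε ^^ (j ℕ.+ j) ≤ 1ℚ
polynomial-bound {ε} K 0≤ε h zero    = ≤-reflexive (solve 0 ((con 1ℚ :+ con 0ℚ) :* con 1ℚ := con 1ℚ) refl)
polynomial-bound {ε} K 0≤ε h (suc j) = begin
  fromℕ (K ^ suc j) * ε ^^ (suc j ℕ.+ suc j)               ≡⟨ cong₂ (λ a b → a * (ε * ε ^^ b)) (fromℕ-* K (K ^ j)) (ℕₚ.+-suc j j) ⟩
  fromℕ K * fromℕ (K ^ j) * (ε * (ε * ε ^^ (j ℕ.+ j)))     ≡⟨ solve 4 (λ k p e x → k :* p :* (e :* (e :* x)) := (k :* (e :* e)) :* (p :* x)) refl (fromℕ K) (fromℕ (K ^ j)) ε (ε ^^ (j ℕ.+ j)) ⟩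
  fromℕ K * (ε * ε) * (fromℕ (K ^ j) * ε ^^ (j ℕ.+ j))     ≤⟨ *-mono (0≤* (0≤fromℕ K) (0≤sq ε)) 0≤1 h (polynomial-bound K 0≤ε h j) ⟩
  1ℚ * 1ℚ                                                  ≡⟨ *-identityˡ 1ℚ ⟩
  1ℚ                                                       ∎
  where open ℚₚ.≤-Reasoning

module Parameters (K′ K : ℕ) (K≡ : K ≡ suc K′) (2≤K : 2 ℕ.≤ K) (n : ℕ) (n≡ : suc n ≡ K ^ E₀) (B : ℕ) (B≡ : B ≡ suc n ^ 9)
  (R : ℕ) (R≡ : suc R ≡ K ^ 39) where
  open PowerReciprocal K′ K K≡

  instance
    K-nonZero : ℕ.NonZero K
    K-nonZero = ℕ.>-nonZero (ℕₚ.≤-trans (ℕ.s≤s ℕ.z≤n) 2≤K)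

  2≤E₀ : 2 ℕ.≤ E₀
  2≤E₀ = subst (2 ℕ.≤_) (sym E₀-def) (ℕ.s≤s (ℕ.s≤s ℕ.z≤n))

  K^-mono : ∀ {a b} → a ℕ.≤ b → K ^ a ℕ.≤ K ^ b
  K^-mono = ℕₚ.^-monoʳ-≤ K

  4≤n : 4 ℕ.≤ suc n
  4≤n = subst (4 ℕ.≤_) (sym n≡) (ℕₚ.≤-trans (ℕₚ.^-monoˡ-≤ 2 2≤K) (K^-mono 2≤E₀))

  open Tower n B B≡ 4≤n

  -- T^Y bounds the difference: the multiplier found by the search is at most T^(2R), and the number
  -- it multiplies is at most T^(base R + 1701). As T ≥ K, a modulus above T^X makes the square of
  -- the difference at most κ³ N.
  X Y k : ℕ
  Y = R ℕ.+ R ℕ.+ (base R ℕ.+ 1701)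
  X = Y ℕ.+ Y ℕ.+ 3
  k = s ℕ.* 12 ℕ.* X

  k≤ : k ℕ.≤ K ^ Ê
  k≤ = subst (λ j → k ℕ.≤ K ^ j) (sym Ê-def) (begin
    s ℕ.* 12 ℕ.* X                                         ≤⟨ ℕₚ.*-mono-≤ (ℕₚ.*-mono-≤ s≤ (ℕₚ.≤-trans (ℕₚ.m≤m+n 12 4) (ℕₚ.^-monoˡ-≤ 4 2≤K))) X≤ ⟩
    K ^ (1 ℕ.+ D) ℕ.* K ^ 4 ℕ.* (K ^ 12 ℕ.* K ^ 39)        ≡⟨ cong₂ ℕ._*_ (sym (ℕₚ.^-distribˡ-+-* K (1 ℕ.+ D) 4)) (sym (ℕₚ.^-distribˡ-+-* K 12 39)) ⟩
    K ^ (1 ℕ.+ D ℕ.+ 4) ℕ.* K ^ (12 ℕ.+ 39)                ≡⟨ sym (ℕₚ.^-distribˡ-+-* K (1 ℕ.+ D ℕ.+ 4) (12 ℕ.+ 39)) ⟩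
    K ^ (1 ℕ.+ D ℕ.+ 4 ℕ.+ (12 ℕ.+ 39))                    ∎)
    where
    open ℕₚ.≤-Reasoning
    D : ℕ
    D = E₀ ℕ.* 9 ℕ.+ E₀ ℕ.* 9
    B*B≡ : B ℕ.* B ≡ K ^ D
    B*B≡ = trans (cong (λ b → b ℕ.* b) (trans B≡ (trans (cong (_^ 9) n≡) (ℕₚ.^-*-assoc K E₀ 9)))) (sym (ℕₚ.^-distribˡ-+-* K (E₀ ℕ.* 9) (E₀ ℕ.* 9)))
    s≤ : s ℕ.≤ K ^ (1 ℕ.+ D)
    s≤ = begin
      s                     ≡⟨ s-def ⟩
      1 ℕ.+ B ℕ.* B         ≡⟨ cong (1 ℕ.+_) B*B≡ ⟩
      1 ℕ.+ K ^ D           ≤⟨ ℕₚ.+-monoˡ-≤ (K ^ D) (ℕₚ.m^n>0 K D) ⟩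
      K ^ D ℕ.+ K ^ D       ≡⟨ cong (K ^ D ℕ.+_) (sym (ℕₚ.+-identityʳ (K ^ D))) ⟩
      2 ℕ.* K ^ D           ≤⟨ ℕₚ.*-monoˡ-≤ (K ^ D) 2≤K ⟩
      K ℕ.* K ^ D           ∎
    X≤ : X ℕ.≤ K ^ 12 ℕ.* K ^ 39
    X≤ = begin
      Y ℕ.+ Y ℕ.+ 3                          ≤⟨ ℕₚ.+-monoˡ-≤ 3 (ℕₚ.+-mono-≤ Y≤ Y≤) ⟩
      Y′ ℕ.+ Y′ ℕ.+ 3                        ≡⟨ collect R ⟩
      R ℕ.* 3404 ℕ.+ 3405                    ≤⟨ ℕₚ.+-monoˡ-≤ 3405 (ℕₚ.*-monoʳ-≤ R (ℕₚ.n≤1+n 3404)) ⟩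
      R ℕ.* 3405 ℕ.+ 3405                    ≡⟨ trans (ℕₚ.+-comm (R ℕ.* 3405) 3405) (ℕₚ.*-comm (suc R) 3405) ⟩
      3405 ℕ.* suc R                         ≤⟨ ℕₚ.*-mono-≤ (ℕₚ.≤-trans (ℕₚ.m≤m+n 3405 691) (ℕₚ.^-monoˡ-≤ 12 2≤K)) (ℕₚ.≤-reflexive R≡) ⟩
      K ^ 12 ℕ.* K ^ 39                      ∎
      where
      Y′ : ℕ
      Y′ = R ℕ.+ R ℕ.+ (R ℕ.* 1700 ℕ.+ 1701)
      Y≤ : Y ℕ.≤ Y′
      Y≤ = ℕₚ.+-monoʳ-≤ (R ℕ.+ R) (ℕₚ.+-monoˡ-≤ 1701 (base≤ R))
      collect : ∀ r → (r ℕ.+ r ℕ.+ (r ℕ.* 1700 ℕ.+ 1701)) ℕ.+ (r ℕ.+ r ℕ.+ (r ℕ.* 1700 ℕ.+ 1701)) ℕ.+ 3 ≡ r ℕ.* 3404 ℕ.+ 3405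
      collect = solve-∀

  module Large (N′ : ℕ) (N>2^k : ¬ suc N′ ℕ.≤ 2 ^ k) where

    K≤T : K ℕ.≤ T
    K≤T = ℕₚ.≤-trans (ℕₚ.≤-trans (ℕₚ.≤-reflexive (sym (ℕₚ.*-identityʳ K))) (ℕₚ.≤-trans (K^-mono (ℕₚ.≤-trans (ℕ.s≤s ℕ.z≤n) 2≤E₀)) (ℕₚ.≤-reflexive (sym n≡)))) (ℕₚ.≤-trans (ℕₚ.m≤n*m (suc n) 4) 4n≤T)

    L : ℕ
    L = T ^ Y

    L²K³≤N : L ℕ.* L ℕ.* K ^ 3 ℕ.≤ suc N′
    L²K³≤N = begin
      L ℕ.* L ℕ.* K ^ 3              ≤⟨ ℕₚ.*-monoʳ-≤ (L ℕ.* L) (ℕₚ.^-monoˡ-≤ 3 K≤T) ⟩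
      L ℕ.* L ℕ.* T ^ 3              ≡⟨ cong (ℕ._* T ^ 3) (sym (ℕₚ.^-distribˡ-+-* T Y Y)) ⟩
      T ^ (Y ℕ.+ Y) ℕ.* T ^ 3        ≡⟨ sym (ℕₚ.^-distribˡ-+-* T (Y ℕ.+ Y) 3) ⟩
      T ^ X                          ≡⟨ trans (cong (_^ X) T-def) (ℕₚ.^-*-assoc 2 (s ℕ.* 12) X) ⟩
      2 ^ k                          ≤⟨ ℕₚ.<⇒≤ (ℕₚ.≰⇒> N>2^k) ⟩
      suc N′                         ∎
      where open ℕₚ.≤-Reasoning

    N-large : fromℕ (L ℕ.* L) ≤ κ ^^ 3 * fromℕ (suc N′)
    N-large = begin
      fromℕ (L ℕ.* L)                                  ≡⟨ sym (trans (*-comm _ 1ℚ) (*-identityˡ _)) ⟩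
      fromℕ (L ℕ.* L) * 1ℚ                             ≡⟨ cong (fromℕ (L ℕ.* L) *_) (sym (pow-inverse 3)) ⟩
      fromℕ (L ℕ.* L) * (fromℕ (K ^ 3) * κ ^^ 3)       ≡⟨ trans (sym (*-assoc _ _ _)) (cong (_* κ ^^ 3) (sym (fromℕ-* (L ℕ.* L) (K ^ 3)))) ⟩
      fromℕ (L ℕ.* L ℕ.* K ^ 3) * κ ^^ 3               ≤⟨ *-monoʳ (Threshold.0≤^ (ℚₚ.<⇒≤ 0<κ) (κ≤½ 2≤K) 3) (fromℕ-mono L²K³≤N) ⟩
      fromℕ (suc N′) * κ ^^ 3                          ≡⟨ *-comm _ _ ⟩
      κ ^^ 3 * fromℕ (suc N′)                          ∎
      where open ℚₚ.≤-Reasoning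

    popular-difference : (A : ℕ → Bool) {δ : ℚ} → 0ℚ ≤ δ → δ ≤ 1ℚ → δ * fromℕ (suc N′) ≤ fromℕ (count (suc N′) A) →
      ∃ λ D → 1 ℕ.≤ D × (δ * δ * δ - κ) * fromℕ (suc N′) ≤ fromℕ (patternCount (suc N′) A (ℤ.+ D))
    popular-difference A 0≤δ δ≤1 dense = Pattern.conclusion scales 0<κ (κ≤½ 2≤K)
      (≤-reflexive (trans (reciprocal-power E₀ n≡) (cong (κ ^^_) E₀-def))) R
      (≤-reflexive (sym (trans (cong (λ m → fromℕ m * κ ^^ 39) R≡) (pow-inverse 39)))) N′ N-large A 0≤δ δ≤1 dense

module Dichotomy (K′ K : ℕ) (K≡ : K ≡ suc K′) (2≤K : 2 ℕ.≤ K) (n : ℕ) (n≡ : suc n ≡ K ^ E₀) (B : ℕ) (B≡ : B ≡ suc n ^ 9)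
  (R : ℕ) (R≡ : suc R ≡ K ^ 39) {ε : ℚ} (0≤ε : 0ℚ ≤ ε) (1≤Kε : 1ℚ ≤ fromℕ K * ε) (Kε²≤1 : fromℕ K * (ε * ε) ≤ 1ℚ)
  (C : ℕ) (C≡ : C ≡ Ê ℕ.+ Ê) (N′ : ℕ) (A : ℕ → Bool) {δ : ℚ} (0≤δ : 0ℚ ≤ δ) (δ≤1 : δ ≤ 1ℚ) where
  open PowerReciprocal K′ K K≡
  private module P = Parameters K′ K K≡ 2≤K n n≡ B B≡ R R≡
  open ℚₚ.≤-Reasoning

  0≤ε^ : ∀ j → 0ℚ ≤ ε ^^ j
  0≤ε^ zero    = 0≤1
  0≤ε^ (suc j) = 0≤* 0≤ε (0≤ε^ j)

  exponent-bound : ℕ→ℚ P.k ℚ.* (ε ^ℚ C) ≤ ℕ→ℚ C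
  exponent-bound = begin
    ℕ→ℚ P.k ℚ.* (ε ^ℚ C)                  ≡⟨ trans (*-coeff _ _) (cong₂ _*_ (sym (fromℕ-/1 P.k)) (trans (^ℚ-^^ ε C) (cong (ε ^^_) C≡))) ⟩
    fromℕ P.k * ε ^^ (Ê ℕ.+ Ê)            ≤⟨ *-monoʳ (0≤ε^ (Ê ℕ.+ Ê)) (fromℕ-mono P.k≤) ⟩
    fromℕ (K ^ Ê) * ε ^^ (Ê ℕ.+ Ê)        ≤⟨ polynomial-bound K 0≤ε Kε²≤1 Ê ⟩
    1ℚ                                    ≡⟨ sym (+-identityʳ 1ℚ) ⟩
    fromℕ 1                               ≤⟨ fromℕ-mono (ℕₚ.≤-trans 1≤Ê (ℕₚ.≤-trans (ℕₚ.m≤m+n Ê Ê) (ℕₚ.≤-reflexive (sym C≡)))) ⟩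
    fromℕ C                               ≡⟨ fromℕ-/1 C ⟩
    ℕ→ℚ C                                 ∎

  dichotomy : δ ℚ.* ℕ→ℚ (suc N′) ≤ ℕ→ℚ (count (suc N′) A) →
    (∃ λ (k : ℕ) → suc N′ ℕ.≤ 2 ^ k × ℕ→ℚ k ℚ.* (ε ^ℚ C) ≤ ℕ→ℚ C)
    ⊎ (∃ λ (d : ℤ) → d ≢ 0ℤ × ((δ ^ℚ 3) ℚ.- ε) ℚ.* ℕ→ℚ (suc N′) ≤ ℕ→ℚ (patternCount (suc N′) A d))
  dichotomy dense = decide (suc N′ ℕₚ.≤? 2 ^ P.k)
    where
    dense′ : δ * fromℕ (suc N′) ≤ fromℕ (count (suc N′) A)
    dense′ = ≤-trans (≤-reflexive (trans (cong (δ *_) (fromℕ-/1 (suc N′))) (sym (*-coeff δ _)))) (≤-trans dense (≤-reflexive (sym (fromℕ-/1 (count (suc N′) A)))))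
    bound : ∀ D → (δ * δ * δ - κ) * fromℕ (suc N′) ≤ fromℕ (patternCount (suc N′) A (ℤ.+ D)) →
      ((δ ^ℚ 3) ℚ.- ε) ℚ.* ℕ→ℚ (suc N′) ≤ ℕ→ℚ (patternCount (suc N′) A (ℤ.+ D))
    bound D h = begin
      ((δ ^ℚ 3) ℚ.- ε) ℚ.* ℕ→ℚ (suc N′)     ≡⟨ trans (*-coeff _ _) (cong₂ _*_ (trans (+-coeff _ _) (cong₂ _+_ (^ℚ-^^ δ 3) (neg-coeff ε))) (sym (fromℕ-/1 (suc N′)))) ⟩
      (δ ^^ 3 - ε) * fromℕ (suc N′)         ≤⟨ *-monoʳ (0≤fromℕ (suc N′)) (≤-by _ (0≤b-a (κ≤ 1≤Kε))
                                                 (solve 3 (λ d k e → d :* d :* d :- k := (d :* (d :* (d :* con 1ℚ)) :- e) :+ (e :- k)) refl δ κ ε)) ⟩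
      (δ * δ * δ - κ) * fromℕ (suc N′)      ≤⟨ h ⟩
      fromℕ (patternCount (suc N′) A (ℤ.+ D)) ≡⟨ fromℕ-/1 (patternCount (suc N′) A (ℤ.+ D)) ⟩
      ℕ→ℚ (patternCount (suc N′) A (ℤ.+ D)) ∎
    decide : Dec (suc N′ ℕ.≤ 2 ^ P.k) → _
    decide (yes small) = inj₁ (P.k , small , exponent-bound)
    decide (no large)  = let (D , 1≤D , h) = P.Large.popular-difference N′ large A 0≤δ δ≤1 dense′ in
      inj₂ (ℤ.+ D , (λ e → ℕₚ.<-irrefl (sym (ℤₚ.+-injective e)) 1≤D) , bound D h)

opaque
  -- Twice Ê, because K is bounded by the inverse square of ε.
  C₀ : ℕ
  C₀ = Ê ℕ.+ Ê

  C₀-def : C₀ ≡ Ê ℕ.+ Ê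
  C₀-def = refl

theorem1p3 : Σ ℕ λ C → (0 ℕ.< C) ×
    ((N : ℕ) → 0 ℕ.< N →
    (δ : ℚ) → 0ℚ ℚ.< δ → δ ℚ.≤ 1ℚ →
    (A : ℕ → Bool) → (∀ x → A x ≡ true → 1 ℕ.≤ x × x ℕ.≤ N) →
    δ ℚ.* ℕ→ℚ N ℚ.≤ ℕ→ℚ (count N A) →
    (ε : ℚ) → 0ℚ ℚ.< ε → ε ℚ.≤ ½ →
    (∃ λ (k : ℕ) → N ℕ.≤ 2 ^ k × ℕ→ℚ k ℚ.* (ε ^ℚ C) ℚ.≤ ℕ→ℚ C)
    ⊎
    (∃ λ (d : ℤ) → d ≢ ℤ.0ℤ ×
    ((δ ^ℚ 3) ℚ.- ε) ℚ.* ℕ→ℚ N ℚ.≤ ℕ→ℚ (patternCount N A d)))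
theorem1p3 = C₀ , ℕₚ.≤-trans 1≤Ê (ℕₚ.≤-trans (ℕₚ.m≤m+n Ê Ê) (ℕₚ.≤-reflexive (sym C₀-def))) ,
  λ { (suc N′) _ δ 0<δ δ≤1 A _ dense ε 0<ε ε≤½ →
    let (K′ , 2≤K , 1≤Kε , Kε²≤1) = scale-for ε 0<ε ε≤½ in
    -- The averages `uni n` have n + 1 points and the search runs through R + 1 stages, hence the
    -- predecessors of powers of K.
    Dichotomy.dichotomy K′ (suc K′) refl 2≤K (ℕ.pred (suc K′ ^ E₀)) (pred-power K′ E₀) (suc (ℕ.pred (suc K′ ^ E₀)) ^ 9) refl
      (ℕ.pred (suc K′ ^ 39)) (pred-power K′ 39) (ℚₚ.<⇒≤ 0<ε) 1≤Kε Kε²≤1 C₀ C₀-def N′ A (ℚₚ.<⇒≤ 0<δ) δ≤1 dense }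
  where
  pred-power : ∀ K′ j → suc (ℕ.pred (suc K′ ^ j)) ≡ suc K′ ^ j
  pred-power K′ j = ℕₚ.suc-pred (suc K′ ^ j) ⦃ ℕ.>-nonZero (ℕₚ.m^n>0 (suc K′) j) ⦄
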